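{- Let $\lambda\vdash n$, let $i$ be a part of $\lambda$ and let $1\le p\le n-1$. Let $d^{p,n-1}_{\lambda,i}$ be the number of $(p,n-1,n)$-dipoles (with unlabelled ordinary edges) having face degree sequence $2\lambda$ and root face of degree $2i$, i.e. the number of $n$-cycles $\sigma\in\mathfrak{S}_n$ with $\sigma^{ -1}(n)=n-1$ and $\sigma C_p\in\mathcal{C}_{\lambda,i}$, where $C_p=(n,1,\ldots,p-1,n-1,p,\ldots,n-2)$. Then \[ d^{p,n-1}_{\lambda,i}=\frac{|\mathcal{C}_{\lambda,i}|\,(n-2)!}{n!}\left(A^{\lambda,i}_{n,p}+B^{\lambda,i}_{n,p}+C^{\lambda,i}_{n,p}\right), \] where \[ A^{\lambda,i}_{n,p}=\sum_{0\le k\le n-2}\frac{(-1)^k\gamma^{(n-k,1^k),n-k}_{\lambda,i}\gamma^{(n-k,1^k),n-k}_{(p,n-p),p}}{d_{(n-k-1,1^k)}}\,\frac{n-1}{n-k-1}, \] \[ B^{\lambda,i}_{n,p}=\sum_{1\le k\le n-1}\frac{(-1)^{k-1}\gamma^{(n-k,1^k),1}_{\lambda,i}\gamma^{(n-k,1^k),1}_{(p,n-p),p}}{d_{(n-k,1^{k-1})}}\,\frac{n-1}{k}, \] \[ C^{\lambda,i}_{n,p}=\sum_{1\le k\le n-3}\frac{(-1)^k\gamma^{(n-k-1,2,1^{k-1}),2}_{\lambda,i}\gamma^{(n-k-1,2,1^{k-1}),2}_{(p,n-p),p}}{d_{(n-k-1,1^k)}}\,\frac{nk(n-k-2)}{(n-k-1)(k+1)}.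 \]
   Context: For $\lambda\vdash n$ and a part $i$ of $\lambda$, $\mathcal{C}_{\lambda,i}$ is the set of permutations in $\mathfrak{S}_n$ of cycle type $\lambda$ with $n$ on a cycle of length $i$, and $K_{\lambda,i}=\sum_{\pi\in\mathcal{C}_{\lambda,i}}\pi$; these form a basis of $Z_1(n)$, the centralizer of $\mathfrak{S}_{n-1}$ in $\mathbb{C}[\mathfrak{S}_n]$, and $[K_{\mu,j}]X$ denotes the coefficient of $K_{\mu,j}$ in $X\in Z_1(n)$. For a standard Young tableau $T$ with $n$ boxes, $c_T(k)=(\text{column})-(\text{row})$ of the box containing $k$. Jucys–Murphy elements: $J_k=\sum_{1\le a<k}(a,k)$. For a standard Young tableau $T$ of shape $\lambda\vdash n$, $e_T$ is the Young seminormal unit: the primitive idempotent of the subalgebra generated by $J_1,\ldots,J_n$ on which each $J_k$ acts by $c_T(k)$. $d_\lambda$ is the number of standard Young tableaux of shape $\lambda$; $\mathrm{SYT}_{\lambda,i}$ is the set of standard Young tableaux of shape $\lambda$ with $n$ at the end of a row of length $i$; $\Gamma^{\lambda,i}=\sum_{T\in\mathrm{SYT}_{\lambda,i}}e_T$; and $\gamma^{\lambda,i}_{\mu,j}=\frac{n!}{d_\lambda}[K_{\mu,j}]\Gamma^{\lambda,i}$. Combinatorially, a dipole is a 2-cell embedding in an orientable surface of a loopless graph with two vertices, rooted at a vertex and an edge (labelled $n$), with a second distinguished edge (labelled $n-1$); $C_p$ is the root vertex rotation (root jump $p$), $\sigma$ the non-root vertex rotation (non-root jump $n-1$), and faces correspond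 to cycles of $\sigma C_p$ (cycle length $m$ $\leftrightarrow$ face degree $2m$), the root face being the one whose cycle contains $n$. -}

module Defs where

open import Data.Bool using (Bool; true; false; if_then_else_; _∧_; not)
open import Data.Nat using (ℕ; zero; suc; _+_; _*_; _∸_; _≤ᵇ_; _≡ᵇ_; _≥_)
import Data.Nat as N
open import Data.Nat using (_!)
open import Data.Nat.ListAction using (sum)
open import Relation.Nullary using (yes; no; ¬?)
open import Data.List using (List; []; _∷_; _++_; map; concatMap; filter; length; upTo; foldr; replicate; inits; applyUpTo; take)
open import Data.List.Properties using (≡-dec)
open import Data.List.Relation.Unary.All using (All)
open import Data.List.Relation.Unary.Linked using (Linked)
open import Data.Product using (_×_; _,_; proj₁; proj₂)
open import Relation.Nullary.Decidable using (does)
open import Relation.Binary.PropositionalEquality using (_≡_)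
open import Data.Integer using (ℤ; +_)
import Data.Integer as Z
open import Data.Rational using (ℚ; 0ℚ; 1ℚ; _/_)
import Data.Rational as Q
import Data.Rational.Properties as QP

IsPartition : ℕ → List ℕ → Set
IsPartition n la = All (λ x → 1 N.≤ x) la × Linked _≥_ la × sum la ≡ n

filterB : {A : Set} → (A → Bool) → List A → List A
filterB p = foldr (λ x r → if p x then x ∷ r else r) []

allB : {A : Set} → (A → Bool) → List A → Bool
allB p = foldr (λ x r → p x ∧ r) true

at : List ℕ → ℕ → ℕ → ℕ
at []       _       d = d
at (x ∷ _)  zero    _ = x
at (_ ∷ xs) (suc k) d = at xs k d

count : ℕ → List ℕ → ℕ
count r w = length (filterB (λ a → a ≡ᵇ r) w)

range : ℕ → ℕ → List ℕ
range a b = applyUpTo (λ k → a + k) (suc b ∸ a)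

insertDesc : ℕ → List ℕ → List ℕ
insertDesc x []       = x ∷ []
insertDesc x (y ∷ ys) = if y ≤ᵇ x then x ∷ y ∷ ys else y ∷ insertDesc x ys

sortDesc : List ℕ → List ℕ
sortDesc = foldr insertDesc []

listEq? : List ℕ → List ℕ → Bool
listEq? xs ys = does (≡-dec N._≟_ xs ys)

-- Permutations of {1,…,n}: a permutation π is the list [π(1), …, π(n)].

Perm : Set
Perm = List ℕ

-- π(x); points outside the list are fixed
app : Perm → ℕ → ℕ
app π x = at π (x ∸ 1) x

insertEverywhere : ℕ → List ℕ → List (List ℕ)
insertEverywhere x []       = (x ∷ []) ∷ []
insertEverywhere x (y ∷ ys) = (x ∷ y ∷ ys) ∷ map (y ∷_) (insertEverywhere x ys)

permutations : List ℕ → List (List ℕ)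
permutations []       = [] ∷ []
permutations (x ∷ xs) = concatMap (insertEverywhere x) (permutations xs)

Sym : ℕ → List Perm
Sym n = permutations (range 1 n)

idPerm : ℕ → Perm
idPerm n = range 1 n

-- composition (σ ∘ τ)(x) = σ(τ(x))  (right-to-left, as functions)
_∘ₚ_ : Perm → Perm → Perm
σ ∘ₚ τ = map (app σ) τ

-- orbit of x under π (fuel = length of π suffices)
orbit : Perm → ℕ → List ℕ
orbit π x = x ∷ go (length π) (app π x)
  where
  go : ℕ → ℕ → List ℕ
  go zero    _ = []
  go (suc f) y = if y ≡ᵇ x then [] else y ∷ go f (app π y)

cycLen : Perm → ℕ → ℕ
cycLen π x = length (orbit π x)

-- cycle type (multiset of cycle lengths; one entry per cycle,
-- indexed by the least element of the cycle), sorted decreasingly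
cycleType : ℕ → Perm → List ℕ
cycleType n π =
  sortDesc (map (cycLen π) (filterB (λ x → allB (λ y → x ≤ᵇ y) (orbit π x)) (range 1 n)))

inC : ℕ → List ℕ → ℕ → Perm → Bool
inC n μ j π = listEq? (cycleType n π) (sortDesc μ) ∧ (cycLen π n ≡ᵇ j)

Cset : ℕ → List ℕ → ℕ → List Perm
Cset n μ j = filterB (inC n μ j) (Sym n)

nextIn : ℕ → List ℕ → ℕ → ℕ
nextIn h []           x = x
nextIn h (a ∷ [])     x = if a ≡ᵇ x then h else x
nextIn h (a ∷ b ∷ cs) x = if a ≡ᵇ x then b else nextIn h (b ∷ cs) x

cyclePerm : ℕ → List ℕ → Perm
cyclePerm n []       = idPerm n
cyclePerm n (h ∷ cs) = map (nextIn h (h ∷ cs)) (range 1 n)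

transp : ℕ → ℕ → ℕ → Perm
transp n a b = cyclePerm n (a ∷ b ∷ [])

Cp : ℕ → ℕ → Perm
Cp n p = cyclePerm n (n ∷ range 1 (p ∸ 1) ++ (n ∸ 1) ∷ range p (n ∸ 2))

-- The group algebra ℚ[S_n], elements as formal sums Σ aₖ πₖ (lists).

Alg : Set
Alg = List (ℚ × Perm)

coeff : Alg → Perm → ℚ
coeff X π = foldr (λ aσ acc → (if listEq? (proj₂ aσ) π then proj₁ aσ else 0ℚ) Q.+ acc) 0ℚ X

_⊕_ : Alg → Alg → Alg
X ⊕ Y = X ++ Y

scale : ℚ → Alg → Alg
scale c X = map (λ aσ → (c Q.* proj₁ aσ , proj₂ aσ)) X

_⊛_ : Alg → Alg → Alg
X ⊛ Y = concatMap (λ aσ → map (λ bτ → (proj₁ aσ Q.* proj₁ bτ , proj₂ aσ ∘ₚ proj₂ bτ)) Y) X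

one : ℕ → Alg
one n = (1ℚ , idPerm n) ∷ []

prodAlg : ℕ → List Alg → Alg
prodAlg n = foldr _⊛_ (one n)

-- total inverse on ℚ (1/q for q ≠ 0; only ever applied to q ≠ 0 below)
inv : ℚ → ℚ
inv q with q QP.≟ 0ℚ
... | yes _ = 0ℚ
... | no q≢0 = Q.1/_ q {{Q.≢-nonZero q≢0}}

_÷'_ : ℚ → ℚ → ℚ
p ÷' q = p Q.* inv q

ℕ→ℚ : ℕ → ℚ
ℕ→ℚ m = + m / 1

ℤ→ℚ : ℤ → ℚ
ℤ→ℚ z = z / 1

JM : ℕ → ℕ → Alg
JM n k = map (λ a → (1ℚ , transp n a k)) (range 1 (k ∸ 1))

-- Standard Young tableaux, encoded by their Yamanouchi words:
-- w = [w₁,…,w_n] with wₖ the (0-indexed) row containing k.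

words : ℕ → ℕ → List (List ℕ)
words zero    r = [] ∷ []
words (suc m) r = concatMap (λ w → map (λ a → w ++ a ∷ []) (upTo r)) (words m r)

latticeOK : ℕ → List ℕ → Bool
latticeOK r w = allB (λ u → allB (λ s → count (suc s) u ≤ᵇ count s u) (upTo r)) (inits w)

SYT : ℕ → List ℕ → List (List ℕ)
SYT n la = filterB (λ w → latticeOK (length la) w ∧ listEq? (map (λ r → count r w) (upTo (length la))) la)
                  (words n (length la))

dim : ℕ → List ℕ → ℕ
dim n la = length (SYT n la)

-- content c_T(k) = column − row of the box containing k (k = 1,…,n)
content : List ℕ → ℕ → ℤ
content w k = + count (at w (k ∸ 1) 0) (take (k ∸ 1) w) Z.- + at w (k ∸ 1) 0

lastRow : List ℕ → ℕ
lastRow w = at w (length w ∸ 1) 0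

SYTi : ℕ → List ℕ → ℕ → List (List ℕ)
SYTi n la i = filterB (λ w → at la (lastRow w) 0 ≡ᵇ i) (SYT n la)

contentRange : ℕ → List ℤ
contentRange k = map (λ a → + a Z.- + (k ∸ 1)) (range 0 (2 * (k ∸ 1)))

-- Young seminormal unit
--   e_T = Π_{k=1}^{n} Π_{c ∈ {-(k-1),…,k-1}, c ≠ c_T(k)} (J_k − c)/(c_T(k) − c),
-- the primitive idempotent on which each J_k acts by c_T(k).
eT : ℕ → List ℕ → Alg
eT n w = prodAlg n (concatMap factors (range 1 n))
  where
  factors : ℕ → List Alg
  factors k = map (λ c → scale (inv (ℤ→ℚ (content w k Z.- c)))
                               (JM n k ⊕ scale (Q.- ℤ→ℚ c) (one n)))
                  (filterB (λ c → not (does (c Z.≟ content w k))) (contentRange k))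

Gamma : ℕ → List ℕ → ℕ → Alg
Gamma n la i = concatMap (eT n) (SYTi n la i)

-- [K_{μ,j}] X for X ∈ Z₁(n): the common coefficient of the π ∈ C_{μ,j}
-- (computed as their average)
coeffK : ℕ → List ℕ → ℕ → Alg → ℚ
coeffK n μ j X =
  foldr (λ π acc → coeff X π Q.+ acc) 0ℚ (Cset n μ j) ÷' ℕ→ℚ (length (Cset n μ j))

gam : ℕ → List ℕ → ℕ → List ℕ → ℕ → ℚ
gam n la i μ j = (ℕ→ℚ (n !) ÷' ℕ→ℚ (dim n la)) Q.* coeffK n μ j (Gamma n la i)

dipoleCount : ℕ → ℕ → List ℕ → ℕ → ℕ
dipoleCount n p la i =
  length (filterB (λ σ → (cycLen σ n ≡ᵇ n) ∧ (app σ (n ∸ 1) ≡ᵇ n) ∧ inC n la i (σ ∘ₚ Cp n p))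
                 (Sym n))

sumQ : List ℚ → ℚ
sumQ = foldr Q._+_ 0ℚ

sgn : ℕ → ℚ
sgn zero          = 1ℚ
sgn (suc zero)    = Q.- 1ℚ
sgn (suc (suc k)) = sgn k

hook : ℕ → ℕ → List ℕ
hook m k = (m ∸ k) ∷ replicate k 1

near : ℕ → ℕ → List ℕ
near n k = (n ∸ k ∸ 1) ∷ 2 ∷ replicate (k ∸ 1) 1

twoRow : ℕ → ℕ → List ℕ
twoRow n p = p ∷ (n ∸ p) ∷ []

termA : ℕ → ℕ → List ℕ → ℕ → ℚ
termA n p la i = sumQ (map (λ k →
  ((sgn k Q.* gam n (hook n k) (n ∸ k) la i Q.* gam n (hook n k) (n ∸ k) (twoRow n p) p)
     ÷' ℕ→ℚ (dim (n ∸ 1) (hook (n ∸ 1) k)))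
  Q.* (ℕ→ℚ (n ∸ 1) ÷' ℕ→ℚ (n ∸ k ∸ 1))) (range 0 (n ∸ 2)))

termB : ℕ → ℕ → List ℕ → ℕ → ℚ
termB n p la i = sumQ (map (λ k →
  ((sgn (k ∸ 1) Q.* gam n (hook n k) 1 la i Q.* gam n (hook n k) 1 (twoRow n p) p)
     ÷' ℕ→ℚ (dim (n ∸ 1) (hook (n ∸ 1) (k ∸ 1))))
  Q.* (ℕ→ℚ (n ∸ 1) ÷' ℕ→ℚ k)) (range 1 (n ∸ 1)))

termC : ℕ → ℕ → List ℕ → ℕ → ℚ
termC n p la i = sumQ (map (λ k →
  ((sgn k Q.* gam n (near n k) 2 la i Q.* gam n (near n k) 2 (twoRow n p) p)
     ÷' ℕ→ℚ (dim (n ∸ 1) (hook (n ∸ 1) k)))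
  Q.* (ℕ→ℚ (n * k * (n ∸ k ∸ 2)) ÷' ℕ→ℚ ((n ∸ k ∸ 1) * (k + 1)))) (range 1 (n ∸ 3)))

rhs : ℕ → ℕ → List ℕ → ℕ → ℚ
rhs n p la i =
  ((ℕ→ℚ (length (Cset n la i)) Q.* ℕ→ℚ ((n ∸ 2) !)) ÷' ℕ→ℚ (n !))
  Q.* (termA n p la i Q.+ termB n p la i Q.+ termC n p la i)

{-# OPTIONS --safe #-}
module Submission where

-- An n-cycle σ with σ(n-1) = n is τ (n-1 n) for an (n-1)-cycle τ of S_{n-1}, so
-- the dipole number counts the (n-1)-cycles τ with τ πp ∈ C_{λ,i}, where
-- πp = (n-1 n) C_p lies in D = C_{(p,n-p),p}.  The sum of the (n-1)-cycles is the
-- product J₂ ⋯ J_{n-1} of Jucys–Murphy elements; it kills the seminormal unit of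
-- T unless deleting n from T leaves a hook, in which case T is a hook with n at
-- the end of the arm (A) or of the leg (B), or n is the inner corner (C).
--
-- The J_k act by right translations on the functions on S_n, where they are
-- self-adjoint; this makes them diagonalisable, and the intertwiners
-- s(J_k - J_{k+1}) + 1 determine their joint spectrum.  Convolution with a
-- function invariant under conjugation by S_{n-1} acts on the image of each unit
-- as a scalar, because ℚ[S_{m+1}] = ℚ[S_m] + ℚ[S_m] s_m ℚ[S_m], so every Γ has
-- rank one on such functions.  The trace of a unit is found from the moments
-- E(1) = 1, E(J_n) = 0, E(J_n²) = n-1 of J_n over S_{n-1}.

open import Defs
open import Data.Bool as Bool using (Bool; true; false; if_then_else_; _∧_; not)
import Data.Bool.Properties as Boolₚ
open import Data.Empty using (⊥; ⊥-elim)
open import Data.Integer as ℤ using (ℤ; -[1+_])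
import Data.Integer.Properties as ℤP
open import Data.List using (List; []; _∷_; _++_; map; concatMap; foldr; foldl; length; replicate; applyUpTo; upTo; inits; take; initLast; _∷ʳ′_)
open import Data.List.Membership.Propositional using (_∈_; _∉_; find; lose)
open import Data.List.Membership.Propositional.Properties using (∈-applyUpTo⁺; ∈-applyUpTo⁻; ∈-map⁺; ∈-map⁻; ∈-concatMap⁻; ∈-concatMap⁺; ∈-++⁻; ∈-++⁺ˡ; ∈-++⁺ʳ; ∈-∃++)
open import Data.List.Membership.Propositional.Properties.WithK using (unique∧set⇒bag)
open import Data.List.Properties using (length-++; ++-assoc; map-∘; map-cong; map-++; map-cong-local; map-id-local; length-map; length-applyUpTo; map-applyUpTo; applyUpTo-∷ʳ; ≡-dec; ∷-injectiveˡ; ∷-injectiveʳ; foldl-++; ++-identityʳ)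
open import Data.List.Relation.Binary.BagAndSetEquality using (∼bag⇒↭)
open import Data.List.Relation.Binary.Permutation.Propositional as Perm using (_↭_; ↭-sym; ↭-trans; ↭-refl; ↭-reflexive)
open import Data.List.Relation.Binary.Permutation.Propositional.Properties as Permₚ using (shift; ∈-resp-↭; ↭-length; drop-mid)
open import Data.List.Relation.Unary.All as All using (All; []; _∷_)
import Data.List.Relation.Unary.All.Properties as Allₚ
open import Data.List.Relation.Unary.AllPairs as AllPairs using ([]; _∷_)
import Data.List.Relation.Unary.AllPairs.Properties as AllPairsₚ
open import Data.List.Relation.Unary.Any using (here; there)
open import Data.List.Relation.Unary.Unique.Propositional using (Unique)
import Data.List.Relation.Unary.Unique.Propositional.Properties as Uniqueₚ
open import Data.Nat as ℕ using (ℕ; zero; suc; z≤n; s≤s; _!)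
import Data.Nat.Properties as ℕP
import Data.Nat.Solver as ℕSolver
open import Data.Product using (_×_; _,_; proj₁; proj₂; ∃; ∃₂)
open import Data.Rational as ℚ using (ℚ; 0ℚ; 1ℚ)
import Data.Rational.Properties as ℚP
import Data.Rational.Solver as ℚSolver
import Data.Rational.Unnormalised as ℚᵘ
import Data.Rational.Unnormalised.Properties as ℚᵘP
open import Data.Sum using (_⊎_; inj₁; inj₂)
open import Data.Unit using (⊤; tt)
open import Function.Bundles using (mk⇔)
open import Relation.Binary using (tri<; tri≈; tri>)
open import Relation.Binary.PropositionalEquality using (_≡_; _≢_; refl; sym; trans; cong; cong₂; subst; subst₂)
open import Relation.Nullary using (¬_; yes; no; Dec; does)
open import Relation.Nullary.Decidable using (dec-true; dec-false)

-- Jucys–Murphy operators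

-- No irreducible representation is constructed. Semisimplicity comes from positivity: over the
-- rationals a sum of squares vanishes only termwise, so a self-adjoint operator whose square kills
-- a function kills it already. Irreducibility is replaced by `Primitive`: E p E is a multiple of E
-- for every unit E and every p in the group algebra.
--
-- Let χC, χD be the indicators of C_{λ,i} and D, and J the product of Jucys-Murphy elements. J χC
-- is invariant under conjugation by S_{n-1} and D is one orbit of that conjugation, so |D| times
-- the dipole number is ⟨J χC, χD⟩. For a family Γ of units with the same last box, rank one means S
-- Γ(δ) = Γ(χC) Γ(χD), where S = ⟨Γ χC, χD⟩ and Γ(f) is the value of Γ f at the identity. Γ(χC) is
-- |C_{λ,i}| times a coefficient of Γ, which is how the two γ factors enter. Γ(δ) is a trace, and J
-- has eigenvalue (-1)^l a! l! on a hook with arm a and leg l. The weights in A, B and C are what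
-- remains after the hook length formula. C lacks k = 0 and k = n-2 because a hook without arm or
-- leg has no inner corner.

module JucysMurphy where
  open import Data.Rational using (_+_; _*_; -_; _-_; _≤_)
  open ℚP
  open ℚSolver.+-*-Solver using (solve; _:=_; _:+_; _:*_; _:-_; :-_; con)
  import Algebra.Properties.AbelianGroup ℤP.+-0-abelianGroup as ℤG

  -- Finite rational sums and division

  ∑ : {A : Set} → (A → ℚ) → List A → ℚ
  ∑ F = foldr (λ x r → F x + r) 0ℚ

  ind : Bool → ℚ
  ind b = if b then 1ℚ else 0ℚ

  variable
    A B : Set

  ∑-cong : {F G : A → ℚ} (xs : List A) → (∀ x → x ∈ xs → F x ≡ G x) → ∑ F xs ≡ ∑ G xs
  ∑-cong [] h = refl
  ∑-cong (x ∷ xs) h = cong₂ _+_ (h x (here refl)) (∑-cong xs (λ y m → h y (there m)))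

  ∑-cong′ : {F G : A → ℚ} (xs : List A) → (∀ x → F x ≡ G x) → ∑ F xs ≡ ∑ G xs
  ∑-cong′ xs h = ∑-cong xs (λ x _ → h x)

  ∑-++ : (F : A → ℚ) (xs ys : List A) → ∑ F (xs ++ ys) ≡ ∑ F xs + ∑ F ys
  ∑-++ F [] ys = sym (+-identityˡ _)
  ∑-++ F (x ∷ xs) ys = trans (cong (F x +_) (∑-++ F xs ys)) (sym (+-assoc (F x) _ _))

  ∑-map : (F : B → ℚ) (g : A → B) (xs : List A) → ∑ F (map g xs) ≡ ∑ (λ x → F (g x)) xs
  ∑-map F g [] = refl
  ∑-map F g (x ∷ xs) = cong (F (g x) +_) (∑-map F g xs)

  ∑-concatMap : (F : B → ℚ) (g : A → List B) (xs : List A) →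
    ∑ F (concatMap g xs) ≡ ∑ (λ x → ∑ F (g x)) xs
  ∑-concatMap F g [] = refl
  ∑-concatMap F g (x ∷ xs) = trans (∑-++ F (g x) _) (cong (∑ F (g x) +_) (∑-concatMap F g xs))

  ∑-+ : (F G : A → ℚ) (xs : List A) → ∑ (λ x → F x + G x) xs ≡ ∑ F xs + ∑ G xs
  ∑-+ F G [] = refl
  ∑-+ F G (x ∷ xs) = trans (cong (F x + G x +_) (∑-+ F G xs))
    (solve 4 (λ a b c d → (a :+ b) :+ (c :+ d) := (a :+ c) :+ (b :+ d)) refl (F x) (G x) _ _)

  ∑-*ˡ : (c : ℚ) (F : A → ℚ) (xs : List A) → ∑ (λ x → c * F x) xs ≡ c * ∑ F xs
  ∑-*ˡ c F [] = sym (*-zeroʳ c)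
  ∑-*ˡ c F (x ∷ xs) = trans (cong (c * F x +_) (∑-*ˡ c F xs)) (sym (*-distribˡ-+ c _ _))

  ∑-*ʳ : (c : ℚ) (F : A → ℚ) (xs : List A) → ∑ (λ x → F x * c) xs ≡ ∑ F xs * c
  ∑-*ʳ c F [] = sym (*-zeroˡ c)
  ∑-*ʳ c F (x ∷ xs) = trans (cong (F x * c +_) (∑-*ʳ c F xs)) (sym (*-distribʳ-+ c (F x) (∑ F xs)))

  ∑-zero : {F : A → ℚ} (xs : List A) → (∀ x → x ∈ xs → F x ≡ 0ℚ) → ∑ F xs ≡ 0ℚ
  ∑-zero [] h = refl
  ∑-zero (x ∷ xs) h = trans (cong₂ _+_ (h x (here refl)) (∑-zero xs (λ y m → h y (there m)))) refl

  ∑-↭ : (F : A → ℚ) {xs ys : List A} → xs ↭ ys → ∑ F xs ≡ ∑ F ys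
  ∑-↭ F Perm.refl = refl
  ∑-↭ F (Perm.prep x p) = cong (F x +_) (∑-↭ F p)
  ∑-↭ F (Perm.swap x y p) = trans (cong (λ z → F x + (F y + z)) (∑-↭ F p))
    (solve 3 (λ a b c → a :+ (b :+ c) := b :+ (a :+ c)) refl (F x) (F y) _)
  ∑-↭ F (Perm.trans p q) = trans (∑-↭ F p) (∑-↭ F q)

  ∑-swap : (F : A → B → ℚ) (xs : List A) (ys : List B) →
    ∑ (λ x → ∑ (F x) ys) xs ≡ ∑ (λ y → ∑ (λ x → F x y) xs) ys
  ∑-swap F [] ys = sym (∑-zero′ ys)
    where
    ∑-zero′ : {B : Set} (ys : List B) → ∑ (λ _ → 0ℚ) ys ≡ 0ℚ
    ∑-zero′ [] = refl
    ∑-zero′ (_ ∷ ys) = trans (+-identityˡ _) (∑-zero′ ys)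
  ∑-swap F (x ∷ xs) ys = trans (cong (∑ (F x) ys +_) (∑-swap F xs ys)) (sym (lem ys))
    where
    lem : ∀ ys → ∑ (λ y → F x y + ∑ (λ x → F x y) xs) ys ≡ ∑ (F x) ys + ∑ (λ y → ∑ (λ x → F x y) xs) ys
    lem [] = refl
    lem (y ∷ ys) = trans (cong (F x y + _ +_) (lem ys))
      (solve 4 (λ a b c d → (a :+ b) :+ (c :+ d) := (a :+ c) :+ (b :+ d)) refl (F x y) _ _ _)

  ∑-single : {F : A → ℚ} (xs : List A) → Unique xs → (a : A) → a ∈ xs →
    (∀ x → x ∈ xs → x ≢ a → F x ≡ 0ℚ) → ∑ F xs ≡ F a
  ∑-single {F = F} (x ∷ xs) (x∉ ∷ u) .x (here refl) h =
    trans (cong (F x +_) (∑-zero xs (λ y m → h y (there m) (λ { refl → All.lookup x∉ m refl })))) (+-identityʳ _)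
  ∑-single {F = F} (x ∷ xs) (x∉ ∷ u) a (there m) h =
    trans (cong₂ _+_ (h x (here refl) (λ { refl → All.lookup x∉ m refl }))
                     (∑-single xs u a m (λ y k → h y (there k)))) (+-identityˡ _)

  ∑-filterB : (b : A → Bool) (F : A → ℚ) (xs : List A) →
    ∑ F (filterB b xs) ≡ ∑ (λ x → ind (b x) * F x) xs
  ∑-filterB b F [] = refl
  ∑-filterB b F (x ∷ xs) with b x
  ... | true  = cong₂ _+_ (sym (*-identityˡ (F x))) (∑-filterB b F xs)
  ... | false = trans (∑-filterB b F xs) (sym (trans (cong (_+ _) (*-zeroˡ (F x))) (+-identityˡ _)))

  ∑-nonneg : {F : A → ℚ} (xs : List A) → (∀ x → 0ℚ ≤ F x) → 0ℚ ≤ ∑ F xs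
  ∑-nonneg [] h = ≤-refl
  ∑-nonneg (x ∷ xs) h = +-mono-≤ (h x) (∑-nonneg xs h)

  ∑-nonneg-zero : {F : A → ℚ} (xs : List A) → (∀ x → 0ℚ ≤ F x) → ∑ F xs ≡ 0ℚ →
    ∀ x → x ∈ xs → F x ≡ 0ℚ
  ∑-nonneg-zero {F = F} (x ∷ xs) h e y m = go m
    where
    le : F x ≤ 0ℚ
    le = subst (F x ≤_) e (subst (_≤ F x + ∑ F xs) (+-identityʳ (F x)) (+-monoʳ-≤ (F x) (∑-nonneg xs h)))
    Fx : F x ≡ 0ℚ
    Fx = ≤-antisym le (h x)
    go : y ∈ x ∷ xs → F y ≡ 0ℚ
    go (here refl) = Fx
    go (there k) = ∑-nonneg-zero xs h (trans (sym (trans (cong (_+ ∑ F xs) Fx) (+-identityˡ _))) e) y k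

  sq-nonneg : (q : ℚ) → 0ℚ ≤ q * q
  sq-nonneg q with ≤-total 0ℚ q
  ... | inj₁ h = subst (_≤ q * q) (*-zeroˡ q) (*-monoʳ-≤-nonNeg q {{ℚ.nonNegative h}} h)
  ... | inj₂ h = subst (_≤ q * q) (*-zeroˡ q) (*-monoʳ-≤-nonPos q {{ℚ.nonPositive h}} h)

  *-inv : (q : ℚ) → q ≢ 0ℚ → q * inv q ≡ 1ℚ
  *-inv q h with q ≟ 0ℚ
  ... | yes e = ⊥-elim (h e)
  ... | no e = *-inverseʳ q {{ℚ.≢-nonZero e}}

  zero-product : (p q : ℚ) → p ≢ 0ℚ → p * q ≡ 0ℚ → q ≡ 0ℚ
  zero-product p q h e = trans (solve 1 (λ q → q := con 1ℚ :* q) refl q)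
    (trans (cong (_* q) (sym (*-inv p h)))
    (trans (solve 3 (λ p i q → (p :* i) :* q := i :* (p :* q)) refl p (inv p) q)
    (trans (cong (inv p *_) e) (*-zeroʳ (inv p)))))

  sq-zero : (q : ℚ) → q * q ≡ 0ℚ → q ≡ 0ℚ
  sq-zero q e with q ≟ 0ℚ
  ... | yes h = h
  ... | no h = zero-product q q h e

  *-cancelˡ : (p q r : ℚ) → p ≢ 0ℚ → p * q ≡ p * r → q ≡ r
  *-cancelˡ p q r h e = lem (zero-product p (q - r) h
      (trans (solve 3 (λ p q r → p :* (q :- r) := p :* q :- p :* r) refl p q r)
      (trans (cong (_- p * r) e) (+-inverseʳ (p * r)))))
    where
    lem : q - r ≡ 0ℚ → q ≡ r
    lem z = trans (solve 2 (λ q r → q := (q :- r) :+ r) refl q r) (trans (cong (_+ r) z) (+-identityˡ r))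

  -- Division by 1 in ℚ normalises through a gcd that does not reduce on variables. The ring laws
  -- for `ℤ→ℚ` are therefore compared among unnormalised rationals, where they compute.
  ℤ→ℚ-toℚᵘ : ∀ z → ℚ.toℚᵘ (ℤ→ℚ z) ℚᵘ.≃ ℚᵘ.mkℚᵘ z 0
  ℤ→ℚ-toℚᵘ z = toℚᵘ-fromℚᵘ (ℚᵘ.mkℚᵘ z 0)

  ℤ→ℚ-+ : ∀ a b → ℤ→ℚ (a ℤ.+ b) ≡ ℤ→ℚ a + ℤ→ℚ b
  ℤ→ℚ-+ a b = toℚᵘ-injective (ℚᵘP.≃-trans (ℤ→ℚ-toℚᵘ (a ℤ.+ b)) (ℚᵘP.≃-sym
    (ℚᵘP.≃-trans (toℚᵘ-homo-+ (ℤ→ℚ a) (ℤ→ℚ b))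
    (ℚᵘP.≃-trans (ℚᵘP.+-cong (ℤ→ℚ-toℚᵘ a) (ℤ→ℚ-toℚᵘ b))
    (ℚᵘ.*≡* (cong (ℤ._* ℤ.+ 1) (cong₂ ℤ._+_ (ℤP.*-identityʳ a) (ℤP.*-identityʳ b))))))))

  ℤ→ℚ-* : ∀ a b → ℤ→ℚ (a ℤ.* b) ≡ ℤ→ℚ a * ℤ→ℚ b
  ℤ→ℚ-* a b = toℚᵘ-injective (ℚᵘP.≃-trans (ℤ→ℚ-toℚᵘ (a ℤ.* b)) (ℚᵘP.≃-sym
    (ℚᵘP.≃-trans (toℚᵘ-homo-* (ℤ→ℚ a) (ℤ→ℚ b))
    (ℚᵘP.≃-trans (ℚᵘP.*-cong (ℤ→ℚ-toℚᵘ a) (ℤ→ℚ-toℚᵘ b))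
    (ℚᵘ.*≡* refl)))))

  ℤ→ℚ-neg : ∀ a → ℤ→ℚ (ℤ.- a) ≡ - ℤ→ℚ a
  ℤ→ℚ-neg a = trans (solve 2 (λ x y → x := (x :+ y) :- y) refl (ℤ→ℚ (ℤ.- a)) (ℤ→ℚ a))
    (trans (cong (_- ℤ→ℚ a) (trans (sym (ℤ→ℚ-+ (ℤ.- a) a)) (cong ℤ→ℚ (ℤP.+-inverseˡ a)))) (+-identityˡ _))

  ℤ→ℚ-- : ∀ a b → ℤ→ℚ (a ℤ.- b) ≡ ℤ→ℚ a - ℤ→ℚ b
  ℤ→ℚ-- a b = trans (ℤ→ℚ-+ a (ℤ.- b)) (cong (ℤ→ℚ a +_) (ℤ→ℚ-neg b))

  ℤ→ℚ-injective : ∀ {a b} → ℤ→ℚ a ≡ ℤ→ℚ b → a ≡ b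
  ℤ→ℚ-injective {a} {b} e with ℚᵘP.≃-trans (ℚᵘP.≃-sym (ℤ→ℚ-toℚᵘ a)) (ℚᵘP.≃-trans (toℚᵘ-cong e) (ℤ→ℚ-toℚᵘ b))
  ... | ℚᵘ.*≡* h = trans (sym (ℤP.*-identityʳ a)) (trans h (ℤP.*-identityʳ b))

  -- A right action of the symmetric group S_n on a finite set through the
  -- adjacent transpositions; π · k is π · (k+1, k+2).
  record CoxeterAction : Set₁ where
    infixl 8 _·_
    field
      P             : Set
      Val           : P → Set
      _·_           : P → ℕ → P
      n             : ℕ
      enum          : List P
      val-·         : ∀ {π} k → Val π → Val (π · k)
      invol         : ∀ π k → π · k · k ≡ π
      far           : ∀ π {i k} → suc (suc i) ℕ.≤ k → π · i · k ≡ π · k · i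
      -- On a list too short to contain all three positions one of the two generators acts trivially
      -- and the braid relation fails; hence the bound and `Val`.
      braid         : ∀ {π} i → suc (suc i) ℕ.< n → Val π →
                      π · i · suc i · i ≡ π · suc i · i · suc i
      enum-·        : ∀ k → map (_· k) enum ↭ enum
      enum-complete : ∀ {π} → Val π → π ∈ enum
      enum-val      : ∀ {π} → π ∈ enum → Val π

  -- The algebra generated by right translations

  module Operators (𝒜 : CoxeterAction) where
    open CoxeterAction 𝒜

    V : Set
    V = P → ℚ

    infix 4 _≐_
    _≐_ : V → V → Set
    f ≐ g = ∀ {π} → Val π → f π ≡ g π

    0ᵛ : V
    0ᵛ _ = 0ℚ

    infixr 7 _*ᵛ_
    _*ᵛ_ : ℚ → V → V
    (c *ᵛ f) π = c * f π

    infixl 6 _+ᵛ_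
    _+ᵛ_ : V → V → V
    (f +ᵛ g) π = f π + g π

    infixl 6 _∔_
    infixr 7 _⊙_
    -- Operators are kept as syntax so that linearity, locality, commutation and preservation of
    -- supports can be proved by induction on the expression.
    data Op : Set where
      sw  : ℕ → Op
      κ   : ℚ → Op
      _∔_ : Op → Op → Op
      _⊙_ : Op → Op → Op

    ⟦_⟧ : Op → V → V
    ⟦ sw k ⟧ f π = f (π · k)
    ⟦ κ c ⟧ f π = c * f π
    ⟦ p ∔ q ⟧ f π = ⟦ p ⟧ f π + ⟦ q ⟧ f π
    ⟦ p ⊙ q ⟧ f = ⟦ p ⟧ (⟦ q ⟧ f)

    ⟦⟧-cong : ∀ p {f g} → f ≐ g → ⟦ p ⟧ f ≐ ⟦ p ⟧ g
    ⟦⟧-cong (sw k) h v = h (val-· k v)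
    ⟦⟧-cong (κ c) h v = cong (c *_) (h v)
    ⟦⟧-cong (p ∔ q) h v = cong₂ _+_ (⟦⟧-cong p h v) (⟦⟧-cong q h v)
    ⟦⟧-cong (p ⊙ q) h = ⟦⟧-cong p (⟦⟧-cong q h)

    ⟦⟧-+ : ∀ p f g → ⟦ p ⟧ (f +ᵛ g) ≐ ⟦ p ⟧ f +ᵛ ⟦ p ⟧ g
    ⟦⟧-+ (sw k) f g v = refl
    ⟦⟧-+ (κ c) f g v = *-distribˡ-+ c _ _
    ⟦⟧-+ (p ∔ q) f g {π} v = trans (cong₂ _+_ (⟦⟧-+ p f g v) (⟦⟧-+ q f g v))
      (solve 4 (λ a b c d → (a :+ b) :+ (c :+ d) := (a :+ c) :+ (b :+ d)) refl (⟦ p ⟧ f π) _ _ _)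
    ⟦⟧-+ (p ⊙ q) f g v = trans (⟦⟧-cong p (⟦⟧-+ q f g) v) (⟦⟧-+ p _ _ v)

    ⟦⟧-* : ∀ p c f → ⟦ p ⟧ (c *ᵛ f) ≐ c *ᵛ ⟦ p ⟧ f
    ⟦⟧-* (sw k) c f v = refl
    ⟦⟧-* (κ d) c f {π} v = solve 3 (λ d c f → d :* (c :* f) := c :* (d :* f)) refl d c (f π)
    ⟦⟧-* (p ∔ q) c f v = trans (cong₂ _+_ (⟦⟧-* p c f v) (⟦⟧-* q c f v)) (sym (*-distribˡ-+ c _ _))
    ⟦⟧-* (p ⊙ q) c f v = trans (⟦⟧-cong p (⟦⟧-* q c f) v) (⟦⟧-* p c _ v)

    ⟦⟧-0 : ∀ p {f} → f ≐ 0ᵛ → ⟦ p ⟧ f ≐ 0ᵛ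
    ⟦⟧-0 p {f} h {π} v = trans (⟦⟧-cong p {f} {0ℚ *ᵛ f} (λ {ρ} w → trans (h w) (sym (*-zeroˡ (f ρ)))) v)
      (trans (⟦⟧-* p 0ℚ f v) (*-zeroˡ (⟦ p ⟧ f π)))

    ⟦⟧-∑ : ∀ p {A : Set} (F : A → V) (xs : List A) →
      ⟦ p ⟧ (λ π → ∑ (λ x → F x π) xs) ≐ (λ π → ∑ (λ x → ⟦ p ⟧ (F x) π) xs)
    ⟦⟧-∑ p F [] = ⟦⟧-0 p (λ _ → refl)
    ⟦⟧-∑ p F (x ∷ xs) v = trans (⟦⟧-+ p (F x) _ v) (cong (⟦ p ⟧ (F x) _ +_) (⟦⟧-∑ p F xs v))

    -- A record, because `p` and `q` cannot be inferred from the underlying statement once `⟦_⟧` has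
    -- computed. `SA` and `Eigen` are wrapped for the same reason.
    record Comm (p q : Op) : Set where
      constructor mk
      field comm : ∀ f → ⟦ p ⟧ (⟦ q ⟧ f) ≐ ⟦ q ⟧ (⟦ p ⟧ f)
    open Comm public

    comm-sym : ∀ {p q} → Comm p q → Comm q p
    comm-sym h = mk λ f v → sym (comm h f v)

    comm-κ : ∀ c q → Comm (κ c) q
    comm-κ c q = mk λ f v → sym (⟦⟧-* q c f v)

    comm-∔ : ∀ {p q r} → Comm p r → Comm q r → Comm (p ∔ q) r
    comm-∔ {r = r} hp hq = mk λ f v → trans (cong₂ _+_ (comm hp f v) (comm hq f v)) (sym (⟦⟧-+ r _ _ v))

    comm-⊙ : ∀ {p q r} → Comm p r → Comm q r → Comm (p ⊙ q) r
    comm-⊙ {p} {q} {r} hp hq = mk λ f v → trans (⟦⟧-cong p (comm hq f) v) (comm hp (⟦ q ⟧ f) v)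

    -- Membership in the group algebra of S_m, which acts on the first m positions.
    In : ℕ → Op → Set
    In m (sw k) = suc k ℕ.< m
    In m (κ _) = ⊤
    In m (p ∔ q) = In m p × In m q
    In m (p ⊙ q) = In m p × In m q

    In-mono : ∀ p {m m′} → m ℕ.≤ m′ → In m p → In m′ p
    In-mono (sw k) le h = ℕP.≤-trans h le
    In-mono (κ _) le h = tt
    In-mono (p ∔ q) le (a , b) = In-mono p le a , In-mono q le b
    In-mono (p ⊙ q) le (a , b) = In-mono p le a , In-mono q le b

    -- The Jucys–Murphy element J_{j+1}.
    X : ℕ → Op
    X zero = κ 0ℚ
    X (suc j) = (sw j ⊙ X j ⊙ sw j) ∔ sw j

    In-X : ∀ j → In (suc j) (X j)
    In-X zero = tt
    In-X (suc j) = (ℕP.≤-refl , In-mono (X j) (ℕP.n≤1+n _) (In-X j) , ℕP.≤-refl) , ℕP.≤-refl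

    sw-sw : ∀ k f → ⟦ sw k ⟧ (⟦ sw k ⟧ f) ≐ f
    sw-sw k f v = cong f (invol _ k)

    sw-far : ∀ {i k} → suc (suc i) ℕ.≤ k → Comm (sw i) (sw k)
    sw-far le = mk λ f v → cong f (far _ le)

    In-far : ∀ p {m i} → In m p → m ℕ.≤ i → Comm p (sw i)
    In-far (sw k) h le = sw-far (ℕP.≤-trans h le)
    In-far (κ c) h le = comm-κ c _
    In-far (p ∔ q) (a , b) le = comm-∔ (In-far p a le) (In-far q b le)
    In-far (p ⊙ q) (a , b) le = comm-⊙ (In-far p a le) (In-far q b le)

    -- With x = `X i`, the element is t s x s t + t s t + t. The braid relation carries s through
    -- the first summand, since s t s x s t = t s t x s t = t s x t s t = t s x s t s, and exchanges
    -- the other two: s (t s t) = t s and s t = (t s t) s.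
    sw-X-next : ∀ i → suc (suc i) ℕ.< n → Comm (sw i) (X (suc (suc i)))
    sw-X-next i lt = mk go
      where
      s t : Op
      s = sw i
      t = sw (suc i)
      go : ∀ f → ⟦ s ⟧ (⟦ X (suc (suc i)) ⟧ f) ≐ ⟦ X (suc (suc i)) ⟧ (⟦ s ⟧ f)
      go f {π} v = trans (cong₂ _+_ (cong₂ _+_ first second) third)
          (solve 3 (λ a b c → (a :+ b) :+ c := (a :+ c) :+ b) refl
            (⟦ X i ⟧ (⟦ s ⟧ (⟦ t ⟧ (⟦ s ⟧ f))) (π · suc i · i)) _ _)
        where
        first : ⟦ X i ⟧ (⟦ s ⟧ (⟦ t ⟧ f)) (π · i · suc i · i) ≡
                ⟦ X i ⟧ (⟦ s ⟧ (⟦ t ⟧ (⟦ s ⟧ f))) (π · suc i · i)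
        first = trans (cong (⟦ X i ⟧ (⟦ s ⟧ (⟦ t ⟧ f))) (braid i lt v))
          (trans (sym (comm (In-far (X i) (In-X i) ℕP.≤-refl) (⟦ s ⟧ (⟦ t ⟧ f)) (val-· i (val-· (suc i) v))))
                 (⟦⟧-cong (X i) (λ w → cong f (sym (braid i lt w))) (val-· i (val-· (suc i) v))))
        second : f (π · i · suc i · i · suc i) ≡ f (π · suc i · i)
        second = cong f (trans (cong (_· suc i) (braid i lt v)) (invol _ (suc i)))
        third : f (π · i · suc i) ≡ f (π · suc i · i · suc i · i)
        third = cong f (sym (trans (cong (_· i) (sym (braid i lt v))) (invol _ i)))

    sw-X : ∀ {i} j → suc (suc i) ℕ.≤ j → j ℕ.< n → Comm (sw i) (X j)
    sw-X {i} (suc j) le lt with ℕP.m≤n⇒m<n∨m≡n le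
    ... | inj₂ refl = sw-X-next i lt
    ... | inj₁ (s≤s le′) = comm-sym (comm-∔
            (comm-⊙ js (comm-⊙ (comm-sym (sw-X j le′ (ℕP.<-trans (ℕP.n<1+n j) lt))) js)) js)
      where
      js : Comm (sw j) (sw i)
      js = comm-sym (sw-far le′)

    In-X-comm : ∀ p {m} → In m p → m ℕ.< n → Comm p (X m)
    In-X-comm (sw k) {m} h lt = sw-X m h lt
    In-X-comm (κ c) {m} h lt = comm-κ c (X m)
    In-X-comm (p ∔ q) (a , b) lt = comm-∔ (In-X-comm p a lt) (In-X-comm q b lt)
    In-X-comm (p ⊙ q) (a , b) lt = comm-⊙ (In-X-comm p a lt) (In-X-comm q b lt)

    -- The element with the smaller index lies in the group algebra of a symmetric group that the
    -- other one centralises.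
    X-comm : ∀ i j → i ℕ.< n → j ℕ.< n → Comm (X i) (X j)
    X-comm i j i<n j<n with ℕP.<-cmp i j
    ... | tri< i<j _ _ = In-X-comm (X i) (In-mono (X i) i<j (In-X i)) j<n
    ... | tri≈ _ refl _ = mk λ f v → refl
    ... | tri> _ _ j<i = comm-sym (In-X-comm (X j) (In-mono (X j) j<i (In-X j)) i<n)

    -- The degenerate affine Hecke relation y s = s x + 1, for x = `X j` and y = `X (suc j)`;
    -- `sw-X-suc` is its mirror image s y = x s + 1.
    X-sw : ∀ j f → ⟦ X (suc j) ⟧ (⟦ sw j ⟧ f) ≐ ⟦ sw j ⟧ (⟦ X j ⟧ f) +ᵛ f
    X-sw j f v = cong₂ _+_ (⟦⟧-cong (X j) (sw-sw j f) (val-· j v)) (sw-sw j f v)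

    sw-X-suc : ∀ j f → ⟦ sw j ⟧ (⟦ X (suc j) ⟧ f) ≐ ⟦ X j ⟧ (⟦ sw j ⟧ f) +ᵛ f
    sw-X-suc j f {π} v = cong₂ _+_ (cong (⟦ X j ⟧ (⟦ sw j ⟧ f)) (invol π j)) (sw-sw j f v)

    -- The Gelfand-Tsetlin subalgebra, the polynomials in the first m Jucys-Murphy elements. Being
    -- commutative, it consists of self-adjoint operators.
    data Pol (m : ℕ) : Op → Set where
      pol-X : ∀ {j} → j ℕ.< m → Pol m (X j)
      pol-κ : ∀ c → Pol m (κ c)
      pol-∔ : ∀ {p q} → Pol m p → Pol m q → Pol m (p ∔ q)
      pol-⊙ : ∀ {p q} → Pol m p → Pol m q → Pol m (p ⊙ q)

    Pol-mono : ∀ {m m′ p} → m ℕ.≤ m′ → Pol m p → Pol m′ p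
    Pol-mono le (pol-X j) = pol-X (ℕP.≤-trans j le)
    Pol-mono le (pol-κ c) = pol-κ c
    Pol-mono le (pol-∔ a b) = pol-∔ (Pol-mono le a) (Pol-mono le b)
    Pol-mono le (pol-⊙ a b) = pol-⊙ (Pol-mono le a) (Pol-mono le b)

    Pol-In : ∀ {m p} → Pol m p → In m p
    Pol-In (pol-X {j} lt) = In-mono (X j) lt (In-X j)
    Pol-In (pol-κ c) = tt
    Pol-In (pol-∔ a b) = Pol-In a , Pol-In b
    Pol-In (pol-⊙ a b) = Pol-In a , Pol-In b

    Pol-comm-X : ∀ {p j} → Pol n p → j ℕ.< n → Comm p (X j)
    Pol-comm-X (pol-X lt) lt′ = X-comm _ _ lt lt′
    Pol-comm-X {j = j} (pol-κ c) lt = comm-κ c (X j)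
    Pol-comm-X (pol-∔ {p} {q} a b) lt = comm-∔ (Pol-comm-X a lt) (Pol-comm-X b lt)
    Pol-comm-X (pol-⊙ {p} {q} a b) lt = comm-⊙ (Pol-comm-X a lt) (Pol-comm-X b lt)

    Pol-comm : ∀ {p q} → Pol n p → Pol n q → Comm p q
    Pol-comm {p} {q} a b = comm-sym (go b)
      where
      go : ∀ {q} → Pol n q → Comm q p
      go (pol-X {j} lt) = comm-sym (Pol-comm-X a lt)
      go (pol-κ c) = comm-κ c p
      go (pol-∔ {q} {r} x y) = comm-∔ (go x) (go y)
      go (pol-⊙ {q} {r} x y) = comm-⊙ (go x) (go y)

    ⟨_,_⟩ : V → V → ℚ
    ⟨ f , g ⟩ = ∑ (λ π → f π * g π) enum

    ⟨⟩-cong : ∀ {f f′ g g′} → f ≐ f′ → g ≐ g′ → ⟨ f , g ⟩ ≡ ⟨ f′ , g′ ⟩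
    ⟨⟩-cong h k = ∑-cong enum (λ π m → cong₂ _*_ (h (enum-val m)) (k (enum-val m)))

    ∑ₑ-+ : ∀ f g h → ∑ (λ π → (f π + g π) * h π) enum ≡ ⟨ f , h ⟩ + ⟨ g , h ⟩
    ∑ₑ-+ f g h = trans (∑-cong′ enum (λ π → *-distribʳ-+ (h π) (f π) (g π)))
      (∑-+ (λ π → f π * h π) (λ π → g π * h π) enum)

    ⟨⟩-sym : ∀ f g → ⟨ f , g ⟩ ≡ ⟨ g , f ⟩
    ⟨⟩-sym f g = ∑-cong′ enum (λ π → *-comm (f π) (g π))

    record SA (p : Op) : Set where
      constructor mk
      field sa : ∀ f g → ⟨ ⟦ p ⟧ f , g ⟩ ≡ ⟨ f , ⟦ p ⟧ g ⟩
    open SA public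

    SA-sw : ∀ k → SA (sw k)
    SA-sw k = mk λ f g → trans (sym (∑-↭ (λ π → f (π · k) * g π) (enum-· k)))
      (trans (∑-map (λ π → f (π · k) * g π) (_· k) enum)
      (∑-cong′ enum (λ π → cong (λ ρ → f ρ * g (π · k)) (invol π k))))

    SA-κ : ∀ c → SA (κ c)
    SA-κ c = mk λ f g → ∑-cong′ enum (λ π → solve 3 (λ c f g → (c :* f) :* g := f :* (c :* g)) refl c (f π) (g π))

    SA-∔ : ∀ {p q} → SA p → SA q → SA (p ∔ q)
    SA-∔ {p} {q} a b = mk λ f g → trans (∑ₑ-+ (⟦ p ⟧ f) (⟦ q ⟧ f) g)
      (trans (cong₂ _+_ (trans (sa a f g) (⟨⟩-sym f (⟦ p ⟧ g))) (trans (sa b f g) (⟨⟩-sym f (⟦ q ⟧ g))))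
      (trans (sym (∑ₑ-+ (⟦ p ⟧ g) (⟦ q ⟧ g) f)) (⟨⟩-sym (⟦ p ∔ q ⟧ g) f)))

    SA-⊙ : ∀ {p q} → Comm p q → SA p → SA q → SA (p ⊙ q)
    SA-⊙ {p} {q} c a b = mk λ f g → trans (sa a (⟦ q ⟧ f) g) (trans (sa b f (⟦ p ⟧ g))
      (⟨⟩-cong {f} {f} (λ v → refl) (λ v → sym (comm c g v))))

    SA-X : ∀ j → SA (X j)
    SA-X zero = SA-κ 0ℚ
    SA-X (suc j) = SA-∔ (mk λ f g → trans (sa (SA-sw j) (⟦ X j ⟧ (⟦ sw j ⟧ f)) g)
      (trans (sa (SA-X j) (⟦ sw j ⟧ f) (⟦ sw j ⟧ g)) (sa (SA-sw j) f (⟦ X j ⟧ (⟦ sw j ⟧ g))))) (SA-sw j)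

    Pol-SA : ∀ {p} → Pol n p → SA p
    Pol-SA (pol-X {j} lt) = SA-X j
    Pol-SA (pol-κ c) = SA-κ c
    Pol-SA (pol-∔ {p} {q} a b) = SA-∔ (Pol-SA a) (Pol-SA b)
    Pol-SA (pol-⊙ {p} {q} a b) = SA-⊙ (Pol-comm a b) (Pol-SA a) (Pol-SA b)

    -- ⟨p f, p f⟩ = ⟨p p f, f⟩ = 0, and a vanishing sum of rational squares has only zero terms.
    SA-nilpotent : ∀ {p} → SA p → ∀ {f} → ⟦ p ⟧ (⟦ p ⟧ f) ≐ 0ᵛ → ⟦ p ⟧ f ≐ 0ᵛ
    SA-nilpotent {p} a {f} h {π} v = sq-zero _
      (∑-nonneg-zero enum (λ ρ → sq-nonneg (⟦ p ⟧ f ρ)) norm π (enum-complete v))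
      where
      norm : ⟨ ⟦ p ⟧ f , ⟦ p ⟧ f ⟩ ≡ 0ℚ
      norm = trans (sym (sa a (⟦ p ⟧ f) f)) (∑-zero enum (λ ρ m → trans (cong (_* f ρ) (h (enum-val m))) (*-zeroˡ (f ρ))))

    sub : Op → ℤ → Op
    sub y a = y ∔ κ (- ℤ→ℚ a)

    prodSub : Op → List ℤ → Op
    prodSub y = foldr (λ a r → sub y a ⊙ r) (κ 1ℚ)

    prodSub-comm : ∀ {p y} → Comm p y → ∀ L → Comm p (prodSub y L)
    prodSub-comm {p} {y} c L = comm-sym (go L)
      where
      go : ∀ L → Comm (prodSub y L) p
      go [] = comm-κ 1ℚ p
      go (a ∷ L) = comm-⊙ (comm-∔ (comm-sym c) (comm-κ _ p)) (go L)

    record Eigen (y : Op) (a : ℤ) (W : V) : Set where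
      constructor mk
      field eig : ⟦ y ⟧ W ≐ ℤ→ℚ a *ᵛ W
    open Eigen public

    sub-eigen : ∀ {y a W} → ⟦ sub y a ⟧ W ≐ 0ᵛ → Eigen y a W
    sub-eigen {y} {a} {W} h = mk λ {π} v → trans (solve 2 (λ z w → z := (z :+ (:- w)) :+ w) refl (⟦ y ⟧ W π) (ℤ→ℚ a * W π))
      (trans (cong (_+ ℤ→ℚ a * W π) (trans (cong (⟦ y ⟧ W π +_) (neg-distribˡ-* (ℤ→ℚ a) (W π))) (h v))) (+-identityˡ _))

    eigen-sub : ∀ {y a W} b → Eigen y a W → ⟦ sub y b ⟧ W ≐ (ℤ→ℚ a - ℤ→ℚ b) *ᵛ W
    eigen-sub {y} {a} {W} b h {π} v = trans (cong (_+ - ℤ→ℚ b * W π) (eig h v))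
      (solve 3 (λ a b w → a :* w :+ (:- b) :* w := (a :- b) :* w) refl (ℤ→ℚ a) (ℤ→ℚ b) (W π))

    eigen-comm : ∀ {y a W} p → Comm p y → Eigen y a W → Eigen y a (⟦ p ⟧ W)
    eigen-comm {y} {a} {W} p c h = mk λ v → trans (sym (comm c W v)) (trans (⟦⟧-cong p (eig h) v) (⟦⟧-* p (ℤ→ℚ a) W v))

    eigen-0 : ∀ {y a b W} → a ≢ b → Eigen y a W → Eigen y b W → W ≐ 0ᵛ
    eigen-0 {y} {a} {b} {W} ne ha hb {π} v = zero-product (ℤ→ℚ a - ℤ→ℚ b) (W π)
      (λ e → ne (ℤ→ℚ-injective (trans (solve 2 (λ a b → a := (a :- b) :+ b) refl (ℤ→ℚ a) (ℤ→ℚ b))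
                (trans (cong (_+ ℤ→ℚ b) e) (+-identityˡ _)))))
      (trans (solve 3 (λ a b w → (a :- b) :* w := a :* w :- b :* w) refl (ℤ→ℚ a) (ℤ→ℚ b) (W π))
      (trans (cong (_- ℤ→ℚ b * W π) (trans (sym (eig ha v)) (eig hb v))) (+-inverseʳ (ℤ→ℚ b * W π))))

    -- Self-adjointness makes y semisimple on the span of its eigenvectors:
    -- an operator that kills the eigenvectors with eigenvalue in L also kills
    -- whatever is annihilated by ∏_{a ∈ L} (y - a).
    spectral : ∀ {g y} (S : ℤ → Set) → SA g → Comm g y →
      (∀ {a W} → S a → Eigen y a W → ⟦ g ⟧ W ≐ 0ᵛ) →
      ∀ L → All S L → ∀ {W} → ⟦ prodSub y L ⟧ W ≐ 0ᵛ → ⟦ g ⟧ W ≐ 0ᵛ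
    spectral {g} {y} S a′ c kill [] [] {W} h = ⟦⟧-0 g (λ {π} v → trans (sym (*-identityˡ (W π))) (h v))
    spectral {g} {y} S a′ c kill (a ∷ L) (s ∷ ss) {W} h =
      SA-nilpotent a′ (kill s (sub-eigen (λ v → trans (sym (comm gc W v)) (ih v))))
      where
      gc : Comm g (sub y a)
      gc = comm-sym (comm-∔ (comm-sym c) (comm-κ _ g))
      sc : Comm (sub y a) y
      sc = comm-∔ (mk λ f v → refl) (comm-κ _ y)
      ih : ⟦ g ⟧ (⟦ sub y a ⟧ W) ≐ 0ᵛ
      ih = spectral {g} {y} S a′ c kill L ss {⟦ sub y a ⟧ W}
        (λ v → trans (sym (comm (prodSub-comm sc L) W v)) (h v))

  ∈-filterB⁺ : (b : A → Bool) {x : A} (xs : List A) → x ∈ xs → b x ≡ true → x ∈ filterB b xs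
  ∈-filterB⁺ b (x ∷ xs) (here refl) e rewrite e = here refl
  ∈-filterB⁺ b (x ∷ xs) (there m) e with b x
  ... | true = there (∈-filterB⁺ b xs m e)
  ... | false = ∈-filterB⁺ b xs m e

  ∈-filterB⁻ : (b : A → Bool) {x : A} (xs : List A) → x ∈ filterB b xs → x ∈ xs × b x ≡ true
  ∈-filterB⁻ b (y ∷ xs) m with b y in e
  ... | false = let (k , h) = ∈-filterB⁻ b xs m in there k , h
  ∈-filterB⁻ b (y ∷ xs) (here refl) | true = here refl , e
  ∈-filterB⁻ b (y ∷ xs) (there m) | true = let (k , h) = ∈-filterB⁻ b xs m in there k , h

  filterB-unique : (b : A → Bool) (xs : List A) → Unique xs → Unique (filterB b xs)
  filterB-unique b [] [] = []
  filterB-unique b (x ∷ xs) (x∉ ∷ u) with b x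
  ... | true = All.tabulate (λ m → All.lookup x∉ (proj₁ (∈-filterB⁻ b xs m))) ∷ filterB-unique b xs u
  ... | false = filterB-unique b xs u

  range-unique : ∀ a b → Unique (range a b)
  range-unique a b = Uniqueₚ.applyUpTo⁺₁ _ _ (λ i<j _ e → ℕP.<⇒≢ i<j (ℕP.+-cancelˡ-≡ a _ _ e))

  ∈-range⁺ : ∀ {a b x} → a ℕ.≤ x → x ℕ.≤ b → x ∈ range a b
  ∈-range⁺ {a} {b} {x} le le′ = subst (_∈ range a b) (ℕP.m+[n∸m]≡n le)
    (∈-applyUpTo⁺ _ (ℕP.≤-trans (ℕP.≤-reflexive (sym (ℕP.+-∸-assoc 1 le))) (ℕP.∸-monoˡ-≤ a (s≤s le′))))

  ∈-range⁻ : ∀ {a b x} → x ∈ range a b → a ℕ.≤ x × x ℕ.≤ b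
  ∈-range⁻ {a} {b} m with ∈-applyUpTo⁻ (a ℕ.+_) m
  ... | i , lt , refl = ℕP.m≤m+n a i , ℕP.≤-pred (ℕP.≤-trans (ℕP.≤-reflexive (sym (ℕP.+-suc a i)))
          (ℕP.≤-trans (ℕP.+-monoʳ-≤ a lt) (ℕP.≤-reflexive (ℕP.m+[n∸m]≡n
            (ℕP.<⇒≤ (ℕP.m∸n≢0⇒n<m {suc b} {a} (λ e → ℕP.n≮0 (subst (i ℕ.<_) e lt))))))))

  -- The possible contents of the (j+1)-st box.
  contents : ℕ → List ℤ
  contents j = contentRange (suc j)

  contents-unique : ∀ j → Unique (contents j)
  contents-unique j = Uniqueₚ.map⁺ (λ {x} {y} e → ℤP.+-injective (ℤG.∙-cancelʳ (ℤ.- ℤ.+ j) (ℤ.+ x) (ℤ.+ y) e)) (range-unique 0 (2 ℕ.* j))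

  ∈-contents⁺ : ∀ {j a} → ℤ.∣ a ∣ ℕ.≤ j → a ∈ contents j
  ∈-contents⁺ {j} {ℤ.+ m} le = subst (_∈ contents j) e (∈-map⁺ (λ a → ℤ.+ a ℤ.- ℤ.+ j) (∈-range⁺ {0} {2 ℕ.* j} {m ℕ.+ j} z≤n
      (ℕP.+-mono-≤ le (ℕP.≤-reflexive (sym (ℕP.+-identityʳ j))))))
    where
    e : ℤ.+ (m ℕ.+ j) ℤ.- ℤ.+ j ≡ ℤ.+ m
    e = trans (cong (ℤ._- ℤ.+ j) (ℤP.pos-+ m j)) (trans (ℤP.+-assoc (ℤ.+ m) (ℤ.+ j) (ℤ.- ℤ.+ j))
          (trans (cong (λ z → ℤ.+ m ℤ.+ z) (ℤP.+-inverseʳ (ℤ.+ j))) (ℤP.+-identityʳ (ℤ.+ m))))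
  ∈-contents⁺ {j} { -[1+ m ]} le = subst (_∈ contents j) e (∈-map⁺ (λ a → ℤ.+ a ℤ.- ℤ.+ j) (∈-range⁺ {0} {2 ℕ.* j} {j ℕ.∸ suc m} z≤n
      (ℕP.≤-trans (ℕP.m∸n≤m j (suc m)) (ℕP.m≤m+n j _))))
    where
    e : ℤ.+ (j ℕ.∸ suc m) ℤ.- ℤ.+ j ≡ -[1+ m ]
    e = trans (ℤP.m-n≡m⊖n (j ℕ.∸ suc m) j) (trans (ℤP.⊖-≤ (ℕP.m∸n≤m j (suc m)))
          (cong (λ k → ℤ.- (ℤ.+ k)) (ℕP.m∸[m∸n]≡n le)))

  ∈-contents⁻ : ∀ {j a} → a ∈ contents j → ℤ.∣ a ∣ ℕ.≤ j
  ∈-contents⁻ {j} m with ∈-map⁻ (λ a → ℤ.+ a ℤ.- ℤ.+ j) m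
  ... | k , mk , refl with ∈-range⁻ {0} {2 ℕ.* j} mk | ℕP.≤-total k j
  ...   | _ , le | inj₁ k≤j = subst (λ z → ℤ.∣ z ∣ ℕ.≤ j) (sym (trans (ℤP.m-n≡m⊖n k j) (ℤP.⊖-≤ k≤j)))
            (subst (ℕ._≤ j) (sym (ℤP.∣-i∣≡∣i∣ (ℤ.+ (j ℕ.∸ k)))) (ℕP.m∸n≤m j k))
  ...   | _ , le | inj₂ j≤k = subst (λ z → ℤ.∣ z ∣ ℕ.≤ j) (sym (trans (ℤP.m-n≡m⊖n k j) (ℤP.⊖-≥ j≤k)))
            (ℕP.≤-trans (ℕP.∸-monoˡ-≤ j le) (ℕP.≤-reflexive (trans (ℕP.m+n∸m≡n j (j ℕ.+ 0)) (ℕP.+-identityʳ j))))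

  -- Intertwiners and the integral spectrum of each Jucys-Murphy element

  module Spectrum (𝒜 : CoxeterAction) where
    open CoxeterAction 𝒜
    open Operators 𝒜

    -- The intertwiner s(x - y) + 1 of x = X i and y = X (i+1), s = sw i.
    Φ : ℕ → Op
    Φ i = (sw i ⊙ (X i ∔ κ (- 1ℚ) ⊙ X (suc i))) ∔ κ 1ℚ

    module _ (i : ℕ) (lt : suc i ℕ.< n) where
      private
        x y : V → V
        x = ⟦ X i ⟧
        y = ⟦ X (suc i) ⟧
        i<n : i ℕ.< n
        i<n = ℕP.<-trans (ℕP.n<1+n i) lt
        xy : ∀ f → x (y f) ≐ y (x f)
        xy = comm (X-comm i (suc i) i<n lt)
        diff : V → V
        diff f π = x f π + - 1ℚ * y f π

      Φ-y : ∀ f → y (⟦ Φ i ⟧ f) ≐ ⟦ Φ i ⟧ (x f)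
      Φ-y f {π} v = trans (⟦⟧-+ (X (suc i)) (⟦ sw i ⟧ (diff f)) (1ℚ *ᵛ f) v)
        (trans (cong₂ _+_ (trans (X-sw i (diff f) v) (cong (_+ diff f π) xd)) (⟦⟧-* (X (suc i)) 1ℚ f v))
        (solve 4 (λ a b c d → (a :+ con (- 1ℚ) :* b) :+ (c :+ con (- 1ℚ) :* d) :+ con 1ℚ :* d
                    := (a :+ con (- 1ℚ) :* b) :+ con 1ℚ :* c) refl
          (x (x f) ρ) (y (x f) ρ) (x f π) (y f π)))
        where
        ρ = π · i
        xd : x (diff f) ρ ≡ x (x f) ρ + - 1ℚ * y (x f) ρ
        xd = trans (⟦⟧-+ (X i) (x f) ((- 1ℚ) *ᵛ y f) (val-· i v))
          (cong (x (x f) ρ +_) (trans (⟦⟧-* (X i) (- 1ℚ) (y f) (val-· i v)) (cong (- 1ℚ *_) (xy f (val-· i v)))))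

      Φ-x : ∀ f → x (⟦ Φ i ⟧ f) ≐ ⟦ Φ i ⟧ (y f)
      Φ-x f {π} v = trans (⟦⟧-+ (X i) (⟦ sw i ⟧ (diff f)) (1ℚ *ᵛ f) v)
        (trans (cong₂ _+_ xs (⟦⟧-* (X i) 1ℚ f v))
        (solve 4 (λ a b c d → ((a :+ con (- 1ℚ) :* b) :- (c :+ con (- 1ℚ) :* d)) :+ con 1ℚ :* c
                    := (a :+ con (- 1ℚ) :* b) :+ con 1ℚ :* d) refl
          (x (y f) ρ) (y (y f) ρ) (x f π) (y f π)))
        where
        ρ = π · i
        yd : y (diff f) ρ ≡ x (y f) ρ + - 1ℚ * y (y f) ρ
        yd = trans (⟦⟧-+ (X (suc i)) (x f) ((- 1ℚ) *ᵛ y f) (val-· i v))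
          (cong₂ _+_ (sym (xy f (val-· i v))) (⟦⟧-* (X (suc i)) (- 1ℚ) (y f) (val-· i v)))
        xs : x (⟦ sw i ⟧ (diff f)) π ≡ (x (y f) ρ + - 1ℚ * y (y f) ρ) - diff f π
        xs = trans (solve 2 (λ a b → a := (a :+ b) :- b) refl (x (⟦ sw i ⟧ (diff f)) π) (diff f π))
          (cong (_- diff f π) (trans (sym (sw-X-suc i (diff f) v)) yd))

      -- The square is 1 - (x - y)². On an eigenvector of x with eigenvalue a it becomes -(y - a -
      -- 1)(y - a + 1), the source of the neighbours a + 1 and a - 1 in `minimal-poly`.
      Φ-Φ : ∀ f → ⟦ Φ i ⟧ (⟦ Φ i ⟧ f) ≐
        (λ π → f π - (x (x f) π - (1ℚ + 1ℚ) * y (x f) π + y (y f) π))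
      Φ-Φ f {π} v = trans (cong₂ (λ a b → (a + - 1ℚ * b) + 1ℚ * ⟦ Φ i ⟧ f π)
          (trans (Φ-x f w) (exp (y f))) (trans (Φ-y f w) (exp (x f))))
        (trans (cong (λ z → ((z + - 1ℚ * yy + 1ℚ * yf) + - 1ℚ * (xx + - 1ℚ * yx + 1ℚ * xf)) + 1ℚ * (xf + - 1ℚ * yf + 1ℚ * f π))
                 (xy f v))
        (solve 6 (λ f xf yf xx yx yy →
            ((yx :+ con (- 1ℚ) :* yy :+ con 1ℚ :* yf) :+ con (- 1ℚ) :* (xx :+ con (- 1ℚ) :* yx :+ con 1ℚ :* xf)) :+ con 1ℚ :* (xf :+ con (- 1ℚ) :* yf :+ con 1ℚ :* f)
            := f :- (xx :- con (1ℚ + 1ℚ) :* yx :+ yy)) refl (f π) xf yf xx yx yy))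
        where
        ρ = π · i
        w = val-· i v
        xf = x f ρ
        yf = y f ρ
        xx = x (x f) π
        yx = y (x f) π
        yy = y (y f) π
        exp : ∀ g → ⟦ Φ i ⟧ g ρ ≡ x g π + - 1ℚ * y g π + 1ℚ * g ρ
        exp g = cong (λ τ → x g τ + - 1ℚ * y g τ + 1ℚ * g ρ) (invol π i)

      Φ-prodSub : ∀ L f → ⟦ prodSub (X (suc i)) L ⟧ (⟦ Φ i ⟧ f) ≐ ⟦ Φ i ⟧ (⟦ prodSub (X i) L ⟧ f)
      Φ-prodSub [] f v = comm (comm-κ 1ℚ (Φ i)) f v
      Φ-prodSub (a ∷ L) f {π} v = trans (⟦⟧-cong (sub (X (suc i)) a) (Φ-prodSub L f) v)
        (trans (cong₂ _+_ (Φ-y g v) (sym (⟦⟧-* (Φ i) (- ℤ→ℚ a) g v))) (sym (⟦⟧-+ (Φ i) (x g) ((- ℤ→ℚ a) *ᵛ g) v)))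
        where g = ⟦ prodSub (X i) L ⟧ f

    prodSub-kill : ∀ {y c W} L → c ∈ L → Eigen y c W → ⟦ prodSub y L ⟧ W ≐ 0ᵛ
    prodSub-kill {y} {c} {W} (a ∷ L) (here refl) h {π} v =
      trans (eigen-sub c (eigen-comm (prodSub y L) (comm-sym (prodSub-comm (mk λ f v → refl) L)) h) v)
      (trans (cong (_* ⟦ prodSub y L ⟧ W π) (+-inverseʳ (ℤ→ℚ c))) (*-zeroˡ (⟦ prodSub y L ⟧ W π)))
    prodSub-kill {y} (a ∷ L) (there m) h = ⟦⟧-0 (sub y a) (prodSub-kill L m h)

    Pol-sub : ∀ {m j} a → j ℕ.< m → Pol m (sub (X j) a)
    Pol-sub a lt = pol-∔ (pol-X lt) (pol-κ _)

    Pol-prodSub : ∀ {m j} L → j ℕ.< m → Pol m (prodSub (X j) L)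
    Pol-prodSub [] lt = pol-κ _
    Pol-prodSub (a ∷ L) lt = pol-⊙ (Pol-sub a lt) (Pol-prodSub L lt)

    -- Induction on j. Let W be an x-eigenvector with eigenvalue a, and let q have the roots -j,
    -- ..., j. Then (y - a - 1)(y - a + 1) q(y) W = -q(y) Φ Φ W = -Φ q(x) Φ W, which is 0 by
    -- induction applied to Φ W. All roots of this annihilator have absolute value at most j + 1,
    -- and `spectral` discards their multiplicities. A second use of `spectral`, for x, passes from
    -- eigenvectors to all functions.
    minimal-poly : ∀ j → j ℕ.< n → ∀ W → ⟦ prodSub (X j) (contents j) ⟧ W ≐ 0ᵛ
    minimal-poly zero lt W {π} v = solve 1 (λ w → con 0ℚ :* (con 1ℚ :* w) :+ (con (- ℤ→ℚ (ℤ.+ 0))) :* (con 1ℚ :* w) := con 0ℚ) refl (W π)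
    minimal-poly (suc j) lt W =
      spectral (λ a → ℤ.∣ a ∣ ℕ.≤ j) gSA (Pol-comm gPol (pol-X j<n)) killx (contents j) (All.tabulate ∈-contents⁻)
        {W} (minimal-poly j j<n W)
      where
      j<n : j ℕ.< n
      j<n = ℕP.<-trans (ℕP.n<1+n j) lt
      x y g : Op
      x = X j
      y = X (suc j)
      g = prodSub y (contents (suc j))
      gPol : Pol n g
      gPol = Pol-prodSub (contents (suc j)) lt
      gSA : SA g
      gSA = Pol-SA gPol
      killx : ∀ {a W} → ℤ.∣ a ∣ ℕ.≤ j → Eigen x a W → ⟦ g ⟧ W ≐ 0ᵛ
      killx {a} {W} le h = spectral {g} {y} (λ c → ℤ.∣ c ∣ ℕ.≤ suc j) gSA (Pol-comm gPol (pol-X lt))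
          (λ b → prodSub-kill (contents (suc j)) (∈-contents⁺ b))
          (a ℤ.+ ℤ.+ 1 ∷ a ℤ.- ℤ.+ 1 ∷ contents j)
          (ℕP.≤-trans (ℤP.∣i+j∣≤∣i∣+∣j∣ a (ℤ.+ 1)) (ℕP.≤-trans (ℕP.≤-reflexive (ℕP.+-comm _ 1)) (s≤s le))
            ∷ ℕP.≤-trans (ℤP.∣i+j∣≤∣i∣+∣j∣ a (ℤ.- ℤ.+ 1)) (ℕP.≤-trans (ℕP.≤-reflexive (ℕP.+-comm _ 1)) (s≤s le))
            ∷ All.tabulate (λ m → ℕP.m≤n⇒m≤1+n (∈-contents⁻ m)))
          {W} killed
        where
        α : ℚ
        α = ℤ→ℚ a
        q = prodSub y (contents j)
        A₊ = ℤ→ℚ (a ℤ.+ ℤ.+ 1)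
        A₋ = ℤ→ℚ (a ℤ.- ℤ.+ 1)
        two : Op
        two = sub y (a ℤ.+ ℤ.+ 1) ⊙ sub y (a ℤ.- ℤ.+ 1)
        ΦΦ : ⟦ two ⟧ W ≐ (- 1ℚ) *ᵛ ⟦ Φ j ⟧ (⟦ Φ j ⟧ W)
        ΦΦ {π} v = trans (cong₂ _+_
            (trans (⟦⟧-+ y (⟦ y ⟧ W) ((- A₋) *ᵛ W) v) (cong (⟦ y ⟧ (⟦ y ⟧ W) π +_) (⟦⟧-* y (- A₋) W v)))
            refl)
          (trans (cong₂ (λ p m → (yy + (- m) * yw) + (- p) * (yw + (- m) * w)) (ℤ→ℚ-+ a (ℤ.+ 1)) (ℤ→ℚ-- a (ℤ.+ 1)))
          (trans (solve 4 (λ a w yw yy → (yy :+ (:- (a :- con 1ℚ)) :* yw) :+ (:- (a :+ con 1ℚ)) :* (yw :+ (:- (a :- con 1ℚ)) :* w)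
                := con (- 1ℚ) :* (w :- (a :* (a :* w) :- con (1ℚ + 1ℚ) :* (a :* yw) :+ yy))) refl α w yw yy)
          (cong (- 1ℚ *_) (sym (trans (Φ-Φ j lt W v) (cong₂ (λ p r → w - (p - (1ℚ + 1ℚ) * r + yy)) xx yx))))))
          where
          w = W π
          yw = ⟦ y ⟧ W π
          yy = ⟦ y ⟧ (⟦ y ⟧ W) π
          xx : ⟦ x ⟧ (⟦ x ⟧ W) π ≡ α * (α * w)
          xx = trans (⟦⟧-cong x (eig h) v) (trans (⟦⟧-* x α W v) (cong (α *_) (eig h v)))
          yx : ⟦ y ⟧ (⟦ x ⟧ W) π ≡ α * yw
          yx = trans (⟦⟧-cong y (eig h) v) (⟦⟧-* y α W v)
        killed : ⟦ two ⟧ (⟦ q ⟧ W) ≐ 0ᵛ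
        killed {π} v = trans (comm (Pol-comm (pol-⊙ (Pol-sub (a ℤ.+ ℤ.+ 1) lt) (Pol-sub (a ℤ.- ℤ.+ 1) lt)) (Pol-prodSub (contents j) lt)) W v)
          (trans (⟦⟧-cong q ΦΦ v) (trans (⟦⟧-* q (- 1ℚ) (⟦ Φ j ⟧ (⟦ Φ j ⟧ W)) v)
          (trans (cong (- 1ℚ *_) (trans (Φ-prodSub j lt (contents j) (⟦ Φ j ⟧ W) v)
            (⟦⟧-0 (Φ j) (minimal-poly j j<n (⟦ Φ j ⟧ W)) v))) refl)))

    fac : ℕ → ℤ → ℤ → Op
    fac j d c = κ (inv (ℤ→ℚ (d ℤ.- c))) ⊙ sub (X j) c

    prodOp : List Op → Op
    prodOp = foldr _⊙_ (κ 1ℚ)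

    others : ℕ → ℤ → List ℤ
    others j d = filterB (λ c → not (does (c ℤ.≟ d))) (contents j)

    -- The Lagrange projection onto the eigenspace X j = d.
    proj : ℕ → ℤ → Op
    proj j d = prodOp (map (fac j d) (others j d))

    ∈-others⁻ : ∀ {j d c} → c ∈ others j d → c ≢ d
    ∈-others⁻ {j} {d} {c} m e with c ℤ.≟ d | proj₂ (∈-filterB⁻ (λ c → not (does (c ℤ.≟ d))) (contents j) m)
    ... | yes _ | ()
    ... | no ne | _ = ne e

    ∈-others⁺ : ∀ {j d c} → c ∈ contents j → c ≢ d → c ∈ others j d
    ∈-others⁺ {j} {d} {c} m ne = ∈-filterB⁺ _ (contents j) m lem
      where
      lem : not (does (c ℤ.≟ d)) ≡ true
      lem with c ℤ.≟ d
      ... | yes e = ⊥-elim (ne e)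
      ... | no _ = refl

    ℤ→ℚ-nonzero : ∀ {a b} → a ≢ b → ℤ→ℚ (a ℤ.- b) ≢ 0ℚ
    ℤ→ℚ-nonzero {a} {b} ne e = ne (ℤP.i-j≡0⇒i≡j a b (ℤ→ℚ-injective e))

    Pol-prodOp : ∀ {m} j d L → j ℕ.< m → Pol m (prodOp (map (fac j d) L))
    Pol-prodOp j d [] lt = pol-κ _
    Pol-prodOp j d (c ∷ L) lt = pol-⊙ (pol-⊙ (pol-κ _) (Pol-sub c lt)) (Pol-prodOp j d L lt)

    Pol-proj : ∀ {m} j d → j ℕ.< m → Pol m (proj j d)
    Pol-proj j d = Pol-prodOp j d (others j d)

    proj-same : ∀ j d {W} → Eigen (X j) d W → ⟦ proj j d ⟧ W ≐ W
    proj-same j d {W} h = go (others j d) (∈-others⁻ {j})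
      where
      go : ∀ L → (∀ {c} → c ∈ L → c ≢ d) → ⟦ prodOp (map (fac j d) L) ⟧ W ≐ W
      go [] ne {π} v = *-identityˡ (W π)
      go (c ∷ L) ne {π} v = trans (⟦⟧-cong (fac j d c) (go L (λ m → ne (there m))) v)
        (trans (cong (inv D *_) (trans (eigen-sub c h v) (cong (_* W π) (sym (ℤ→ℚ-- d c)))))
        (trans (solve 3 (λ i d w → i :* (d :* w) := (d :* i) :* w) refl (inv D) D (W π))
        (trans (cong (_* W π) (*-inv D (ℤ→ℚ-nonzero (λ e → ne (here refl) (sym e))))) (*-identityˡ (W π)))))
        where D = ℤ→ℚ (d ℤ.- c)

    proj-other : ∀ j d {a W} → ℤ.∣ a ∣ ℕ.≤ j → a ≢ d → j ℕ.< n → Eigen (X j) a W → ⟦ proj j d ⟧ W ≐ 0ᵛ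
    proj-other j d {a} {W} le ne lt h = go (others j d) (∈-others⁺ {j} (∈-contents⁺ le) ne)
      where
      go : ∀ L → a ∈ L → ⟦ prodOp (map (fac j d) L) ⟧ W ≐ 0ᵛ
      go (c ∷ L) (here refl) {π} v = trans (cong (inv (ℤ→ℚ (d ℤ.- c)) *_)
        (trans (eigen-sub a (eigen-comm r (Pol-comm (Pol-prodOp j d L lt) (pol-X lt)) h) v)
          (trans (cong (_* U π) (+-inverseʳ (ℤ→ℚ a))) (*-zeroˡ (U π))))) (*-zeroʳ (inv (ℤ→ℚ (d ℤ.- c))))
        where
        r = prodOp (map (fac j d) L)
        U = ⟦ r ⟧ W
      go (c ∷ L) (there m) = ⟦⟧-0 (fac j d c) (go L m)

    -- Every function is annihilated by the minimal polynomial of `X j`, so an identity between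
    -- polynomials in the Jucys-Murphy elements can be checked on eigenvectors of `X j`.
    by-eigenvectors : ∀ {g j} → j ℕ.< n → Pol n g →
      (∀ {a W} → ℤ.∣ a ∣ ℕ.≤ j → Eigen (X j) a W → ⟦ g ⟧ W ≐ 0ᵛ) → ∀ W → ⟦ g ⟧ W ≐ 0ᵛ
    by-eigenvectors {g} {j} lt pg kill W = spectral (λ a → ℤ.∣ a ∣ ℕ.≤ j) (Pol-SA pg) (Pol-comm pg (pol-X lt)) kill
      (contents j) (All.tabulate ∈-contents⁻) {W} (minimal-poly j lt W)

    proj-eigen : ∀ j d → j ℕ.< n → ∀ W → Eigen (X j) d (⟦ proj j d ⟧ W)
    proj-eigen j d lt W = sub-eigen (by-eigenvectors {sub (X j) d ⊙ proj j d} lt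
        (pol-⊙ (Pol-sub d lt) (Pol-proj j d lt)) kill W)
      where
      kill : ∀ {a U} → ℤ.∣ a ∣ ℕ.≤ j → Eigen (X j) a U → ⟦ sub (X j) d ⟧ (⟦ proj j d ⟧ U) ≐ 0ᵛ
      kill {a} {U} le h {π} v with a ℤ.≟ d
      ... | no ne = ⟦⟧-0 (sub (X j) d) (proj-other j d le ne lt h) v
      ... | yes refl = trans (⟦⟧-cong (sub (X j) d) (proj-same j d h) v)
              (trans (eigen-sub d h v) (trans (cong (_* U π) (+-inverseʳ (ℤ→ℚ d))) (*-zeroˡ (U π))))

    sumOp : List Op → Op
    sumOp = foldr _∔_ (κ 0ℚ)

    ⟦sumOp⟧ : ∀ {A : Set} (F : A → Op) L f → ⟦ sumOp (map F L) ⟧ f ≐ (λ π → ∑ (λ a → ⟦ F a ⟧ f π) L)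
    ⟦sumOp⟧ F [] f {π} v = *-zeroˡ (f π)
    ⟦sumOp⟧ F (a ∷ L) f {π} v = cong (⟦ F a ⟧ f π +_) (⟦sumOp⟧ F L f v)

    Pol-sumOp : ∀ {m} {A : Set} {F : A → Op} L → (∀ a → Pol m (F a)) → Pol m (sumOp (map F L))
    Pol-sumOp [] h = pol-κ _
    Pol-sumOp (a ∷ L) h = pol-∔ (h a) (Pol-sumOp L h)

    proj-sum : ∀ j → j ℕ.< n → ∀ W → W ≐ (λ π → ∑ (λ d → ⟦ proj j d ⟧ W π) (contents j))
    proj-sum j lt W {π} v = trans (solve 2 (λ w s → w := s :- (s :+ con (- 1ℚ) :* w)) refl (W π) (⟦ total ⟧ W π))
        (trans (cong (λ z → ⟦ total ⟧ W π - z) (by-eigenvectors {total ∔ κ (- 1ℚ)} lt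
          (pol-∔ (Pol-sumOp (contents j) (λ d → Pol-proj j d lt)) (pol-κ _)) kill W v))
        (trans (solve 1 (λ s → s :- con 0ℚ := s) refl (⟦ total ⟧ W π)) (⟦sumOp⟧ (proj j) (contents j) W v)))
      where
      total : Op
      total = sumOp (map (proj j) (contents j))
      kill : ∀ {a U} → ℤ.∣ a ∣ ℕ.≤ j → Eigen (X j) a U → ⟦ total ∔ κ (- 1ℚ) ⟧ U ≐ 0ᵛ
      kill {a} {U} le h {ρ} w = trans (cong (_+ - 1ℚ * U ρ) (trans (⟦sumOp⟧ (proj j) (contents j) U w)
        (trans (∑-single (contents j) (contents-unique j) a (∈-contents⁺ le)
            (λ d m ne → proj-other j d le (λ e → ne (sym e)) lt h w))
          (proj-same j a h w))))
        (solve 1 (λ u → u :+ con (- 1ℚ) :* u := con 0ℚ) refl (U ρ))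

  sumℤ : List ℤ → ℤ
  sumℤ = foldr ℤ._+_ (ℤ.+ 0)

  -- All vectors within the bounds of `minimal-poly`, whether or not a tableau has them. The units
  -- over `box m` thus sum to the identity without any combinatorics of tableaux.
  box : ℕ → List (List ℤ)
  box zero = [] ∷ []
  box (suc m) = concatMap (λ c → map (_∷ c) (contents m)) (box m)

  box-length : ∀ m {c} → c ∈ box m → length c ≡ m
  box-length zero (here refl) = refl
  box-length (suc m) {c} k with ∈-concatMap⁻ (λ c → map (_∷ c) (contents m)) {xs = box m} k
  ... | any with find any
  ... | c′ , c′∈ , k′ with ∈-map⁻ (_∷ c′) k′
  ... | d , _ , refl = cong suc (box-length m c′∈)

  box-unique : ∀ m → Unique (box m)
  box-unique zero = [] ∷ []
  box-unique (suc m) = Uniqueₚ.concat⁺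
    (Allₚ.map⁺ (All.tabulate (λ {c} _ → Uniqueₚ.map⁺ (λ { refl → refl }) (contents-unique m))))
    (AllPairsₚ.map⁺ (AllPairs.map (λ ne {_} kk → disjoint ne (proj₁ kk) (proj₂ kk)) (box-unique m)))
    where
    disjoint : ∀ {c c′ x} → c ≢ c′ → x ∈ map (_∷ c) (contents m) → x ∈ map (_∷ c′) (contents m) → ⊥
    disjoint {c} {c′} ne k k′ with ∈-map⁻ (_∷ c) k | ∈-map⁻ (_∷ c′) k′
    ... | d , _ , refl | d′ , _ , refl = ne refl

  -- Seminormal units and their primitivity

  module SeminormalUnits (𝒜 : CoxeterAction) where
    open CoxeterAction 𝒜
    open Operators 𝒜
    open Spectrum 𝒜

    -- Content vectors are stored with the content of the last box first.
    E : List ℤ → Op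
    E [] = κ 1ℚ
    E (d ∷ c) = E c ⊙ proj (length c) d

    Eig : List ℤ → V → Set
    Eig [] W = ⊤
    Eig (d ∷ c) W = Eigen (X (length c)) d W × Eig c W

    E-Pol : ∀ {m} c → length c ℕ.≤ m → Pol m (E c)
    E-Pol [] le = pol-κ _
    E-Pol (d ∷ c) le = pol-⊙ (E-Pol c (ℕP.≤-trans (ℕP.n≤1+n _) le)) (Pol-proj (length c) d le)

    E-In : ∀ c → In (length c) (E c)
    E-In c = Pol-In (E-Pol c ℕP.≤-refl)

    Eig-comm : ∀ p c {W} → (∀ j → j ℕ.< length c → Comm p (X j)) → Eig c W → Eig c (⟦ p ⟧ W)
    Eig-comm p [] h e = tt
    Eig-comm p (d ∷ c) h (e , es) = eigen-comm p (h (length c) ℕP.≤-refl) e , Eig-comm p c (λ j lt → h j (ℕP.m≤n⇒m≤1+n lt)) es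

    E-eig : ∀ c → length c ℕ.≤ n → ∀ f → Eig c (⟦ E c ⟧ f)
    E-eig [] le f = tt
    E-eig (d ∷ c) le f = eigen-comm (E c) (Pol-comm-X (E-Pol c (ℕP.<⇒≤ le)) le) (proj-eigen (length c) d le f)
      , E-eig c (ℕP.<⇒≤ le) (⟦ proj (length c) d ⟧ f)

    E-fix : ∀ c {W} → Eig c W → ⟦ E c ⟧ W ≐ W
    E-fix [] {W} e {π} v = *-identityˡ (W π)
    E-fix (d ∷ c) (e , es) v = trans (⟦⟧-cong (E c) (proj-same (length c) d e) v) (E-fix c es v)

    Eig-distinct : ∀ c c′ {W} → length c ≡ length c′ → c ≢ c′ → Eig c W → Eig c′ W → W ≐ 0ᵛ
    Eig-distinct [] [] le ne _ _ = ⊥-elim (ne refl)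
    Eig-distinct (d ∷ c) (d′ ∷ c′) {W} le ne (e , es) (e′ , es′) with d ℤ.≟ d′
    ... | no d≢ = eigen-0 d≢ e (subst (λ k → Eigen (X k) d′ W) (sym (ℕP.suc-injective le)) e′)
    ... | yes refl = Eig-distinct c c′ (ℕP.suc-injective le) (λ { refl → ne refl }) es es′

    E-proj-sum : ∀ c → length c ℕ.< n → ∀ f → ⟦ E c ⟧ f ≐ (λ π → ∑ (λ d → ⟦ E (d ∷ c) ⟧ f π) (contents (length c)))
    E-proj-sum c lt f v = trans (⟦⟧-cong (E c) (proj-sum (length c) lt f) v)
      (⟦⟧-∑ (E c) (λ d → ⟦ proj (length c) d ⟧ f) (contents (length c)) v)

    box-sum : ∀ m → m ℕ.≤ n → ∀ f → f ≐ (λ π → ∑ (λ c → ⟦ E c ⟧ f π) (box m))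
    box-sum zero le f {π} v = solve 1 (λ a → a := con 1ℚ :* a :+ con 0ℚ) refl (f π)
    box-sum (suc m) le f {π} v = trans (box-sum m (ℕP.<⇒≤ le) f v)
      (trans (∑-cong (box m) step) (sym (∑-concatMap (λ c → ⟦ E c ⟧ f π) (λ c → map (_∷ c) (contents m)) (box m))))
      where
      step : ∀ c → c ∈ box m → ⟦ E c ⟧ f π ≡ ∑ (λ c → ⟦ E c ⟧ f π) (map (_∷ c) (contents m))
      step c mem with box-length m mem
      ... | refl = trans (E-proj-sum c le f v) (sym (∑-map (λ c → ⟦ E c ⟧ f π) (_∷ c) (contents m)))

    -- The class sum of the transpositions of S_m, central in its group algebra. On a joint
    -- eigenvector it takes the sum of the contents as its eigenvalue.
    Z : ℕ → Op
    Z zero = κ 0ℚ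
    Z (suc m) = Z m ∔ X m

    Z-In : ∀ m → In m (Z m)
    Z-In zero = tt
    Z-In (suc m) = In-mono (Z m) (ℕP.n≤1+n m) (Z-In m) , In-X m

    Z-Pol : ∀ m → Pol m (Z m)
    Z-Pol zero = pol-κ _
    Z-Pol (suc m) = pol-∔ (Pol-mono (ℕP.n≤1+n m) (Z-Pol m)) (pol-X ℕP.≤-refl)

    Z-eig : ∀ c {W} → Eig c W → Eigen (Z (length c)) (sumℤ c) W
    Z-eig [] {W} e = mk λ {π} v → refl
    Z-eig (d ∷ c) {W} (e , es) = mk λ {π} v → trans (cong₂ _+_ (eig (Z-eig c es) v) (eig e v))
      (trans (sym (*-distribʳ-+ (W π) (ℤ→ℚ (sumℤ c)) (ℤ→ℚ d)))
        (cong (_* W π) (trans (sym (ℤ→ℚ-+ (sumℤ c) d)) (cong ℤ→ℚ (ℤP.+-comm (sumℤ c) d)))))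

    -- In the critical case k + 2 = m, s commutes with x + y because the two affine Hecke relations
    -- give s x + s y = (y s - 1) + (x s + 1).
    sw-Z : ∀ k m → suc k ℕ.< m → m ℕ.≤ n → Comm (sw k) (Z m)
    sw-Z k (suc m) (s≤s lt) le with ℕP.m≤n⇒m<n∨m≡n lt
    ... | inj₁ lt′ = comm-sym (comm-∔ (comm-sym (sw-Z k m lt′ (ℕP.<⇒≤ le))) (comm-sym (sw-X m lt′ le)))
    ... | inj₂ refl = mk λ f {π} v → trans (cong₂ _+_ (cong₂ _+_ (comm (comm-sym (In-far (Z k) (Z-In k) ℕP.≤-refl)) f v) refl) (sw-X-suc k f v))
          (trans (solve 4 (λ z a b c → (z :+ a) :+ (b :+ c) := (z :+ b) :+ (a :+ c)) refl
                    (⟦ Z k ⟧ (⟦ sw k ⟧ f) π) (⟦ X k ⟧ f (π · k)) (⟦ X k ⟧ (⟦ sw k ⟧ f) π) (f π))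
            (cong ((⟦ Z k ⟧ (⟦ sw k ⟧ f) π + ⟦ X k ⟧ (⟦ sw k ⟧ f) π) +_) (sym (X-sw k f v))))

    In-Z : ∀ p {m} → In m p → m ℕ.≤ n → Comm p (Z m)
    In-Z (sw k) {m} h le = sw-Z k m h le
    In-Z (κ c) {m} h le = comm-κ c (Z m)
    In-Z (p ∔ q) (a , b) le = comm-∔ (In-Z p a le) (In-Z q b le)
    In-Z (p ⊙ q) (a , b) le = comm-⊙ (In-Z p a le) (In-Z q b le)

    comm-prodOp : ∀ {p} j d L → Comm p (X j) → Comm (prodOp (map (fac j d) L)) p
    comm-prodOp j d [] h = comm-κ _ _
    comm-prodOp j d (c ∷ L) h = comm-⊙ (comm-⊙ (comm-κ _ _) (comm-∔ (comm-sym h) (comm-κ _ _))) (comm-prodOp j d L h)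

    comm-proj : ∀ {p} j d → Comm p (X j) → Comm p (proj j d)
    comm-proj j d h = comm-sym (comm-prodOp j d (others j d) h)

    -- ℚ[S_{m+1}] = ℚ[S_m] + ℚ[S_m] s_m ℚ[S_m].
    data Split : ℕ → Op → Set where
      base : ∀ {m a} → In m a → Split m a
      mid  : ∀ {k a b} → In (suc k) a → In (suc k) b → Split (suc k) (a ⊙ sw k ⊙ b)
      plus : ∀ {m p q} → Split m p → Split m q → Split m (p ∔ q)
      same : ∀ {m p q} → (∀ f → ⟦ p ⟧ f ≐ ⟦ q ⟧ f) → Split m p → Split m q

    -- Two occurrences of t = `sw k` around a lower element reduce to at most one. If r is in S_k,
    -- then t r t = r. If r = c s d with c and d commuting with t, then t c s d t = c t s t d = c s
    -- t s d.
    sandwich : ∀ {k r} → suc k ℕ.< n → Split k r → ∀ a b → In (suc k) a → In (suc k) b →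
      Split (suc k) (a ⊙ sw k ⊙ r ⊙ sw k ⊙ b)
    sandwich {k} lt (base {a = r} h) a b ha hb =
      same (λ f v → ⟦⟧-cong a (λ w → sym (trans (comm (comm-sym (In-far r h ℕP.≤-refl)) (⟦ sw k ⟧ (⟦ b ⟧ f)) w)
                      (⟦⟧-cong r (sw-sw k (⟦ b ⟧ f)) w))) v)
        (base {a = a ⊙ r ⊙ b} (ha , In-mono r (ℕP.n≤1+n k) h , hb))
    sandwich {suc k} lt (mid {a = c} {d} hc hd) a b ha hb =
      same (λ f v → ⟦⟧-cong a (λ w → sym (eq f w)) v)
        (mid {a = a ⊙ c ⊙ sw k} {sw k ⊙ d ⊙ b} (ha , In-mono c (ℕP.n≤1+n _) hc , ℕP.≤-refl)
          (ℕP.≤-refl , In-mono d (ℕP.n≤1+n _) hd , hb))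
      where
      s = sw k
      t = sw (suc k)
      eq : ∀ f → ⟦ t ⊙ (c ⊙ s ⊙ d) ⊙ t ⊙ b ⟧ f ≐ ⟦ c ⊙ s ⊙ t ⊙ s ⊙ d ⊙ b ⟧ f
      eq f v = trans (comm (comm-sym (In-far c hc ℕP.≤-refl)) (⟦ s ⊙ d ⊙ t ⊙ b ⟧ f) v)
        (⟦⟧-cong c (λ {ρ} w → trans (comm (In-far d hd ℕP.≤-refl) (⟦ b ⟧ f) (val-· k (val-· (suc k) w)))
          (cong (⟦ d ⟧ (⟦ b ⟧ f)) (sym (braid k lt w)))) v)
    sandwich lt (plus {p = p} {q} x y) a b ha hb =
      same (λ f v → trans (sym (⟦⟧-+ a _ _ v)) (⟦⟧-cong a (λ w → refl) v))
        (plus (sandwich lt x a b ha hb) (sandwich lt y a b ha hb))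
    sandwich {k} lt (same h x) a b ha hb =
      same (λ f v → ⟦⟧-cong a (λ w → h _ (val-· k w)) v) (sandwich lt x a b ha hb)

    In-1-0 : ∀ p → In 1 p → In 0 p
    In-1-0 (sw k) (s≤s ())
    In-1-0 (κ _) h = tt
    In-1-0 (p ∔ q) (a , b) = In-1-0 p a , In-1-0 q b
    In-1-0 (p ⊙ q) (a , b) = In-1-0 p a , In-1-0 q b

    -- Mutual recursion with `product`: the product of two middle terms contains s (b c) s, and
    -- `sandwich` removes one s after b c has been decomposed one level below.
    decompose : ∀ m p → m ℕ.< n → In (suc m) p → Split m p
    product : ∀ {m p q} → m ℕ.< n → Split m p → Split m q → Split m (p ⊙ q)
    product {p = p} {q} lt (plus x y) z = same (λ f v → refl) (plus (product lt x z) (product lt y z))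
    product lt (same h x) z = same (λ f v → h _ v) (product lt x z)
    product {p = p} lt x@(base _) (plus y z) = same (λ f v → sym (⟦⟧-+ p _ _ v)) (plus (product lt x y) (product lt x z))
    product {p = p} lt x@(base _) (same h y) = same (λ f v → ⟦⟧-cong p (h f) v) (product lt x y)
    product {p = p} lt x@(mid _ _) (plus y z) = same (λ f v → sym (⟦⟧-+ p _ _ v)) (plus (product lt x y) (product lt x z))
    product {p = p} lt x@(mid _ _) (same h y) = same (λ f v → ⟦⟧-cong p (h f) v) (product lt x y)
    product lt (base ha) (base hb) = base (ha , hb)
    product lt (base {a = r} hr) (mid {a = a} {b} ha hb) = same (λ f v → refl) (mid {a = r ⊙ a} {b} (hr , ha) hb)
    product lt (mid {a = a} {b} ha hb) (base {a = r} hr) = same (λ f v → refl) (mid {a = a} {b ⊙ r} ha (hb , hr))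
    product {suc k} lt (mid {a = a} {b} ha hb) (mid {a = c} {d} hc hd) =
      same (λ f v → refl) (sandwich lt (decompose k (b ⊙ c) (ℕP.<⇒≤ lt) (hb , hc)) a d ha hd)
    decompose zero p lt h = base (In-1-0 p h)
    decompose (suc m) (sw k) lt h with ℕP.m≤n⇒m<n∨m≡n h
    ... | inj₁ (s≤s h′) = base h′
    ... | inj₂ refl = same (λ f {π} v → solve 1 (λ a → con 1ℚ :* (con 1ℚ :* a) := a) refl (f (π · m))) (mid {a = κ 1ℚ} {κ 1ℚ} tt tt)
    decompose (suc m) (κ c) lt h = base tt
    decompose (suc m) (p ∔ q) lt (a , b) = plus (decompose (suc m) p lt a) (decompose (suc m) q lt b)
    decompose (suc m) (p ⊙ q) lt (a , b) = product lt (decompose (suc m) p lt a) (decompose (suc m) q lt b)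

    In-0-scalar : ∀ p → In 0 p → ∃ λ φ → ∀ f → ⟦ p ⟧ f ≐ φ *ᵛ f
    In-0-scalar (κ c) h = c , λ f v → refl
    In-0-scalar (p ∔ q) (a , b) with In-0-scalar p a | In-0-scalar q b
    ... | φ , e | ψ , e′ = φ + ψ , λ f {π} v → trans (cong₂ _+_ (e f v) (e′ f v)) (sym (*-distribʳ-+ (f π) φ ψ))
    In-0-scalar (p ⊙ q) (a , b) with In-0-scalar p a | In-0-scalar q b
    ... | φ , e | ψ , e′ = φ * ψ , λ f {π} v → trans (e (⟦ q ⟧ f) v) (trans (cong (φ *_) (e′ f v)) (sym (*-assoc φ ψ (f π))))

    Primitive : List ℤ → Op → Set
    Primitive c p = ∃ λ φ → ∀ f → ⟦ E c ⟧ (⟦ p ⟧ (⟦ E c ⟧ f)) ≐ φ *ᵛ ⟦ E c ⟧ f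

    primitive-scalar : ∀ c p → length c ℕ.≤ n → In 0 p → Primitive c p
    primitive-scalar c p le h with In-0-scalar p h
    ... | φ , e = φ , λ f v → trans (⟦⟧-cong (E c) (e _) v) (trans (⟦⟧-* (E c) φ _ v)
            (cong (φ *_) (E-fix c (E-eig c le f) v)))

    module Step (k : ℕ) (lt : suc k ℕ.< n) (u : List ℤ) (lu : length u ≡ suc k) (d : ℤ)
                (ih : ∀ p → In (suc k) p → Primitive u p) where
      private
        m = suc k
        P′ : Op
        P′ = proj (length u) d
        c = d ∷ u
        lc : length c ℕ.≤ n
        lc = subst (λ z → suc z ℕ.≤ n) (sym lu) lt

      step-base : ∀ a → In m a → Primitive c a
      step-base a ha with ih a ha
      ... | φ , e = φ , λ f v → let g = ⟦ P′ ⟧ f in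
          trans (⟦⟧-cong (E u) (λ w → sym (comm aP (⟦ E u ⟧ g) w)) v)
          (trans (⟦⟧-cong (E u) (⟦⟧-cong a (proj-same (length u) d (proj₁ (E-eig c lc f)))) v)
          (e g v))
        where
        aP : Comm a P′
        aP = comm-proj (length u) d (In-X-comm a (subst (λ z → In z a) (sym lu) ha) lc)

      -- Insert the resolution of the identity twice, by units W applied after b and units U applied
      -- after s. Only U = W survives; there s contributes the scalar `ψ W`, and what remains is E u
      -- a (E W) b E u, a multiple of E u by `ih`.
      step-mid : ∀ a b → In m a → In m b → Primitive c (a ⊙ sw k ⊙ b)
      step-mid a b ha hb = ∑ φ′ (box m) , λ f {π} v → trans (expand f v)
          (trans (∑-cong (box m) (λ W mW → term f W (box-length m mW) mW v)) (∑-*ʳ (⟦ E c ⟧ f π) φ′ (box m)))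
        where
        s = sw k
        -- `ih` needs the length of `W` to place `E W` in S_m. The sum runs over `box m`, where the
        -- test always succeeds, so the default 0 does not occur in it.
        φW : List ℤ → ℚ
        φW W with length W ℕ.≟ m
        ... | yes e = proj₁ (ih (a ⊙ E W ⊙ b) (ha , subst (λ z → In z (E W)) e (E-In W) , hb))
        ... | no _ = 0ℚ
        φW-eq : ∀ W → length W ≡ m → ∀ f → ⟦ E u ⟧ (⟦ a ⟧ (⟦ E W ⟧ (⟦ b ⟧ (⟦ E u ⟧ f)))) ≐ φW W *ᵛ ⟦ E u ⟧ f
        φW-eq W e with length W ℕ.≟ m
        ... | yes e′ = proj₂ (ih (a ⊙ E W ⊙ b) (ha , subst (λ z → In z (E W)) e′ (E-In W) , hb))
        ... | no ne = ⊥-elim (ne e)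
        ψ : List ℤ → ℚ
        ψ [] = 0ℚ
        ψ (w ∷ W) = inv (ℤ→ℚ (d ℤ.- w))
        φ′ : List ℤ → ℚ
        φ′ W = ψ W * φW W
        m≤n : m ℕ.≤ n
        m≤n = ℕP.<⇒≤ lt
        commX : ∀ p → In m p → Comm p (X (length u))
        commX p h = subst (λ z → Comm p (X z)) (sym lu) (In-X-comm p h lt)
        commZ : ∀ p → In m p → Comm p (Z m)
        commZ p h = In-Z p h m≤n
        module _ (f : V) where
          g : V
          g = ⟦ E c ⟧ f
          gE : Eig c g
          gE = E-eig c lc f
          gZ : Eigen (Z m) (sumℤ u) g
          gZ = subst (λ z → Eigen (Z z) (sumℤ u) g) lu (Z-eig u (proj₂ gE))
          gW : List ℤ → V
          gW W = ⟦ E W ⟧ (⟦ b ⟧ g)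

          expand : ⟦ E c ⟧ (⟦ a ⟧ (⟦ s ⟧ (⟦ b ⟧ g))) ≐ λ π → ∑ (λ W → ⟦ E c ⟧ (⟦ a ⟧ (⟦ s ⟧ (gW W))) π) (box m)
          expand v = trans (⟦⟧-cong (E c ⊙ a ⊙ s) (box-sum m m≤n (⟦ b ⟧ g)) v) (⟦⟧-∑ (E c ⊙ a ⊙ s) gW (box m) v)

          module _ (W : List ℤ) (lW : length W ≡ m) where
            EW-In : In m (E W)
            EW-In = subst (λ z → In z (E W)) lW (E-In W)
            gW-eig : Eig W (gW W)
            gW-eig = E-eig W (subst (ℕ._≤ n) (sym lW) m≤n) (⟦ b ⟧ g)
            gW-Z : Eigen (Z m) (sumℤ u) (gW W)
            gW-Z = eigen-comm (E W) (commZ (E W) EW-In) (eigen-comm b (commZ b hb) gZ)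
            gW-Z′ : Eigen (Z m) (sumℤ W) (gW W)
            gW-Z′ = subst (λ z → Eigen (Z z) (sumℤ W) (gW W)) lW (Z-eig W gW-eig)
            gW-X : Eigen (X (length u)) d (gW W)
            gW-X = eigen-comm (E W) (commX (E W) EW-In) (eigen-comm b (commX b hb) (proj₁ gE))
            gW-eig⁺ : Eig (d ∷ W) (gW W)
            gW-eig⁺ = subst (λ z → Eigen (X z) d (gW W)) (trans lu (sym lW)) gW-X , gW-eig

            hU : List ℤ → V
            hU U = ⟦ E U ⟧ (⟦ s ⟧ (gW W))

            hU-eig : ∀ U → length U ≡ m → Eig U (hU U)
            hU-eig U lU = E-eig U (subst (ℕ._≤ n) (sym lU) m≤n) (⟦ s ⟧ (gW W))

            -- Centrality of `Z m` in S_m forces the entries of W and of U to have the sum of those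
            -- of u, unless the term vanishes. Since s commutes with all but the last of the first m
            -- Jucys-Murphy elements, U and W agree below their top entries; equal sums then make
            -- the top entries equal.
            off-diagonal : ∀ U → length U ≡ m → U ≢ W → ⟦ E c ⟧ (⟦ a ⟧ (hU U)) ≐ 0ᵛ
            off-diagonal U lU ne {π} v with sumℤ W ℤ.≟ sumℤ u
            ... | no σW = ⟦⟧-0 (E c ⊙ a ⊙ E U ⊙ s) (eigen-0 σW gW-Z′ gW-Z) v
            ... | yes eW with sumℤ U ℤ.≟ sumℤ u
            ...   | no σU = eigen-0 σU (eigen-comm (E c) cZ (eigen-comm a (commZ a ha)
                      (subst (λ z → Eigen (Z z) (sumℤ U) (hU U)) lU (Z-eig U (hU-eig U lU)))))
                      (subst (λ z → Eigen (Z z) (sumℤ u) (⟦ E c ⟧ (⟦ a ⟧ (hU U)))) lu (Z-eig u (proj₂ (E-eig c lc (⟦ a ⟧ (hU U)))))) v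
              where
              cZ : Comm (E c) (Z m)
              cZ = Pol-comm (E-Pol c lc) (Pol-mono m≤n (Z-Pol m))
            ...   | yes eU = ⟦⟧-0 (E c ⊙ a) (zeroU U W lU lW ne (trans eU (sym eW)) (hU-eig U lU) gW-eig) v
              where
              zeroU : ∀ U W → length U ≡ m → length W ≡ m → U ≢ W → sumℤ U ≡ sumℤ W → ∀ {h} →
                Eig U (⟦ E U ⟧ (⟦ s ⟧ h)) → Eig W h → ⟦ E U ⟧ (⟦ s ⟧ h) ≐ 0ᵛ
              zeroU (x ∷ U) (w ∷ W) lU lW ne es {h} eU eW = Eig-distinct U W (trans (ℕP.suc-injective lU) (sym (ℕP.suc-injective lW)))
                (λ { refl → ne (cong (_∷ U) (ℤG.∙-cancelʳ (sumℤ U) x w es)) })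
                (proj₂ eU)
                (Eig-comm (E (x ∷ U)) W (λ j lt′ → Pol-comm-X (E-Pol (x ∷ U) (subst (ℕ._≤ n) (sym lU) m≤n)) (jn lt′))
                  (Eig-comm s W (λ j lt′ → comm-sym (In-far (X j) (In-X j) (ℕP.≤-trans lt′ (ℕP.≤-reflexive (ℕP.suc-injective lW))))) (proj₂ eW)))
                where
                jn : ∀ {j} → j ℕ.< length W → j ℕ.< n
                jn lt′ = ℕP.<-trans lt′ (ℕP.<-≤-trans (ℕP.≤-reflexive lW) m≤n)

            -- Apply F to y s h = s x h + h: this gives (d - w) F s h = h, so 1/(d - w) is the
            -- diagonal seminormal coefficient. If d = w, the same equation gives h = 0, which
            -- agrees with `inv` being 0 at 0.
            diagonal : ⟦ E (d ∷ W) ⟧ (⟦ s ⟧ (gW W)) ≐ ψ W *ᵛ gW W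
            diagonal = go W lW gW-eig⁺
              where
              go : ∀ W → length W ≡ m → ∀ {h} → Eig (d ∷ W) h → ⟦ E (d ∷ W) ⟧ (⟦ s ⟧ h) ≐ ψ W *ᵛ h
              go (w ∷ W) lW {h} (ed , ew , eW) {π} v with ℕP.suc-injective lW
              ... | refl = concl
                where
                F = E (d ∷ w ∷ W)
                y = ⟦ F ⟧ (⟦ s ⟧ h) π
                eq : ∀ {τ} → Val τ → ℤ→ℚ d * ⟦ F ⟧ (⟦ s ⟧ h) τ ≡ ℤ→ℚ w * ⟦ F ⟧ (⟦ s ⟧ h) τ + h τ
                eq v = trans (sym (eig (proj₁ (E-eig (d ∷ w ∷ W) lt (⟦ s ⟧ h))) v))
                  (trans (sym (comm (Pol-comm-X (E-Pol (d ∷ w ∷ W) lt) lt) (⟦ s ⟧ h) v))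
                  (trans (⟦⟧-cong F (λ w′ → trans (X-sw k h w′) (cong (_+ h _) (eig ew (val-· k w′)))) v)
                  (trans (⟦⟧-+ F (ℤ→ℚ w *ᵛ ⟦ s ⟧ h) h v)
                  (cong₂ _+_ (⟦⟧-* F (ℤ→ℚ w) (⟦ s ⟧ h) v) (E-fix (d ∷ w ∷ W) (ed , ew , eW) v)))))
                D = ℤ→ℚ (d ℤ.- w)
                concl : y ≡ inv D * h π
                concl with d ℤ.≟ w
                ... | yes refl = trans (⟦⟧-0 (F ⊙ s) h0 v) (sym (trans (cong (inv D *_) (h0 v)) (*-zeroʳ (inv D))))
                  where
                  h0 : h ≐ 0ᵛ
                  h0 {τ} v′ = trans (solve 2 (λ a b → b := (a :+ b) :- a) refl (ℤ→ℚ w * ⟦ F ⟧ (⟦ s ⟧ h) τ) (h τ))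
                    (trans (cong (_- ℤ→ℚ w * ⟦ F ⟧ (⟦ s ⟧ h) τ) (sym (eq v′))) (+-inverseʳ (ℤ→ℚ w * ⟦ F ⟧ (⟦ s ⟧ h) τ)))
                ... | no ne = trans (solve 1 (λ y → y := con 1ℚ :* y) refl y)
                    (trans (cong (_* y) (sym (*-inv D (ℤ→ℚ-nonzero ne))))
                    (trans (solve 3 (λ D i y → (D :* i) :* y := i :* (D :* y)) refl D (inv D) y)
                    (cong (inv D *_) (trans (cong (_* y) (ℤ→ℚ-- d w))
                      (trans (solve 3 (λ d w y → (d :- w) :* y := d :* y :- w :* y) refl (ℤ→ℚ d) (ℤ→ℚ w) y)
                      (trans (cong (_- ℤ→ℚ w * y) (eq v)) (solve 2 (λ a h → (a :+ h) :- a := h) refl (ℤ→ℚ w * y) (h π))))))))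

            term : W ∈ box m → ⟦ E c ⟧ (⟦ a ⟧ (⟦ s ⟧ (gW W))) ≐ φ′ W *ᵛ g
            term mW {π} v = trans (⟦⟧-cong (E c ⊙ a) (box-sum m m≤n (⟦ s ⟧ (gW W))) v)
              (trans (⟦⟧-∑ (E c ⊙ a) hU (box m) v)
              (trans (∑-single (box m) (box-unique m) W mW (λ U mU ne → off-diagonal U (box-length m mU) ne v))
              (trans (⟦⟧-cong (E u) (λ w → trans (sym (comm aP (hU W) w)) (⟦⟧-cong a inner w)) v)
              (trans (⟦⟧-* (E u ⊙ a) (ψ W) (gW W) v)
              (trans (cong (ψ W *_) (φW-eq W lW (⟦ P′ ⟧ f) v)) (sym (*-assoc (ψ W) (φW W) (g π))))))))
              where
              aP : Comm a P′
              aP = comm-proj (length u) d (commX a ha)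
              inner : ⟦ P′ ⟧ (hU W) ≐ ψ W *ᵛ gW W
              inner w = trans (sym (comm (comm-proj (length u) d (commX (E W) EW-In)) (⟦ s ⟧ (gW W)) w))
                (trans (cong (λ z → ⟦ E W ⟧ (⟦ proj z d ⟧ (⟦ s ⟧ (gW W))) _) (trans lu (sym lW))) (diagonal w))

    primitivity : ∀ m c p → length c ≡ m → m ℕ.≤ n → In m p → Primitive c p
    primitivity zero c p lc le h = primitive-scalar c p (subst (ℕ._≤ n) (sym lc) le) h
    primitivity (suc zero) c p lc le h = primitive-scalar c p (subst (ℕ._≤ n) (sym lc) le) (In-1-0 p h)
    primitivity (suc (suc k)) (d ∷ u) p lc le h = go (decompose (suc k) p le h)
      where
      open Step k le u (ℕP.suc-injective lc) d (λ q → primitivity (suc k) u q (ℕP.suc-injective lc) (ℕP.<⇒≤ le))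
      go : ∀ {p} → Split (suc k) p → Primitive (d ∷ u) p
      go (base {a = a} h) = step-base a h
      go (mid {a = a} {b} ha hb) = step-mid a b ha hb
      go (plus x y) with go x | go y
      ... | φ , e | ψ , e′ = φ + ψ , λ f {π} v → trans (⟦⟧-+ (E (d ∷ u)) _ _ v)
              (trans (cong₂ _+_ (e f v) (e′ f v)) (sym (*-distribʳ-+ (⟦ E (d ∷ u) ⟧ f π) φ ψ)))
      go (same h x) with go x
      ... | φ , e = φ , λ f v → trans (⟦⟧-cong (E (d ∷ u)) (λ w → sym (h _ w)) v) (e f v)
  

  -- A hook tableau is the list of its boxes 2, …, m, last box first; true stands
  -- for a box in the arm and false for a box in the leg.
  cnt : Bool → List Bool → ℕ
  cnt t [] = 0
  cnt true (true ∷ b) = suc (cnt true b)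
  cnt true (false ∷ b) = cnt true b
  cnt false (true ∷ b) = cnt false b
  cnt false (false ∷ b) = suc (cnt false b)

  -- The content of the next box of an arm or leg that already has k boxes besides the corner.
  cont : Bool → ℕ → ℤ
  cont true k = ℤ.+ suc k
  cont false k = -[1+ k ]

  cs : List Bool → List ℤ
  cs [] = ℤ.+ 0 ∷ []
  cs (t ∷ b) = cont t (cnt t b) ∷ cs b

  bits : ℕ → List (List Bool)
  bits zero = [] ∷ []
  bits (suc m) = map (true ∷_) (bits m) ++ map (false ∷_) (bits m)

  bits-length : ∀ m {b} → b ∈ bits m → length b ≡ m
  bits-length zero (here refl) = refl
  bits-length (suc m) k with ∈-++⁻ (map (true ∷_) (bits m)) k
  ... | inj₁ k′ with ∈-map⁻ (true ∷_) k′
  ...   | b , kb , refl = cong suc (bits-length m kb)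
  bits-length (suc m) k | inj₂ k′ with ∈-map⁻ (false ∷_) k′
  ...   | b , kb , refl = cong suc (bits-length m kb)

  cs-length : ∀ b → length (cs b) ≡ suc (length b)
  cs-length [] = refl
  cs-length (t ∷ b) = cong suc (cs-length b)

  cnt-same : ∀ t b → cnt t (t ∷ b) ≡ suc (cnt t b)
  cnt-same true b = refl
  cnt-same false b = refl

  cnt-diff : ∀ t b → cnt t (not t ∷ b) ≡ cnt t b
  cnt-diff true b = refl
  cnt-diff false b = refl

  cnt-diff′ : ∀ t b → cnt (not t) (t ∷ b) ≡ cnt (not t) b
  cnt-diff′ true b = refl
  cnt-diff′ false b = refl

  cnt-total : ∀ b → cnt true b ℕ.+ cnt false b ≡ length b
  cnt-total [] = refl
  cnt-total (true ∷ b) = cong suc (cnt-total b)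
  cnt-total (false ∷ b) = trans (ℕP.+-suc _ _) (cong suc (cnt-total b))

  cnt-≤ : ∀ t b → cnt t b ℕ.≤ length b
  cnt-≤ true b = ℕP.≤-trans (ℕP.m≤m+n _ _) (ℕP.≤-reflexive (cnt-total b))
  cnt-≤ false b = ℕP.≤-trans (ℕP.m≤n+m _ (cnt true b)) (ℕP.≤-reflexive (cnt-total b))

  cont-abs : ∀ t k → ℤ.∣ cont t k ∣ ≡ suc k
  cont-abs true k = refl
  cont-abs false k = refl

  cont-injective : ∀ t {k l} → cont t k ≡ cont t l → k ≡ l
  cont-injective t {k} {l} e = ℕP.suc-injective (trans (sym (cont-abs t k)) (trans (cong ℤ.∣_∣ e) (cont-abs t l)))

  cont≢0 : ∀ t {k} → cont t k ≢ ℤ.+ 0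
  cont≢0 true ()
  cont≢0 false ()

  cont-opp : ∀ t {k l} → cont t k ≢ cont (not t) l
  cont-opp true ()
  cont-opp false ()

  -- The content of the outermost box of a limb with k boxes; for k = 0 this is the corner.
  prev : Bool → ℕ → ℤ
  prev t zero = ℤ.+ 0
  prev t (suc k) = cont t k

  Far : ℤ → ℤ → Set
  Far a b = 2 ℕ.≤ ℤ.∣ a ℤ.- b ∣

  far-sym : ∀ a b → Far a b → Far b a
  far-sym a b h = subst (2 ℕ.≤_) (ℤP.∣i-j∣≡∣j-i∣ a b) h

  far-opp : ∀ t k l → Far (cont t k) (cont (not t) l)
  far-opp true k l = s≤s (ℕP.≤-trans (s≤s z≤n) (ℕP.m≤n+m (suc l) k))
  far-opp false k l = far-sym (cont true l) (cont false k) (far-opp true l k)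

  prev-near : ∀ t k → ℤ.∣ prev t k ℤ.- cont t k ∣ ≡ 1
  prev-near true zero = refl
  prev-near false zero = refl
  prev-near true (suc k) = trans (cong ℤ.∣_∣ (trans (ℤP.m-n≡m⊖n (suc k) (suc (suc k))) (ℤP.⊖-≤ (ℕP.n≤1+n (suc k)))))
    (trans (ℤP.∣-i∣≡∣i∣ (ℤ.+ (suc (suc k) ℕ.∸ suc k))) (trans (cong ℤ.∣_∣ (cong ℤ.+_ (ℕP.+-∸-assoc 1 {k} ℕP.≤-refl))) (cong suc (ℕP.n∸n≡0 k))))
  prev-near false (suc k) = trans (cong ℤ.∣_∣ (trans (ℤP.[1+m]⊖[1+n]≡m⊖n (suc k) k) (ℤP.⊖-≥ (ℕP.n≤1+n k))))
    (trans (ℕP.+-∸-assoc 1 {k} ℕP.≤-refl) (cong suc (ℕP.n∸n≡0 k)))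

  far-cont : ∀ t k d → d ≢ cont t k → d ≢ cont t (suc k) → d ≢ prev t k → Far d (cont t k)
  far-cont t k d n₀ n₁ n₂ = go (d ℤ.- cont t k) refl
    where
    back : ∀ {z} → d ℤ.- cont t k ≡ z → d ≡ z ℤ.+ cont t k
    back refl = sym (trans (ℤP.+-assoc d (ℤ.- cont t k) (cont t k)) (trans (cong (λ z → d ℤ.+ z) (ℤP.+-inverseˡ (cont t k))) (ℤP.+-identityʳ d)))
    up : ∀ t k → d ≢ cont t (suc k) → d ≢ prev t k → d ≢ ℤ.+ 1 ℤ.+ cont t k
    up true k a b = a
    up false zero a b = b
    up false (suc k) a b = b
    down : ∀ t k → d ≢ cont t (suc k) → d ≢ prev t k → d ≢ -[1+ 0 ] ℤ.+ cont t k
    down true zero a b = b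
    down true (suc k) a b = b
    down false k a b = a
    go : ∀ z → d ℤ.- cont t k ≡ z → 2 ℕ.≤ ℤ.∣ z ∣
    go (ℤ.+ zero) e = ⊥-elim (n₀ (trans (back e) (ℤP.+-identityˡ _)))
    go (ℤ.+ suc zero) e = ⊥-elim (up t k n₁ n₂ (back e))
    go (ℤ.+ suc (suc z)) e = s≤s (s≤s z≤n)
    go -[1+ zero ] e = ⊥-elim (down t k n₁ n₂ (back e))
    go -[1+ suc z ] e = s≤s (s≤s z≤n)

  ∑-three : {F : A → ℚ} (_≟′_ : (x y : A) → Dec (x ≡ y)) (xs : List A) → Unique xs → (a b c : A) →
    a ∈ xs → b ∈ xs → c ∈ xs → a ≢ b → a ≢ c → b ≢ c →
    (∀ x → x ∈ xs → x ≢ a → x ≢ b → x ≢ c → F x ≡ 0ℚ) → ∑ F xs ≡ F a + F b + F c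
  ∑-three {A = A} {F} _≟′_ xs u a b c ma mb mc ab ac bc h =
    trans (∑-cong xs split) (trans (∑-+ (λ x → at′ a x + at′ b x) (at′ c) xs) (cong₂ _+_ (trans (∑-+ (at′ a) (at′ b) xs) (cong₂ _+_ (one-term ma) (one-term mb))) (one-term mc)))
    where
    at′ : A → A → ℚ
    at′ y x = if does (x ≟′ y) then F x else 0ℚ
    at-same : ∀ y → at′ y y ≡ F y
    at-same y with y ≟′ y
    ... | yes _ = refl
    ... | no ne = ⊥-elim (ne refl)
    at-other : ∀ {x y} → x ≢ y → at′ y x ≡ 0ℚ
    at-other {x} {y} ne with x ≟′ y
    ... | yes e = ⊥-elim (ne e)
    ... | no _ = refl
    one-term : ∀ {y} → y ∈ xs → ∑ (at′ y) xs ≡ F y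
    one-term {y} m = trans (∑-single xs u y m (λ x _ ne → at-other ne)) (at-same y)
    split : ∀ x → x ∈ xs → F x ≡ at′ a x + at′ b x + at′ c x
    split x m with x ≟′ a
    ... | yes refl = sym (trans (cong₂ (λ p q → F x + p + q) (at-other ab) (at-other ac)) (solve 1 (λ f → f :+ con 0ℚ :+ con 0ℚ := f) refl (F x)))
    ... | no na with x ≟′ b
    ...   | yes refl = sym (trans (cong (λ q → 0ℚ + F x + q) (at-other bc)) (solve 1 (λ f → con 0ℚ :+ f :+ con 0ℚ := f) refl (F x)))
    ...   | no nb with x ≟′ c
    ...     | yes refl = sym (solve 1 (λ f → con 0ℚ :+ con 0ℚ :+ f := f) refl (F x))
    ...     | no nc = h x m na nb nc

  -- Content vectors that extend a hook

  module Hooks (𝒜 : CoxeterAction) where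
    open CoxeterAction 𝒜
    open Operators 𝒜
    open Spectrum 𝒜
    open SeminormalUnits 𝒜

    Vanish : List ℤ → Set
    Vanish c = ∀ g → Eig c g → g ≐ 0ᵛ

    -- The intertwiner on a joint eigenvector, where x - y is the scalar q.
    T : ℕ → ℚ → Op
    T i q = (κ q ⊙ sw i) ∔ κ 1ℚ

    gap : ℤ → ℤ → ℚ
    gap a b = ℤ→ℚ a - ℤ→ℚ b

    T-comm : ∀ {i q p} → Comm (sw i) p → Comm (T i q) p
    T-comm h = comm-∔ (comm-⊙ (comm-κ _ _) h) (comm-κ _ _)

    T-Eig-low : ∀ c q {g} → Eig c g → Eig c (⟦ T (length c) q ⟧ g)
    T-Eig-low c q = Eig-comm (T (length c) q) c (λ j lt → T-comm (comm-sym (In-far (X j) (In-X j) lt)))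

    T-Eig : ∀ a b c {g} → Eig (b ∷ a ∷ c) g → Eig (a ∷ b ∷ c) (⟦ T (length c) (gap a b) ⟧ g)
    T-Eig a b c {g} (eb , ea , ec) = mk upper , mk lower , T-Eig-low c (gap a b) ec
      where
      i = length c
      q = gap a b
      s = ⟦ sw i ⟧
      upper : ⟦ X (suc i) ⟧ (⟦ T i q ⟧ g) ≐ ℤ→ℚ a *ᵛ ⟦ T i q ⟧ g
      upper {π} v = trans (⟦⟧-+ (X (suc i)) (q *ᵛ s g) (1ℚ *ᵛ g) v)
        (trans (cong₂ _+_ (trans (⟦⟧-* (X (suc i)) q (s g) v) (cong (q *_) (trans (X-sw i g v) (cong (_+ g π) (eig ea (val-· i v))))))
                          (trans (⟦⟧-* (X (suc i)) 1ℚ g v) (cong (1ℚ *_) (eig eb v))))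
        (solve 4 (λ a b sg g → (a :- b) :* (a :* sg :+ g) :+ con 1ℚ :* (b :* g) := a :* ((a :- b) :* sg :+ con 1ℚ :* g)) refl
          (ℤ→ℚ a) (ℤ→ℚ b) (g (π · i)) (g π)))
      xs : ∀ {π} → Val π → ⟦ X i ⟧ (s g) π ≡ ℤ→ℚ b * g (π · i) - g π
      xs {π} v = trans (solve 2 (λ a b → a := (a :+ b) :- b) refl (⟦ X i ⟧ (s g) π) (g π))
        (cong (_- g π) (trans (sym (sw-X-suc i g v)) (eig eb (val-· i v))))
      lower : ⟦ X i ⟧ (⟦ T i q ⟧ g) ≐ ℤ→ℚ b *ᵛ ⟦ T i q ⟧ g
      lower {π} v = trans (⟦⟧-+ (X i) (q *ᵛ s g) (1ℚ *ᵛ g) v)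
        (trans (cong₂ _+_ (trans (⟦⟧-* (X i) q (s g) v) (cong (q *_) (xs v)))
                          (trans (⟦⟧-* (X i) 1ℚ g v) (cong (1ℚ *_) (eig ea v))))
        (solve 4 (λ a b sg g → (a :- b) :* (b :* sg :- g) :+ con 1ℚ :* (a :* g) := b :* ((a :- b) :* sg :+ con 1ℚ :* g)) refl
          (ℤ→ℚ a) (ℤ→ℚ b) (g (π · i)) (g π)))

    T-back : ∀ i a b g → ⟦ T i (gap b a) ⟧ (⟦ T i (gap a b) ⟧ g) ≐ (1ℚ - gap a b * gap a b) *ᵛ g
    T-back i a b g {π} v = trans (cong (λ ρ → gap b a * (gap a b * g ρ + 1ℚ * g (π · i)) + 1ℚ * (gap a b * g (π · i) + 1ℚ * g π)) (invol π i))
      (solve 4 (λ a b sg g → (b :- a) :* ((a :- b) :* g :+ con 1ℚ :* sg) :+ con 1ℚ :* ((a :- b) :* sg :+ con 1ℚ :* g)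
         := (con 1ℚ :- (a :- b) :* (a :- b)) :* g) refl (ℤ→ℚ a) (ℤ→ℚ b) (g (π · i)) (g π))

    T-Eig-deep : ∀ hi a b c {g} → length (hi ++ b ∷ a ∷ c) ℕ.≤ n → Eig (hi ++ b ∷ a ∷ c) g →
      Eig (hi ++ a ∷ b ∷ c) (⟦ T (length c) (gap a b) ⟧ g)
    T-Eig-deep [] a b c le e = T-Eig a b c e
    T-Eig-deep (h ∷ hi) a b c {g} le (e , es) =
      subst (λ z → Eigen (X z) h (⟦ T (length c) (gap a b) ⟧ g)) same-length
        (eigen-comm (T (length c) (gap a b)) (T-comm (sw-X (length (hi ++ b ∷ a ∷ c)) two le)) e)
      , T-Eig-deep hi a b c (ℕP.<⇒≤ le) es
      where
      same-length : length (hi ++ b ∷ a ∷ c) ≡ length (hi ++ a ∷ b ∷ c)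
      same-length = trans (length-++ hi) (sym (length-++ hi))
      two : suc (suc (length c)) ℕ.≤ length (hi ++ b ∷ a ∷ c)
      two = ℕP.≤-trans (ℕP.m≤n+m _ (length hi)) (ℕP.≤-reflexive (sym (length-++ hi)))

    gap-nonzero : ∀ a b → Far a b → 1ℚ - gap a b * gap a b ≢ 0ℚ
    gap-nonzero a b h e = contra h (trans (sym (ℤP.abs-* (a ℤ.- b) (a ℤ.- b))) (cong ℤ.∣_∣ square))
      where
      square : (a ℤ.- b) ℤ.* (a ℤ.- b) ≡ ℤ.+ 1
      square = ℤ→ℚ-injective (trans (ℤ→ℚ-* (a ℤ.- b) (a ℤ.- b)) (trans (cong (λ z → z * z) (ℤ→ℚ-- a b))
        (trans (solve 1 (λ x → x := con 1ℚ :- (con 1ℚ :- x)) refl (gap a b * gap a b)) (cong (λ z → 1ℚ - z) e))))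
      contra : ∀ {k} → 2 ℕ.≤ k → k ℕ.* k ≢ 1
      contra {suc (suc k)} (s≤s (s≤s z≤n)) ()

    vanish-∷ : ∀ {d c} → Vanish c → Vanish (d ∷ c)
    vanish-∷ h g (_ , e) = h g e

    -- The intertwiner exchanges the two entries, and going there and back multiplies by 1 - (a -
    -- b)², which is nonzero when |a - b| is at least 2. It is therefore injective on these
    -- eigenvectors.
    vanish-deep : ∀ hi a b c → length (hi ++ b ∷ a ∷ c) ℕ.≤ n → Far a b → Vanish (hi ++ a ∷ b ∷ c) → Vanish (hi ++ b ∷ a ∷ c)
    vanish-deep hi a b c le h van g e {π} v = zero-product _ (g π) (gap-nonzero a b h)
      (trans (sym (T-back (length c) a b g v)) (⟦⟧-0 (T (length c) (gap b a)) (van _ (T-Eig-deep hi a b c le e)) v))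

    -- With x = y = a on g, the affine Hecke relation gives (y - a) s g = g and (y - a)² s g = 0, a
    -- Jordan block, which self-adjointness of y - a excludes.
    vanish-equal : ∀ a c → suc (length c) ℕ.< n → Vanish (a ∷ a ∷ c)
    vanish-equal a c lt g (ea′ , ea , ec) {π} v = trans (sym (step v)) (SA-nilpotent (Pol-SA (Pol-sub a lt)) twice v)
      where
      i = length c
      y = sub (X (suc i)) a
      step : ⟦ y ⟧ (⟦ sw i ⟧ g) ≐ g
      step {ρ} w = trans (cong (_+ - ℤ→ℚ a * g (ρ · i)) (trans (X-sw i g w) (cong (_+ g ρ) (eig ea (val-· i w)))))
        (solve 3 (λ a s g → (a :* s :+ g) :+ (:- a) :* s := g) refl (ℤ→ℚ a) (g (ρ · i)) (g ρ))
      twice : ⟦ y ⟧ (⟦ y ⟧ (⟦ sw i ⟧ g)) ≐ 0ᵛ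
      twice {ρ} w = trans (⟦⟧-cong y step w) (trans (eigen-sub a ea′ w) (trans (cong (_* g ρ) (+-inverseʳ (ℤ→ℚ a))) (*-zeroˡ (g ρ))))

    -- Either adjacent exchange would create two equal neighbours, so both intertwiners kill g.
    -- Hence s_i acts by -D and s_{i+1} by D, where D = a - b and D² = 1. The two sides of the braid
    -- relation then act by D and -D.
    vanish-braid : ∀ a b c → suc (suc (length c)) ℕ.< n → ℤ.∣ a ℤ.- b ∣ ≡ 1 → Vanish (a ∷ b ∷ a ∷ c)
    vanish-braid a b c lt near g e@(_ , es) {π} v = trans (sym (trans (cong (_* g π) DD) (*-identityˡ (g π))))
        (trans (*-assoc D D (g π)) (trans (cong (D *_) Dg) (*-zeroʳ D)))
      where
      i = length c
      D = gap a b
      abs-one : ∀ z → ℤ.∣ z ∣ ≡ 1 → z ℤ.* z ≡ ℤ.+ 1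
      abs-one (ℤ.+ suc zero) refl = refl
      abs-one -[1+ zero ] refl = refl
      DD : D * D ≡ 1ℚ
      DD = trans (cong (λ z → z * z) (sym (ℤ→ℚ-- a b))) (trans (sym (ℤ→ℚ-* (a ℤ.- b) (a ℤ.- b))) (cong ℤ→ℚ (abs-one (a ℤ.- b) near)))
      low : ∀ {ρ} → Val ρ → g (ρ · i) ≡ - D * g ρ
      low {ρ} w = trans (sym (trans (cong (_* g (ρ · i)) DD) (*-identityˡ _)))
        (trans (solve 3 (λ D s g → (D :* D) :* s := D :* (D :* s :+ con 1ℚ :* g) :+ (:- D) :* g) refl D (g (ρ · i)) (g ρ))
        (trans (cong (λ z → D * z + - D * g ρ) (vanish-equal a (b ∷ c) lt _ (T-Eig-deep (a ∷ []) a b c lt e) w))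
          (solve 2 (λ D g → D :* con 0ℚ :+ (:- D) :* g := (:- D) :* g) refl D (g ρ))))
      high : ∀ {ρ} → Val ρ → g (ρ · suc i) ≡ D * g ρ
      high {ρ} w = trans (sym (trans (cong (_* g (ρ · suc i)) DD) (*-identityˡ _)))
        (trans (solve 4 (λ a b s g → ((a :- b) :* (a :- b)) :* s := (:- (a :- b)) :* ((b :- a) :* s :+ con 1ℚ :* g) :- (:- (a :- b)) :* g :+ con 0ℚ) refl (ℤ→ℚ a) (ℤ→ℚ b) (g (ρ · suc i)) (g ρ))
        (trans (cong (λ z → (- D) * z - (- D) * g ρ + 0ℚ) (vanish-equal a c (ℕP.<⇒≤ lt) _ (proj₂ (T-Eig b a (a ∷ c) e)) w))
          (solve 2 (λ D g → (:- D) :* con 0ℚ :- (:- D) :* g :+ con 0ℚ := D :* g) refl D (g ρ))))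
      Dg : D * g π ≡ 0ℚ
      Dg = trans (solve 2 (λ D g → D :* g := con ℚ.½ :* (D :* g :+ D :* g)) refl D (g π))
        (trans (cong (λ z → ℚ.½ * (D * g π + z)) opposite) (solve 2 (λ D g → con ℚ.½ :* (D :* g :+ (:- D) :* g) := con 0ℚ) refl D (g π)))
        where
        lhs : g (π · i · suc i · i) ≡ D * g π
        lhs = trans (low (val-· (suc i) (val-· i v))) (trans (cong (- D *_) (trans (high (val-· i v)) (cong (D *_) (low v))))
          (trans (solve 2 (λ D g → (:- D) :* (D :* ((:- D) :* g)) := (D :* D) :* (D :* g)) refl D (g π)) (trans (cong (_* (D * g π)) DD) (*-identityˡ _))))
        rhs′ : g (π · suc i · i · suc i) ≡ - D * g π
        rhs′ = trans (high (val-· i (val-· (suc i) v))) (trans (cong (D *_) (trans (low (val-· (suc i) v)) (cong (- D *_) (high v))))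
          (trans (solve 2 (λ D g → D :* ((:- D) :* (D :* g)) := (D :* D) :* ((:- D) :* g)) refl D (g π)) (trans (cong (_* (- D * g π)) DD) (*-identityˡ _))))
        opposite : D * g π ≡ - D * g π
        opposite = trans (sym lhs) (trans (cong g (braid i lt v)) rhs′)

    vanish-one : ∀ d → d ≢ ℤ.+ 0 → Vanish (d ∷ [])
    vanish-one d ne g (e , _) {π} v = zero-product (ℤ→ℚ d) (g π) (λ z → ne (ℤ→ℚ-injective z))
      (trans (sym (eig e v)) (*-zeroˡ (g π)))

    -- If d equals the last content, use `vanish-equal`. If d is far from it, exchange the two and
    -- remove the last box from the hook. Otherwise d is the content just before the last one on the
    -- same limb. That gives the pattern a b a when the two preceding boxes lie on that limb, or
    -- when only the corner precedes; else the intervening box of the other limb is moved away. This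
    -- deletes a box from inside `b`, hence the bound `m` on the length in place of structural
    -- recursion.
    hook-vanish : ∀ m b → length b ℕ.≤ m → ∀ d → suc (length (cs b)) ℕ.≤ n →
      (∀ t → d ≢ cont t (cnt t b)) → (d ≡ ℤ.+ 0 → ∃ λ t → cnt t b ≡ 0) → Vanish (d ∷ cs b)
    hook-vanish m [] lm d le ne z with d ℤ.≟ ℤ.+ 0
    ... | yes refl = vanish-equal (ℤ.+ 0) [] le
    ... | no d≢0 = vanish-deep [] (ℤ.+ 0) d [] le (far-0 d d≢0 (ne true) (ne false)) (vanish-∷ {ℤ.+ 0} {d ∷ []} (vanish-one d d≢0))
      where
      far-0 : ∀ d → d ≢ ℤ.+ 0 → d ≢ ℤ.+ 1 → d ≢ -[1+ 0 ] → Far (ℤ.+ 0) d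
      far-0 (ℤ.+ zero) a _ _ = ⊥-elim (a refl)
      far-0 (ℤ.+ suc zero) _ a _ = ⊥-elim (a refl)
      far-0 (ℤ.+ suc (suc d)) _ _ _ = s≤s (s≤s z≤n)
      far-0 -[1+ zero ] _ _ a = ⊥-elim (a refl)
      far-0 -[1+ suc d ] _ _ _ = s≤s (s≤s z≤n)
    hook-vanish (suc m) (t ∷ b) (s≤s lm) d le ne z with d ℤ.≟ cont t (cnt t b)
    ... | yes refl = vanish-equal d (cs b) le
    ... | no n₀ with d ℤ.≟ prev t (cnt t b)
    ...   | no n₂ = vanish-deep [] (cont t (cnt t b)) d (cs b) le
              (far-sym d _ (far-cont t (cnt t b) d n₀ (λ e → ne t (trans e (cong (cont t) (sym (cnt-same t b))))) n₂))
              (vanish-∷ {cont t (cnt t b)} {d ∷ cs b} (hook-vanish m b lm d (ℕP.<⇒≤ le) ne′ z′))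
      where
      ne′ : ∀ u → d ≢ cont u (cnt u b)
      ne′ u with u Bool.≟ t
      ... | yes refl = n₀
      ... | no u≢t = λ e → ne u (trans e (cong (cont u) (sym (subst (λ w → cnt u (w ∷ b) ≡ cnt u b) (sym (Boolₚ.¬-not (λ q → u≢t (sym q)))) (cnt-diff u b)))))
      z′ : d ≡ ℤ.+ 0 → ∃ λ u → cnt u b ≡ 0
      z′ e with z e
      ... | u , h with u Bool.≟ t
      ...   | yes refl = ⊥-elim (ℕP.1+n≢0 (trans (sym (cnt-same t b)) h))
      ...   | no u≢t = u , trans (sym (subst (λ w → cnt u (w ∷ b) ≡ cnt u b) (sym (Boolₚ.¬-not (λ q → u≢t (sym q)))) (cnt-diff u b))) h
    ...   | yes refl = below b lm le z
      where
      below : ∀ b → length b ℕ.≤ m → suc (length (cs (t ∷ b))) ℕ.≤ n →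
        (prev t (cnt t b) ≡ ℤ.+ 0 → ∃ λ u → cnt u (t ∷ b) ≡ 0) → Vanish (prev t (cnt t b) ∷ cs (t ∷ b))
      below [] lm le z = vanish-braid (ℤ.+ 0) (cont t 0) [] le (prev-near t 0)
      below (u ∷ b) lm le z with u Bool.≟ t
      ... | yes refl rewrite cnt-same t b = vanish-braid (cont t (cnt t b)) (cont t (suc (cnt t b))) (cs b) le (prev-near t (suc (cnt t b)))
      ... | no u≢t with Boolₚ.¬-not u≢t
      ...   | refl rewrite cnt-diff t b = go (cnt t b) refl
        where
        go : ∀ k → cnt t b ≡ k → Vanish (prev t k ∷ cont t k ∷ cs (not t ∷ b))
        -- Here d = 0 and both limbs are nonempty, so d would be the inner corner. The assumption on
        -- d = 0 gives an empty limb.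
        go zero e with z (cong (prev t) e)
        ... | u , h with u Bool.≟ t
        ...   | yes refl = ⊥-elim (ℕP.1+n≢0 (trans (sym (cnt-same t (not t ∷ b))) h))
        ...   | no u≢t with Boolₚ.¬-not u≢t
        ...     | refl = ⊥-elim (ℕP.1+n≢0 (trans (sym (trans (cnt-diff′ t (not t ∷ b)) (cnt-same (not t) b))) h))
        -- `y` belongs to the opposite limb, hence is far from both entries before it. It moves to
        -- the front and is dropped, leaving a shorter hook extended by the same d.
        go (suc k) e = vanish-deep (cont t k ∷ []) y (cont t (suc k)) (cs b) le (far-sym _ y (far-opp t (suc k) _))
            (vanish-deep [] y (cont t k) (cont t (suc k) ∷ cs b) le (far-sym _ y (far-opp t k _))
              (vanish-∷ {y} {cont t k ∷ cont t (suc k) ∷ cs b}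
                (subst (λ c → Vanish (cont t k ∷ cont t c ∷ cs b)) e
                  (hook-vanish m (t ∷ b) lm (cont t k) (ℕP.<⇒≤ le) ne″ (λ z → ⊥-elim (cont≢0 t z))))))
          where
          ne″ : ∀ u → cont t k ≢ cont u (cnt u (t ∷ b))
          ne″ u q with u Bool.≟ t
          ... | yes refl = ℕP.<⇒≢ (ℕP.m≤n⇒m≤1+n ℕP.≤-refl) (trans (cont-injective t q) (trans (cnt-same t b) (cong suc e)))
          ... | no u≢t with Boolₚ.¬-not u≢t
          ...   | refl = cont-opp t q
          y = cont (not t) (cnt (not t) b)

    E-vanish : ∀ c → length c ℕ.≤ n → Vanish c → ∀ f → ⟦ E c ⟧ f ≐ 0ᵛ
    E-vanish c le van f = van (⟦ E c ⟧ f) (E-eig c le f)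

    cs-bound : ∀ t b → ℤ.∣ cont t (cnt t b) ∣ ℕ.≤ length (cs b)
    cs-bound t b = subst₂ ℕ._≤_ (sym (cont-abs t (cnt t b))) (sym (cs-length b)) (s≤s (cnt-≤ t b))

    arm-of leg-of inner-of : List Bool → List ℤ
    arm-of b = cs (true ∷ b)
    leg-of b = cs (false ∷ b)
    inner-of b = ℤ.+ 0 ∷ cs b

    E-inner-zero : ∀ b t → suc (length (cs b)) ℕ.≤ n → cnt t b ≡ 0 → ∀ f → ⟦ E (inner-of b) ⟧ f ≐ 0ᵛ
    E-inner-zero b t le e = E-vanish (inner-of b) le (hook-vanish (length b) b ℕP.≤-refl (ℤ.+ 0) le
      (λ u q → cont≢0 u (sym q)) (λ _ → t , e))

    -- `hook-vanish` leaves only the boxes at the end of the arm, at the end of the leg and in the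
    -- inner corner. The weight G will be 1, d or d².
    E-three : ∀ b → length (cs b) ℕ.< n → (G : ℤ → ℚ) → ∀ f {π} → Val π →
      ∑ (λ d → G d * ⟦ E (d ∷ cs b) ⟧ f π) (contents (length (cs b))) ≡
        G (cont true (cnt true b)) * ⟦ E (arm-of b) ⟧ f π + G (cont false (cnt false b)) * ⟦ E (leg-of b) ⟧ f π
          + G (ℤ.+ 0) * ⟦ E (inner-of b) ⟧ f π
    E-three b lt G f {π} v = ∑-three ℤ._≟_ (contents (length (cs b))) (contents-unique (length (cs b))) (cont true _) (cont false _) (ℤ.+ 0)
      (∈-contents⁺ (cs-bound true b)) (∈-contents⁺ (cs-bound false b)) (∈-contents⁺ {length (cs b)} z≤n)
      (λ ()) (λ ()) (λ ())
      (λ d _ na nb nc → trans (cong (G d *_) (E-vanish (d ∷ cs b) lt (hook-vanish (length b) b ℕP.≤-refl d lt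
          (λ { true → na ; false → nb }) (λ z → ⊥-elim (nc z))) f v)) (*-zeroʳ (G d)))

    E-X : ∀ d c f → length c ℕ.< n → ⟦ E (d ∷ c) ⟧ (⟦ X (length c) ⟧ f) ≐ ℤ→ℚ d *ᵛ ⟦ E (d ∷ c) ⟧ f
    E-X d c f lt v = trans (comm (Pol-comm-X (E-Pol (d ∷ c) lt) lt) f v) (eig (proj₁ (E-eig (d ∷ c) lt f)) v)

    -- The eigenvalue of J₂ ⋯ J_m on the hook unit: the product of the contents outside the corner.
    kap : List Bool → ℚ
    kap [] = 1ℚ
    kap (t ∷ b) = ℤ→ℚ (cont t (cnt t b)) * kap b

    JJ : ℕ → Op
    JJ zero = κ 1ℚ
    JJ (suc m) = JJ m ⊙ X (suc m)

    -- At each step the inner corner drops out because its content is 0, so the sum stays over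
    -- hooks.
    JJ-expand : ∀ m → m ℕ.< n → ∀ f → ⟦ JJ m ⟧ f ≐ (λ π → ∑ (λ b → kap b * ⟦ E (cs b) ⟧ f π) (bits m))
    JJ-expand zero lt f {π} v = sym (trans (+-identityʳ _) (cong (1ℚ *_) (E-fix (ℤ.+ 0 ∷ []) {f} (mk (λ _ → refl) , tt) v)))
    JJ-expand (suc m) lt f {π} v = trans (JJ-expand m (ℕP.<⇒≤ lt) (⟦ X (suc m) ⟧ f) v)
      (trans (∑-cong (bits m) step)
      (trans (∑-+ (λ b → kap (true ∷ b) * ⟦ E (arm-of b) ⟧ f π) (λ b → kap (false ∷ b) * ⟦ E (leg-of b) ⟧ f π) (bits m))
      (sym (trans (∑-++ (λ b → kap b * ⟦ E (cs b) ⟧ f π) (map (true ∷_) (bits m)) (map (false ∷_) (bits m)))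
        (cong₂ _+_ (∑-map (λ b → kap b * ⟦ E (cs b) ⟧ f π) (true ∷_) (bits m)) (∑-map (λ b → kap b * ⟦ E (cs b) ⟧ f π) (false ∷_) (bits m)))))))
      where
      step : ∀ b → b ∈ bits m → kap b * ⟦ E (cs b) ⟧ (⟦ X (suc m) ⟧ f) π ≡
        kap (true ∷ b) * ⟦ E (arm-of b) ⟧ f π + kap (false ∷ b) * ⟦ E (leg-of b) ⟧ f π
      step b mem = trans (cong (kap b *_) (trans
          (subst (λ z → ⟦ E (cs b) ⟧ (⟦ X z ⟧ f) π ≡ ∑ (λ d → ℤ→ℚ d * ⟦ E (d ∷ cs b) ⟧ f π) (contents (length (cs b)))) len
            (trans (E-proj-sum (cs b) lc (⟦ X (length (cs b)) ⟧ f) v)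
              (∑-cong′ (contents (length (cs b))) (λ d → E-X d (cs b) f lc v))))
          (E-three b lc ℤ→ℚ f v)))
        (solve 6 (λ k a l ea el e0 → k :* (a :* ea :+ l :* el :+ con 0ℚ :* e0) := (a :* k) :* ea :+ (l :* k) :* el) refl
          (kap b) (ℤ→ℚ (cont true (cnt true b))) (ℤ→ℚ (cont false (cnt false b))) (⟦ E (arm-of b) ⟧ f π) (⟦ E (leg-of b) ⟧ f π) (⟦ E (inner-of b) ⟧ f π))
        where
        len : length (cs b) ≡ suc m
        len = trans (cs-length b) (cong suc (bits-length m mem))
        lc : length (cs b) ℕ.< n
        lc = subst (ℕ._< n) (sym len) lt

    E-split : ∀ b → length (cs b) ℕ.< n → ∀ f → ⟦ E (cs b) ⟧ f ≐ ⟦ E (arm-of b) ⟧ f +ᵛ ⟦ E (leg-of b) ⟧ f +ᵛ ⟦ E (inner-of b) ⟧ f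
    E-split b lt f {π} v = trans (E-proj-sum (cs b) lt f v)
      (trans (∑-cong′ (contents (length (cs b))) (λ d → sym (*-identityˡ (⟦ E (d ∷ cs b) ⟧ f π))))
      (trans (E-three b lt (λ _ → 1ℚ) f v)
        (solve 3 (λ a b c → con 1ℚ :* a :+ con 1ℚ :* b :+ con 1ℚ :* c := a :+ b :+ c) refl (⟦ E (arm-of b) ⟧ f π) (⟦ E (leg-of b) ⟧ f π) (⟦ E (inner-of b) ⟧ f π))))

  ℕ→ℚ-+ : ∀ a b → ℕ→ℚ (a ℕ.+ b) ≡ ℕ→ℚ a + ℕ→ℚ b
  ℕ→ℚ-+ a b = trans (cong ℤ→ℚ (ℤP.pos-+ a b)) (ℤ→ℚ-+ (ℤ.+ a) (ℤ.+ b))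

  ℕ→ℚ-* : ∀ a b → ℕ→ℚ (a ℕ.* b) ≡ ℕ→ℚ a * ℕ→ℚ b
  ℕ→ℚ-* a b = trans (cong ℤ→ℚ (ℤP.pos-* a b)) (ℤ→ℚ-* (ℤ.+ a) (ℤ.+ b))

  ℕ→ℚ-suc≢0 : ∀ a → ℕ→ℚ (suc a) ≢ 0ℚ
  ℕ→ℚ-suc≢0 a e with ℤ→ℚ-injective {ℤ.+ suc a} {ℤ.+ 0} e
  ... | ()

  counts-↭ : ∀ b → b ↭ replicate (cnt true b) true ++ replicate (cnt false b) false
  counts-↭ [] = Perm.refl
  counts-↭ (true ∷ b) = Perm.prep true (counts-↭ b)
  counts-↭ (false ∷ b) = Perm.trans (Perm.prep false (counts-↭ b)) (Perm.↭-sym (shift false (replicate (cnt true b) true) _))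

  same-counts-↭ : ∀ b b′ → (∀ t → cnt t b ≡ cnt t b′) → b ↭ b′
  same-counts-↭ b b′ h = Perm.trans (counts-↭ b)
    (subst₂ (λ k l → replicate k true ++ replicate l false ↭ b′) (sym (h true)) (sym (h false)) (Perm.↭-sym (counts-↭ b′)))

  record RegularAction : Set₁ where
    field
      action : CoxeterAction
    open CoxeterAction action public
    field
      e₀        : P
      val-e₀    : Val e₀
      comp      : P → P → P
      comp-e₀   : ∀ {π} → Val π → comp π e₀ ≡ π
      comp-·    : ∀ π ρ k → comp π (ρ · k) ≡ comp π ρ · k
      comp-assoc : ∀ {π ρ τ} → Val π → Val ρ → Val τ → comp (comp π ρ) τ ≡ comp π (comp ρ τ)
      word      : ∀ {ρ} → Val ρ → ∃ λ w → All (λ k → suc k ℕ.< n) w × foldl _·_ e₀ w ≡ ρ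
      enum-conj : ∀ k → map (λ ρ → comp (e₀ · k) (ρ · k)) enum ↭ enum
      ent       : P → ℕ → ℕ
      ent-left  : ∀ {π k} → suc k ℕ.< n → Val π → ent (π · k) k ≡ ent π (suc k)
      ent-right : ∀ {π k} → suc k ℕ.< n → Val π → ent (π · k) (suc k) ≡ ent π k
      ent-other : ∀ {π k j} → j ≢ k → j ≢ suc k → ent (π · k) j ≡ ent π j
      ent-inj   : ∀ {π i j} → Val π → i ℕ.< n → j ℕ.< n → ent π i ≡ ent π j → i ≡ j
      δ         : P → ℚ
      δ-e₀      : δ e₀ ≡ 1ℚ
      δ-supp    : ∀ {π j} → Val π → j ℕ.< n → ent π j ≢ ent e₀ j → δ π ≡ 0ℚ

  -- Traces of the units

  module Regular (ℛ : RegularAction) where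
    open RegularAction ℛ
    open Operators action
    open Spectrum action
    open SeminormalUnits action
    open Hooks action

    -- Vanishing on a set B of permutations stable under right multiplication by S_m persists under
    -- the whole group algebra of S_m. The sets used prescribe or forbid the entry at position m.
    In-vanish : ∀ p {m} (B : P → Set) → (∀ {π k} → suc k ℕ.< m → B π → B (π · k)) → In m p →
      ∀ {h} → (∀ {π} → Val π → B π → h π ≡ 0ℚ) → ∀ {π} → Val π → B π → ⟦ p ⟧ h π ≡ 0ℚ
    In-vanish (sw k) B inv-B i hz v b = hz (val-· k v) (inv-B i b)
    In-vanish (κ c) B inv-B i hz v b = trans (cong (c *_) (hz v b)) (*-zeroʳ c)
    In-vanish (p ∔ q) B inv-B (i , j) hz v b = trans (cong₂ _+_ (In-vanish p B inv-B i hz v b) (In-vanish q B inv-B j hz v b)) refl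
    In-vanish (p ⊙ q) B inv-B (i , j) hz = In-vanish p B inv-B i (In-vanish q B inv-B j hz)

    ent-inv : ∀ {π k m} → suc k ℕ.< m → ent (π · k) m ≡ ent π m
    ent-inv {k = k} {m} lt = ent-other (λ e → ℕP.<⇒≢ (ℕP.<-trans (ℕP.n<1+n k) lt) (sym e)) (λ e → ℕP.<⇒≢ lt (sym e))

    Supp : ℕ → ℕ → V → Set
    Supp j a f = ∀ {π} → Val π → ent π j ≢ a → f π ≡ 0ℚ

    ent-neq : ∀ {π k a} → suc k ℕ.< n → Val π → ent π (suc k) ≡ a → ent π k ≢ a
    ent-neq {k = k} lt v e e′ = ℕP.<⇒≢ (ℕP.n<1+n k) (ent-inj v (ℕP.<⇒≤ lt) lt (trans e′ (sym e)))

    Supp-sw : ∀ {k a f} → suc k ℕ.< n → Supp (suc k) a f → Supp k a (⟦ sw k ⟧ f)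
    Supp-sw {k} lt s v ne = s (val-· k v) (λ e → ne (trans (sym (ent-right lt v)) e))

    -- The first moment is 0: every transposition in `X j` moves position j, so no translate of the
    -- support meets it again.
    X-Supp : ∀ j a {f} → j ℕ.< n → Supp j a f → ∀ {π} → Val π → ent π j ≡ a → ⟦ X j ⟧ f π ≡ 0ℚ
    X-Supp zero a {f} lt s {π} v e = *-zeroˡ (f π)
    X-Supp (suc k) a {f} lt s {π} v e = trans (cong₂ _+_
      (X-Supp k a (ℕP.<⇒≤ lt) (Supp-sw lt s) (val-· k v) (trans (ent-left lt v) e))
      (s (val-· k v) (λ e′ → ent-neq lt v e (trans (sym (ent-right lt v)) e′)))) refl

    -- The second moment: in a product (a, j+1)(b, j+1) the last position returns only if a = b, and
    -- there are j such pairs.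
    XX-Supp : ∀ j a {f} → j ℕ.< n → Supp j a f → ∀ {π} → Val π → ent π j ≡ a → ⟦ X j ⟧ (⟦ X j ⟧ f) π ≡ ℕ→ℚ j * f π
    XX-Supp zero a {f} lt s {π} v e = solve 1 (λ f → con 0ℚ :* (con 0ℚ :* f) := con 0ℚ :* f) refl (f π)
    XX-Supp (suc k) a {f} lt s {π} v e = trans (cong₂ _+_ first second)
        (trans (solve 2 (λ k f → (k :* f :+ con 0ℚ) :+ (con 0ℚ :+ f) := (con 1ℚ :+ k) :* f) refl (ℕ→ℚ k) (f π))
          (cong (_* f π) (sym (ℕ→ℚ-+ 1 k))))
      where
      w = val-· k v
      Xk-right : ⟦ X k ⟧ f (π · k) ≡ 0ℚ
      Xk-right = In-vanish (X k) {suc k} (λ ρ → ent ρ (suc k) ≢ a) (λ i b e′ → b (trans (sym (ent-inv i)) e′)) (In-X k) s w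
        (λ e′ → ent-neq lt v e (trans (sym (ent-right lt v)) e′))
      Xk-sw : ⟦ X k ⟧ (⟦ sw k ⟧ f) π ≡ 0ℚ
      Xk-sw = In-vanish (X k) {suc k} (λ ρ → ent ρ (suc k) ≡ a) (λ i b → trans (ent-inv i) b) (In-X k)
        (λ {ρ} u b → s (val-· k u) (λ e′ → ent-neq lt u b (trans (sym (ent-right lt u)) e′))) v e
      first : ⟦ X k ⟧ (⟦ sw k ⟧ (⟦ X (suc k) ⟧ f)) (π · k) ≡ ℕ→ℚ k * f π + 0ℚ
      first = trans (⟦⟧-cong (X k) (sw-X-suc k f) w) (trans (⟦⟧-+ (X k) (⟦ X k ⟧ (⟦ sw k ⟧ f)) f w)
        (cong₂ _+_ (trans (XX-Supp k a (ℕP.<⇒≤ lt) (Supp-sw lt s) w (trans (ent-left lt v) e)) (cong (λ ρ → ℕ→ℚ k * f ρ) (invol π k))) Xk-right))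
      second : ⟦ X (suc k) ⟧ f (π · k) ≡ 0ℚ + f π
      second = cong₂ _+_ (trans (cong (⟦ X k ⟧ (⟦ sw k ⟧ f)) (invol π k)) Xk-sw) (cong f (invol π k))

    -- The coefficient of the identity in the unit, that is, its trace on the regular representation
    -- divided by the group order.
    tr : List ℤ → ℚ
    tr c = ⟦ E c ⟧ δ e₀

    E-Supp : ∀ c → length c ℕ.< n → Supp (length c) (ent e₀ (length c)) (⟦ E c ⟧ δ)
    E-Supp c lt = In-vanish (E c) (λ ρ → ent ρ (length c) ≢ ent e₀ (length c)) (λ i b e → b (trans (sym (ent-inv i)) e))
      (E-In c) (λ v → δ-supp v lt)

    -- The three extensions of a hook have contents α, -λ′ and 0. Their traces are the weights of a
    -- measure whose moments of order 0, 1, 2 are t, 0 and m t; this determines them, with N = α +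
    -- λ′ = m + 1.
    module HookTrace (b : List Bool) (lt : length (cs b) ℕ.< n) where
      private
        m = length (cs b)
        α λ′ t tA tL tI : ℚ
        α = ℕ→ℚ (suc (cnt true b))
        λ′ = ℕ→ℚ (suc (cnt false b))
        t = tr (cs b)
        tA = tr (arm-of b)
        tL = tr (leg-of b)
        tI = tr (inner-of b)
        leg-value : ℤ→ℚ (cont false (cnt false b)) ≡ - λ′
        leg-value = ℤ→ℚ-neg (ℤ.+ suc (cnt false b))
        total : t ≡ tA + tL + tI
        total = E-split b lt δ val-e₀
        Xm = X m
        first-moment : 0ℚ ≡ α * tA + (- λ′) * tL + 0ℚ * tI
        first-moment = trans (sym (X-Supp m (ent e₀ m) lt (E-Supp (cs b) lt) val-e₀ refl))
          (trans (sym (comm (Pol-comm-X (E-Pol (cs b) (ℕP.<⇒≤ lt)) lt) δ val-e₀))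
          (trans (E-proj-sum (cs b) lt (⟦ Xm ⟧ δ) val-e₀)
          (trans (∑-cong′ (contents m) (λ d → E-X d (cs b) δ lt val-e₀))
          (trans (E-three b lt ℤ→ℚ δ val-e₀) (cong (λ z → α * tA + z * tL + 0ℚ * tI) leg-value)))))
        second-moment : ℕ→ℚ m * t ≡ (α * α) * tA + ((- λ′) * (- λ′)) * tL + (0ℚ * 0ℚ) * tI
        second-moment = trans (sym (XX-Supp m (ent e₀ m) lt (E-Supp (cs b) lt) val-e₀ refl))
          (trans (sym (comm (Pol-comm (E-Pol (cs b) (ℕP.<⇒≤ lt)) (pol-⊙ (pol-X lt) (pol-X lt))) δ val-e₀))
          (trans (E-proj-sum (cs b) lt (⟦ Xm ⟧ (⟦ Xm ⟧ δ)) val-e₀)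
          (trans (∑-cong′ (contents m) (λ d → trans (E-X d (cs b) (⟦ Xm ⟧ δ) lt val-e₀)
              (trans (cong (ℤ→ℚ d *_) (E-X d (cs b) δ lt val-e₀)) (sym (*-assoc (ℤ→ℚ d) (ℤ→ℚ d) _)))))
          (trans (E-three b lt (λ d → ℤ→ℚ d * ℤ→ℚ d) δ val-e₀) (cong (λ z → (α * α) * tA + (z * z) * tL + (0ℚ * 0ℚ) * tI) leg-value)))))
        N = ℕ→ℚ (suc m)
        sizes : α + λ′ ≡ N
        sizes = trans (sym (ℕ→ℚ-+ (suc (cnt true b)) (suc (cnt false b)))) (cong (λ z → ℕ→ℚ (suc z))
          (trans (ℕP.+-suc (cnt true b) (cnt false b)) (trans (cong suc (cnt-total b)) (sym (cs-length b)))))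
        m-value : ℕ→ℚ m ≡ α + λ′ - 1ℚ
        m-value = trans (solve 1 (λ m → m := (con 1ℚ :+ m) :- con 1ℚ) refl (ℕ→ℚ m))
          (cong (_- 1ℚ) (trans (sym (ℕ→ℚ-+ 1 m)) (sym sizes)))

      arm-trace : tA * (α * N) ≡ ℕ→ℚ m * t
      arm-trace = trans (cong (λ z → tA * (α * z)) (sym sizes))
        (trans (solve 5 (λ α l tA tL tI → tA :* (α :* (α :+ l)) :=
             ((α :* α) :* tA :+ ((:- l) :* (:- l)) :* tL :+ (con 0ℚ :* con 0ℚ) :* tI) :+ l :* (α :* tA :+ (:- l) :* tL :+ con 0ℚ :* tI)) refl α λ′ tA tL tI)
        (trans (cong₂ (λ p q → p + λ′ * q) (sym second-moment) (sym first-moment)) (solve 2 (λ p l → p :+ l :* con 0ℚ := p) refl (ℕ→ℚ m * t) λ′)))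

      leg-trace : tL * (λ′ * N) ≡ ℕ→ℚ m * t
      leg-trace = trans (cong (λ z → tL * (λ′ * z)) (sym sizes))
        (trans (solve 5 (λ α l tA tL tI → tL :* (l :* (α :+ l)) :=
             ((α :* α) :* tA :+ ((:- l) :* (:- l)) :* tL :+ (con 0ℚ :* con 0ℚ) :* tI) :- α :* (α :* tA :+ (:- l) :* tL :+ con 0ℚ :* tI)) refl α λ′ tA tL tI)
        (trans (cong₂ (λ p q → p - α * q) (sym second-moment) (sym first-moment)) (solve 2 (λ p l → p :- l :* con 0ℚ := p) refl (ℕ→ℚ m * t) α)))

      inner-trace : tI * (α * λ′) ≡ t * (ℕ→ℚ (cnt true b) * ℕ→ℚ (cnt false b))
      inner-trace = *-cancelˡ N _ _ (ℕ→ℚ-suc≢0 m)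
        (trans (solve 6 (λ N tI tA tL α l → N :* (tI :* (α :* l)) := (tA :+ tL :+ tI) :* (α :* l) :* N :- (tA :* (α :* N)) :* l :- (tL :* (l :* N)) :* α) refl N tI tA tL α λ′)
        (trans (cong₂ (λ p q → p * (α * λ′) * N - q * λ′ - tL * (λ′ * N) * α) (sym total) arm-trace)
        (trans (cong (λ q → t * (α * λ′) * N - ℕ→ℚ m * t * λ′ - q * α) leg-trace)
        (trans (cong₂ (λ p q → t * (α * λ′) * p - q * t * λ′ - q * t * α) (sym sizes) m-value)
        (trans (solve 3 (λ t α l → t :* (α :* l) :* (α :+ l) :- (α :+ l :- con 1ℚ) :* t :* l :- (α :+ l :- con 1ℚ) :* t :* α
                  := (α :+ l) :* (t :* ((α :- con 1ℚ) :* (l :- con 1ℚ)))) refl t α λ′)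
        (cong₂ (λ p q → p * (t * q)) sizes (cong₂ _*_ (pred-value (cnt true b)) (pred-value (cnt false b)))))))))
        where
        pred-value : ∀ k → ℕ→ℚ (suc k) - 1ℚ ≡ ℕ→ℚ k
        pred-value k = trans (cong (_- 1ℚ) (ℕ→ℚ-+ 1 k)) (solve 1 (λ k → (con 1ℚ :+ k) :- con 1ℚ := k) refl (ℕ→ℚ k))

    -- The factor a! l! (a + l + 1) is the product of the hook lengths. Each added box changes it by
    -- the ratio found in `arm-trace` or `leg-trace`.
    hook-trace : ∀ b → length (cs b) ℕ.≤ n → tr (cs b) * (ℕ→ℚ (cnt true b !) * ℕ→ℚ (cnt false b !) * ℕ→ℚ (length (cs b))) ≡ 1ℚ
    hook-trace [] le = trans (cong (_* (1ℚ * 1ℚ * 1ℚ)) (trans (E-fix (ℤ.+ 0 ∷ []) {δ} (mk (λ _ → refl) , tt) val-e₀) δ-e₀)) refl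
    hook-trace (true ∷ b) le = trans (cong (λ z → tr (arm-of b) * (z * ℕ→ℚ (cnt false b !) * ℕ→ℚ (suc (length (cs b))))) (ℕ→ℚ-* (suc (cnt true b)) (cnt true b !)))
      (trans (solve 5 (λ t a f g N → t :* ((a :* f) :* g :* N) := (t :* (a :* N)) :* (f :* g)) refl
          (tr (arm-of b)) (ℕ→ℚ (suc (cnt true b))) (ℕ→ℚ (cnt true b !)) (ℕ→ℚ (cnt false b !)) (ℕ→ℚ (suc (length (cs b)))))
      (trans (cong (_* (ℕ→ℚ (cnt true b !) * ℕ→ℚ (cnt false b !))) (HookTrace.arm-trace b le))
      (trans (solve 4 (λ m t f g → (m :* t) :* (f :* g) := t :* (f :* g :* m)) refl (ℕ→ℚ (length (cs b))) (tr (cs b)) (ℕ→ℚ (cnt true b !)) (ℕ→ℚ (cnt false b !)))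
        (hook-trace b (ℕP.<⇒≤ le)))))
    hook-trace (false ∷ b) le = trans (cong (λ z → tr (leg-of b) * (ℕ→ℚ (cnt true b !) * z * ℕ→ℚ (suc (length (cs b))))) (ℕ→ℚ-* (suc (cnt false b)) (cnt false b !)))
      (trans (solve 5 (λ t a f g N → t :* (f :* (a :* g) :* N) := (t :* (a :* N)) :* (f :* g)) refl
          (tr (leg-of b)) (ℕ→ℚ (suc (cnt false b))) (ℕ→ℚ (cnt true b !)) (ℕ→ℚ (cnt false b !)) (ℕ→ℚ (suc (length (cs b)))))
      (trans (cong (_* (ℕ→ℚ (cnt true b !) * ℕ→ℚ (cnt false b !))) (HookTrace.leg-trace b le))
      (trans (solve 4 (λ m t f g → (m :* t) :* (f :* g) := t :* (f :* g :* m)) refl (ℕ→ℚ (length (cs b))) (tr (cs b)) (ℕ→ℚ (cnt true b !)) (ℕ→ℚ (cnt false b !)))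
        (hook-trace b (ℕP.<⇒≤ le)))))

    -- Convolution with functions invariant under S_{n-1}

    wordOp : List ℕ → Op
    wordOp [] = κ 1ℚ
    wordOp (k ∷ w) = sw k ⊙ wordOp w

    wordOp-In : ∀ {w} → All (λ k → suc k ℕ.< n) w → In n (wordOp w)
    wordOp-In [] = tt
    wordOp-In (h ∷ hs) = h , wordOp-In hs

    ⟦wordOp⟧ : ∀ w f π → ⟦ wordOp w ⟧ f π ≡ f (foldl _·_ π w)
    ⟦wordOp⟧ [] f π = *-identityˡ (f π)
    ⟦wordOp⟧ (k ∷ w) f π = ⟦wordOp⟧ w f (π · k)

    comp-word : ∀ w π ρ → foldl _·_ (comp π ρ) w ≡ comp π (foldl _·_ ρ w)
    comp-word [] π ρ = refl
    comp-word (k ∷ w) π ρ = trans (cong (λ τ → foldl _·_ τ w) (sym (comp-· π ρ k))) (comp-word w π (ρ · k))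

    -- comp (e₀ · k) (ρ · k) is the conjugate of ρ by (k+1, k+2).
    ClassFunction : V → Set
    ClassFunction χ = ∀ {k} → suc (suc k) ℕ.< n → ∀ {ρ} → Val ρ → χ (comp (e₀ · k) (ρ · k)) ≡ χ ρ

    module Convolution (χ : V) where
      -- Spelling each ρ as a word in the generators makes convolution an `Op`, to which
      -- `primitivity` and the centrality of `Z` apply.
      conv′ : ∀ L → All Val L → Op
      conv′ [] [] = κ 0ℚ
      conv′ (ρ ∷ L) (v ∷ vs) = (κ (χ ρ) ⊙ wordOp (proj₁ (word v))) ∔ conv′ L vs

      conv : Op
      conv = conv′ enum (All.tabulate enum-val)

      conv′-In : ∀ L vs → In n (conv′ L vs)
      conv′-In [] [] = tt
      conv′-In (ρ ∷ L) (v ∷ vs) = (tt , wordOp-In (proj₁ (proj₂ (word v)))) , conv′-In L vs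

      conv-In : In n conv
      conv-In = conv′-In enum _

      ⟦conv′⟧ : ∀ L vs f {π} → Val π → ⟦ conv′ L vs ⟧ f π ≡ ∑ (λ ρ → χ ρ * f (comp π ρ)) L
      ⟦conv′⟧ [] [] f {π} v = *-zeroˡ (f π)
      ⟦conv′⟧ (ρ ∷ L) (w ∷ vs) f {π} v = cong₂ _+_ (cong (χ ρ *_) (trans (⟦wordOp⟧ (proj₁ (word w)) f π) (cong f
        (trans (cong (λ τ → foldl _·_ τ (proj₁ (word w))) (sym (comp-e₀ v)))
        (trans (comp-word (proj₁ (word w)) π e₀) (cong (comp π) (proj₂ (proj₂ (word w)))))))))
        (⟦conv′⟧ L vs f v)

      ⟦conv⟧ : ∀ f {π} → Val π → ⟦ conv ⟧ f π ≡ ∑ (λ ρ → χ ρ * f (comp π ρ)) enum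
      ⟦conv⟧ = ⟦conv′⟧ enum _

      module _ (cls : ClassFunction χ) where
        -- Substitute s ρ s for ρ: then (π s)(s ρ s) = (π ρ) s, while χ keeps its value.
        conv-sw : ∀ {k} → suc (suc k) ℕ.< n → Comm conv (sw k)
        conv-sw {k} lt = mk λ f {π} v → trans (⟦conv⟧ (⟦ sw k ⟧ f) v)
            (sym (trans (⟦conv⟧ f (val-· k v))
            (trans (sym (∑-↭ (λ ρ → χ ρ * f (comp (π · k) ρ)) (enum-conj k)))
            (trans (∑-map (λ ρ → χ ρ * f (comp (π · k) ρ)) (λ ρ → comp (e₀ · k) (ρ · k)) enum)
            (∑-cong enum (λ ρ m → cong₂ _*_ (cls lt (enum-val m)) (cong f (cancel v (enum-val m)))))))))
          where
          cancel : ∀ {π ρ} → Val π → Val ρ → comp (π · k) (comp (e₀ · k) (ρ · k)) ≡ comp π ρ · k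
          cancel {π} {ρ} v w = trans (sym (comp-assoc (val-· k v) (val-· k val-e₀) (val-· k w)))
            (trans (cong (λ τ → comp τ (ρ · k)) (trans (comp-· (π · k) e₀ k) (trans (cong (_· k) (comp-e₀ (val-· k v))) (invol π k))))
              (comp-· π ρ k))

        conv-lower : ∀ p {m} → In m p → m ℕ.< n → Comm conv p
        conv-lower p h lt = comm-sym (go p h)
          where
          go : ∀ p → In _ p → Comm p conv
          go (sw k) h = comm-sym (conv-sw (ℕP.≤-<-trans h lt))
          go (κ c) h = comm-κ c conv
          go (p ∔ q) (a , b) = comm-∔ (go p a) (go q b)
          go (p ⊙ q) (a , b) = comm-⊙ (go p a) (go q b)

        -- The last Jucys–Murphy element is a difference of central elements of
        -- ℚ[S_n] and ℚ[S_{n-1}].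
        conv-X : ∀ j → j ℕ.< n → Comm conv (X j)
        conv-X j lt with ℕP.m≤n⇒m<n∨m≡n lt
        ... | inj₁ lt′ = conv-lower (X j) (In-X j) lt′
        ... | inj₂ e = mk λ f {π} v → let z = ⟦ conv ⟧ (⟦ Z j ⟧ f) π in
            trans (solve 2 (λ z x → x := (z :+ x) :- z) refl z (⟦ conv ⟧ (⟦ X j ⟧ f) π))
            (trans (cong₂ _-_ (trans (sym (⟦⟧-+ conv (⟦ Z j ⟧ f) (⟦ X j ⟧ f) v)) (comm central f v)) (comm (conv-lower (Z j) (Z-In j) lt) f v))
              (solve 2 (λ z x → (z :+ x) :- z := x) refl (⟦ Z j ⟧ (⟦ conv ⟧ f) π) (⟦ X j ⟧ (⟦ conv ⟧ f) π)))
          where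
          central : Comm conv (Z (suc j))
          central = In-Z conv (subst (λ z → In z conv) (sym e) conv-In) lt

        record IsScalar (c : List ℤ) (w : ℚ) : Set where
          constructor mk
          field scales : ∀ g → Eig c g → ⟦ conv ⟧ g ≐ w *ᵛ g
        open IsScalar

        scalar : ∀ c → length c ≡ n → ∃ λ w → IsScalar c w
        scalar c lc with primitivity n c conv lc ℕP.≤-refl conv-In
        ... | w , h = w , mk λ g e v → trans (sym (E-fix c (Eig-comm conv c (λ j lt → conv-X j (subst (j ℕ.<_) lc lt)) e) v))
              (trans (⟦⟧-cong (E c ⊙ conv) (λ u → sym (E-fix c e u)) v) (trans (h g v) (cong (w *_) (E-fix c e v))))

        -- The intertwiner uses a transposition of S_{n-1}, so it commutes with `conv` and carries
        -- the scalar from one order of the contents to the other; far contents make it invertible.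
        scalar-swap : ∀ hi a b lo {w} → length (hi ++ b ∷ a ∷ lo) ℕ.≤ n → suc (suc (length lo)) ℕ.< n → Far a b →
          IsScalar (hi ++ a ∷ b ∷ lo) w → IsScalar (hi ++ b ∷ a ∷ lo) w
        scalar-swap hi a b lo {w} le lt far′ s = mk λ g e {π} v → *-cancelˡ D (⟦ conv ⟧ g π) (w * g π) (gap-nonzero a b far′)
            (trans (sym (T-back i a b (⟦ conv ⟧ g) v))
            (trans (⟦⟧-cong (T i (gap b a)) {⟦ T i (gap a b) ⟧ (⟦ conv ⟧ g)} (λ u → trans (comm TC g u) (scales s (⟦ T i (gap a b) ⟧ g) (T-Eig-deep hi a b lo le e) u)) v)
            (trans (⟦⟧-* (T i (gap b a)) w (⟦ T i (gap a b) ⟧ g) v)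
            (trans (cong (w *_) (T-back i a b g v)) (solve 3 (λ w D g → w :* (D :* g) := D :* (w :* g)) refl w D (g π))))))
          where
          i = length lo
          D = 1ℚ - gap a b * gap a b
          TC : Comm (T i (gap a b)) conv
          TC = T-comm (comm-sym (conv-sw lt))

        cs-prefix : ∀ pre w w′ → (∀ t → cnt t w ≡ cnt t w′) → ∃ λ hi → cs (pre ++ w) ≡ hi ++ cs w × cs (pre ++ w′) ≡ hi ++ cs w′
        cs-prefix pre w w′ h = proj₁ (go pre) , proj₁ (proj₂ (go pre)) , proj₁ (proj₂ (proj₂ (go pre)))
          where
          go : ∀ pre → ∃ λ hi → cs (pre ++ w) ≡ hi ++ cs w × cs (pre ++ w′) ≡ hi ++ cs w′ × (∀ t → cnt t (pre ++ w) ≡ cnt t (pre ++ w′))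
          go [] = [] , refl , refl , h
          go (u ∷ pre) with go pre
          ... | hi , e , e′ , c = cont u (cnt u (pre ++ w)) ∷ hi , cong (_ ∷_) e , cong₂ _∷_ (cong (cont u) (sym (c u))) e′ , c′ u
            where
            c′ : ∀ u t → cnt t (u ∷ pre ++ w) ≡ cnt t (u ∷ pre ++ w′)
            c′ true true = cong suc (c true)
            c′ true false = c false
            c′ false true = c true
            c′ false false = cong suc (c false)

        adjacent-step : ∀ d hi {a b lo c c′ w} → c ≡ hi ++ a ∷ b ∷ lo → c′ ≡ hi ++ b ∷ a ∷ lo → suc (length c) ≡ n → Far a b →
          IsScalar (d ∷ c) w → IsScalar (d ∷ c′) w
        adjacent-step d hi {a} {b} {lo} refl refl le far′ = scalar-swap (d ∷ hi) a b lo
          (ℕP.≤-reflexive (trans (cong suc (trans (length-++ hi) (sym (length-++ hi)))) le))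
          (ℕP.<-≤-trans (s≤s (ℕP.≤-trans (ℕP.m≤n+m _ (length hi)) (ℕP.≤-reflexive (sym (length-++ hi))))) (ℕP.≤-reflexive le)) far′

        scalar-adjacent : ∀ d {w} pre u v suf → suc (length (cs (pre ++ u ∷ v ∷ suf))) ≡ n →
          IsScalar (d ∷ cs (pre ++ u ∷ v ∷ suf)) w → IsScalar (d ∷ cs (pre ++ v ∷ u ∷ suf)) w
        scalar-adjacent d pre true true suf le s = s
        scalar-adjacent d pre false false suf le s = s
        scalar-adjacent d {w} pre true false suf le s with cs-prefix pre (true ∷ false ∷ suf) (false ∷ true ∷ suf) (λ { true → refl ; false → refl })
        ... | hi , e , e′ = adjacent-step d hi e e′ le (far-opp true (cnt true suf) (cnt false suf)) s
        scalar-adjacent d {w} pre false true suf le s with cs-prefix pre (false ∷ true ∷ suf) (true ∷ false ∷ suf) (λ { true → refl ; false → refl })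
        ... | hi , e , e′ = adjacent-step d hi e e′ le (far-opp false (cnt false suf) (cnt true suf)) s

        -- Two fillings of one hook differ by exchanges of consecutive boxes. Exchanging an arm box
        -- with a leg box is allowed because their contents have opposite signs and so are far; two
        -- boxes of the same limb give the same list.
        scalar-↭ : ∀ d {w} pre {xs ys} → xs ↭ ys → suc (length (cs (pre ++ xs))) ≡ n →
          IsScalar (d ∷ cs (pre ++ xs)) w → IsScalar (d ∷ cs (pre ++ ys)) w
        scalar-↭ d pre Perm.refl le s = s
        scalar-↭ d {w} pre (Perm.prep {xs} {ys} x p) le s = subst (λ z → IsScalar (d ∷ cs z) w) (++-assoc pre (x ∷ []) ys)
          (scalar-↭ d (pre ++ x ∷ []) p (trans (cong (λ z → suc (length (cs z))) (++-assoc pre (x ∷ []) xs)) le)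
            (subst (λ z → IsScalar (d ∷ cs z) w) (sym (++-assoc pre (x ∷ []) xs)) s))
        scalar-↭ d {w} pre (Perm.swap {xs} {ys} x y p) le s = subst (λ z → IsScalar (d ∷ cs z) w) (++-assoc pre (y ∷ x ∷ []) ys)
          (scalar-↭ d (pre ++ y ∷ x ∷ []) p
            (trans (cong suc (trans (len (pre ++ y ∷ x ∷ []) xs) (trans (cong (λ z → suc (z ℕ.+ length xs)) (trans (length-++ pre) (sym (length-++ pre {x ∷ y ∷ []}))))
              (trans (sym (len (pre ++ x ∷ y ∷ []) xs)) (cong (λ z → length (cs z)) (++-assoc pre (x ∷ y ∷ []) xs)))))) le)
            (subst (λ z → IsScalar (d ∷ cs z) w) (sym (++-assoc pre (y ∷ x ∷ []) xs)) (scalar-adjacent d pre x y xs le s)))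
          where
          len : ∀ a b → length (cs (a ++ b)) ≡ suc (length a ℕ.+ length b)
          len a b = trans (cs-length (a ++ b)) (cong suc (length-++ a))
        scalar-↭ d pre (Perm.trans {xs} {ys} p q) le s = scalar-↭ d pre q
          (trans (cong suc (trans (cs-length (pre ++ ys)) (trans (cong suc (trans (length-++ pre) (trans (cong (length pre ℕ.+_) (sym (Permₚ.↭-length p))) (sym (length-++ pre))))) (sym (cs-length (pre ++ xs)))))) le)
          (scalar-↭ d pre p le s)

        -- The value of `conv` g at the identity is ⟨ g , χ ⟩. One scalar serves the whole family
        -- and every f, which is the rank-one property of its sum.
        family-scalar : ∀ d F A L → (∀ {b} → b ∈ F → cnt true b ≡ A × cnt false b ≡ L) → suc (suc (A ℕ.+ L)) ≡ n →
          ∃ λ w → ∀ f → ∑ (λ b → ⟨ ⟦ E (d ∷ cs b) ⟧ f , χ ⟩) F ≡ w * ∑ (λ b → ⟦ E (d ∷ cs b) ⟧ f e₀) F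
        family-scalar d F A L h le = w , λ f → trans (∑-cong F (term f)) (∑-*ˡ w (λ b → ⟦ E (d ∷ cs b) ⟧ f e₀) F)
          where
          b₀ : List Bool
          b₀ = replicate A true ++ replicate L false
          len : ∀ b → cnt true b ≡ A → cnt false b ≡ L → suc (length (cs b)) ≡ n
          len b eA eL = trans (cong suc (trans (cs-length b) (cong suc (trans (sym (cnt-total b)) (cong₂ ℕ._+_ eA eL))))) le
          cnt-t : ∀ a l → cnt true (replicate a true ++ replicate l false) ≡ a
          cnt-t (suc a) l = cong suc (cnt-t a l)
          cnt-t zero zero = refl
          cnt-t zero (suc l) = cnt-t zero l
          cnt-f : ∀ a l → cnt false (replicate a true ++ replicate l false) ≡ l
          cnt-f (suc a) l = cnt-f a l
          cnt-f zero zero = refl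
          cnt-f zero (suc l) = cong suc (cnt-f zero l)
          l₀ : suc (length (cs b₀)) ≡ n
          l₀ = len b₀ (cnt-t A L) (cnt-f A L)
          w = proj₁ (scalar (d ∷ cs b₀) l₀)
          term : ∀ f b → b ∈ F → ⟨ ⟦ E (d ∷ cs b) ⟧ f , χ ⟩ ≡ w * ⟦ E (d ∷ cs b) ⟧ f e₀
          term f b m = trans (∑-cong enum (λ ρ k → trans (*-comm (g ρ) (χ ρ)) (cong (λ τ → χ ρ * g τ) (sym (comp-id (enum-val k))))))
              (trans (sym (⟦conv⟧ g val-e₀)) (scales scal g (E-eig (d ∷ cs b) (ℕP.≤-reflexive (len b eA eL)) f) val-e₀))
            where
            g = ⟦ E (d ∷ cs b) ⟧ f
            eA = proj₁ (h m)
            eL = proj₂ (h m)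
            comp-id : ∀ {ρ} → Val ρ → comp e₀ ρ ≡ ρ
            comp-id v with word v
            ... | u , _ , refl = trans (sym (comp-word u e₀ e₀)) (cong (λ τ → foldl _·_ τ u) (comp-e₀ val-e₀))
            scal : IsScalar (d ∷ cs b) w
            scal = scalar-↭ d [] (same-counts-↭ b₀ b (λ { true → trans (cnt-t A L) (sym eA) ; false → trans (cnt-f A L) (sym eL) })) l₀
              (proj₂ (scalar (d ∷ cs b₀) l₀))

open JucysMurphy
open import Data.Bool using (T)
open import Data.Nat using (_+_; _*_; _∸_; _≤_; _<_; _≤ᵇ_; _≡ᵇ_)
open import Data.Nat.Properties

-- Permutations as lists

unique-set-↭ : {xs ys : List A} → Unique xs → Unique ys → (∀ {x} → x ∈ xs → x ∈ ys) → (∀ {x} → x ∈ ys → x ∈ xs) → xs ↭ ys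
unique-set-↭ u u′ f g = ∼bag⇒↭ (unique∧set⇒bag u u′ (mk⇔ f g))

unique-resp-↭ : {xs ys : List A} → xs ↭ ys → Unique xs → Unique ys
unique-resp-↭ Perm.refl u = u
unique-resp-↭ (Perm.prep x p) (h ∷ u) = Permₚ.All-resp-↭ p h ∷ unique-resp-↭ p u
unique-resp-↭ (Perm.swap x y p) ((xy ∷ hx) ∷ hy ∷ u) =
  ((λ e → xy (sym e)) ∷ Permₚ.All-resp-↭ p hy) ∷ Permₚ.All-resp-↭ p hx ∷ unique-resp-↭ p u
unique-resp-↭ (Perm.trans p q) u = unique-resp-↭ q (unique-resp-↭ p u)

unique-map-local : (f : A → B) (xs : List A) → (∀ {x y} → x ∈ xs → y ∈ xs → f x ≡ f y → x ≡ y) → Unique xs → Unique (map f xs)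
unique-map-local f [] h [] = []
unique-map-local f (x ∷ xs) h (x∉ ∷ u) =
  Allₚ.map⁺ (All.tabulate (λ {y} m e → All.lookup x∉ m (h (here refl) (there m) e)))
  ∷ unique-map-local f xs (λ a b → h (there a) (there b)) u

swapAt : ℕ → List A → List A
swapAt zero (a ∷ b ∷ l) = b ∷ a ∷ l
swapAt (suc k) (a ∷ l) = a ∷ swapAt k l
swapAt k l = l

swapAt-↭ : ∀ k (l : List A) → swapAt k l ↭ l
swapAt-↭ zero [] = ↭-refl
swapAt-↭ zero (a ∷ []) = ↭-refl
swapAt-↭ zero (a ∷ b ∷ l) = Perm.swap b a ↭-refl
swapAt-↭ (suc k) [] = ↭-refl
swapAt-↭ (suc k) (a ∷ l) = Perm.prep a (swapAt-↭ k l)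

swapAt-invol : ∀ (l : List A) k → swapAt k (swapAt k l) ≡ l
swapAt-invol [] zero = refl
swapAt-invol (a ∷ []) zero = refl
swapAt-invol (a ∷ b ∷ l) zero = refl
swapAt-invol [] (suc k) = refl
swapAt-invol (a ∷ l) (suc k) = cong (a ∷_) (swapAt-invol l k)

swapAt-[] : ∀ k → swapAt k ([] {A = A}) ≡ []
swapAt-[] zero = refl
swapAt-[] (suc k) = refl

swapAt-far : ∀ (l : List A) {i k} → suc (suc i) ≤ k → swapAt k (swapAt i l) ≡ swapAt i (swapAt k l)
swapAt-far [] {i} {k} le = trans (cong (swapAt k) (swapAt-[] i)) (trans (swapAt-[] k) (sym (trans (cong (swapAt i) (swapAt-[] k)) (swapAt-[] i))))
swapAt-far (a ∷ _) {zero} {suc zero} (s≤s ())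
swapAt-far (a ∷ []) {zero} {suc (suc k)} le = refl
swapAt-far (a ∷ b ∷ l) {zero} {suc (suc k)} le = refl
swapAt-far (a ∷ l) {suc i} {suc k} (s≤s le) = cong (a ∷_) (swapAt-far l le)

swapAt-braid : ∀ (l : List A) i → suc (suc i) < length l →
  swapAt i (swapAt (suc i) (swapAt i l)) ≡ swapAt (suc i) (swapAt i (swapAt (suc i) l))
swapAt-braid (a ∷ b ∷ []) zero (s≤s (s≤s ()))
swapAt-braid (a ∷ b ∷ c ∷ l) zero lt = refl
swapAt-braid (a ∷ l) (suc i) (s≤s lt) = cong (a ∷_) (swapAt-braid l i lt)

map-swapAt : (f : A → B) (k : ℕ) (l : List A) → map f (swapAt k l) ≡ swapAt k (map f l)
map-swapAt f zero [] = refl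
map-swapAt f zero (a ∷ []) = refl
map-swapAt f zero (a ∷ b ∷ l) = refl
map-swapAt f (suc k) [] = refl
map-swapAt f (suc k) (a ∷ l) = cong (f a ∷_) (map-swapAt f k l)

at-swapAt-left : ∀ k l {d} → suc k < length l → at (swapAt k l) k d ≡ at l (suc k) d
at-swapAt-left zero (a ∷ b ∷ l) lt = refl
at-swapAt-left zero (a ∷ []) (s≤s ())
at-swapAt-left (suc k) (a ∷ l) (s≤s lt) = at-swapAt-left k l lt

at-swapAt-right : ∀ k l {d} → suc k < length l → at (swapAt k l) (suc k) d ≡ at l k d
at-swapAt-right zero (a ∷ b ∷ l) lt = refl
at-swapAt-right zero (a ∷ []) (s≤s ())
at-swapAt-right (suc k) (a ∷ l) (s≤s lt) = at-swapAt-right k l lt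

at-swapAt-other : ∀ k l {j d} → j ≢ k → j ≢ suc k → at (swapAt k l) j d ≡ at l j d
at-swapAt-other zero [] n₁ n₂ = refl
at-swapAt-other zero (a ∷ []) n₁ n₂ = refl
at-swapAt-other zero (a ∷ b ∷ l) {zero} n₁ n₂ = ⊥-elim (n₁ refl)
at-swapAt-other zero (a ∷ b ∷ l) {suc zero} n₁ n₂ = ⊥-elim (n₂ refl)
at-swapAt-other zero (a ∷ b ∷ l) {suc (suc j)} n₁ n₂ = refl
at-swapAt-other (suc k) [] n₁ n₂ = refl
at-swapAt-other (suc k) (a ∷ l) {zero} n₁ n₂ = refl
at-swapAt-other (suc k) (a ∷ l) {suc j} n₁ n₂ = at-swapAt-other k l (λ e → n₁ (cong suc e)) (λ e → n₂ (cong suc e))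

at-∈ : ∀ l {i d} → i < length l → at l i d ∈ l
at-∈ (a ∷ l) {zero} lt = here refl
at-∈ (a ∷ l) {suc i} (s≤s lt) = there (at-∈ l lt)

∈-at : ∀ {l y} → y ∈ l → ∃ λ i → i < length l × (∀ d → at l i d ≡ y)
∈-at (here refl) = 0 , s≤s z≤n , λ d → refl
∈-at (there m) with ∈-at m
... | i , lt , e = suc i , s≤s lt , e

at-injective : ∀ l {i j d d′} → Unique l → i < length l → j < length l → at l i d ≡ at l j d′ → i ≡ j
at-injective (a ∷ l) {zero} {zero} u lt lt′ e = refl
at-injective (a ∷ l) {zero} {suc j} (h ∷ u) lt (s≤s lt′) e = ⊥-elim (All.lookup h (at-∈ l lt′) e)
at-injective (a ∷ l) {suc i} {zero} (h ∷ u) (s≤s lt) lt′ e = ⊥-elim (All.lookup h (at-∈ l lt) (sym e))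
at-injective (a ∷ l) {suc i} {suc j} (h ∷ u) (s≤s lt) (s≤s lt′) e = cong suc (at-injective l u lt lt′ e)

at-map : ∀ (f : ℕ → ℕ) l i {d d′} → i < length l → at (map f l) i d ≡ f (at l i d′)
at-map f (a ∷ l) zero lt = refl
at-map f (a ∷ l) (suc i) (s≤s lt) = at-map f l i lt

at-applyUpTo : ∀ l (g : ℕ → ℕ) → applyUpTo (λ i → at l i (g i)) (length l) ≡ l
at-applyUpTo [] g = refl
at-applyUpTo (a ∷ l) g = cong (a ∷_) (at-applyUpTo l (λ i → g (suc i)))

range-length : ∀ n → length (range 1 n) ≡ n
range-length n = length-applyUpTo (1 +_) n

map-app-range : ∀ π → map (app π) (range 1 (length π)) ≡ π
map-app-range π = trans (map-applyUpTo (1 +_) (app π) (length π)) (at-applyUpTo π suc)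

insertEverywhere-∈⁻ : ∀ x ys {l} → l ∈ insertEverywhere x ys → ∃₂ λ a b → ys ≡ a ++ b × l ≡ a ++ x ∷ b
insertEverywhere-∈⁻ x [] (here refl) = [] , [] , refl , refl
insertEverywhere-∈⁻ x (y ∷ ys) (here refl) = [] , y ∷ ys , refl , refl
insertEverywhere-∈⁻ x (y ∷ ys) (there m) with ∈-map⁻ (y ∷_) m
... | l , k , refl with insertEverywhere-∈⁻ x ys k
... | a , b , refl , refl = y ∷ a , b , refl , refl

insertEverywhere-∈⁺ : ∀ x a b → a ++ x ∷ b ∈ insertEverywhere x (a ++ b)
insertEverywhere-∈⁺ x [] [] = here refl
insertEverywhere-∈⁺ x [] (y ∷ b) = here refl
insertEverywhere-∈⁺ x (y ∷ a) b = there (∈-map⁺ (y ∷_) (insertEverywhere-∈⁺ x a b))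

∈-permutations⁻ : ∀ xs {π} → π ∈ permutations xs → π ↭ xs
∈-permutations⁻ [] (here refl) = ↭-refl
∈-permutations⁻ (x ∷ xs) m with find (∈-concatMap⁻ (insertEverywhere x) {xs = permutations xs} m)
... | ys , my , k with insertEverywhere-∈⁻ x ys k
... | a , b , refl , refl = ↭-trans (shift x a b) (Perm.prep x (∈-permutations⁻ xs my))

∈-permutations⁺ : ∀ xs {π} → π ↭ xs → π ∈ permutations xs
∈-permutations⁺ [] p rewrite Permₚ.↭-empty-inv p = here refl
∈-permutations⁺ (x ∷ xs) {π} p with ∈-∃++ (∈-resp-↭ (↭-sym p) (here refl))
... | a , b , refl = ∈-concatMap⁺ (insertEverywhere x) (lose (∈-permutations⁺ xs (drop-mid a [] p)) (insertEverywhere-∈⁺ x a b))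

insertEverywhere-unique : ∀ x ys → x ∉ ys → Unique (insertEverywhere x ys)
insertEverywhere-unique x [] ne = [] ∷ []
insertEverywhere-unique x (y ∷ ys) ne =
  All.tabulate (λ m e → ne (here (head-eq m e))) ∷ Uniqueₚ.map⁺ ∷-injectiveʳ (insertEverywhere-unique x ys (λ k → ne (there k)))
  where
  head-eq : ∀ {l} → l ∈ map (y ∷_) (insertEverywhere x ys) → x ∷ y ∷ ys ≡ l → x ≡ y
  head-eq m e with ∈-map⁻ (y ∷_) m
  head-eq m refl | _ , _ , refl = refl

insert-cancel : ∀ {x : ℕ} a b a′ b′ → x ∉ a ++ b → x ∉ a′ ++ b′ → a ++ x ∷ b ≡ a′ ++ x ∷ b′ → a ++ b ≡ a′ ++ b′
insert-cancel [] b [] b′ n n′ e = ∷-injectiveʳ e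
insert-cancel [] b (y ∷ a′) b′ n n′ e = ⊥-elim (n′ (here (∷-injectiveˡ e)))
insert-cancel (y ∷ a) b [] b′ n n′ e = ⊥-elim (n (here (sym (∷-injectiveˡ e))))
insert-cancel (y ∷ a) b (y′ ∷ a′) b′ n n′ e = cong₂ _∷_ (∷-injectiveˡ e)
  (insert-cancel a b a′ b′ (λ k → n (there k)) (λ k → n′ (there k)) (∷-injectiveʳ e))

permutations-unique : ∀ xs → Unique xs → Unique (permutations xs)
permutations-unique [] u = [] ∷ []
permutations-unique (x ∷ xs) (x∉ ∷ u) = Uniqueₚ.concat⁺
  (Allₚ.map⁺ (All.tabulate (λ {ys} m → insertEverywhere-unique x ys (notin m))))
  (AllPairsₚ.map⁺ (pairs (permutations xs) (λ m → notin m) (permutations-unique xs u)))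
  where
  notin : ∀ {ys} → ys ∈ permutations xs → x ∉ ys
  notin m k = All.lookup x∉ (∈-resp-↭ (∈-permutations⁻ xs m) k) refl
  pairs : ∀ L → (∀ {ys} → ys ∈ L → x ∉ ys) → Unique L →
    AllPairs.AllPairs (λ a b → ∀ {v} → ¬ (v ∈ insertEverywhere x a × v ∈ insertEverywhere x b)) L
  pairs [] h [] = []
  pairs (ys ∷ L) h (y∉ ∷ u) = All.tabulate (λ {zs} m {v} kk → clash ys zs (h (here refl)) (h (there m)) (All.lookup y∉ m) (proj₁ kk) (proj₂ kk))
      ∷ pairs L (λ m → h (there m)) u
    where
    clash : ∀ ys zs → x ∉ ys → x ∉ zs → ys ≢ zs → ∀ {v} → v ∈ insertEverywhere x ys → v ∈ insertEverywhere x zs → ⊥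
    clash ys zs ny nz ne k k′ with insertEverywhere-∈⁻ x ys k | insertEverywhere-∈⁻ x zs k′
    ... | a , b , refl , refl | a′ , b′ , refl , e = ne (insert-cancel a b a′ b′ ny nz e)

-- A derivation of `↭` is read as a sorting procedure; the length of the settled prefix `pre` is the
-- position of the next adjacent swap.
↭-word : ∀ pre {xs ys : List ℕ} → xs ↭ ys → ∃ λ w →
  All (λ k → suc k < length (pre ++ xs)) w × foldl (λ π k → swapAt k π) (pre ++ xs) w ≡ pre ++ ys
↭-word pre Perm.refl = [] , [] , refl
↭-word pre (Perm.prep {xs} {ys} x p) with ↭-word (pre ++ x ∷ []) p
... | w , h , e rewrite ++-assoc pre (x ∷ []) xs | ++-assoc pre (x ∷ []) ys = w , h , e
↭-word pre (Perm.swap {xs} {ys} x y p) with ↭-word (pre ++ y ∷ x ∷ []) p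
... | w , h , e rewrite ++-assoc pre (y ∷ x ∷ []) xs | ++-assoc pre (y ∷ x ∷ []) ys =
  length pre ∷ w
  , subst (suc (length pre) <_) (sym (length-++ pre)) (subst (_≤ length pre + suc (suc (length xs))) (trans (+-suc (length pre) 1) (cong suc (+-comm (length pre) 1))) (+-monoʳ-≤ (length pre) (s≤s (s≤s z≤n))))
    ∷ All.map (λ {k} → subst (suc k <_) (trans (length-++ pre) (sym (length-++ pre)))) h
  , trans (cong (λ π → foldl (λ π k → swapAt k π) π w) (swap-mid pre)) e
  where
  swap-mid : ∀ pre → swapAt (length pre) (pre ++ x ∷ y ∷ xs) ≡ pre ++ y ∷ x ∷ xs
  swap-mid [] = refl
  swap-mid (z ∷ pre) = cong (z ∷_) (swap-mid pre)
↭-word pre (Perm.trans {xs} {ys} p q) with ↭-word pre p | ↭-word pre q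
... | w , h , e | w′ , h′ , e′ = w ++ w′
  , Allₚ.++⁺ h (All.map (λ {k} → subst (suc k <_) (trans (length-++ pre) (trans (cong (length pre +_) (sym (↭-length p))) (sym (length-++ pre))))) h′)
  , trans (foldl-++ _ (pre ++ xs) w w′) (trans (cong (λ π → foldl (λ π k → swapAt k π) π w′) e) e′)

-- The symmetric group as a regular action

module SymmetricGroup (n : ℕ) where

  Val : List ℕ → Set
  Val π = π ↭ range 1 n

  id₀ : List ℕ
  id₀ = range 1 n

  val-length : ∀ {π} → Val π → length π ≡ n
  val-length v = trans (↭-length v) (range-length n)

  val-unique : ∀ {π} → Val π → Unique π
  val-unique v = unique-resp-↭ (↭-sym v) (range-unique 1 n)

  val-swap : ∀ {π} k → Val π → Val (swapAt k π)
  val-swap {π} k v = ↭-trans (swapAt-↭ k π) v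

  app-∈ : ∀ {π x} → Val π → x ∈ id₀ → app π x ∈ id₀
  app-∈ {π} {zero} v m with ∈-range⁻ {1} {n} m
  ... | () , _
  app-∈ {π} {suc x} v m = ∈-resp-↭ v (at-∈ π (subst (x <_) (sym (val-length v)) (proj₂ (∈-range⁻ {1} {n} m))))

  app-inj : ∀ {π x y} → Val π → x ∈ id₀ → y ∈ id₀ → app π x ≡ app π y → x ≡ y
  app-inj {π} {zero} v m m′ e with ∈-range⁻ {1} {n} m
  ... | () , _
  app-inj {π} {suc x} {zero} v m m′ e with ∈-range⁻ {1} {n} m′
  ... | () , _
  app-inj {π} {suc x} {suc y} v m m′ e = cong suc (at-injective π (val-unique v)
    (subst (x <_) (sym (val-length v)) (proj₂ (∈-range⁻ {1} {n} m))) (subst (y <_) (sym (val-length v)) (proj₂ (∈-range⁻ {1} {n} m′))) e)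

  map-app-id₀ : ∀ {π} → Val π → map (app π) id₀ ≡ π
  map-app-id₀ {π} v = trans (cong (λ k → map (app π) (range 1 k)) (sym (val-length v))) (map-app-range π)

  app-surj : ∀ {π y} → Val π → y ∈ id₀ → ∃ λ x → x ∈ id₀ × app π x ≡ y
  app-surj {π} v m with ∈-map⁻ (app π) (subst (_ ∈_) (sym (map-app-id₀ v)) (∈-resp-↭ (↭-sym v) m))
  ... | x , k , e = x , k , sym e

  perm-ext : ∀ {π ρ} → Val π → Val ρ → (∀ {x} → x ∈ id₀ → app π x ≡ app ρ x) → π ≡ ρ
  perm-ext v w h = trans (sym (map-app-id₀ v)) (trans (map-cong-local (All.tabulate h)) (map-app-id₀ w))

  app-map : ∀ (f : ℕ → ℕ) {τ x} → Val τ → x ∈ id₀ → app (map f τ) x ≡ f (app τ x)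
  app-map f {τ} {zero} v m with ∈-range⁻ {1} {n} m
  ... | () , _
  app-map f {τ} {suc x} v m = at-map f τ x (subst (x <_) (sym (val-length v)) (proj₂ (∈-range⁻ {1} {n} m)))

  app-∘ : ∀ σ {τ x} → Val τ → x ∈ id₀ → app (σ ∘ₚ τ) x ≡ app σ (app τ x)
  app-∘ σ = app-map (app σ)

  val-id : Val id₀
  val-id = ↭-refl

  app-id₀ : ∀ {x} → x ∈ id₀ → app id₀ x ≡ x
  app-id₀ {zero} m with ∈-range⁻ {1} {n} m
  ... | () , _
  app-id₀ {suc x} m = at-upTo (1 +_) n (proj₂ (∈-range⁻ {1} {n} m))
    where
    at-upTo : ∀ (f : ℕ → ℕ) k {i d} → i < k → at (applyUpTo f k) i d ≡ f i
    at-upTo f (suc k) {zero} lt = refl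
    at-upTo f (suc k) {suc i} (s≤s lt) = at-upTo (λ j → f (suc j)) k lt

  app-map-id₀ : ∀ (f : ℕ → ℕ) {x} → x ∈ id₀ → app (map f id₀) x ≡ f x
  app-map-id₀ f m = trans (app-map f val-id m) (cong f (app-id₀ m))

  val-∘ : ∀ {σ τ} → Val σ → Val τ → Val (σ ∘ₚ τ)
  val-∘ {σ} {τ} v w = ↭-trans (Permₚ.map⁺ (app σ) w) (↭-trans (↭-reflexive (map-app-id₀ v)) v)

  ∘-assoc : ∀ π {ρ τ} → Val ρ → Val τ → (π ∘ₚ ρ) ∘ₚ τ ≡ π ∘ₚ (ρ ∘ₚ τ)
  ∘-assoc π {ρ} {τ} v w = trans (map-cong-local (All.tabulate (λ m → app-∘ π v (∈-resp-↭ w m)))) (map-∘ τ)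

  ∘-idʳ : ∀ {π} → Val π → π ∘ₚ id₀ ≡ π
  ∘-idʳ = map-app-id₀

  ∘-idˡ : ∀ {π} → Val π → id₀ ∘ₚ π ≡ π
  ∘-idˡ v = map-id-local (All.tabulate (λ m → app-id₀ (∈-resp-↭ v m)))

  sym-∈ : ∀ {π} → Val π → π ∈ Sym n
  sym-∈ = ∈-permutations⁺ id₀

  sym-val : ∀ {π} → π ∈ Sym n → Val π
  sym-val = ∈-permutations⁻ id₀

  sym-unique : Unique (Sym n)
  sym-unique = permutations-unique id₀ (range-unique 1 n)

  reindex : (f g : List ℕ → List ℕ) → (∀ {π} → Val π → Val (f π)) → (∀ {π} → Val π → Val (g π)) →
    (∀ {π} → Val π → g (f π) ≡ π) → (∀ {π} → Val π → f (g π) ≡ π) → map f (Sym n) ↭ Sym n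
  reindex f g vf vg gf fg = unique-set-↭
    (unique-map-local f (Sym n) (λ m m′ e → trans (sym (gf (sym-val m))) (trans (cong g e) (gf (sym-val m′)))) sym-unique)
    sym-unique
    (λ m → let (π , k , e) = ∈-map⁻ f m in subst (_∈ Sym n) (sym e) (sym-∈ (vf (sym-val k))))
    (λ m → subst (_∈ map f (Sym n)) (fg (sym-val m)) (∈-map⁺ f (sym-∈ (vg (sym-val m)))))

  -- s k is the transposition (k+1, k+2).
  s : ℕ → List ℕ
  s k = swapAt k id₀

  val-s : ∀ k → Val (s k)
  val-s k = val-swap k val-id

  ∘-swap : ∀ π ρ k → π ∘ₚ swapAt k ρ ≡ swapAt k (π ∘ₚ ρ)
  ∘-swap π ρ k = map-swapAt (app π) k ρ

  ∘-s : ∀ {π} k → Val π → π ∘ₚ s k ≡ swapAt k π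
  ∘-s {π} k v = trans (∘-swap π id₀ k) (cong (swapAt k) (∘-idʳ v))

  s-s : ∀ k → s k ∘ₚ s k ≡ id₀
  s-s k = trans (∘-s k (val-s k)) (swapAt-invol id₀ k)

  conj : ℕ → List ℕ → List ℕ
  conj k π = s k ∘ₚ swapAt k π

  val-conj : ∀ k {π} → Val π → Val (conj k π)
  val-conj k v = val-∘ (val-s k) (val-swap k v)

  conj-invol : ∀ k {π} → Val π → conj k (conj k π) ≡ π
  conj-invol k {π} v = trans (cong (s k ∘ₚ_) (trans (cong (swapAt k) (∘-swap (s k) π k)) (swapAt-invol (s k ∘ₚ π) k)))
    (trans (sym (∘-assoc (s k) (val-s k) v)) (trans (cong (_∘ₚ π) (s-s k)) (∘-idˡ v)))

  action : CoxeterAction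
  action = record
    { P = List ℕ ; Val = Val ; _·_ = λ π k → swapAt k π ; n = n ; enum = Sym n
    ; val-· = val-swap ; invol = swapAt-invol
    ; far = swapAt-far
    ; braid = λ {π} i lt v → swapAt-braid π i (subst (suc (suc i) <_) (sym (val-length v)) lt)
    ; enum-· = λ k → reindex (swapAt k) (swapAt k) (val-swap k) (val-swap k) (λ {π} _ → swapAt-invol π k) (λ {π} _ → swapAt-invol π k)
    ; enum-complete = sym-∈ ; enum-val = sym-val }

  listEq-refl : ∀ xs → listEq? xs xs ≡ true
  listEq-refl xs = dec-true (≡-dec ℕ._≟_ xs xs) refl

  listEq-≢ : ∀ {xs ys} → xs ≢ ys → listEq? xs ys ≡ false
  listEq-≢ {xs} {ys} ne = dec-false (≡-dec ℕ._≟_ xs ys) ne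

  regular : RegularAction
  regular = record
    { action = action ; e₀ = id₀ ; val-e₀ = val-id ; comp = _∘ₚ_
    ; comp-e₀ = ∘-idʳ ; comp-· = ∘-swap ; comp-assoc = λ {π} _ v w → ∘-assoc π v w
    ; word = λ v → let (w , h , e) = ↭-word [] (↭-sym v) in w , All.map (λ {k} → subst (suc k <_) (range-length n)) h , e
    ; enum-conj = λ k → reindex (conj k) (conj k) (val-conj k) (val-conj k) (conj-invol k) (conj-invol k)
    ; ent = λ π j → at π j 0
    ; ent-left = λ {π} {k} lt v → at-swapAt-left k π (subst (suc k <_) (sym (val-length v)) lt)
    ; ent-right = λ {π} {k} lt v → at-swapAt-right k π (subst (suc k <_) (sym (val-length v)) lt)
    ; ent-other = λ {π} {k} → at-swapAt-other k π
    ; ent-inj = λ {π} {i} {j} v lt lt′ → at-injective π (val-unique v) (subst (i <_) (sym (val-length v)) lt) (subst (j <_) (sym (val-length v)) lt′)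
    ; δ = λ π → ind (listEq? π id₀)
    ; δ-e₀ = cong ind (listEq-refl id₀)
    ; δ-supp = λ {π} {j} v lt ne → cong ind (listEq-≢ {π} (λ e → ne (cong (λ l → at l j 0) e))) }

-- Cycles

module _ (f : ℕ → ℕ) (x : ℕ) where

  walk : ℕ → ℕ → List ℕ
  walk zero _ = []
  walk (suc k) y = if y ≡ᵇ x then [] else y ∷ walk k (f y)

  -- Chain y u: iterating f from y visits exactly u before reaching x.
  data Chain : ℕ → List ℕ → Set where
    done : Chain x []
    step : ∀ {y u} → y ≢ x → Chain (f y) u → Chain y (y ∷ u)

  -- The points visited from x so far, latest first, before any return to x. It is the growing
  -- counterpart of `Chain`, needed while the return is not yet known.
  data Path : ℕ → List ℕ → Set where
    start : Path x (x ∷ [])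
    next  : ∀ {y vs} → Path y vs → f y ≢ x → Path (f y) (f y ∷ vs)

≡ᵇ-refl : ∀ x → (x ≡ᵇ x) ≡ true
≡ᵇ-refl zero = refl
≡ᵇ-refl (suc x) = ≡ᵇ-refl x

≡ᵇ-≢ : ∀ {x y} → x ≢ y → (x ≡ᵇ y) ≡ false
≡ᵇ-≢ {zero} {zero} ne = ⊥-elim (ne refl)
≡ᵇ-≢ {zero} {suc y} ne = refl
≡ᵇ-≢ {suc x} {zero} ne = refl
≡ᵇ-≢ {suc x} {suc y} ne = ≡ᵇ-≢ (λ e → ne (cong suc e))

≡ᵇ-sound : ∀ {x y} → (x ≡ᵇ y) ≡ true → x ≡ y
≡ᵇ-sound {x} {y} e with x ≟ y
... | yes h = h
... | no ne with trans (sym e) (≡ᵇ-≢ ne)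
... | ()

module _ {f : ℕ → ℕ} {x : ℕ} where

  walk-chain : ∀ {y u} k → length u ≤ k → Chain f x y u → walk f x k y ≡ u
  walk-chain zero z≤n done = refl
  walk-chain (suc k) le done rewrite ≡ᵇ-refl x = refl
  walk-chain (suc k) (s≤s le) (step {y} ne c) rewrite ≡ᵇ-≢ ne = cong (y ∷_) (walk-chain k le c)

  unwind : ∀ {y vs u} → Path f x y vs → Chain f x (f y) u → ∃ λ u′ → Chain f x (f x) u′
  unwind start c = _ , c
  unwind (next p ne) c = unwind p (step ne c)

  path-head : ∀ {y vs} → Path f x y vs → ∃ λ ws → vs ≡ y ∷ ws
  path-head start = [] , refl
  path-head (next {vs = vs} p ne) = vs , refl

  path-pred : ∀ {y ws w} → Path f x y (y ∷ ws) → w ∈ y ∷ ws → w ≢ x → ∃ λ w′ → w′ ∈ ws × f w′ ≡ w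
  path-pred start (here refl) ne = ⊥-elim (ne refl)
  path-pred start (there ()) ne
  path-pred (next {y} p q) m ne with path-head p
  path-pred (next {y} p q) (here refl) ne | ws , refl = y , here refl , refl
  path-pred (next {y} p q) (there m) ne | ws , refl with path-pred p m ne
  ... | w′ , k , e = w′ , there k , e

  chain-map : ∀ {y u} → Chain f x y u → y ∷ map f u ≡ u ++ x ∷ []
  chain-map done = refl
  chain-map (step {y} ne c) = cong (y ∷_) (chain-map c)

  chain-∉ : ∀ {y u} → Chain f x y u → x ∉ u
  chain-∉ (step ne c) (here e) = ne (sym e)
  chain-∉ (step ne c) (there m) = chain-∉ c m

  chain-det : ∀ {y u u′} → Chain f x y u → Chain f x y u′ → u ≡ u′
  chain-det done done = refl
  chain-det done (step ne c) = ⊥-elim (ne refl)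
  chain-det (step ne c) done = ⊥-elim (ne refl)
  chain-det (step {y} ne c) (step _ c′) = cong (y ∷_) (chain-det c c′)

  chain-suffix : ∀ {z u y} → Chain f x z u → y ∈ u → ∃ λ u′ → Chain f x y u′ × length u′ ≤ length u
  chain-suffix c@(step ne _) (here refl) = _ , c , ≤-refl
  chain-suffix (step ne c) (there m) with chain-suffix c m
  ... | u′ , c′ , le = u′ , c′ , m≤n⇒m≤1+n le

  -- A repeated point would start a strictly shorter chain at its second visit, against determinism.
  chain-unique : ∀ {y u} → Chain f x y u → Unique u
  chain-unique done = []
  chain-unique (step {y} {u} ne c) = All.tabulate notin ∷ chain-unique c
    where
    notin : ∀ {w} → w ∈ u → y ≢ w
    notin m refl with chain-suffix c m
    ... | u′ , c′ , le with chain-det (step ne c) c′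
    ... | refl = 1+n≰n le

  chain-from-map : ∀ {y} u → y ∷ map f u ≡ u ++ x ∷ [] → x ∉ u → Chain f x y u
  chain-from-map [] refl ne = done
  chain-from-map (z ∷ u) e ne with ∷-injectiveˡ e
  ... | refl = step (λ q → ne (here (sym q))) (chain-from-map u (∷-injectiveʳ e) (λ k → ne (there k)))

-- The cycle (x u₁ u₂ ...) encoded by one list equation, so that rotating or conjugating a cycle is
-- list algebra.
record Cyc (f : ℕ → ℕ) (x : ℕ) (u : List ℕ) : Set where
  constructor mk
  field
    rotates : map f (x ∷ u) ≡ u ++ x ∷ []
    distinct : Unique (x ∷ u)
open Cyc

cyc-from-chain : ∀ {f x u} → Chain f x (f x) u → Cyc f x u
cyc-from-chain c = mk (chain-map c) (All.tabulate (λ m e → chain-∉ c (subst (_∈ _) (sym e) m)) ∷ chain-unique c)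

chain-from-cyc : ∀ {f x u} → Cyc f x u → Chain f x (f x) u
chain-from-cyc {u = u} (mk e (h ∷ _)) = chain-from-map u e (λ m → All.lookup h m refl)

unique-⊆-length : {xs ys : List A} → Unique xs → (∀ {x} → x ∈ xs → x ∈ ys) → length xs ≤ length ys
unique-⊆-length {xs = []} u h = z≤n
unique-⊆-length {xs = x ∷ xs} (x∉ ∷ u) h with ∈-∃++ (h (here refl))
... | a , b , refl = subst (suc (length xs) ≤_) (sym (trans (length-++ a) (trans (+-suc (length a) (length b)) (cong suc (sym (length-++ a))))))
  (s≤s (unique-⊆-length u sub))
  where
  sub : ∀ {y} → y ∈ xs → y ∈ a ++ b
  sub m with ∈-++⁻ a (h (there m))
  ... | inj₁ k = ∈-++⁺ˡ k
  ... | inj₂ (here e) = ⊥-elim (All.lookup x∉ m (sym e))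
  ... | inj₂ (there k) = ∈-++⁺ʳ a k

unique-⊆-full : (_≟′_ : (x y : A) → Dec (x ≡ y)) {xs ys : List A} → Unique xs → (∀ {x} → x ∈ xs → x ∈ ys) →
  length ys ≤ length xs → ∀ {y} → y ∈ ys → y ∈ xs
unique-⊆-full _≟′_ {xs} {ys} u h le {y} m with any-∈ xs
  where
  any-∈ : ∀ xs → Dec (y ∈ xs)
  any-∈ [] = no λ ()
  any-∈ (x ∷ xs) with y ≟′ x | any-∈ xs
  ... | yes e | _ = yes (here e)
  ... | no _ | yes k = yes (there k)
  ... | no ne | no nk = no λ { (here e) → ne e ; (there k) → nk k }
... | yes k = k
... | no nk = ⊥-elim (1+n≰n (≤-trans (unique-⊆-length {xs = y ∷ xs} {ys}
        (All.tabulate (λ { k refl → nk k }) ∷ u) (λ { (here refl) → m ; (there k) → h k })) le))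

++-split : (p q : List A) {r t : List A} → length p ≡ length q → p ++ r ≡ q ++ t → p ≡ q × r ≡ t
++-split [] [] le e = refl , e
++-split (v ∷ p) (w ∷ q) le e with ++-split p q (suc-injective le) (∷-injectiveʳ e)
... | h , h′ = cong₂ _∷_ (∷-injectiveˡ e) h , h′

cyc-rotate : ∀ {f x} a y b → Cyc f x (a ++ y ∷ b) → Cyc f y (b ++ x ∷ a)
cyc-rotate {f} {x} a y b (mk e u) = mk eq (unique-resp-↭ rot u)
  where
  rot : x ∷ a ++ y ∷ b ↭ y ∷ b ++ x ∷ a
  rot = Permₚ.++-comm (x ∷ a) (y ∷ b)
  both : (f x ∷ map f a) ++ f y ∷ map f b ≡ (a ++ y ∷ []) ++ b ++ x ∷ []
  both = trans (sym (map-++ f (x ∷ a) (y ∷ b))) (trans e (trans (++-assoc a (y ∷ b) (x ∷ [])) (sym (++-assoc a (y ∷ []) (b ++ x ∷ [])))))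
  parts = ++-split (f x ∷ map f a) (a ++ y ∷ [])
    (trans (cong suc (length-map f a)) (sym (trans (length-++ a) (+-comm (length a) 1)))) both
  eq : map f (y ∷ b ++ x ∷ a) ≡ (b ++ x ∷ a) ++ y ∷ []
  eq = trans (map-++ f (y ∷ b) (x ∷ a)) (trans (cong₂ _++_ (proj₂ parts) (proj₁ parts))
    (trans (++-assoc b (x ∷ []) (a ++ y ∷ [])) (sym (++-assoc b (x ∷ a) (y ∷ [])))))

-- The auxiliary function of orbit has no name outside its definition; the
-- placeholder in the type of visits-walk is solved to it by orbit-walk.
mutual
  visits-walk : ∀ π x k y → _ ≡ walk (app π) x k y

  orbit-walk : ∀ π x → orbit π x ≡ x ∷ walk (app π) x (length π) (app π x)
  orbit-walk π x with length π | app π x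
  ... | k | y = cong (x ∷_) (visits-walk π x k y)

  visits-walk π x zero y = refl
  visits-walk π x (suc k) y = cong (λ l → if y ≡ᵇ x then [] else y ∷ l) (visits-walk π x k (app π y))

module Orbits (n : ℕ) where
  open SymmetricGroup n

  cyc-⊆ : ∀ {π x u} → Val π → x ∈ id₀ → Cyc (app π) x u → ∀ {y} → y ∈ x ∷ u → y ∈ id₀
  cyc-⊆ {π} {x} {u} v mx c (here refl) = mx
  cyc-⊆ {π} {x} {u} v mx c (there m) = go (app-∈ v mx) (chain-from-cyc c) m
    where
    go : ∀ {y u w} → y ∈ id₀ → Chain (app π) x y u → w ∈ u → w ∈ id₀
    go my (step ne c) (here refl) = my
    go my (step ne c) (there m) = go (app-∈ v my) c m

  cyc-orbit : ∀ {π x u} → Val π → x ∈ id₀ → Cyc (app π) x u → orbit π x ≡ x ∷ u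
  cyc-orbit {π} {x} {u} v mx c = trans (orbit-walk π x) (cong (x ∷_) (walk-chain (length π)
    (≤-trans (n≤1+n _) (≤-trans (unique-⊆-length (distinct c) (cyc-⊆ v mx c)) (≤-reflexive (trans (range-length n) (sym (val-length v))))))
    (chain-from-cyc c)))

  -- Pigeonhole: while the path has not returned to x, its next point is new, since a repetition
  -- would give two points with the same image. So n steps suffice.
  cyc-exists : ∀ {π x} → Val π → x ∈ id₀ → ∃ λ u → Cyc (app π) x u
  cyc-exists {π} {x} v mx with search n start ([] ∷ []) (λ { (here refl) → mx }) (+-comm 1 n)
    where
    f = app π
    search : ∀ k {y vs} → Path f x y vs → Unique vs → (∀ {w} → w ∈ vs → w ∈ id₀) → length vs + k ≡ n + 1 → ∃ λ u → Chain f x (f x) u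
    search zero {y} {vs} p u sub e = ⊥-elim (1+n≰n (≤-trans (≤-reflexive (trans (+-comm 1 n) (trans (sym e) (+-identityʳ (length vs)))))
      (≤-trans (unique-⊆-length u sub) (≤-reflexive (range-length n)))))
    search (suc k) {y} {vs} p u sub e with f y ≟ x
    ... | yes q = unwind p (subst (λ z → Chain f x z []) (sym q) done)
    ... | no ne = search k (next p ne) (All.tabulate (λ m q → fresh (subst (_∈ vs) (sym q) m)) ∷ u)
          (λ { (here refl) → app-∈ v my ; (there m) → sub m }) (trans (sym (+-suc (length vs) k)) e)
      where
      my : y ∈ id₀
      my with path-head p
      ... | ws , refl = sub (here refl)
      fresh : f y ∉ vs
      fresh m with path-head p
      fresh m | ws , refl with path-pred p m ne
      ... | w′ , k′ , e′ = All.lookup (AllPairs.head u) k′ (sym (app-inj v (sub (there k′)) my e′))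
  ... | u , c = u , cyc-from-chain c

  orbit-cyc : ∀ {π x} → Val π → x ∈ id₀ → ∃ λ u → orbit π x ≡ x ∷ u × Cyc (app π) x u
  orbit-cyc v mx with cyc-exists v mx
  ... | u , c = u , cyc-orbit v mx c , c

  cyc-same : ∀ {π x u y} → Val π → x ∈ id₀ → Cyc (app π) x u → y ∈ x ∷ u → orbit π y ↭ x ∷ u
  cyc-same v mx c (here refl) = ↭-reflexive (cyc-orbit v mx c)
  cyc-same {π} {x} {u} {y} v mx c (there m) with ∈-∃++ m
  ... | a , b , refl = ↭-trans (↭-reflexive (cyc-orbit v (cyc-⊆ v mx c (there m)) (cyc-rotate a y b c))) (Permₚ.++-comm (y ∷ b) (x ∷ a))

  orbit-same : ∀ {π x y} → Val π → x ∈ id₀ → y ∈ orbit π x → orbit π y ↭ orbit π x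
  orbit-same v mx m with orbit-cyc v mx
  ... | u , e , c rewrite e = cyc-same v mx c m

  orbit-⊆ : ∀ {π x y} → Val π → x ∈ id₀ → y ∈ orbit π x → y ∈ id₀
  orbit-⊆ {y = y} v mx m with orbit-cyc v mx
  ... | u , e , c = cyc-⊆ v mx c (subst (y ∈_) e m)

  cycLen-cyc : ∀ {π x u} → Val π → x ∈ id₀ → Cyc (app π) x u → cycLen π x ≡ suc (length u)
  cycLen-cyc v mx c = cong length (cyc-orbit v mx c)

allB-sound : (p : A → Bool) (xs : List A) → allB p xs ≡ true → ∀ {y} → y ∈ xs → p y ≡ true
allB-sound p (x ∷ xs) e m with p x in q
allB-sound p (x ∷ xs) e (here refl) | true = q
allB-sound p (x ∷ xs) e (there m) | true = allB-sound p xs e m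

allB-complete : (p : A → Bool) (xs : List A) → (∀ {y} → y ∈ xs → p y ≡ true) → allB p xs ≡ true
allB-complete p [] h = refl
allB-complete p (x ∷ xs) h rewrite h (here refl) = allB-complete p xs (λ m → h (there m))

≤ᵇ-sound : ∀ {x y} → (x ≤ᵇ y) ≡ true → x ≤ y
≤ᵇ-sound {x} {y} e = ≤ᵇ⇒≤ x y (subst T (sym e) tt)

≤ᵇ-complete : ∀ {x y} → x ≤ y → (x ≤ᵇ y) ≡ true
≤ᵇ-complete {x} {y} le with x ≤ᵇ y in e
... | true = refl
... | false = ⊥-elim (subst T e (≤⇒≤ᵇ le))

≤ᵇ-false : ∀ {x y} → ¬ (x ≤ y) → (x ≤ᵇ y) ≡ false
≤ᵇ-false {x} {y} nle with x ≤ᵇ y in e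
... | true = ⊥-elim (nle (≤ᵇ-sound e))
... | false = refl

insertDesc-comm-< : ∀ {x y} → x < y → ∀ l → insertDesc x (insertDesc y l) ≡ insertDesc y (insertDesc x l)
insertDesc-comm-< lt [] rewrite ≤ᵇ-complete (<⇒≤ lt) | ≤ᵇ-false (<⇒≱ lt) = refl
insertDesc-comm-< {x} {y} lt (z ∷ l) with z ≤? x | z ≤? y
... | yes a | yes b rewrite ≤ᵇ-complete a | ≤ᵇ-complete b | ≤ᵇ-complete (<⇒≤ lt) | ≤ᵇ-false (<⇒≱ lt) | ≤ᵇ-complete a = refl
... | yes a | no b = ⊥-elim (b (≤-trans a (<⇒≤ lt)))
... | no a | yes b rewrite ≤ᵇ-false a | ≤ᵇ-complete b | ≤ᵇ-false (<⇒≱ lt) | ≤ᵇ-false a = refl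
... | no a | no b rewrite ≤ᵇ-false a | ≤ᵇ-false b | ≤ᵇ-false a = cong (z ∷_) (insertDesc-comm-< lt l)

insertDesc-comm : ∀ x y l → insertDesc x (insertDesc y l) ≡ insertDesc y (insertDesc x l)
insertDesc-comm x y l with <-cmp x y
... | tri≈ _ refl _ = refl
... | tri< x<y _ _ = insertDesc-comm-< x<y l
... | tri> _ _ y<x = sym (insertDesc-comm-< y<x l)

sortDesc-resp-↭ : ∀ {xs ys} → xs ↭ ys → sortDesc xs ≡ sortDesc ys
sortDesc-resp-↭ Perm.refl = refl
sortDesc-resp-↭ (Perm.prep x p) = cong (insertDesc x) (sortDesc-resp-↭ p)
sortDesc-resp-↭ (Perm.swap {xs} {ys} x y p) = trans (insertDesc-comm x y (sortDesc xs)) (cong (λ l → insertDesc y (insertDesc x l)) (sortDesc-resp-↭ p))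
sortDesc-resp-↭ (Perm.trans p q) = trans (sortDesc-resp-↭ p) (sortDesc-resp-↭ q)

sortDesc-length : ∀ xs → length (sortDesc xs) ≡ length xs
sortDesc-length [] = refl
sortDesc-length (x ∷ xs) = trans (insert-length x (sortDesc xs)) (cong suc (sortDesc-length xs))
  where
  insert-length : ∀ x l → length (insertDesc x l) ≡ suc (length l)
  insert-length x [] = refl
  insert-length x (y ∷ l) with y ≤ᵇ x
  ... | true = refl
  ... | false = cong suc (insert-length x l)

minimum : ∀ x u → ∃ λ m → m ∈ x ∷ u × (∀ {y} → y ∈ x ∷ u → m ≤ y)
minimum x [] = x , here refl , λ { (here refl) → ≤-refl }
minimum x (y ∷ u) with minimum y u
... | m , k , h with x ≤? m
...   | yes le = x , here refl , λ { (here refl) → ≤-refl ; (there q) → ≤-trans le (h q) }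
...   | no nle = m , there k , λ { (here refl) → <⇒≤ (≰⇒> nle) ; (there q) → h q }

unique-++⁻ : (xs : List A) {ys : List A} → Unique (xs ++ ys) → (∀ {x} → x ∈ xs → x ∉ ys) × Unique ys
unique-++⁻ [] u = (λ ()) , u
unique-++⁻ (x ∷ xs) (h ∷ u) with unique-++⁻ xs u
... | d , u′ = (λ { (here refl) k → All.lookup h (∈-++⁺ʳ xs k) refl ; (there m) → d m }) , u′

cl : ℕ × List ℕ → List ℕ
cl (x , u) = x ∷ u

tl : List ℕ → List ℕ
tl [] = []
tl (_ ∷ l) = l

swapAt-++ : ∀ k (l r : List A) → suc k < length l → swapAt k (l ++ r) ≡ swapAt k l ++ r
swapAt-++ zero (a ∷ b ∷ l) r lt = refl
swapAt-++ zero (a ∷ []) r (s≤s ())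
swapAt-++ (suc k) (a ∷ l) r (s≤s lt) = cong (a ∷_) (swapAt-++ k l r lt)

-- Cycle types and conjugation

module CycleTypes (n : ℕ) where
  open SymmetricGroup n
  open Orbits n

  mins : List ℕ → List ℕ
  mins π = filterB (λ x → allB (λ y → x ≤ᵇ y) (orbit π x)) (range 1 n)

  ∈-mins⁻ : ∀ π {x} → x ∈ mins π → x ∈ id₀ × (∀ {y} → y ∈ orbit π x → x ≤ y)
  ∈-mins⁻ π {x} m with ∈-filterB⁻ (λ x → allB (λ y → x ≤ᵇ y) (orbit π x)) (range 1 n) m
  ... | k , e = k , λ q → ≤ᵇ-sound (allB-sound (λ y → x ≤ᵇ y) (orbit π x) e q)

  ∈-mins⁺ : ∀ π {x} → x ∈ id₀ → (∀ {y} → y ∈ orbit π x → x ≤ y) → x ∈ mins π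
  ∈-mins⁺ π {x} m h = ∈-filterB⁺ _ (range 1 n) m (allB-complete (λ y → x ≤ᵇ y) (orbit π x) (λ q → ≤ᵇ-complete (h q)))

  mins-unique : ∀ π → Unique (mins π)
  mins-unique π = filterB-unique _ (range 1 n) (range-unique 1 n)

  orbit-tl : ∀ {π x} → Val π → x ∈ id₀ → Cyc (app π) x (tl (orbit π x))
  orbit-tl {π} {x} v m with orbit-cyc v m
  ... | u , e , c = subst (λ l → Cyc (app π) x (tl l)) (sym e) c

  mins-disjoint : ∀ {π x x′ y} → Val π → x ∈ mins π → x′ ∈ mins π → y ∈ orbit π x → y ∈ orbit π x′ → x ≡ x′
  mins-disjoint {π} {x} {x′} {y} v m m′ k k′ = ≤-antisym (proj₂ (∈-mins⁻ π m) (∈-resp-↭ same (here refl))) (proj₂ (∈-mins⁻ π m′) (∈-resp-↭ (↭-sym same) (here refl)))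
    where
    same : orbit π x′ ↭ orbit π x
    same = ↭-trans (↭-sym (orbit-same v (proj₁ (∈-mins⁻ π m′)) k′)) (orbit-same v (proj₁ (∈-mins⁻ π m)) k)

  orbits-cover : ∀ {π} → Val π → concatMap (orbit π) (mins π) ↭ range 1 n
  orbits-cover {π} v = unique-set-↭
      (Uniqueₚ.concat⁺ (Allₚ.map⁺ (All.tabulate (λ m → distinct (orbit-tl v (proj₁ (∈-mins⁻ π m))))))
        (AllPairsₚ.map⁺ (pairs (mins π) (λ m → m) (mins-unique π))))
      (range-unique 1 n)
      (λ m → let (x , k , k′) = find (∈-concatMap⁻ (orbit π) {xs = mins π} m) in orbit-⊆ v (proj₁ (∈-mins⁻ π k)) k′)
      cover
    where
    pairs : ∀ L → (∀ {x} → x ∈ L → x ∈ mins π) → Unique L → AllPairs.AllPairs (λ a b → ∀ {y} → ¬ (y ∈ orbit π a × y ∈ orbit π b)) L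
    pairs [] h [] = []
    pairs (x ∷ L) h (x∉ ∷ u) = All.tabulate (λ m {y} kk → All.lookup x∉ m (mins-disjoint v (h (here refl)) (h (there m)) (proj₁ kk) (proj₂ kk)))
      ∷ pairs L (λ m → h (there m)) u
    cover : ∀ {y} → y ∈ range 1 n → y ∈ concatMap (orbit π) (mins π)
    cover {y} my with minimum y (tl (orbit π y))
    ... | m , k , h = ∈-concatMap⁺ (orbit π) (lose (∈-mins⁺ π (orbit-⊆ v my k) (λ q → h (∈-resp-↭ same q))) (∈-resp-↭ (↭-sym same) (here refl)))
      where
      same : orbit π m ↭ orbit π y
      same = orbit-same v my k

  module _ {π : List ℕ} (v : Val π) (ls : List (ℕ × List ℕ))
           (cyc : All (λ c → Cyc (app π) (proj₁ c) (proj₂ c)) ls) (cov : concatMap cl ls ↭ range 1 n) where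
    private
      minc : ℕ × List ℕ → ℕ
      minc (x , u) = proj₁ (minimum x u)
      minc-∈ : ∀ c → minc c ∈ cl c
      minc-∈ (x , u) = proj₁ (proj₂ (minimum x u))
      base-∈ : ∀ {c} → c ∈ ls → proj₁ c ∈ id₀
      base-∈ m = ∈-resp-↭ cov (∈-concatMap⁺ cl (lose m (here refl)))
      same : ∀ {c y} → c ∈ ls → y ∈ cl c → orbit π y ↭ cl c
      same m k = cyc-same v (base-∈ m) (All.lookup cyc m) k
      sub-id : ∀ {c y} → c ∈ ls → y ∈ cl c → y ∈ id₀
      sub-id m k = ∈-resp-↭ cov (∈-concatMap⁺ cl (lose m k))
      uniq : ∀ L → Unique (concatMap cl L) → Unique (map minc L)
      uniq [] u = []
      uniq (c ∷ L) u with unique-++⁻ (cl c) u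
      ... | d , u′ = Allₚ.map⁺ (All.tabulate (λ {c′} m e → d (minc-∈ c) (subst (_∈ concatMap cl L) (sym e) (∈-concatMap⁺ cl (lose m (minc-∈ c′))))))
            ∷ uniq L u′

    mins-cycles : mins π ↭ map minc ls
    mins-cycles = unique-set-↭ (mins-unique π) (uniq ls (unique-resp-↭ (↭-sym cov) (range-unique 1 n))) to from
      where
      to : ∀ {x} → x ∈ mins π → x ∈ map minc ls
      to {x} m with ∈-mins⁻ π m
      ... | mx , le with find (∈-concatMap⁻ cl {xs = ls} (∈-resp-↭ (↭-sym cov) mx))
      ... | c , mc , k = subst (_∈ map minc ls) (≤-antisym (proj₂ (proj₂ (minimum (proj₁ c) (proj₂ c))) k) (le (∈-resp-↭ (↭-sym (same mc k)) (minc-∈ c)))) (∈-map⁺ minc mc)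
      from : ∀ {x} → x ∈ map minc ls → x ∈ mins π
      from m with ∈-map⁻ minc m
      ... | c , mc , refl = ∈-mins⁺ π (sub-id mc (minc-∈ c)) (λ q → proj₂ (proj₂ (minimum (proj₁ c) (proj₂ c))) (∈-resp-↭ (same mc (minc-∈ c)) q))

    -- Frees cycle types from the choice of least elements: any list of cycles covering 1, ..., n,
    -- with any base points, gives the same multiset of lengths.
    cycle-lengths : map (cycLen π) (mins π) ↭ map (λ c → length (cl c)) ls
    cycle-lengths = ↭-trans (Permₚ.map⁺ (cycLen π) mins-cycles) (↭-reflexive (trans (sym (map-∘ ls))
      (map-cong-local (All.tabulate (λ {c} m → ↭-length (same m (minc-∈ c)))))))

  cyc-transport : ∀ π′ {π G x u} → Val π → Val G → (∀ {y} → y ∈ id₀ → app π′ (app G y) ≡ app G (app π y)) → x ∈ id₀ →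
    Cyc (app π) x u → Cyc (app π′) (app G x) (map (app G) u)
  cyc-transport π′ {π} {G} {x} {u} v vG h mx c = mk
    (trans (sym (map-∘ (x ∷ u))) (trans (map-cong-local (All.tabulate (λ m → h (cyc-⊆ v mx c m))))
      (trans (map-∘ (x ∷ u)) (trans (cong (map (app G)) (rotates c)) (map-++ (app G) u (x ∷ []))))))
    (unique-map-local (app G) (x ∷ u) (λ m m′ → app-inj vG (cyc-⊆ v mx c m) (cyc-⊆ v mx c m′)) (distinct c))

  app-swap : ∀ k {π x} → Val π → x ∈ id₀ → app (swapAt k π) x ≡ app π (app (s k) x)
  app-swap k {π} {x} v m = trans (cong (λ l → app l x) (sym (∘-s k v))) (app-∘ π (val-s k) m)

  s-invol : ∀ k {x} → x ∈ id₀ → app (s k) (app (s k) x) ≡ x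
  s-invol k m = trans (sym (app-∘ (s k) (val-s k) m)) (trans (cong (λ l → app l _) (s-s k)) (app-id₀ m))

  app-conj : ∀ k {π x} → Val π → x ∈ id₀ → app (conj k π) x ≡ app (s k) (app π (app (s k) x))
  app-conj k {π} v m = trans (app-∘ (s k) (val-swap k v) m) (cong (app (s k)) (app-swap k v m))

  conj-s : ∀ k {π} → Val π → ∀ {y} → y ∈ id₀ → app (conj k π) (app (s k) y) ≡ app (s k) (app π y)
  conj-s k {π} v m = trans (app-conj k v (app-∈ (val-s k) m)) (cong (λ z → app (s k) (app π z)) (s-invol k m))

  cycLen-conj : ∀ k {π x} → Val π → x ∈ id₀ → cycLen (conj k π) (app (s k) x) ≡ cycLen π x
  cycLen-conj k {π} {x} v m with cyc-exists v m
  ... | u , c = trans (cycLen-cyc (val-conj k v) (app-∈ (val-s k) m) (cyc-transport (conj k π) v (val-s k) (conj-s k v) m c))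
    (trans (cong suc (length-map (app (s k)) u)) (sym (cycLen-cyc v m c)))

  cycleType-conj : ∀ k {π} → Val π → cycleType n (conj k π) ≡ cycleType n π
  cycleType-conj k {π} v = sortDesc-resp-↭ (↭-trans (cycle-lengths (val-conj k v) ls cycs cov) (↭-reflexive lens))
    where
    S = app (s k)
    conjCycle : ℕ → ℕ × List ℕ
    conjCycle x = S x , map S (tl (orbit π x))
    ls = map conjCycle (mins π)
    cycs : All (λ c → Cyc (app (conj k π)) (proj₁ c) (proj₂ c)) ls
    cycs = Allₚ.map⁺ (All.tabulate (λ m → cyc-transport (conj k π) v (val-s k) (conj-s k v) (proj₁ (∈-mins⁻ π m)) (orbit-tl v (proj₁ (∈-mins⁻ π m)))))
    cat-map : ∀ L → concatMap cl (map conjCycle L) ≡ map S (concatMap (orbit π) L)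
    cat-map [] = refl
    cat-map (x ∷ L) = trans (cong (map S (orbit π x) ++_) (cat-map L)) (sym (map-++ S (orbit π x) (concatMap (orbit π) L)))
    cov : concatMap cl ls ↭ range 1 n
    cov = ↭-trans (↭-reflexive (cat-map (mins π))) (↭-trans (Permₚ.map⁺ S (orbits-cover v)) (↭-trans (↭-reflexive (map-app-id₀ (val-s k))) (val-s k)))
    lens : map (λ c → length (cl c)) ls ≡ map (cycLen π) (mins π)
    lens = trans (sym (map-∘ (mins π))) (map-cong (λ x → cong suc (length-map S (tl (orbit π x)))) (mins π))

  s-fixes : ∀ k {x} → x ∈ id₀ → suc (suc k) < x → app (s k) x ≡ x
  s-fixes k {suc x} m (s≤s lt) = trans (at-swapAt-other k id₀ (λ { refl → <-irrefl refl (<-trans (n<1+n _) lt) }) (λ { refl → <-irrefl refl lt })) (app-id₀ m)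

  n∈id₀ : 1 ≤ n → n ∈ id₀
  n∈id₀ le = ∈-range⁺ le ≤-refl

  inC-conj : ∀ μ j k {π} → suc (suc k) < n → Val π → inC n μ j (conj k π) ≡ inC n μ j π
  inC-conj μ j k {π} lt v = cong₂ (λ t l → listEq? t (sortDesc μ) ∧ (l ≡ᵇ j)) (cycleType-conj k v)
    (trans (cong (cycLen (conj k π)) (sym (s-fixes k nn lt))) (cycLen-conj k v nn))
    where
    nn = n∈id₀ (≤-trans (s≤s z≤n) lt)

  ConjInv : {B : Set} → (List ℕ → B) → Set
  ConjInv h = ∀ k {π} → suc (suc k) < n → Val π → h (conj k π) ≡ h π

  χ : List ℕ → ℕ → List ℕ → ℚ
  χ μ j π = ind (inC n μ j π)

  χ-conj : ∀ μ j → ConjInv (χ μ j)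
  χ-conj μ j k lt v = cong ind (inC-conj μ j k lt v)

  -- Membership in S_{n-1}, witnessed by a word in its generators, so that invariance under single
  -- conjugations extends by induction on the word.
  Fixing : List ℕ → Set
  Fixing g = ∃ λ w → All (λ k → suc (suc k) < n) w × foldl (λ π k → swapAt k π) id₀ w ≡ g

  val-foldl : ∀ w {g} → Val g → Val (foldl (λ π k → swapAt k π) g w)
  val-foldl [] v = v
  val-foldl (k ∷ w) v = val-foldl w (val-swap k v)

  conj-transport : {B : Set} {h : List ℕ → B} → ConjInv h → ∀ {g} → Fixing g → ∀ {π π′} → Val π → Val π′ →
    π ∘ₚ g ≡ g ∘ₚ π′ → h π ≡ h π′
  conj-transport {h = h} inv-h (w , aw , refl) = go w aw val-id (λ v v′ e → cong h (trans (sym (∘-idʳ v)) (trans e (∘-idˡ v′))))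
    where
    Q : List ℕ → Set
    Q g = ∀ {π π′} → Val π → Val π′ → π ∘ₚ g ≡ g ∘ₚ π′ → h π ≡ h π′
    go : ∀ w → All (λ k → suc (suc k) < n) w → ∀ {g} → Val g → Q g → Q (foldl (λ π k → swapAt k π) g w)
    go [] [] vg q = q
    go (k ∷ w) (lt ∷ lts) {g} vg q = go w lts (val-swap k vg) (λ {π} {π′} v v′ e → trans (q v (val-conj k v′) (begin′ v v′ e)) (inv-h k lt v′))
      where
      begin′ : ∀ {π π′} → Val π → Val π′ → π ∘ₚ swapAt k g ≡ swapAt k g ∘ₚ π′ → π ∘ₚ g ≡ g ∘ₚ conj k π′
      begin′ {π} {π′} v v′ e = trans (sym (swapAt-invol (π ∘ₚ g) k)) (trans (cong (swapAt k) (trans (sym (∘-swap π g k)) e))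
        (trans (cong (λ l → swapAt k (l ∘ₚ π′)) (sym (∘-s k vg))) (trans (sym (∘-swap (g ∘ₚ s k) π′ k)) (∘-assoc g (val-s k) (val-swap k v′)))))

  -- τ π and π τ are conjugate by τ, which lies in S_{n-1}.
  class-comm : {B : Set} {h : List ℕ → B} → ConjInv h → ∀ {τ} → Fixing τ → ∀ {π} → Val π → h (τ ∘ₚ π) ≡ h (π ∘ₚ τ)
  class-comm {h = h} inv-h (w , aw , refl) = go w aw val-id (λ v → cong h (trans (∘-idˡ v) (sym (∘-idʳ v))))
    where
    Q : List ℕ → Set
    Q τ = ∀ {π} → Val π → h (τ ∘ₚ π) ≡ h (π ∘ₚ τ)
    go : ∀ w → All (λ k → suc (suc k) < n) w → ∀ {τ} → Val τ → Q τ → Q (foldl (λ π k → swapAt k π) τ w)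
    go [] [] vt q = q
    go (k ∷ w) (lt ∷ lts) {τ} vt q = go w lts (val-swap k vt) (λ {π} v → trans
      (cong h (trans (cong (_∘ₚ π) (sym (∘-s k vt))) (∘-assoc τ (val-s k) v)))
      (trans (q (val-∘ (val-s k) v)) (trans (cong h (∘-assoc (s k) v vt))
      (trans (cong h (cong (s k ∘ₚ_) (sym (swapAt-invol (π ∘ₚ τ) k)))) (trans (inv-h k lt (val-swap k (val-∘ v vt))) (cong h (sym (∘-swap π τ k))))))))

  -- τ is σ with M cut out: the cycle of M under σ reads M, r, a, and τ closes a, r by sending a
  -- directly to σ(M).
  cycLen-remove : ∀ {σ τ a M} → Val σ → Val τ → a ∈ id₀ → M ∈ id₀ → a ≢ M → app σ a ≡ M → app τ a ≡ app σ M →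
    (∀ {z} → z ∈ id₀ → z ≢ a → z ≢ M → app τ z ≡ app σ z) → cycLen σ M ≡ suc (cycLen τ a)
  cycLen-remove {σ} {τ} {a} {M} vσ vτ ma mM ne e₁ e₂ e₃ with cyc-exists vσ mM
  ... | u , c with initLast u
  ... | [] = ⊥-elim (ne (app-inj vσ ma mM (trans e₁ (sym (∷-injectiveˡ (rotates c))))))
  ... | r ∷ʳ′ a′ = trans (cycLen-cyc vσ mM c) (cong suc (trans (trans (length-++ r) (+-comm (length r) 1)) (sym (cycLen-cyc vτ ma ca))))
    where
    parts : app σ M ∷ map (app σ) r ≡ r ++ a′ ∷ [] × app σ a′ ∷ [] ≡ M ∷ []
    parts = ++-split (app σ M ∷ map (app σ) r) (r ++ a′ ∷ [])
      (trans (cong suc (length-map (app σ) r)) (sym (trans (length-++ r) (+-comm (length r) 1))))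
      (trans (cong (app σ M ∷_) (sym (map-++ (app σ) r (a′ ∷ [])))) (rotates c))
    a′≡a : a′ ≡ a
    a′≡a = app-inj vσ (cyc-⊆ vσ mM c (there (∈-++⁺ʳ r (here refl)))) ma (trans (∷-injectiveˡ (proj₂ parts)) (sym e₁))
    uniq : Unique (r ++ a′ ∷ [])
    uniq = AllPairs.tail (distinct c)
    r∌a : ∀ {z} → z ∈ r → z ≢ a
    r∌a m q = proj₁ (unique-++⁻ r uniq) m (here (trans q (sym a′≡a)))
    r∌M : ∀ {z} → z ∈ r → z ≢ M
    r∌M m q = All.lookup (AllPairs.head (distinct c)) (∈-++⁺ˡ m) (sym q)
    ca : Cyc (app τ) a r
    ca = mk (trans (cong₂ _∷_ e₂ (map-cong-local (All.tabulate (λ m → e₃ (cyc-⊆ vσ mM c (there (∈-++⁺ˡ m))) (r∌a m) (r∌M m)))))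
          (trans (proj₁ parts) (cong (λ z → r ++ z ∷ []) a′≡a)))
        (unique-resp-↭ (↭-trans (Permₚ.++-comm r (a′ ∷ [])) (↭-reflexive (cong (_∷ r) a′≡a))) uniq)

  Fix : ℕ → List ℕ → Set
  Fix m τ = ∀ {x} → x ∈ id₀ → m < x → app τ x ≡ x

  -- A cycle of length m inside 1, ..., m is all of it, so every point there may serve as its base.
  cycLen-base : ∀ {τ m a b} → Val τ → m ≤ n → Fix m τ → a ∈ id₀ → b ∈ id₀ → a ≤ m → b ≤ m → cycLen τ a ≡ m → cycLen τ b ≡ m
  cycLen-base {τ} {m} {a} {b} v mn fix ma mb la lb e with orbit-cyc v ma
  ... | u , q , c = trans (↭-length (cyc-same v ma c b∈)) (trans (cong length (sym q)) e)
    where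
    small : ∀ {y} → y ∈ a ∷ u → y ∈ range 1 m
    small {y} k with y ≤? m
    ... | yes le = ∈-range⁺ (proj₁ (∈-range⁻ {1} {n} (cyc-⊆ v ma c k))) le
    ... | no nle = ⊥-elim (nle (≤-trans (≤-reflexive (sym (single (∈-resp-↭ (↭-sym (cyc-same v ma c k)) (here refl))))) la))
      where
      my = cyc-⊆ v ma c k
      fixed : Cyc (app τ) y []
      fixed = mk (cong (_∷ []) (fix my (≰⇒> nle))) ([] ∷ [])
      single : a ∈ orbit τ y → a ≡ y
      single k′ with subst (a ∈_) (cyc-orbit v my fixed) k′
      ... | here e = e
    b∈ : b ∈ a ∷ u
    b∈ = unique-⊆-full _≟_ (distinct c) small (≤-reflexive (trans (range-length m) (trans (sym e) (cong length q)))) (∈-range⁺ (proj₁ (∈-range⁻ {1} {n} mb)) lb)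

∧-true : ∀ {a b} → a ∧ b ≡ true → a ≡ true × b ≡ true
∧-true {true} {true} e = refl , refl

bool-iff : ∀ {a b : Bool} → (a ≡ true → b ≡ true) → (b ≡ true → a ≡ true) → a ≡ b
bool-iff {true} f g = sym (f refl)
bool-iff {false} {true} f g with g refl
... | ()
bool-iff {false} {false} f g = refl

count-ind : (b : A → Bool) (xs : List A) → ℕ→ℚ (length (filterB b xs)) ≡ ∑ (λ x → ind (b x)) xs
count-ind b [] = refl
count-ind b (x ∷ xs) with b x
... | true = trans (ℕ→ℚ-+ 1 (length (filterB b xs))) (cong (1ℚ ℚ.+_) (count-ind b xs))
... | false = trans (count-ind b xs) (sym (ℚP.+-identityˡ _))

map-≡-∈ : {f g : A → B} (l : List A) → map f l ≡ map g l → ∀ {x} → x ∈ l → f x ≡ g x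
map-≡-∈ (y ∷ l) e (here refl) = ∷-injectiveˡ e
map-≡-∈ (y ∷ l) e (there m) = map-≡-∈ l (∷-injectiveʳ e) m

applyUpTo-+ : (f : ℕ → A) (q r : ℕ) → applyUpTo f (q + r) ≡ applyUpTo f q ++ applyUpTo (λ i → f (q + i)) r
applyUpTo-+ f zero r = refl
applyUpTo-+ f (suc q) r = cong (f 0 ∷_) (applyUpTo-+ (λ i → f (suc i)) q r)

range-split : ∀ q r → range 1 (q + r) ≡ range 1 q ++ range (suc q) (q + r)
range-split q r = trans (applyUpTo-+ suc q r) (cong (λ k → range 1 q ++ applyUpTo (suc q +_) k) (sym (m+n∸m≡n q r)))

range-snoc : ∀ j → range 1 (suc j) ≡ range 1 j ++ suc j ∷ []
range-snoc j = sym (applyUpTo-∷ʳ (1 +_) j)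

nextIn-rotate : ∀ h a cs → Unique (a ∷ cs) → map (nextIn h (a ∷ cs)) (a ∷ cs) ≡ cs ++ h ∷ []
nextIn-rotate h a [] u rewrite ≡ᵇ-refl a = refl
nextIn-rotate h a (b ∷ cs) (a∉ ∷ u) = cong₂ _∷_ first (trans (map-cong-local (All.tabulate rest)) (nextIn-rotate h b cs u))
  where
  first : nextIn h (a ∷ b ∷ cs) a ≡ b
  first rewrite ≡ᵇ-refl a = refl
  rest : ∀ {x} → x ∈ b ∷ cs → nextIn h (a ∷ b ∷ cs) x ≡ nextIn h (b ∷ cs) x
  rest m rewrite ≡ᵇ-≢ (All.lookup a∉ m) = refl

-- Transpositions and sums of long cycles

module CycleSums (n : ℕ) where
  open SymmetricGroup n
  open Orbits n
  open CycleTypes n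
  open Operators action
  open Hooks action

  app-s-left : ∀ {k} → suc k < n → app (s k) (suc k) ≡ suc (suc k)
  app-s-left {k} lt = trans (at-swapAt-left k id₀ (subst (suc k <_) (sym (range-length n)) lt))
    (trans (at-default id₀ (subst (suc k <_) (sym (range-length n)) lt)) (app-id₀ (∈-range⁺ (s≤s z≤n) lt)))
    where
    at-default : ∀ l {i d d′} → i < length l → at l i d ≡ at l i d′
    at-default (a ∷ l) {zero} lt = refl
    at-default (a ∷ l) {suc i} (s≤s lt) = at-default l lt

  app-s-right : ∀ {k} → suc k < n → app (s k) (suc (suc k)) ≡ suc k
  app-s-right {k} lt = trans (cong (app (s k)) (sym (app-s-left lt))) (s-invol k (∈-range⁺ (s≤s z≤n) (<⇒≤ lt)))

  app-s-other : ∀ {k x} → x ∈ id₀ → x ≢ suc k → x ≢ suc (suc k) → app (s k) x ≡ x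
  app-s-other {k} {zero} m n₁ n₂ with ∈-range⁻ {1} {n} m
  ... | () , _
  app-s-other {k} {suc x} m n₁ n₂ = trans (at-swapAt-other k id₀ (λ e → n₁ (cong suc e)) (λ e → n₂ (cong suc e))) (app-id₀ m)

  tp : ℕ → ℕ → List ℕ
  tp a b = transp n a b

  app-tp : ∀ a b {x} → x ∈ id₀ → app (tp a b) x ≡ nextIn a (a ∷ b ∷ []) x
  app-tp a b = app-map-id₀ (nextIn a (a ∷ b ∷ []))

  tp-left : ∀ a b → a ∈ id₀ → app (tp a b) a ≡ b
  tp-left a b m = trans (app-tp a b m) lem
    where
    lem : nextIn a (a ∷ b ∷ []) a ≡ b
    lem rewrite ≡ᵇ-refl a = refl

  tp-right : ∀ a b → b ∈ id₀ → a ≢ b → app (tp a b) b ≡ a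
  tp-right a b m ne = trans (app-tp a b m) lem
    where
    lem : nextIn a (a ∷ b ∷ []) b ≡ a
    lem rewrite ≡ᵇ-≢ ne | ≡ᵇ-refl b = refl

  tp-other : ∀ a b {x} → x ∈ id₀ → x ≢ a → x ≢ b → app (tp a b) x ≡ x
  tp-other a b {x} m na nb = trans (app-tp a b m) lem
    where
    lem : nextIn a (a ∷ b ∷ []) x ≡ x
    lem rewrite ≡ᵇ-≢ (λ e → na (sym e)) | ≡ᵇ-≢ (λ e → nb (sym e)) = refl

  tp-tp : ∀ a b {x} → a ∈ id₀ → b ∈ id₀ → a ≢ b → x ∈ id₀ → app (tp a b) (app (tp a b) x) ≡ x
  tp-tp a b {x} ma mb ne m with x ≟ a | x ≟ b
  ... | yes refl | _ = trans (cong (app (tp a b)) (tp-left a b ma)) (tp-right a b mb ne)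
  ... | no _ | yes refl = trans (cong (app (tp a b)) (tp-right a b mb ne)) (tp-left a b ma)
  ... | no na | no nb = trans (cong (app (tp a b)) (tp-other a b m na nb)) (tp-other a b m na nb)

  tp-∈ : ∀ a b {x} → a ∈ id₀ → b ∈ id₀ → a ≢ b → x ∈ id₀ → app (tp a b) x ∈ id₀
  tp-∈ a b {x} ma mb ne m with x ≟ a | x ≟ b
  ... | yes refl | _ = subst (_∈ id₀) (sym (tp-left a b ma)) mb
  ... | no _ | yes refl = subst (_∈ id₀) (sym (tp-right a b mb ne)) ma
  ... | no na | no nb = subst (_∈ id₀) (sym (tp-other a b m na nb)) m

  val-tp : ∀ {a b} → a ∈ id₀ → b ∈ id₀ → a ≢ b → Val (tp a b)
  val-tp {a} {b} ma mb ne = ↭-trans (↭-reflexive (map-cong-local (All.tabulate (λ m → sym (app-tp a b m)))))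
    (unique-set-↭ (unique-map-local (app (tp a b)) id₀ (λ m m′ e → trans (sym (tp-tp a b ma mb ne m)) (trans (cong (app (tp a b)) e) (tp-tp a b ma mb ne m′))) (range-unique 1 n))
      (range-unique 1 n)
      (λ m → let (x , k , e) = ∈-map⁻ (app (tp a b)) m in subst (_∈ id₀) (sym e) (tp-∈ a b ma mb ne k))
      (λ m → subst (_∈ map (app (tp a b)) id₀) (tp-tp a b ma mb ne m) (∈-map⁺ (app (tp a b)) (tp-∈ a b ma mb ne m))))

  tp-ext : ∀ {π a b} → Val π → a ∈ id₀ → b ∈ id₀ → a ≢ b → app π a ≡ b → app π b ≡ a →
    (∀ {x} → x ∈ id₀ → x ≢ a → x ≢ b → app π x ≡ x) → tp a b ≡ π
  tp-ext {π} {a} {b} v ma mb ne ea eb eo = perm-ext (val-tp ma mb ne) v pointwise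
    where
    pointwise : ∀ {x} → x ∈ id₀ → app (tp a b) x ≡ app π x
    pointwise {x} m with x ≟ a | x ≟ b
    ... | yes refl | _ = trans (tp-left a b ma) (sym ea)
    ... | no _ | yes refl = trans (tp-right a b mb ne) (sym eb)
    ... | no na | no nb = trans (tp-other a b m na nb) (sym (eo m na nb))

  tp-s : ∀ {j} → suc j < n → tp (suc j) (suc (suc j)) ≡ s j
  tp-s {j} lt = tp-ext (val-s j) (∈-range⁺ (s≤s z≤n) (<⇒≤ lt)) (∈-range⁺ (s≤s z≤n) lt) (<⇒≢ (n<1+n _))
    (app-s-left lt) (app-s-right lt) (λ m → app-s-other m)

  tp-conj : ∀ {a j} → suc j < n → 1 ≤ a → a < suc j → tp a (suc (suc j)) ≡ conj j (tp a (suc j))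
  tp-conj {a} {j} lt la aj = tp-ext (val-conj j vT) ma m₂ (<⇒≢ (m≤n⇒m≤1+n aj)) atA atB other
    where
    m₁ = ∈-range⁺ {1} {n} {suc j} (s≤s z≤n) (<⇒≤ lt)
    m₂ = ∈-range⁺ {1} {n} {suc (suc j)} (s≤s z≤n) lt
    ma = ∈-range⁺ {1} {n} la (≤-trans (<⇒≤ aj) (<⇒≤ lt))
    vT = val-tp ma m₁ (<⇒≢ aj)
    S = app (s j)
    Sa : S a ≡ a
    Sa = app-s-other ma (<⇒≢ aj) (<⇒≢ (m≤n⇒m≤1+n aj))
    atA : app (conj j (tp a (suc j))) a ≡ suc (suc j)
    atA = trans (app-conj j vT ma) (trans (cong (λ z → S (app (tp a (suc j)) z)) Sa) (trans (cong S (tp-left a (suc j) ma)) (app-s-left lt)))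
    atB : app (conj j (tp a (suc j))) (suc (suc j)) ≡ a
    atB = trans (app-conj j vT m₂) (trans (cong (λ z → S (app (tp a (suc j)) z)) (app-s-right lt)) (trans (cong S (tp-right a (suc j) m₁ (<⇒≢ aj))) Sa))
    other : ∀ {x} → x ∈ id₀ → x ≢ a → x ≢ suc (suc j) → app (conj j (tp a (suc j))) x ≡ x
    other {x} m na nb with x ≟ suc j
    ... | yes refl = trans (app-conj j vT m) (trans (cong (λ z → S (app (tp a (suc j)) z)) (app-s-left lt))
          (trans (cong S (tp-other a (suc j) m₂ (λ e → <⇒≢ (m≤n⇒m≤1+n aj) (sym e)) (λ e → <⇒≢ (n<1+n _) (sym e)))) (app-s-right lt)))
    ... | no nc = trans (app-conj j vT m) (trans (cong (λ z → S (app (tp a (suc j)) z)) (app-s-other m nc nb))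
          (trans (cong S (tp-other a (suc j) m na nc)) (app-s-other m nc nb)))

  -- Matches the recursive `X` with the sum of transpositions: conjugating (a, j) by (j, j+1) gives
  -- (a, j+1), and the extra summand is (j, j+1) itself.
  X-sum : ∀ j → j < n → ∀ f {π} → Val π → ⟦ X j ⟧ f π ≡ ∑ (λ a → f (π ∘ₚ tp a (suc j))) (range 1 j)
  X-sum zero lt f {π} v = ℚP.*-zeroˡ (f π)
  X-sum (suc j) lt f {π} v = trans (cong₂ ℚ._+_
      (trans (X-sum j (<⇒≤ lt) (⟦ sw j ⟧ f) (val-swap j v)) (∑-cong (range 1 j) term))
      (trans (cong f (trans (sym (∘-s j v)) (cong (π ∘ₚ_) (sym (tp-s lt))))) (sym (ℚP.+-identityʳ _))))
    (trans (sym (∑-++ F (range 1 j) (suc j ∷ []))) (cong (∑ F) (sym (range-snoc j))))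
    where
    F : ℕ → ℚ
    F a = f (π ∘ₚ tp a (suc (suc j)))
    term : ∀ a → a ∈ range 1 j → f (swapAt j (swapAt j π ∘ₚ tp a (suc j))) ≡ F a
    term a m with ∈-range⁻ {1} {j} m
    ... | la , le = cong f (trans (sym (∘-swap (swapAt j π) (tp a (suc j)) j))
        (trans (cong (_∘ₚ swapAt j (tp a (suc j))) (sym (∘-s j v)))
        (trans (∘-assoc π (val-s j) (val-swap j (val-tp (∈-range⁺ la (≤-trans le (<⇒≤ (<⇒≤ lt)))) (∈-range⁺ (s≤s z≤n) (<⇒≤ lt)) (<⇒≢ (s≤s le)))))
        (cong (π ∘ₚ_) (sym (tp-conj lt la (s≤s le)))))))

  isCyc : ℕ → List ℕ → Bool
  isCyc m τ = allB (λ x → app τ x ≡ᵇ x) (range (suc m) n) ∧ (cycLen τ m ≡ᵇ m)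

  isCyc-sound : ∀ {m τ} → isCyc m τ ≡ true → Fix m τ × cycLen τ m ≡ m
  isCyc-sound {m} {τ} e with ∧-true e
  ... | a , b = (λ mx lt → ≡ᵇ-sound (allB-sound (λ x → app τ x ≡ᵇ x) (range (suc m) n) a (∈-range⁺ lt (proj₂ (∈-range⁻ {1} {n} mx))))) , ≡ᵇ-sound b

  isCyc-complete : ∀ {m τ} → Fix m τ → cycLen τ m ≡ m → isCyc m τ ≡ true
  isCyc-complete {m} {τ} fix e = cong₂ _∧_
    (allB-complete (λ x → app τ x ≡ᵇ x) (range (suc m) n) (λ {y} k → let (a , b) = ∈-range⁻ {suc m} {n} k in
      trans (cong (_≡ᵇ y) (fix (∈-range⁺ (≤-trans (s≤s z≤n) a) b) a)) (≡ᵇ-refl y)))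
    (trans (cong (_≡ᵇ m) e) (≡ᵇ-refl m))

  ind-false : ∀ {b : Bool} → (b ≡ true → ⊥) → ind b ≡ 0ℚ
  ind-false {true} h = ⊥-elim (h refl)
  ind-false {false} h = refl

  cycLen-fixed : ∀ {τ x} → Val τ → x ∈ id₀ → app τ x ≡ x → cycLen τ x ≡ 1
  cycLen-fixed v m e = cycLen-cyc v m (mk (cong (_∷ []) e) ([] ∷ []))

  module _ {m : ℕ} (lt : suc m < n) {σ : List ℕ} (v : Val σ) where
    private
      M = suc (suc m)
      mM : M ∈ id₀
      mM = ∈-range⁺ (s≤s z≤n) lt
      in-range : ∀ {a} → a ∈ range 1 (suc m) → a ∈ id₀ × a < M
      in-range k = let (la , le) = ∈-range⁻ {1} {suc m} k in ∈-range⁺ la (≤-trans le (<⇒≤ lt)) , s≤s le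

    extension-unique : ∀ {a} → a ∈ range 1 (suc m) → isCyc (suc m) (σ ∘ₚ tp a M) ≡ true → app σ a ≡ M
    extension-unique {a} k e = let (ma , a<M) = in-range k in
      trans (cong (app σ) (sym (tp-right a M mM (<⇒≢ a<M))))
        (trans (sym (app-∘ σ (val-tp ma mM (<⇒≢ a<M)) mM)) (proj₁ (isCyc-sound {suc m} {σ ∘ₚ tp a M} e) mM ≤-refl))

    extension-cyc : ∀ {a} → a ∈ range 1 (suc m) → app σ a ≡ M → isCyc (suc m) (σ ∘ₚ tp a M) ≡ isCyc M σ
    extension-cyc {a} k eM = bool-iff to from
      where
      ma = proj₁ (in-range k)
      ne = <⇒≢ (proj₂ (in-range k))
      τ = σ ∘ₚ tp a M
      vT = val-tp ma mM ne
      vτ = val-∘ v vT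
      atM : app τ M ≡ M
      atM = trans (app-∘ σ vT mM) (trans (cong (app σ) (tp-right a M mM ne)) eM)
      atA : app τ a ≡ app σ M
      atA = trans (app-∘ σ vT ma) (cong (app σ) (tp-left a M ma))
      atO : ∀ {z} → z ∈ id₀ → z ≢ a → z ≢ M → app τ z ≡ app σ z
      atO mz na nb = trans (app-∘ σ vT mz) (cong (app σ) (tp-other a M mz na nb))
      len : cycLen σ M ≡ suc (cycLen τ a)
      len = cycLen-remove v vτ ma mM ne eM atA atO
      m₁ : suc m ∈ id₀
      m₁ = ∈-range⁺ (s≤s z≤n) (<⇒≤ lt)
      beyond : ∀ {x} → M < x → x ≢ a × x ≢ M
      beyond q = (λ { refl → <-asym q (proj₂ (in-range k)) }) , (λ { refl → <-irrefl refl q })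
      to : isCyc (suc m) τ ≡ true → isCyc M σ ≡ true
      to e with isCyc-sound {suc m} {τ} e
      ... | fix , l = isCyc-complete {M} {σ} (λ mx q → let (na , nb) = beyond q in trans (sym (atO mx na nb)) (fix mx (<-trans (n<1+n _) q)))
        (trans len (cong suc (cycLen-base vτ (<⇒≤ lt) fix m₁ ma ≤-refl (≤-pred (proj₂ (in-range k))) l)))
      from : isCyc M σ ≡ true → isCyc (suc m) τ ≡ true
      from e with isCyc-sound {M} {σ} e
      ... | fix , l = isCyc-complete {suc m} {τ} fixτ (cycLen-base vτ (<⇒≤ lt) fixτ ma m₁ (≤-pred (proj₂ (in-range k))) ≤-refl (suc-injective (trans (sym len) l)))
        where
        fixτ : Fix (suc m) τ
        fixτ {x} mx q with x ≟ M
        ... | yes refl = atM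
        ... | no nM = let q′ = ≤∧≢⇒< q (λ e → nM (sym e)) ; (na , nb) = beyond q′ in trans (atO mx na nb) (fix mx q′)

    -- An M-cycle σ is τ (a M) with τ an (M-1)-cycle for exactly one a, the preimage of M under σ.
    -- Hence one more Jucys-Murphy factor lengthens the cycles without multiplicity.
    extension-sum : ∑ (λ a → ind (isCyc (suc m) (σ ∘ₚ tp a M))) (range 1 (suc m)) ≡ ind (isCyc M σ)
    extension-sum with app-surj v mM
    ... | a , ma , eM with a ≤? suc m
    ...   | yes le = trans (∑-single (range 1 (suc m)) (range-unique 1 (suc m)) a ka
                (λ b kb ne → ind-false (λ e → ne (app-inj v (proj₁ (in-range kb)) ma (trans (extension-unique kb e) (sym eM))))))
              (cong ind (extension-cyc ka eM))
      where
      ka : a ∈ range 1 (suc m)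
      ka = ∈-range⁺ (proj₁ (∈-range⁻ {1} {n} ma)) le
    ...   | no nle = trans (∑-zero (range 1 (suc m)) (λ b kb → ind-false (λ e → nle (subst (_≤ suc m)
                (app-inj v (proj₁ (in-range kb)) ma (trans (extension-unique kb e) (sym eM))) (≤-pred (proj₂ (in-range kb)))))))
              (sym (ind-false notcyc))
      where
      notcyc : isCyc M σ ≡ true → ⊥
      notcyc e with isCyc-sound {M} {σ} e
      ... | fix , l with a ≟ M
      ...   | yes refl with trans (sym (cycLen-fixed v mM eM)) l
      ...     | ()
      notcyc e | fix , l | no ne = ne (trans (sym (fix ma (≤∧≢⇒< (≰⇒> nle) (λ q → ne (sym q))))) eM)

  isCyc-1 : 1 ≤ n → isCyc 1 id₀ ≡ true
  isCyc-1 le = isCyc-complete {1} {id₀} (λ mx _ → app-id₀ mx) (cycLen-fixed val-id (∈-range⁺ ≤-refl le) (app-id₀ (∈-range⁺ ≤-refl le)))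

  isCyc-1-id : ∀ {τ} → 1 ≤ n → Val τ → isCyc 1 τ ≡ true → τ ≡ id₀
  isCyc-1-id {τ} le v e with isCyc-sound {1} {τ} e
  ... | fix , l = perm-ext v val-id (λ {x} mx → trans (pointwise mx) (sym (app-id₀ mx)))
    where
    m1 = ∈-range⁺ {1} {n} ≤-refl le
    at-1 : app τ 1 ≡ 1
    at-1 with cyc-exists v m1
    ... | [] , c = ∷-injectiveˡ (rotates c)
    ... | y ∷ u , c with trans (sym l) (cycLen-cyc v m1 c)
    ...   | ()
    pointwise : ∀ {x} → x ∈ id₀ → app τ x ≡ x
    pointwise {x} mx with x ≟ 1
    ... | yes refl = at-1
    ... | no ne = fix mx (≤∧≢⇒< (proj₁ (∈-range⁻ {1} {n} mx)) (λ q → ne (sym q)))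

  -- J₂ ⋯ J_{m+1} is the sum of the (m+1)-cycles of S_{m+1}.
  JJ-cycles : ∀ m → m < n → ∀ f {π} → Val π → ⟦ JJ m ⟧ f π ≡ ∑ (λ τ → ind (isCyc (suc m) τ) ℚ.* f (π ∘ₚ τ)) (Sym n)
  JJ-cycles zero lt f {π} v = sym (trans (∑-single (Sym n) sym-unique id₀ (sym-∈ val-id)
      (λ τ k ne → trans (cong (ℚ._* f (π ∘ₚ τ)) (ind-false (λ e → ne (isCyc-1-id lt (sym-val k) e)))) (ℚP.*-zeroˡ (f (π ∘ₚ τ)))))
    (trans (cong (λ b → ind b ℚ.* f (π ∘ₚ id₀)) (isCyc-1 lt)) (cong (λ ρ → 1ℚ ℚ.* f ρ) (∘-idʳ v))))
  JJ-cycles (suc m) lt f {π} v = trans (JJ-cycles m (<⇒≤ lt) (⟦ X (suc m) ⟧ f) v)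
    (trans (∑-cong (Sym n) (λ τ k → trans (cong (c τ ℚ.*_) (X-sum (suc m) lt f (val-∘ v (sym-val k)))) (sym (∑-*ˡ (c τ) (λ a → f ((π ∘ₚ τ) ∘ₚ tp a M)) (range 1 (suc m))))))
    (trans (∑-swap (λ τ a → c τ ℚ.* f ((π ∘ₚ τ) ∘ₚ tp a M)) (Sym n) (range 1 (suc m)))
    (trans (∑-cong (range 1 (suc m)) move)
    (trans (∑-swap (λ a σ → c (σ ∘ₚ tp a M) ℚ.* f (π ∘ₚ σ)) (range 1 (suc m)) (Sym n))
    (∑-cong (Sym n) (λ σ k → trans (∑-*ʳ (f (π ∘ₚ σ)) (λ a → c (σ ∘ₚ tp a M)) (range 1 (suc m))) (cong (ℚ._* f (π ∘ₚ σ)) (extension-sum lt (sym-val k)))))))))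
    where
    M = suc (suc m)
    c : List ℕ → ℚ
    c τ = ind (isCyc (suc m) τ)
    move : ∀ a → a ∈ range 1 (suc m) → ∑ (λ τ → c τ ℚ.* f ((π ∘ₚ τ) ∘ₚ tp a M)) (Sym n) ≡ ∑ (λ σ → c (σ ∘ₚ tp a M) ℚ.* f (π ∘ₚ σ)) (Sym n)
    move a k = trans (sym (∑-↭ (λ τ → c τ ℚ.* f ((π ∘ₚ τ) ∘ₚ T′)) (reindex (_∘ₚ T′) (_∘ₚ T′) (λ w → val-∘ w vT) (λ w → val-∘ w vT) cancel cancel)))
      (trans (∑-map (λ τ → c τ ℚ.* f ((π ∘ₚ τ) ∘ₚ T′)) (_∘ₚ T′) (Sym n))
      (∑-cong (Sym n) (λ σ kσ → cong (λ ρ → c (σ ∘ₚ T′) ℚ.* f ρ)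
        (trans (∘-assoc π (val-∘ (sym-val kσ) vT) vT) (cong (π ∘ₚ_) (cancel (sym-val kσ)))))))
      where
      bounds = ∈-range⁻ {1} {suc m} k
      T′ = tp a M
      ma = ∈-range⁺ {1} {n} (proj₁ bounds) (≤-trans (proj₂ bounds) (<⇒≤ lt))
      mM = ∈-range⁺ {1} {n} {M} (s≤s z≤n) lt
      ne = <⇒≢ (s≤s (proj₂ bounds))
      vT : Val T′
      vT = val-tp ma mM ne
      cancel : ∀ {σ} → Val σ → (σ ∘ₚ T′) ∘ₚ T′ ≡ σ
      cancel {σ} w = trans (∘-assoc σ vT vT) (trans (cong (σ ∘ₚ_)
        (perm-ext (val-∘ vT vT) val-id (λ mx → trans (app-∘ T′ vT mx) (trans (tp-tp a M ma mM ne mx) (sym (app-id₀ mx))))) ) (∘-idʳ w))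

  conj-∘ : ∀ k {π τ} → Val π → Val τ → conj k π ∘ₚ conj k τ ≡ conj k (π ∘ₚ τ)
  conj-∘ k {π} {τ} v w = trans (∘-assoc (s k) (val-swap k v) (val-conj k w))
    (cong (s k ∘ₚ_) (trans (sym (∘-assoc (swapAt k π) (val-s k) (val-swap k w)))
      (trans (cong (_∘ₚ swapAt k τ) (trans (∘-s k (val-swap k v)) (swapAt-invol π k))) (∘-swap π τ k))))

  isCyc-conj : ∀ m k {τ} → suc m ≡ n → suc (suc k) < n → Val τ → isCyc m τ ≡ true → isCyc m (conj k τ) ≡ true
  isCyc-conj m k {τ} refl (s≤s lt) v e with isCyc-sound {m} {τ} e
  ... | fix , l = isCyc-complete {m} {conj k τ} fix′
      (cycLen-base (val-conj k v) (n≤1+n m) fix′ (app-∈ (val-s k) mm) mm Sm ≤-refl (trans (cycLen-conj k v mm) l))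
    where
    mm : m ∈ id₀
    mm = ∈-range⁺ (≤-trans (s≤s z≤n) lt) (n≤1+n m)
    fix-S : ∀ {x} → x ∈ id₀ → m < x → app (s k) x ≡ x
    fix-S mx q = s-fixes k mx (≤-<-trans lt q)
    fix′ : Fix m (conj k τ)
    fix′ {x} mx q = trans (app-conj k v mx) (trans (cong (λ z → app (s k) (app τ z)) (fix-S mx q)) (trans (cong (app (s k)) (fix mx q)) (fix-S mx q)))
    Sm : app (s k) m ≤ m
    Sm with app (s k) m ≤? m
    ... | yes le = le
    ... | no nle = ⊥-elim (<-irrefl refl (≤-trans (≰⇒> nle) (≤-reflexive
          (trans (sym (fix-S (app-∈ (val-s k) mm) (≰⇒> nle))) (s-invol k mm)))))

  -- Here the cycles have length n-1, and conjugation by S_{n-1} permutes them.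
  JJ-conj : ∀ m {f : List ℕ → ℚ} → suc (suc m) ≡ n → ConjInv f → ConjInv (⟦ JJ m ⟧ f)
  JJ-conj m {f} e inv-f k {π} lt v = trans (JJ-cycles m m<n f (val-conj k v))
    (trans (sym (∑-↭ F (reindex (conj k) (conj k) (val-conj k) (val-conj k) (conj-invol k) (conj-invol k))))
    (trans (∑-map F (conj k) (Sym n))
    (trans (∑-cong (Sym n) (λ τ kτ → cong₂ (λ b g → ind b ℚ.* g) (same (sym-val kτ)) (trans (cong f (conj-∘ k v (sym-val kτ))) (inv-f k lt (val-∘ v (sym-val kτ))))))
    (sym (JJ-cycles m m<n f v)))))
    where
    m<n : m < n
    m<n = subst (m <_) e (s≤s (n≤1+n m))
    F : List ℕ → ℚ
    F τ = ind (isCyc (suc m) τ) ℚ.* f (conj k π ∘ₚ τ)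
    same : ∀ {τ} → Val τ → isCyc (suc m) (conj k τ) ≡ isCyc (suc m) τ
    same {τ} w = bool-iff (λ h → subst (λ z → isCyc (suc m) z ≡ true) (conj-invol k w) (isCyc-conj (suc m) k e lt (val-conj k w) h)) (isCyc-conj (suc m) k e lt w)

listEq-sound : ∀ {xs ys} → listEq? xs ys ≡ true → xs ≡ ys
listEq-sound {xs} {ys} e with ≡-dec _≟_ xs ys
... | yes h = h

-- Dipoles as products with a two-cycle permutation

module Dipoles (q r : ℕ) where
  N n p : ℕ
  N = q + r
  n = suc (suc N)
  p = suc q
  open SymmetricGroup n
  open Orbits n
  open CycleTypes n
  open CycleSums n
  open Operators action
  open Hooks action

  private
    n∈ : n ∈ id₀
    n∈ = ∈-range⁺ (s≤s z≤n) ≤-refl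
    n-1∈ : suc N ∈ id₀
    n-1∈ = ∈-range⁺ (s≤s z≤n) (n≤1+n _)
    R₁ R₂ L : List ℕ
    R₁ = range 1 q
    R₂ = range (suc q) N
    L = n ∷ R₁ ++ suc N ∷ R₂

    id₀-split : id₀ ≡ R₁ ++ R₂ ++ suc N ∷ n ∷ []
    id₀-split = trans (range-snoc (suc N)) (trans (cong (_++ n ∷ []) (trans (range-snoc N) (cong (_++ suc N ∷ []) (range-split q r))))
      (trans (++-assoc (R₁ ++ R₂) (suc N ∷ []) (n ∷ [])) (++-assoc R₁ R₂ (suc N ∷ n ∷ []))))

  regroup : ∀ {x y : ℕ} u w → u ++ w ++ y ∷ x ∷ [] ↭ x ∷ u ++ y ∷ w
  regroup {x} {y} u w = ↭-trans (↭-reflexive (trans (cong (u ++_) (sym (++-assoc w (y ∷ []) (x ∷ [])))) (sym (++-assoc u (w ++ y ∷ []) (x ∷ [])))))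
    (↭-trans (Permₚ.++-comm (u ++ w ++ y ∷ []) (x ∷ [])) (Perm.prep x (Permₚ.++⁺ˡ u (Permₚ.++-comm w (y ∷ [])))))

  private
    L↭ : L ↭ id₀
    L↭ = ↭-trans (↭-sym (regroup R₁ R₂)) (↭-reflexive (sym id₀-split))

    next-fun : ℕ → ℕ
    next-fun = nextIn n L

    next-L : map next-fun L ≡ (R₁ ++ suc N ∷ R₂) ++ n ∷ []
    next-L = nextIn-rotate n n (R₁ ++ suc N ∷ R₂) (unique-resp-↭ (↭-sym L↭) (range-unique 1 n))

  val-Cp : Val (Cp n p)
  val-Cp = ↭-trans (Permₚ.map⁺ next-fun (↭-sym L↭)) (↭-trans (↭-reflexive next-L) (↭-trans (Permₚ.++-comm (R₁ ++ suc N ∷ R₂) (n ∷ [])) L↭))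

  -- Left multiplication by (n-1 n) cuts the cycle `Cp` in two: n followed by 1, ..., q, of length
  -- p, and n-1 followed by q+1, ..., N, of length n-p.
  πp : List ℕ
  πp = s N ∘ₚ Cp n p

  val-πp : Val πp
  val-πp = val-∘ (val-s N) val-Cp

  private
    S : ℕ → ℕ
    S = app (s N)
    S-low : ∀ {x} → x ∈ R₁ ⊎ x ∈ R₂ → S x ≡ x
    S-low {x} k = app-s-other (∈-range⁺ (proj₁ (bounds k)) (≤-trans (proj₂ (bounds k)) (m≤n⇒m≤1+n (n≤1+n N))))
        (<⇒≢ (s≤s (proj₂ (bounds k)))) (<⇒≢ (s≤s (m≤n⇒m≤1+n (proj₂ (bounds k)))))
      where
      bounds : x ∈ R₁ ⊎ x ∈ R₂ → 1 ≤ x × x ≤ N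
      bounds (inj₁ m) = proj₁ (∈-range⁻ {1} {q} m) , ≤-trans (proj₂ (∈-range⁻ {1} {q} m)) (m≤m+n q r)
      bounds (inj₂ m) = ≤-trans (s≤s z≤n) (proj₁ (∈-range⁻ {suc q} {N} m)) , proj₂ (∈-range⁻ {suc q} {N} m)
    map-S : ∀ l → (∀ {x} → x ∈ l → x ∈ R₁ ⊎ x ∈ R₂) → map S l ≡ l
    map-S l h = map-id-local (All.tabulate (λ m → S-low (h m)))
    πp-L : map (app πp) L ≡ (R₁ ++ n ∷ []) ++ R₂ ++ suc N ∷ []
    πp-L = trans (map-cong-local (All.tabulate (λ {x} m → trans (app-∘ (s N) val-Cp (∈-resp-↭ L↭ m)) (cong S (app-map-id₀ next-fun (∈-resp-↭ L↭ m))))))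
      (trans (map-∘ L) (trans (cong (map S) (trans next-L (++-assoc R₁ (suc N ∷ R₂) (n ∷ []))))
      (trans (map-++ S R₁ (suc N ∷ R₂ ++ n ∷ []))
      (trans (cong₂ _++_ (map-S R₁ inj₁) (cong₂ _∷_ (app-s-left ≤-refl) (trans (map-++ S R₂ (n ∷ [])) (cong₂ _++_ (map-S R₂ inj₂) (cong (_∷ []) (app-s-right ≤-refl))))))
        (sym (++-assoc R₁ (n ∷ []) (R₂ ++ suc N ∷ [])))))))
    πp-parts : map (app πp) (n ∷ R₁) ≡ R₁ ++ n ∷ [] × map (app πp) (suc N ∷ R₂) ≡ R₂ ++ suc N ∷ []
    πp-parts = ++-split (map (app πp) (n ∷ R₁)) (R₁ ++ n ∷ [])
      (trans (length-map (app πp) (n ∷ R₁)) (sym (trans (length-++ R₁) (+-comm (length R₁) 1))))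
      (trans (sym (map-++ (app πp) (n ∷ R₁) (suc N ∷ R₂))) πp-L)
    L-unique : Unique L
    L-unique = unique-resp-↭ (↭-sym L↭) (range-unique 1 n)
    unique-prefix : ∀ (a : List ℕ) {b} → Unique (a ++ b) → Unique a
    unique-prefix [] u = []
    unique-prefix (x ∷ a) (h ∷ u) = Allₚ.++⁻ˡ a h ∷ unique-prefix a u
    cyc₁ : Cyc (app πp) n R₁
    cyc₁ = mk (proj₁ πp-parts) (unique-prefix (n ∷ R₁) L-unique)
    cyc₂ : Cyc (app πp) (suc N) R₂
    cyc₂ = mk (proj₂ πp-parts) (proj₂ (unique-++⁻ (n ∷ R₁) L-unique))
    lenR₁ : length R₁ ≡ q
    lenR₁ = range-length q
    lenR₂ : length R₂ ≡ r
    lenR₂ = trans (length-applyUpTo (suc q +_) (N ∸ q)) (m+n∸m≡n q r)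

  n∸p : n ∸ p ≡ suc r
  n∸p = trans (cong (_∸ q) (sym (+-suc q r))) (m+n∸m≡n q (suc r))

  πp-inC : inC n (twoRow n p) p πp ≡ true
  πp-inC = cong₂ _∧_
    (trans (cong (λ l → listEq? l (sortDesc (twoRow n p))) type) (listEq-refl (sortDesc (twoRow n p))))
    (trans (cong (_≡ᵇ p) (trans (cycLen-cyc val-πp n∈ cyc₁) (cong suc lenR₁))) (≡ᵇ-refl p))
    where
    type : cycleType n πp ≡ sortDesc (twoRow n p)
    type = trans (sortDesc-resp-↭ (cycle-lengths val-πp ((n , R₁) ∷ (suc N , R₂) ∷ []) (cyc₁ ∷ cyc₂ ∷ [])
        (↭-trans (↭-reflexive (cong (λ l → n ∷ R₁ ++ suc N ∷ l) (++-identityʳ R₂))) L↭)))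
      (cong₂ (λ a b → sortDesc (a ∷ b ∷ [])) (cong suc lenR₁) (trans (cong suc lenR₂) (sym n∸p)))

  fixing-snoc : ∀ l → Val (l ++ n ∷ []) → Fixing (l ++ n ∷ [])
  fixing-snoc l v with ↭-word [] (↭-sym l↭)
    where
    l↭ : l ↭ range 1 (suc N)
    l↭ = ↭-trans (↭-reflexive (sym (++-identityʳ l))) (↭-trans (drop-mid l (range 1 (suc N)) (↭-trans v (↭-reflexive (range-snoc (suc N)))))
      (↭-reflexive (++-identityʳ (range 1 (suc N)))))
  ... | w , h , e = w , All.map (λ {k} lt → s≤s (subst (suc (suc k) ≤_) (range-length (suc N)) lt)) h
      , trans (cong (λ g → foldl (λ π k → swapAt k π) g w) (range-snoc (suc N))) (trans (extend w h) (cong (_++ n ∷ []) e))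
    where
    extend : ∀ w {g} → All (λ k → suc k < length g) w →
      foldl (λ π k → swapAt k π) (g ++ n ∷ []) w ≡ foldl (λ π k → swapAt k π) g w ++ n ∷ []
    extend [] [] = refl
    extend (k ∷ w) {g} (lt ∷ lts) = trans (cong (λ l → foldl (λ π k → swapAt k π) l w) (swapAt-++ k g (n ∷ []) lt))
      (extend w (All.map (λ {j} → subst (suc j <_) (sym (↭-length (swapAt-↭ k g)))) lts))

  fixing : ∀ {τ} → Val τ → app τ n ≡ n → Fixing τ
  fixing {τ} v e with initLast τ
  ... | [] with val-length v
  ...   | ()
  fixing {τ} v e | l ∷ʳ′ a = subst (λ z → Fixing (l ++ z ∷ [])) (sym a≡n) (fixing-snoc l (subst (λ z → Val (l ++ z ∷ [])) a≡n v))
    where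
    len : length l ≡ suc N
    len = suc-injective (trans (sym (trans (length-++ l) (+-comm (length l) 1))) (val-length v))
    at-last : ∀ l {d} → at (l ++ a ∷ []) (length l) d ≡ a
    at-last [] = refl
    at-last (x ∷ l) = at-last l
    a≡n : a ≡ n
    a≡n = trans (sym (at-last l {n})) (trans (cong (λ k → at (l ++ a ∷ []) k n) len) e)

  module _ {π : List ℕ} (v : Val π) where
    private
      -- The one-line word U W z n lays the two cycles of π over those of `πp`. It sends n to
      -- itself, so it conjugates within S_{n-1}.
      conjugator : ∀ U z W → Cyc (app π) n U → Cyc (app π) z W → n ∷ U ++ z ∷ W ↭ id₀ → length U ≡ q → length W ≡ r →
        ∃ λ g → Fixing g × π ∘ₚ g ≡ g ∘ₚ πp
      conjugator U z W cU cW cov lU lW = g , fix , perm-ext (val-∘ v vg) (val-∘ vg val-πp) pointwise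
        where
        g = U ++ W ++ z ∷ n ∷ []
        vg : Val g
        vg = ↭-trans (regroup U W) cov
        g-snoc : (U ++ W ++ z ∷ []) ++ n ∷ [] ≡ g
        g-snoc = trans (++-assoc U (W ++ z ∷ []) (n ∷ [])) (cong (U ++_) (++-assoc W (z ∷ []) (n ∷ [])))
        fix : Fixing g
        fix = subst Fixing g-snoc (fixing-snoc (U ++ W ++ z ∷ []) (subst Val (sym g-snoc) vg))
        G = app g
        all-g : map G R₁ ++ map G (R₂ ++ suc N ∷ n ∷ []) ≡ U ++ W ++ z ∷ n ∷ []
        all-g = trans (sym (map-++ G R₁ (R₂ ++ suc N ∷ n ∷ []))) (trans (cong (map G) (sym id₀-split)) (map-app-id₀ vg))
        s₁ = ++-split (map G R₁) U (trans (length-map G R₁) (trans lenR₁ (sym lU))) all-g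
        s₂ = ++-split (map G R₂) W (trans (length-map G R₂) (trans lenR₂ (sym lW))) (trans (sym (map-++ G R₂ (suc N ∷ n ∷ []))) (proj₂ s₁))
        gz : G (suc N) ≡ z
        gz = ∷-injectiveˡ (proj₂ s₂)
        gn : G n ≡ n
        gn = ∷-injectiveˡ (∷-injectiveʳ (proj₂ s₂))
        on₁ : map (λ x → app π (G x)) (n ∷ R₁) ≡ map (λ x → G (app πp x)) (n ∷ R₁)
        on₁ = trans (map-∘ (n ∷ R₁)) (trans (cong (map (app π)) (cong₂ _∷_ gn (proj₁ s₁))) (trans (rotates cU)
          (sym (trans (map-∘ (n ∷ R₁)) (trans (cong (map G) (proj₁ πp-parts)) (trans (map-++ G R₁ (n ∷ [])) (cong₂ (λ a b → a ++ b ∷ []) (proj₁ s₁) gn)))))))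
        on₂ : map (λ x → app π (G x)) (suc N ∷ R₂) ≡ map (λ x → G (app πp x)) (suc N ∷ R₂)
        on₂ = trans (map-∘ (suc N ∷ R₂)) (trans (cong (map (app π)) (cong₂ _∷_ gz (proj₁ s₂))) (trans (rotates cW)
          (sym (trans (map-∘ (suc N ∷ R₂)) (trans (cong (map G) (proj₂ πp-parts)) (trans (map-++ G R₂ (suc N ∷ [])) (cong₂ (λ a b → a ++ b ∷ []) (proj₁ s₂) gz)))))))
        pointwise : ∀ {x} → x ∈ id₀ → app (π ∘ₚ g) x ≡ app (g ∘ₚ πp) x
        pointwise {x} m = trans (app-∘ π vg m) (trans (both (∈-++⁻ (n ∷ R₁) (∈-resp-↭ (↭-sym L↭) m))) (sym (app-∘ g val-πp m)))
          where
          both : x ∈ n ∷ R₁ ⊎ x ∈ suc N ∷ R₂ → app π (G x) ≡ G (app πp x)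
          both (inj₁ k) = map-≡-∈ (n ∷ R₁) on₁ k
          both (inj₂ k) = map-≡-∈ (suc N ∷ R₂) on₂ k

      two : ∀ {x₁ x₂} → x₂ ∈ id₀ → orbit π x₁ ++ orbit π x₂ ↭ id₀ → n ∈ orbit π x₁ → x₁ ∈ id₀ → cycLen π n ≡ p →
        ∃ λ g → Fixing g × π ∘ₚ g ≡ g ∘ₚ πp
      two {x₁} {x₂} m₂ cov k m₁ l = conjugator (tl (orbit π n)) x₂ (tl (orbit π x₂)) (orbit-tl v n∈) (orbit-tl v m₂) cov′ lU lW
        where
        cov′ : orbit π n ++ orbit π x₂ ↭ id₀
        cov′ = ↭-trans (Permₚ.++⁺ʳ (orbit π x₂) (orbit-same v m₁ k)) cov
        lU : length (tl (orbit π n)) ≡ q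
        lU = suc-injective l
        lW : length (tl (orbit π x₂)) ≡ r
        lW = +-cancelˡ-≡ q _ _ (suc-injective (suc-injective (trans (cong suc (sym (+-suc q _)))
          (trans (cong (λ z → z + length (orbit π x₂)) (sym l)) (trans (sym (length-++ (orbit π n))) (trans (↭-length cov′) (range-length n)))))))

      from-mins : ∀ L → length L ≡ 2 → concatMap (orbit π) L ↭ id₀ → (∀ {x} → x ∈ L → x ∈ id₀) → cycLen π n ≡ p → ∃ λ g → Fixing g × π ∘ₚ g ≡ g ∘ₚ πp
      from-mins (x₁ ∷ x₂ ∷ []) refl cov h l with ∈-++⁻ (orbit π x₁) (∈-resp-↭ (↭-sym cov′) n∈)
        where
        cov′ : orbit π x₁ ++ orbit π x₂ ↭ id₀
        cov′ = ↭-trans (↭-reflexive (cong (orbit π x₁ ++_) (sym (++-identityʳ (orbit π x₂))))) cov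
      ... | inj₁ k = two (h (there (here refl))) (↭-trans (↭-reflexive (cong (orbit π x₁ ++_) (sym (++-identityʳ (orbit π x₂))))) cov) k (h (here refl)) l
      ... | inj₂ k = two (h (here refl)) (↭-trans (Permₚ.++-comm (orbit π x₂) (orbit π x₁)) (↭-trans (↭-reflexive (cong (orbit π x₁ ++_) (sym (++-identityʳ (orbit π x₂))))) cov)) k (h (there (here refl))) l

    conjugate-πp : inC n (twoRow n p) p π ≡ true → ∃ λ g → Fixing g × π ∘ₚ g ≡ g ∘ₚ πp
    conjugate-πp e with ∧-true e
    ... | a , b = from-mins (mins π) len (orbits-cover v) (λ m → proj₁ (∈-mins⁻ π m)) (≡ᵇ-sound b)
      where
      type : cycleType n π ≡ sortDesc (twoRow n p)
      type = listEq-sound a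
      len : length (mins π) ≡ 2
      len = trans (sym (length-map (cycLen π) (mins π))) (trans (sym (sortDesc-length (map (cycLen π) (mins π)))) (trans (cong length type) (sortDesc-length (twoRow n p))))

  -- The class D is a single orbit under conjugation by S_{n-1}: a permutation with two cycles is
  -- fixed up to such conjugation by the length of the cycle through n.
  class-constant : {h : List ℕ → ℚ} → ConjInv h → ∀ {π} → π ∈ Cset n (twoRow n p) p → h π ≡ h πp
  class-constant {h} inv-h {π} m = constant (conjugate-πp v (proj₂ parts))
    where
    parts = ∈-filterB⁻ (inC n (twoRow n p) p) (Sym n) m
    v : Val π
    v = sym-val (proj₁ parts)
    constant : (∃ λ g → Fixing g × π ∘ₚ g ≡ g ∘ₚ πp) → h π ≡ h πp
    constant (g , fix , eq) = conj-transport inv-h fix v val-πp eq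

  module _ (la : List ℕ) (i : ℕ) where
    private
      dip : List ℕ → ℚ
      dip σ = ind ((cycLen σ n ≡ᵇ n) ∧ (app σ (suc N) ≡ᵇ n) ∧ inC n la i (σ ∘ₚ Cp n p))

      term : ∀ {τ} → Val τ → dip (swapAt N τ) ≡ ind (isCyc (suc N) τ) ℚ.* χ la i (πp ∘ₚ τ)
      term {τ} v with app τ n ≟ n
      ... | no ne = trans (ind-false (λ e → ne (trans (sym at-a) (≡ᵇ-sound (proj₁ (∧-true (proj₂ (∧-true {cycLen σ n ≡ᵇ n} e))))))))
            (sym (trans (cong (ℚ._* χ la i (πp ∘ₚ τ)) (ind-false (λ e → ne (proj₁ (isCyc-sound {suc N} {τ} e) n∈ ≤-refl)))) (ℚP.*-zeroˡ (χ la i (πp ∘ₚ τ)))))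
        where
        σ = swapAt N τ
        at-a : app σ (suc N) ≡ app τ n
        at-a = trans (app-swap N v n-1∈) (cong (app τ) (app-s-left ≤-refl))
      ... | yes fixn = trans (cong ind (cong₂ _∧_ (sym cyc-eq) (cong₂ _∧_ (trans (cong (_≡ᵇ n) (trans at-a fixn)) (≡ᵇ-refl n)) refl)))
            (trans (ind-∧ (isCyc (suc N) τ)) (cong (ind (isCyc (suc N) τ) ℚ.*_) class))
        where
        σ = swapAt N τ
        vσ = val-swap N v
        at-a : app σ (suc N) ≡ app τ n
        at-a = trans (app-swap N v n-1∈) (cong (app τ) (app-s-left ≤-refl))
        ind-∧ : ∀ a {b} → ind (a ∧ b) ≡ ind a ℚ.* ind b
        ind-∧ true {b} = sym (ℚP.*-identityˡ (ind b))
        ind-∧ false {b} = sym (ℚP.*-zeroˡ (ind b))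
        len : cycLen σ n ≡ suc (cycLen τ (suc N))
        len = cycLen-remove vσ v n-1∈ n∈ (<⇒≢ (n<1+n _)) (trans at-a fixn)
          (sym (trans (app-swap N v n∈) (cong (app τ) (app-s-right ≤-refl))))
          (λ mz na nb → sym (trans (app-swap N v mz) (cong (app τ) (app-s-other mz na nb))))
        fixed : Fix (suc N) τ
        fixed {x} mx lt = subst (λ z → app τ z ≡ z) (≤-antisym lt (proj₂ (∈-range⁻ {1} {n} mx))) fixn
        cyc-eq : isCyc (suc N) τ ≡ (cycLen σ n ≡ᵇ n)
        cyc-eq = trans (cong (_∧ (cycLen τ (suc N) ≡ᵇ suc N)) (allB-complete (λ x → app τ x ≡ᵇ x) (range n n) (λ {y} k →
            let (a , b) = ∈-range⁻ {n} {n} k in trans (cong (_≡ᵇ y) (fixed (∈-range⁺ (≤-trans (s≤s z≤n) a) b) a)) (≡ᵇ-refl y))))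
          (sym (cong (_≡ᵇ n) len))
        class : ind (inC n la i (σ ∘ₚ Cp n p)) ≡ χ la i (πp ∘ₚ τ)
        class = trans (cong (χ la i) (trans (cong (_∘ₚ Cp n p) (sym (∘-s N v))) (∘-assoc τ (val-s N) val-Cp)))
          (class-comm (χ-conj la i) (fixing v fixn) val-πp)

    -- Substitute σ = τ (n-1 n). The condition σ(n-1) = n becomes τ(n) = n, and σ `Cp` becomes τ
    -- `πp`, which may be replaced by `πp` τ inside the class; this is the order in which right
    -- translations act.
    dipole-sum : ℕ→ℚ (dipoleCount n p la i) ≡ ⟦ JJ N ⟧ (χ la i) πp
    dipole-sum = trans (count-ind _ (Sym n)) (trans (sym (∑-↭ dip (reindex (swapAt N) (swapAt N) (val-swap N) (val-swap N) (λ {π} _ → swapAt-invol π N) (λ {π} _ → swapAt-invol π N))))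
      (trans (∑-map dip (swapAt N) (Sym n)) (trans (∑-cong (Sym n) (λ τ k → term (sym-val k))) (sym (JJ-cycles N (s≤s (n≤1+n N)) (χ la i) val-πp)))))

-- Restates the results with n and p as variables, where `Dipoles` has the sums n = q + r + 2 and p
-- = q + 1.
record DipoleFacts (N n p : ℕ) : Set₁ where
  open SymmetricGroup n
  open CycleTypes n
  open Operators action
  open Hooks action
  field
    πp             : List ℕ
    val-πp         : Val πp
    πp-inC         : inC n (twoRow n p) p πp ≡ true
    class-constant : {h : List ℕ → ℚ} → ConjInv h → ∀ {π} → π ∈ Cset n (twoRow n p) p → h π ≡ h πp
    dipole-sum     : ∀ la i → ℕ→ℚ (dipoleCount n p la i) ≡ ⟦ JJ N ⟧ (χ la i) πp

dipole-facts : ∀ {N n p} → suc (suc N) ≡ n → 1 ≤ p → p ≤ suc N → DipoleFacts N n p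
dipole-facts {N} {p = suc q} refl _ (s≤s q≤N) = subst (λ M → DipoleFacts M (suc (suc M)) (suc q)) (m+[n∸m]≡n q≤N)
  (record { Dipoles q (N ∸ q) })

-- Standard Young tableaux of hook and near-hook shape

∈-inits⁻ : (w : List A) {u : List A} → u ∈ inits w → ∃ λ v → w ≡ u ++ v
∈-inits⁻ w (here refl) = w , refl
∈-inits⁻ (x ∷ w) (there m) with ∈-map⁻ (x ∷_) m
... | u , k , refl with ∈-inits⁻ w k
... | v , e = v , cong (x ∷_) e

∈-inits⁺ : (u v : List A) → u ∈ inits (u ++ v)
∈-inits⁺ [] v = here refl
∈-inits⁺ (x ∷ u) v = there (∈-map⁺ (x ∷_) (∈-inits⁺ u v))

count-++ : ∀ r u v → count r (u ++ v) ≡ count r u + count r v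
count-++ r [] v = refl
count-++ r (a ∷ u) v with a ≡ᵇ r
... | true = cong suc (count-++ r u v)
... | false = count-++ r u v

count-same : ∀ x → count x (x ∷ []) ≡ 1
count-same x rewrite ≡ᵇ-refl x = refl

count-diff : ∀ {r x} → r ≢ x → count r (x ∷ []) ≡ 0
count-diff ne rewrite ≡ᵇ-≢ (λ e → ne (sym e)) = refl

count-snoc-same : ∀ x w → count x (w ++ x ∷ []) ≡ suc (count x w)
count-snoc-same x w = trans (count-++ x w (x ∷ [])) (trans (cong (count x w +_) (count-same x)) (+-comm (count x w) 1))

count-snoc-diff : ∀ {r x} w → r ≢ x → count r (w ++ x ∷ []) ≡ count r w
count-snoc-diff {r} {x} w ne = trans (count-++ r w (x ∷ [])) (trans (cong (count r w +_) (count-diff ne)) (+-identityʳ (count r w)))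

count-∈ : ∀ {x w} → x ∈ w → count x w ≢ 0
count-∈ {x} {a ∷ w} (here refl) e rewrite ≡ᵇ-refl x with e
... | ()
count-∈ {x} {a ∷ w} (there m) e with a ≡ᵇ x
... | false = count-∈ m e

count-∉ : ∀ {x w} → x ∉ w → count x w ≡ 0
count-∉ {x} {[]} ne = refl
count-∉ {x} {a ∷ w} ne rewrite ≡ᵇ-≢ {a} {x} (λ e → ne (here (sym e))) = count-∉ (λ m → ne (there m))

-- The lattice condition over all splittings and all rows. Unlike the Boolean test it does not
-- mention the number of rows, so it passes to prefixes of smaller shape.
Lat : List ℕ → Set
Lat w = ∀ u v → w ≡ u ++ v → ∀ s → count (suc s) u ≤ count s u

Shape : (ℕ → ℕ) → List ℕ → Set
Shape sh w = ∀ r → count r w ≡ sh r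

lat-prefix : ∀ w x → Lat (w ++ x ∷ []) → Lat w
lat-prefix w x l u v e = l u (v ++ x ∷ []) (trans (cong (_++ x ∷ []) e) (++-assoc u v (x ∷ [])))

lat-whole : ∀ w → Lat w → ∀ s → count (suc s) w ≤ count s w
lat-whole w l = l w [] (sym (++-identityʳ w))

lat-[] : Lat []
lat-[] [] v e s = z≤n
lat-[] (x ∷ u) v () s

snoc-prefix : ∀ (w : List A) x u v → w ++ x ∷ [] ≡ u ++ v → (∃ λ v′ → w ≡ u ++ v′) ⊎ w ++ x ∷ [] ≡ u
snoc-prefix w x [] v e = inj₁ (w , refl)
snoc-prefix [] x (y ∷ []) v e = inj₂ (cong (_∷ []) (∷-injectiveˡ e))
snoc-prefix [] x (y ∷ z ∷ u) v ()
snoc-prefix (a ∷ w) x (y ∷ u) v e with ∷-injectiveˡ e | snoc-prefix w x u v (∷-injectiveʳ e)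
... | refl | inj₁ (v′ , e′) = inj₁ (v′ , cong (a ∷_) e′)
... | refl | inj₂ e′ = inj₂ (cong (a ∷_) e′)

lat-snoc : ∀ w x → Lat w → (∀ s → count (suc s) (w ++ x ∷ []) ≤ count s (w ++ x ∷ [])) → Lat (w ++ x ∷ [])
lat-snoc w x l h u v e s with snoc-prefix w x u v e
... | inj₁ (v′ , e′) = l u v′ e′ s
... | inj₂ refl = h s

row : List ℕ → ℕ → ℕ
row la r = at la r 0

row-beyond : ∀ la {r} → length la ≤ r → row la r ≡ 0
row-beyond [] le = refl
row-beyond (a ∷ la) {suc r} (s≤s le) = row-beyond la le

words-length : ∀ n r {w} → w ∈ words n r → length w ≡ n × (∀ {x} → x ∈ w → x < r)
words-length zero r (here refl) = refl , λ ()
words-length (suc n) r m with find (∈-concatMap⁻ (λ w → map (λ a → w ++ a ∷ []) (upTo r)) {xs = words n r} m)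
... | w′ , k , k′ with ∈-map⁻ (λ a → w′ ++ a ∷ []) k′ | words-length n r k
... | a , ka , refl | l , h = trans (length-++ w′) (trans (+-comm (length w′) 1) (cong suc l)) , bound
  where
  bound : ∀ {x} → x ∈ w′ ++ a ∷ [] → x < r
  bound q with ∈-++⁻ w′ q
  ... | inj₁ q′ = h q′
  ... | inj₂ (here refl) with ∈-applyUpTo⁻ (λ i → i) ka
  ...   | i , lt , refl = lt

words-complete : ∀ n r w → length w ≡ n → (∀ {x} → x ∈ w → x < r) → w ∈ words n r
words-complete zero r [] l h = here refl
words-complete (suc n) r w l h with initLast w
words-complete (suc n) r .[] () h | []
words-complete (suc n) r .(w′ ++ a ∷ []) l h | w′ ∷ʳ′ a = ∈-concatMap⁺ (λ w → map (λ a → w ++ a ∷ []) (upTo r))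
  (lose (words-complete n r w′ (suc-injective (trans (sym (trans (length-++ w′) (+-comm (length w′) 1))) l)) (λ k → h (∈-++⁺ˡ k)))
    (∈-map⁺ (λ a → w′ ++ a ∷ []) (∈-applyUpTo⁺ (λ i → i) (h (∈-++⁺ʳ w′ (here refl))))))

snoc-injective : (a b : List A) {x y : A} → a ++ x ∷ [] ≡ b ++ y ∷ [] → a ≡ b × x ≡ y
snoc-injective [] [] refl = refl , refl
snoc-injective [] (z ∷ []) ()
snoc-injective [] (z ∷ z′ ∷ b) ()
snoc-injective (w ∷ []) [] ()
snoc-injective (w ∷ w′ ∷ a) [] ()
snoc-injective (w ∷ a) (z ∷ b) e with snoc-injective a b (∷-injectiveʳ e)
... | h , h′ = cong₂ _∷_ (∷-injectiveˡ e) h , h′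

words-unique : ∀ n r → Unique (words n r)
words-unique zero r = [] ∷ []
words-unique (suc n) r = Uniqueₚ.concat⁺
  (Allₚ.map⁺ (All.tabulate (λ {w} _ → Uniqueₚ.map⁺ (λ e → proj₂ (snoc-injective w w e)) (Uniqueₚ.upTo⁺ r))))
  (AllPairsₚ.map⁺ (AllPairs.map (λ ne {_} kk → disjoint ne (proj₁ kk) (proj₂ kk)) (words-unique n r)))
  where
  disjoint : ∀ {w w′ x} → w ≢ w′ → x ∈ map (λ a → w ++ a ∷ []) (upTo r) → x ∈ map (λ a → w′ ++ a ∷ []) (upTo r) → ⊥
  disjoint {w} {w′} ne k k′ with ∈-map⁻ (λ a → w ++ a ∷ []) k | ∈-map⁻ (λ a → w′ ++ a ∷ []) k′
  ... | _ , _ , e | _ , _ , e′ = ne (proj₁ (snoc-injective w w′ (trans (sym e) e′)))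

shape-list : ∀ (f : ℕ → ℕ) la → map f (upTo (length la)) ≡ la → ∀ {r} → r < length la → f r ≡ row la r
shape-list f la e {r} lt = trans (sym (at-up f (length la) lt)) (cong (λ l → at l r 0) (trans (sym (map-applyUpTo (λ i → i) f (length la))) e))
  where
  at-up : ∀ (f : ℕ → ℕ) k {i} → i < k → at (applyUpTo f k) i 0 ≡ f i
  at-up f (suc k) {zero} lt = refl
  at-up f (suc k) {suc i} (s≤s lt) = at-up (λ j → f (suc j)) k lt

∈-SYT⁻ : ∀ n la {w} → w ∈ SYT n la → length w ≡ n × Lat w × Shape (row la) w
∈-SYT⁻ n la {w} m with ∈-filterB⁻ _ (words n (length la)) m
... | k , e with words-length n (length la) k | ∧-true {latticeOK (length la) w} e
... | l , h | e₁ , e₂ = l , lat , shape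
  where
  shape : Shape (row la) w
  shape r with r <? length la
  ... | yes lt = shape-list (λ r → count r w) la (listEq-sound e₂) lt
  ... | no nlt = trans (count-∉ (λ m → nlt (h m))) (sym (row-beyond la (≮⇒≥ nlt)))
  lat : Lat w
  lat u v q s with s <? length la
  ... | yes lt = ≤ᵇ-sound (allB-sound _ (upTo (length la)) (allB-sound _ (inits w) e₁ (subst (λ z → u ∈ inits z) (sym q) (∈-inits⁺ u v))) (∈-applyUpTo⁺ (λ i → i) lt))
  ... | no nlt = ≤-trans (≤-reflexive (count-∉ {suc s} {u} (λ m → nlt (<-trans (n<1+n s) (h (subst (suc s ∈_) (sym q) (∈-++⁺ˡ m))))))) z≤n

∈-SYT⁺ : ∀ n la {w} → length w ≡ n → Lat w → Shape (row la) w → w ∈ SYT n la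
∈-SYT⁺ n la {w} l lat shape = ∈-filterB⁺ _ (words n (length la))
  (words-complete n (length la) w l bound)
  (cong₂ _∧_ (allB-complete _ (inits w) (λ {u} k → let (v , e) = ∈-inits⁻ w k in allB-complete _ (upTo (length la)) (λ {s} _ → ≤ᵇ-complete (lat u v e s))))
    (trans (cong (λ z → listEq? z la) (trans (map-applyUpTo (λ i → i) (λ r → count r w) (length la))
      (trans (applyUpTo-cong (length la) shape) (at-applyUpTo la (λ _ → 0))))) (dec-true (≡-dec _≟_ la la) refl)))
  where
  applyUpTo-cong : ∀ {f g : ℕ → ℕ} k → (∀ i → f i ≡ g i) → applyUpTo f k ≡ applyUpTo g k
  applyUpTo-cong zero h = refl
  applyUpTo-cong (suc k) h = cong₂ _∷_ (h 0) (applyUpTo-cong k (λ i → h (suc i)))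
  bound : ∀ {x} → x ∈ w → x < length la
  bound {x} m with x <? length la
  ... | yes lt = lt
  ... | no nlt = ⊥-elim (count-∈ m (trans (shape x) (row-beyond la (≮⇒≥ nlt))))

SYT-unique : ∀ n la → Unique (SYT n la)
SYT-unique n la = filterB-unique _ (words n (length la)) (words-unique n (length la))

wd : List Bool → List ℕ
wd [] = 0 ∷ []
wd (true ∷ b) = wd b ++ 0 ∷ []
wd (false ∷ b) = wd b ++ suc (cnt false b) ∷ []

hk : ℕ → ℕ → List ℕ
hk a l = suc a ∷ replicate l 1

wd-length : ∀ b → length (wd b) ≡ suc (length b)
wd-length [] = refl
wd-length (true ∷ b) = trans (length-++ (wd b)) (trans (+-comm (length (wd b)) 1) (cong suc (wd-length b)))
wd-length (false ∷ b) = trans (length-++ (wd b)) (trans (+-comm (length (wd b)) 1) (cong suc (wd-length b)))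

ones-here : ∀ l → row (replicate (suc l) 1) l ≡ 1
ones-here zero = refl
ones-here (suc l) = ones-here l

ones-beyond : ∀ l → row (replicate l 1) l ≡ 0
ones-beyond zero = refl
ones-beyond (suc l) = ones-beyond l

ones-other : ∀ l {r} → r ≢ l → row (replicate (suc l) 1) r ≡ row (replicate l 1) r
ones-other zero {zero} ne = ⊥-elim (ne refl)
ones-other zero {suc r} ne = refl
ones-other (suc l) {zero} ne = refl
ones-other (suc l) {suc r} ne = ones-other l (λ e → ne (cong suc e))

ones-antitone : ∀ l r → row (replicate l 1) (suc r) ≤ row (replicate l 1) r
ones-antitone zero r = z≤n
ones-antitone (suc zero) zero = z≤n
ones-antitone (suc (suc l)) zero = ≤-refl
ones-antitone (suc l) (suc r) = ones-antitone l r

ones-≤1 : ∀ l r → row (replicate l 1) r ≤ 1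
ones-≤1 zero r = z≤n
ones-≤1 (suc l) zero = ≤-refl
ones-≤1 (suc l) (suc r) = ones-≤1 l r

ones-pos : ∀ l {r} → row (replicate l 1) r ≢ 0 → r < l
ones-pos zero ne = ⊥-elim (ne refl)
ones-pos (suc l) {zero} ne = s≤s z≤n
ones-pos (suc l) {suc r} ne = s≤s (ones-pos l ne)

ones-in : ∀ l {r} → r < l → row (replicate l 1) r ≡ 1
ones-in (suc l) {zero} lt = refl
ones-in (suc l) {suc r} (s≤s lt) = ones-in l lt

wd-shape : ∀ b → Shape (row (hk (cnt true b) (cnt false b))) (wd b)
wd-shape [] zero = refl
wd-shape [] (suc r) = refl
wd-shape (true ∷ b) zero = trans (count-snoc-same 0 (wd b)) (cong suc (wd-shape b 0))
wd-shape (true ∷ b) (suc r) = trans (count-snoc-diff (wd b) (λ ())) (wd-shape b (suc r))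
wd-shape (false ∷ b) zero = trans (count-snoc-diff (wd b) (λ ())) (wd-shape b 0)
wd-shape (false ∷ b) (suc r) with r ≟ cnt false b
... | yes refl = trans (count-snoc-same (suc r) (wd b)) (trans (cong suc (trans (wd-shape b (suc r)) (ones-beyond r))) (sym (ones-here r)))
... | no ne = trans (count-snoc-diff (wd b) (λ e → ne (suc-injective e))) (trans (wd-shape b (suc r)) (sym (ones-other (cnt false b) ne)))

hk-antitone : ∀ a l s → row (hk a l) (suc s) ≤ row (hk a l) s
hk-antitone a l zero = ≤-trans (ones-≤1 l 0) (s≤s z≤n)
hk-antitone a l (suc s) = ones-antitone l s

antitone-lat : ∀ {sh} w → Shape sh w → (∀ s → sh (suc s) ≤ sh s) → ∀ s → count (suc s) w ≤ count s w
antitone-lat w sh h s = subst₂ _≤_ (sym (sh (suc s))) (sym (sh s)) (h s)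

wd-lat : ∀ b → Lat (wd b)
wd-lat [] = lat-snoc [] 0 lat-[] (antitone-lat (0 ∷ []) (wd-shape []) (hk-antitone 0 0))
wd-lat (true ∷ b) = lat-snoc (wd b) 0 (wd-lat b) (antitone-lat (wd (true ∷ b)) (wd-shape (true ∷ b)) (hk-antitone _ (cnt false b)))
wd-lat (false ∷ b) = lat-snoc (wd b) _ (wd-lat b) (antitone-lat (wd (false ∷ b)) (wd-shape (false ∷ b)) (hk-antitone _ (suc (cnt false b))))

shape-[] : ∀ w → (∀ r → count r w ≡ 0) → w ≡ []
shape-[] [] h = refl
shape-[] (x ∷ w) h = ⊥-elim (count-∈ {x} {x ∷ w} (here refl) (h x))

lat-zero : ∀ w → Lat w → count 0 w ≡ 0 → ∀ r → count r w ≡ 0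
lat-zero w l e zero = e
lat-zero w l e (suc r) = n≤0⇒n≡0 (≤-trans (lat-whole w l r) (≤-reflexive (lat-zero w l e r)))

-- Remove the largest entry. A last letter 0 ends the arm. A last letter suc y has y ≤ l by the
-- shape; if y < l, its removal would empty row y + 1 while row y + 2 still has a letter, against
-- the lattice condition, so it ends the leg.
hook-complete : ∀ m w a l → length w ≡ m → Lat w → Shape (row (hk a l)) w → ∃ λ b → w ≡ wd b × cnt true b ≡ a × cnt false b ≡ l
hook-complete zero [] a l refl lat sh with sh 0
... | ()
hook-complete (suc m) w a l len lat sh with initLast w
hook-complete (suc m) .[] a l () lat sh | []
hook-complete (suc m) .(w ++ 0 ∷ []) zero l len lat sh | w ∷ʳ′ zero = [] , cong (_++ 0 ∷ []) (shape-[] w zeros) , refl , sym (legs l sh)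
  where
  zeros : ∀ r → count r w ≡ 0
  zeros = lat-zero w (lat-prefix w 0 lat) (suc-injective (trans (sym (count-snoc-same 0 w)) (sh 0)))
  legs : ∀ l → Shape (row (hk 0 l)) (w ++ 0 ∷ []) → l ≡ 0
  legs zero sh = refl
  legs (suc l) sh with trans (sym (zeros 1)) (trans (sym (count-snoc-diff {1} {0} w (λ ()))) (sh 1))
  ... | ()
hook-complete (suc m) .(w ++ 0 ∷ []) (suc a) l len lat sh | w ∷ʳ′ zero
  with hook-complete m w a l (suc-injective (trans (sym (trans (length-++ w) (+-comm (length w) 1))) len)) (lat-prefix w 0 lat) sh′
  where
  sh′ : Shape (row (hk a l)) w
  sh′ zero = suc-injective (trans (sym (count-snoc-same 0 w)) (sh 0))
  sh′ (suc r) = trans (sym (count-snoc-diff {suc r} {0} w (λ ()))) (sh (suc r))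
... | b , refl , refl , refl = true ∷ b , refl , refl , refl
hook-complete (suc m) .(w ++ suc y ∷ []) a zero len lat sh | w ∷ʳ′ suc y with trans (sym (count-snoc-same (suc y) w)) (sh (suc y))
... | ()
hook-complete (suc m) .(w ++ suc y ∷ []) a (suc l) len lat sh | w ∷ʳ′ suc y
  with y≡l | hook-complete m w a l (suc-injective (trans (sym (trans (length-++ w) (+-comm (length w) 1))) len)) (lat-prefix w (suc y) lat) sh′
  where
  y≤l : y ≤ l
  y≤l = ≤-pred (ones-pos (suc l) (λ e → 1+n≢0 (trans (sym (count-snoc-same (suc y) w)) (trans (sh (suc y)) e))))
  cy : count (suc y) w ≡ 0
  cy = suc-injective (trans (sym (count-snoc-same (suc y) w)) (trans (sh (suc y)) (ones-in (suc l) (s≤s y≤l))))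
  y≡l : y ≡ l
  y≡l with y ≟ l
  ... | yes e = e
  ... | no ne = ⊥-elim (1+n≢0 (trans (sym (ones-in (suc l) (s≤s (≤∧≢⇒< y≤l ne)))) (trans (sym (sh (suc (suc y))))
        (trans (count-snoc-diff {suc (suc y)} {suc y} w (λ e → 1+n≢n (suc-injective e))) (n≤0⇒n≡0 (≤-trans (lat-whole w (lat-prefix w (suc y) lat) (suc y)) (≤-reflexive cy)))))))
  sh′ : Shape (row (hk a l)) w
  sh′ zero = trans (sym (count-snoc-diff {0} {suc y} w (λ ()))) (sh 0)
  sh′ (suc r) with r ≟ y
  ... | yes refl = trans cy (sym (trans (cong (row (replicate l 1)) y≡l) (ones-beyond l)))
  ... | no ne = trans (sym (count-snoc-diff {suc r} {suc y} w (λ e → ne (suc-injective e)))) (trans (sh (suc r)) (ones-other l (λ e → ne (trans e (sym y≡l)))))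
... | refl | b , refl , refl , refl = false ∷ b , refl , refl , refl

bits-complete : ∀ L b → length b ≡ L → b ∈ bits L
bits-complete zero [] e = here refl
bits-complete (suc L) (true ∷ b) e = ∈-++⁺ˡ (∈-map⁺ (true ∷_) (bits-complete L b (suc-injective e)))
bits-complete (suc L) (false ∷ b) e = ∈-++⁺ʳ (map (true ∷_) (bits L)) (∈-map⁺ (false ∷_) (bits-complete L b (suc-injective e)))

bits-unique : ∀ L → Unique (bits L)
bits-unique zero = [] ∷ []
bits-unique (suc L) = Uniqueₚ.++⁺ (Uniqueₚ.map⁺ ∷-injectiveʳ (bits-unique L)) (Uniqueₚ.map⁺ ∷-injectiveʳ (bits-unique L)) clash
  where
  clash : ∀ {b} → ¬ (b ∈ map (true ∷_) (bits L) × b ∈ map (false ∷_) (bits L))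
  clash (k , k′) with ∈-map⁻ (true ∷_) k | ∈-map⁻ (false ∷_) k′
  ... | _ , _ , refl | _ , _ , ()

hookbits : ℕ → ℕ → List (List Bool)
hookbits L k = filterB (λ b → cnt false b ≡ᵇ k) (bits L)

HB : ℕ → ℕ → List (List Bool)
HB a l = hookbits (a + l) l

∈-HB⁻ : ∀ a l {b} → b ∈ HB a l → cnt true b ≡ a × cnt false b ≡ l
∈-HB⁻ a l {b} m with ∈-filterB⁻ (λ b → cnt false b ≡ᵇ l) (bits (a + l)) m
... | k , e = +-cancelʳ-≡ l (cnt true b) a (trans (cong (cnt true b +_) (sym (≡ᵇ-sound {cnt false b} e))) (trans (cnt-total b) (bits-length (a + l) k)))
  , ≡ᵇ-sound e

∈-HB⁺ : ∀ {a l b} → cnt true b ≡ a → cnt false b ≡ l → b ∈ HB a l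
∈-HB⁺ {b = b} refl refl = ∈-filterB⁺ (λ b′ → cnt false b′ ≡ᵇ cnt false b) (bits (cnt true b + cnt false b))
  (bits-complete (cnt true b + cnt false b) b (sym (cnt-total b))) (≡ᵇ-refl (cnt false b))

HB-unique : ∀ a l → Unique (HB a l)
HB-unique a l = filterB-unique _ (bits (a + l)) (bits-unique (a + l))

wd-nonempty : ∀ b → wd b ≢ []
wd-nonempty b e with trans (sym (wd-length b)) (cong length e)
... | ()

wd-injective : ∀ b b′ → wd b ≡ wd b′ → b ≡ b′
wd-injective [] [] e = refl
wd-injective [] (true ∷ b′) e = ⊥-elim (wd-nonempty b′ (sym (proj₁ (snoc-injective [] (wd b′) e))))
wd-injective [] (false ∷ b′) e = ⊥-elim (wd-nonempty b′ (sym (proj₁ (snoc-injective [] (wd b′) e))))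
wd-injective (true ∷ b) [] e = ⊥-elim (wd-nonempty b (proj₁ (snoc-injective (wd b) [] e)))
wd-injective (false ∷ b) [] e = ⊥-elim (wd-nonempty b (proj₁ (snoc-injective (wd b) [] e)))
wd-injective (true ∷ b) (true ∷ b′) e = cong (true ∷_) (wd-injective b b′ (proj₁ (snoc-injective (wd b) (wd b′) e)))
wd-injective (false ∷ b) (false ∷ b′) e = cong (false ∷_) (wd-injective b b′ (proj₁ (snoc-injective (wd b) (wd b′) e)))
wd-injective (true ∷ b) (false ∷ b′) e with proj₂ (snoc-injective (wd b) (wd b′) e)
... | ()
wd-injective (false ∷ b) (true ∷ b′) e with proj₂ (snoc-injective (wd b) (wd b′) e)
... | ()

map-unique-set : (f : List Bool → List ℕ) → (∀ {b b′} → f b ≡ f b′ → b ≡ b′) → ∀ {bs ws} → Unique bs → Unique ws →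
  (∀ {b} → b ∈ bs → f b ∈ ws) → (∀ {w} → w ∈ ws → ∃ λ b → b ∈ bs × w ≡ f b) → ws ↭ map f bs
map-unique-set f inj ub uw h h′ = unique-set-↭ uw (Uniqueₚ.map⁺ inj ub)
  (λ m → let (b , k , e) = h′ m in subst (_∈ map f _) (sym e) (∈-map⁺ f k))
  (λ m → let (b , k , e) = ∈-map⁻ f m in subst (_∈ _) (sym e) (h k))

hook-hk : ∀ a l → hook (suc (a + l)) l ≡ hk a l
hook-hk a l = cong (_∷ replicate l 1) (m+n∸n≡m (suc a) l)

wd-SYT : ∀ {a l} b → cnt true b ≡ a → cnt false b ≡ l → wd b ∈ SYT (suc (a + l)) (hk a l)
wd-SYT b refl refl = ∈-SYT⁺ (suc (cnt true b + cnt false b)) (hk (cnt true b) (cnt false b)) (trans (wd-length b) (cong suc (sym (cnt-total b)))) (wd-lat b) (wd-shape b)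

SYT-hook : ∀ a l → SYT (suc (a + l)) (hk a l) ↭ map wd (HB a l)
SYT-hook a l = map-unique-set wd (λ {b} {b′} → wd-injective b b′) (HB-unique a l) (SYT-unique (suc (a + l)) (hk a l))
  (λ {b} m → let (ea , el) = ∈-HB⁻ a l m in wd-SYT b ea el)
  (λ {w} m → let (len , lat , sh) = ∈-SYT⁻ (suc (a + l)) (hk a l) m
                 (b , e , ea , el) = hook-complete (suc (a + l)) w a l len lat sh in b , ∈-HB⁺ ea el , e)

lastRow-snoc : ∀ w x → lastRow (w ++ x ∷ []) ≡ x
lastRow-snoc w x = trans (cong (λ k → at (w ++ x ∷ []) k 0) (cong (_∸ 1) (trans (length-++ w) (+-comm (length w) 1)))) (at-end w)
  where
  at-end : ∀ w → at (w ++ x ∷ []) (length w) 0 ≡ x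
  at-end [] = refl
  at-end (y ∷ w) = at-end w

∈-SYTi⁺ : ∀ n la i {w x} → w ++ x ∷ [] ∈ SYT n la → row la x ≡ i → w ++ x ∷ [] ∈ SYTi n la i
∈-SYTi⁺ n la i {w} {x} m e = ∈-filterB⁺ (λ w → at la (lastRow w) 0 ≡ᵇ i) (SYT n la) m
  (trans (cong (_≡ᵇ i) (trans (cong (row la) (lastRow-snoc w x)) e)) (≡ᵇ-refl i))

∈-SYTi⁻ : ∀ n la i {w x} → w ++ x ∷ [] ∈ SYTi n la i → row la x ≡ i
∈-SYTi⁻ n la i {w} {x} m = trans (cong (row la) (sym (lastRow-snoc w x))) (≡ᵇ-sound (proj₂ (∈-filterB⁻ (λ w → at la (lastRow w) 0 ≡ᵇ i) (SYT n la) m)))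

∈-SYTi-lat : ∀ n la i {w} → w ∈ SYTi n la i → Lat w × Shape (row la) w
∈-SYTi-lat n la i m = proj₂ (∈-SYT⁻ n la (proj₁ (∈-filterB⁻ (λ w → at la (lastRow w) 0 ≡ᵇ i) (SYT n la) m)))

SYTi-unique : ∀ n la i → Unique (SYTi n la i)
SYTi-unique n la i = filterB-unique (λ w → at la (lastRow w) 0 ≡ᵇ i) (SYT n la) (SYT-unique n la)

SYTi-arm : ∀ a l → SYTi (suc (suc (a + l))) (hk (suc a) l) (suc (suc a)) ↭ map (λ b → wd (true ∷ b)) (HB a l)
SYTi-arm a l = map-unique-set (λ b → wd (true ∷ b)) (λ {b} {b′} e → ∷-injectiveʳ (wd-injective (true ∷ b) (true ∷ b′) e)) (HB-unique a l) (SYTi-unique n la i)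
  (λ {b} m → let (ea , el) = ∈-HB⁻ a l m in ∈-SYTi⁺ n la i {wd b} (wd-SYT (true ∷ b) (cong suc ea) el) refl)
  (λ {w} m → let (lat , sh) = ∈-SYTi-lat n la i m in from m (hook-complete (length w) w (suc a) l refl lat sh))
  where
  n i : ℕ
  n = suc (suc (a + l))
  i = suc (suc a)
  la : List ℕ
  la = hk (suc a) l
  from : ∀ {w} → w ∈ SYTi n la i → (∃ λ b → w ≡ wd b × cnt true b ≡ suc a × cnt false b ≡ l) → ∃ λ b → b ∈ HB a l × w ≡ wd (true ∷ b)
  from m ([] , e , () , el)
  from m (true ∷ b , e , ea , el) = b , ∈-HB⁺ (suc-injective ea) el , e
  from m (false ∷ b , refl , ea , refl) with trans (sym (∈-SYTi⁻ n la i {wd b} m)) (ones-here (cnt false b))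
  ... | ()

SYTi-leg : ∀ a l → SYTi (suc (suc (a + l))) (hk a (suc l)) 1 ↭ map (λ b → wd (false ∷ b)) (HB a l)
SYTi-leg a l = map-unique-set (λ b → wd (false ∷ b)) (λ {b} {b′} e → ∷-injectiveʳ (wd-injective (false ∷ b) (false ∷ b′) e)) (HB-unique a l) (SYTi-unique n la 1)
  (λ {b} m → let (ea , el) = ∈-HB⁻ a l m in ∈-SYTi⁺ n la 1 {wd b} (subst (λ k → wd (false ∷ b) ∈ SYT (suc k) la) (+-suc a l) (wd-SYT (false ∷ b) ea (cong suc el)))
     (trans (cong (row (replicate (suc l) 1)) el) (ones-here l)))
  (λ {w} m → let (lat , sh) = ∈-SYTi-lat n la 1 m in from m (hook-complete (length w) w a (suc l) refl lat sh))
  where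
  n : ℕ
  n = suc (suc (a + l))
  la : List ℕ
  la = hk a (suc l)
  from : ∀ {w} → w ∈ SYTi n la 1 → (∃ λ b → w ≡ wd b × cnt true b ≡ a × cnt false b ≡ suc l) → ∃ λ b → b ∈ HB a l × w ≡ wd (false ∷ b)
  from m ([] , e , ea , ())
  from m (false ∷ b , e , ea , el) = b , ∈-HB⁺ ea (suc-injective el) , e
  from m (true ∷ b , refl , refl , el) with ∈-SYTi⁻ n la 1 {wd b} m
  ... | ()

-- Near-hook tableaux

nr : ℕ → ℕ → List ℕ
nr a l = suc (suc a) ∷ 2 ∷ replicate l 1

near-nr : ∀ a l → near (suc (suc (suc a + suc l))) (suc l) ≡ nr a l
near-nr a l = cong (λ k → k ∷ 2 ∷ replicate l 1) (cong (_∸ 1) (trans (cong (_∸ l) (cong suc (cong suc (+-suc a l)))) (m+n∸n≡m (3 + a) l)))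

inn : List Bool → List ℕ
inn b = wd b ++ 1 ∷ []

nr-antitone : ∀ a l s → row (nr a l) (suc s) ≤ row (nr a l) s
nr-antitone a l zero = s≤s (s≤s z≤n)
nr-antitone a l (suc zero) = ≤-trans (ones-≤1 l 0) (s≤s z≤n)
nr-antitone a l (suc (suc s)) = ones-antitone l s

inn-shape : ∀ {a l} b → cnt true b ≡ suc a → cnt false b ≡ suc l → Shape (row (nr a l)) (inn b)
inn-shape {a} {l} b ea el r with subst₂ (λ x y → Shape (row (hk x y)) (wd b)) ea el (wd-shape b)
inn-shape b ea el zero | sh = trans (count-snoc-diff (wd b) (λ ())) (sh 0)
inn-shape b ea el (suc zero) | sh = trans (count-snoc-same 1 (wd b)) (cong suc (sh 1))
inn-shape b ea el (suc (suc r)) | sh = trans (count-snoc-diff (wd b) (λ ())) (sh (suc (suc r)))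

inn-length : ∀ {a l} b → cnt true b ≡ a → cnt false b ≡ l → length (inn b) ≡ suc (suc (a + l))
inn-length b refl refl = trans (length-++ (wd b)) (trans (+-comm (length (wd b)) 1) (cong suc (trans (wd-length b) (cong suc (sym (cnt-total b))))))

near-tab : ∀ a l w x → Lat w → length (w ++ x ∷ []) ≡ suc (suc (suc a + suc l)) → Shape (row (nr a l)) (w ++ x ∷ []) → w ++ x ∷ [] ∈ SYT (suc (suc (suc a + suc l))) (nr a l)
near-tab a l w x lat len sh = ∈-SYT⁺ (suc (suc (suc a + suc l))) (nr a l) len (lat-snoc w x lat (antitone-lat (w ++ x ∷ []) sh (nr-antitone a l))) sh

inn-SYT : ∀ {a l} b → cnt true b ≡ suc a → cnt false b ≡ suc l → inn b ∈ SYT (suc (suc (suc a + suc l))) (nr a l)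
inn-SYT {a} {l} b ea el = near-tab a l (wd b) 1 (wd-lat b) (inn-length b ea el) (inn-shape b ea el)

inn-injective : ∀ {b b′} → inn b ≡ inn b′ → b ≡ b′
inn-injective {b} {b′} e = wd-injective b b′ (proj₁ (snoc-injective (wd b) (wd b′) e))

near-inner : ∀ a l w → Lat (w ++ 1 ∷ []) → Shape (row (nr a l)) (w ++ 1 ∷ []) → ∃ λ b → b ∈ HB (suc a) (suc l) × w ++ 1 ∷ [] ≡ inn b
near-inner a l w lat sh with hook-complete (length w) w (suc a) (suc l) refl (lat-prefix w 1 lat) sh′
  where
  sh′ : Shape (row (hk (suc a) (suc l))) w
  sh′ zero = trans (sym (count-snoc-diff {0} {1} w (λ ()))) (sh 0)
  sh′ (suc zero) = suc-injective (trans (sym (count-snoc-same 1 w)) (sh 1))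
  sh′ (suc (suc r)) = trans (sym (count-snoc-diff {suc (suc r)} {1} w (λ ()))) (sh (suc (suc r)))
... | b , e , ea , el = b , ∈-HB⁺ ea el , cong (_++ 1 ∷ []) e

-- In the shape (2, 2, 1^l) both long rows have length 2, so the row length alone does not place n
-- in the second row. Removing n from the first would leave a row of 1 above a row of 2.
near-arm≢ : ∀ l w → Lat (w ++ 0 ∷ []) → Shape (row (nr 0 l)) (w ++ 0 ∷ []) → ⊥
near-arm≢ l w lat sh = 1+n≰n (≤-trans (≤-reflexive (sym (trans (sym (count-snoc-diff {1} {0} w (λ ()))) (sh 1))))
  (≤-trans (lat-whole w (lat-prefix w 0 lat) 0) (≤-reflexive (suc-injective (trans (sym (count-snoc-same 0 w)) (sh 0))))))

SYTi-inner : ∀ a l → SYTi (suc (suc (suc a + suc l))) (nr a l) 2 ↭ map inn (HB (suc a) (suc l))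
SYTi-inner a l = map-unique-set inn inn-injective (HB-unique (suc a) (suc l)) (SYTi-unique n (nr a l) 2)
  (λ {b} m → let (ea , el) = ∈-HB⁻ (suc a) (suc l) m in ∈-SYTi⁺ n (nr a l) 2 {wd b} (inn-SYT b ea el) refl)
  (λ {w} m → let (lat , sh) = ∈-SYTi-lat n (nr a l) 2 m in from w m lat sh)
  where
  n : ℕ
  n = suc (suc (suc a + suc l))
  from : ∀ w → w ∈ SYTi n (nr a l) 2 → Lat w → Shape (row (nr a l)) w → ∃ λ b → b ∈ HB (suc a) (suc l) × w ≡ inn b
  from w m lat sh with initLast w
  from .[] m lat sh | [] with sh 0
  ... | ()
  from .(w ++ 1 ∷ []) m lat sh | w ∷ʳ′ suc zero = near-inner a l w lat sh
  from .(w ++ 0 ∷ []) m lat sh | w ∷ʳ′ zero with ∈-SYTi⁻ n (nr a l) 2 {w} m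
  ... | refl = ⊥-elim (near-arm≢ l w lat sh)
  from .(w ++ suc (suc y) ∷ []) m lat sh | w ∷ʳ′ suc (suc y) = ⊥-elim (1+n≰n (subst (_≤ 1) (∈-SYTi⁻ n (nr a l) 2 {w} m) (ones-≤1 l y)))

-- The branching rule for (a+2, 2, 1^l): the largest entry is the inner corner, leaving a hook, or
-- ends the first row, or ends the leg. For a = 0 the first row, and for l = 0 the leg, has no
-- removable box.
NR NR-arm NR-leg : ℕ → ℕ → List (List ℕ)
NR a l = map inn (HB (suc a) (suc l)) ++ NR-arm a l ++ NR-leg a l
NR-arm zero l = []
NR-arm (suc a) l = map (_++ 0 ∷ []) (NR a l)
NR-leg a zero = []
NR-leg a (suc l) = map (_++ suc (suc l) ∷ []) (NR a l)

NR-shape : ∀ a l {w} → w ∈ NR a l → Lat w × length w ≡ suc (suc (suc a + suc l)) × Shape (row (nr a l)) w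
NR-shape a l {w} m with ∈-++⁻ (map inn (HB (suc a) (suc l))) m
... | inj₁ k with ∈-map⁻ inn k
...   | b , kb , refl with ∈-HB⁻ (suc a) (suc l) kb
...     | ea , el = lat-snoc (wd b) 1 (wd-lat b) (antitone-lat (inn b) (inn-shape b ea el) (nr-antitone a l)) , inn-length b ea el , inn-shape b ea el
NR-shape a l {w} m | inj₂ k with ∈-++⁻ (NR-arm a l) k
NR-shape (suc a) l m | inj₂ _ | inj₁ k with ∈-map⁻ (_++ 0 ∷ []) k
... | w , kw , refl with NR-shape a l kw
...   | lat , len , sh = lat-snoc w 0 lat (antitone-lat (w ++ 0 ∷ []) sh′ (nr-antitone (suc a) l)) , trans (length-++ w) (trans (+-comm (length w) 1) (cong suc len)) , sh′
  where
  sh′ : Shape (row (nr (suc a) l)) (w ++ 0 ∷ [])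
  sh′ zero = trans (count-snoc-same 0 w) (cong suc (sh 0))
  sh′ (suc r) = trans (count-snoc-diff w (λ ())) (sh (suc r))
NR-shape a (suc l) m | inj₂ _ | inj₂ k with ∈-map⁻ (_++ suc (suc l) ∷ []) k
... | w , kw , refl with NR-shape a l kw
...   | lat , len , sh = lat-snoc w (suc (suc l)) lat (antitone-lat (w ++ suc (suc l) ∷ []) sh′ (nr-antitone a (suc l)))
        , trans (length-++ w) (trans (+-comm (length w) 1) (trans (cong suc len) (cong (λ z → suc (suc z)) (sym (+-suc (suc a) (suc l)))))) , sh′
  where
  sh′ : Shape (row (nr a (suc l))) (w ++ suc (suc l) ∷ [])
  sh′ zero = trans (count-snoc-diff w (λ ())) (sh 0)
  sh′ (suc zero) = trans (count-snoc-diff w (λ ())) (sh 1)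
  sh′ (suc (suc r)) with r ≟ l
  ... | yes refl = trans (count-snoc-same (suc (suc r)) w) (trans (cong suc (trans (sh (suc (suc r))) (ones-beyond r))) (sym (ones-here r)))
  ... | no ne = trans (count-snoc-diff w (λ e → ne (suc-injective (suc-injective e)))) (trans (sh (suc (suc r))) (sym (ones-other l ne)))

NR-complete : ∀ m a l w → length w ≡ m → Lat w → Shape (row (nr a l)) w → w ∈ NR a l
NR-complete zero a l [] refl lat sh with sh 0
... | ()
NR-complete (suc m) a l w len lat sh with initLast w
NR-complete (suc m) a l .[] () lat sh | []
NR-complete (suc m) a l .(w ++ 1 ∷ []) len lat sh | w ∷ʳ′ suc zero with near-inner a l w lat sh
... | b , kb , e = ∈-++⁺ˡ (subst (_∈ map inn (HB (suc a) (suc l))) (sym e) (∈-map⁺ inn kb))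
NR-complete (suc m) zero l .(w ++ 0 ∷ []) len lat sh | w ∷ʳ′ zero = ⊥-elim (near-arm≢ l w lat sh)
NR-complete (suc m) (suc a) l .(w ++ 0 ∷ []) len lat sh | w ∷ʳ′ zero =
  ∈-++⁺ʳ (map inn (HB (suc (suc a)) (suc l))) (∈-++⁺ˡ (∈-map⁺ (_++ 0 ∷ []) (NR-complete m a l w
    (suc-injective (trans (sym (trans (length-++ w) (+-comm (length w) 1))) len)) (lat-prefix w 0 lat) sh′)))
  where
  sh′ : Shape (row (nr a l)) w
  sh′ zero = suc-injective (trans (sym (count-snoc-same 0 w)) (sh 0))
  sh′ (suc r) = trans (sym (count-snoc-diff {suc r} {0} w (λ ()))) (sh (suc r))
NR-complete (suc m) a zero .(w ++ suc (suc y) ∷ []) len lat sh | w ∷ʳ′ suc (suc y) with trans (sym (count-snoc-same (suc (suc y)) w)) (sh (suc (suc y)))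
... | ()
NR-complete (suc m) a (suc l) .(w ++ suc (suc y) ∷ []) len lat sh | w ∷ʳ′ suc (suc y) =
  ∈-++⁺ʳ (map inn (HB (suc a) (suc (suc l)))) (∈-++⁺ʳ (NR-arm a (suc l))
    (subst (λ z → w ++ suc (suc z) ∷ [] ∈ map (_++ suc (suc l) ∷ []) (NR a l)) (sym y≡l) (∈-map⁺ (_++ suc (suc l) ∷ []) (NR-complete m a l w
      (suc-injective (trans (sym (trans (length-++ w) (+-comm (length w) 1))) len)) (lat-prefix w (suc (suc y)) lat) sh′))))
  where
  Y = suc (suc y)
  y≤l : y ≤ l
  y≤l = ≤-pred (ones-pos (suc l) (λ e → 1+n≢0 (trans (sym (count-snoc-same Y w)) (trans (sh Y) e))))
  cy : count Y w ≡ 0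
  cy = suc-injective (trans (sym (count-snoc-same Y w)) (trans (sh Y) (ones-in (suc l) (s≤s y≤l))))
  y≡l : y ≡ l
  y≡l with y ≟ l
  ... | yes e = e
  ... | no ne = ⊥-elim (1+n≢0 (trans (sym (ones-in (suc l) (s≤s (≤∧≢⇒< y≤l ne)))) (trans (sym (sh (suc Y)))
        (trans (count-snoc-diff {suc Y} {Y} w 1+n≢n) (n≤0⇒n≡0 (≤-trans (lat-whole w (lat-prefix w Y lat) Y) (≤-reflexive cy)))))))
  sh′ : Shape (row (nr a l)) w
  sh′ zero = trans (sym (count-snoc-diff {0} {Y} w (λ ()))) (sh 0)
  sh′ (suc zero) = trans (sym (count-snoc-diff {1} {Y} w (λ ()))) (sh 1)
  sh′ (suc (suc r)) with r ≟ y
  ... | yes refl = trans cy (sym (trans (cong (row (replicate l 1)) y≡l) (ones-beyond l)))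
  ... | no ne = trans (sym (count-snoc-diff {suc (suc r)} {Y} w (λ e → ne (suc-injective (suc-injective e))))) (trans (sh (suc (suc r))) (ones-other l (λ e → ne (trans e (sym y≡l)))))

NR-unique : ∀ a l → Unique (NR a l)
NR-unique a l = Uniqueₚ.++⁺ (Uniqueₚ.map⁺ inn-injective (HB-unique (suc a) (suc l))) (Uniqueₚ.++⁺ (arm-unique a l) (leg-unique a l) clash₂) clash₁
  where
  arm-unique : ∀ a l → Unique (NR-arm a l)
  arm-unique zero l = []
  arm-unique (suc a) l = Uniqueₚ.map⁺ (λ {x} {y} e → proj₁ (snoc-injective x y e)) (NR-unique a l)
  leg-unique : ∀ a l → Unique (NR-leg a l)
  leg-unique a zero = []
  leg-unique a (suc l) = Uniqueₚ.map⁺ (λ {x} {y} e → proj₁ (snoc-injective x y e)) (NR-unique a l)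
  arm-last : ∀ a l {w} → w ∈ NR-arm a l → ∃ λ w′ → w ≡ w′ ++ 0 ∷ []
  arm-last (suc a) l m = let (w′ , _ , e) = ∈-map⁻ (_++ 0 ∷ []) m in w′ , e
  leg-last : ∀ a l {w} → w ∈ NR-leg a l → ∃₂ λ w′ y → w ≡ w′ ++ suc (suc y) ∷ []
  leg-last a (suc l) m = let (w′ , _ , e) = ∈-map⁻ (_++ suc (suc l) ∷ []) m in w′ , l , e
  clash₂ : ∀ {w} → ¬ (w ∈ NR-arm a l × w ∈ NR-leg a l)
  clash₂ (k , k′) with arm-last a l k | leg-last a l k′
  ... | w′ , refl | w″ , y , e with proj₂ (snoc-injective w′ w″ e)
  ... | ()
  clash₁ : ∀ {w} → ¬ (w ∈ map inn (HB (suc a) (suc l)) × w ∈ NR-arm a l ++ NR-leg a l)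
  clash₁ (k , k′) with ∈-map⁻ inn k | ∈-++⁻ (NR-arm a l) k′
  clash₁ (k , k′) | b , _ , refl | inj₁ q with arm-last a l q
  ... | w′ , e with proj₂ (snoc-injective (wd b) w′ e)
  ... | ()
  clash₁ (k , k′) | b , _ , refl | inj₂ q with leg-last a l q
  ... | w′ , y , e with proj₂ (snoc-injective (wd b) w′ e)
  ... | ()

dim-near : ∀ a l → dim (suc (suc (suc a + suc l))) (nr a l) ≡ length (NR a l)
dim-near a l = ↭-length (unique-set-↭ (SYT-unique n (nr a l)) (NR-unique a l)
  (λ {w} m → let (len , lat , sh) = ∈-SYT⁻ n (nr a l) m in NR-complete n a l w len lat sh)
  (λ m → let (lat , len , sh) = NR-shape a l m in ∈-SYT⁺ n (nr a l) len lat sh))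
  where
  n : ℕ
  n = suc (suc (suc a + suc l))

dim-hook : ∀ a l → dim (suc (a + l)) (hk a l) ≡ length (HB a l)
dim-hook a l = trans (↭-length (SYT-hook a l)) (length-map wd (HB a l))

-- Counting hook and near-hook tableaux

filterB-++ : (p : A → Bool) (xs ys : List A) → filterB p (xs ++ ys) ≡ filterB p xs ++ filterB p ys
filterB-++ p [] ys = refl
filterB-++ p (x ∷ xs) ys with p x
... | true = cong (x ∷_) (filterB-++ p xs ys)
... | false = filterB-++ p xs ys

filterB-map-length : (p : B → Bool) (f : A → B) (xs : List A) → length (filterB p (map f xs)) ≡ length (filterB (λ x → p (f x)) xs)
filterB-map-length p f [] = refl
filterB-map-length p f (x ∷ xs) with p (f x)
... | true = cong suc (filterB-map-length p f xs)
... | false = filterB-map-length p f xs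

filterB-none : (xs : List A) → filterB (λ _ → false) xs ≡ []
filterB-none [] = refl
filterB-none (x ∷ xs) = filterB-none xs

hookbits-suc : ∀ L k → length (hookbits (suc L) (suc k)) ≡ length (hookbits L (suc k)) + length (hookbits L k)
hookbits-suc L k = trans (cong length (filterB-++ _ (map (true ∷_) (bits L)) (map (false ∷_) (bits L))))
  (trans (length-++ (filterB _ (map (true ∷_) (bits L)))) (cong₂ _+_ (filterB-map-length _ (true ∷_) (bits L)) (filterB-map-length _ (false ∷_) (bits L))))

hookbits-zero : ∀ L → length (hookbits L 0) ≡ 1
hookbits-zero zero = refl
hookbits-zero (suc L) = trans (cong length (filterB-++ _ (map (true ∷_) (bits L)) (map (false ∷_) (bits L))))
  (trans (length-++ (filterB _ (map (true ∷_) (bits L)))) (trans (cong₂ _+_ (trans (filterB-map-length _ (true ∷_) (bits L)) (hookbits-zero L))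
    (trans (filterB-map-length _ (false ∷_) (bits L)) (cong length (filterB-none (bits L))))) refl))

hookbits-beyond : ∀ L j → length (hookbits L (suc (j + L))) ≡ 0
hookbits-beyond zero j = refl
hookbits-beyond (suc L) j = trans (hookbits-suc L (j + suc L)) (cong₂ _+_
  (trans (cong (λ z → length (hookbits L (suc z))) (+-suc j L)) (hookbits-beyond L (suc j)))
  (trans (cong (λ z → length (hookbits L z)) (+-suc j L)) (hookbits-beyond L j)))

module _ where
  open ℕSolver.+-*-Solver using (solve; _:=_; _:+_; _:*_; con)

  hook-count : ∀ a l → length (HB a l) * (a ! * l !) ≡ (a + l) !
  hook-count zero zero = refl
  hook-count (suc a) zero = trans (cong₂ _*_ (hookbits-zero (suc a + 0)) (*-identityʳ (suc a !))) (trans (*-identityˡ (suc a !)) (cong (λ z → suc z !) (sym (+-identityʳ a))))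
  hook-count zero (suc l) = trans (cong (_* (1 * suc l !)) (trans (hookbits-suc l l) (cong (_+ length (hookbits l l)) (hookbits-beyond l 0))))
    (trans (solve 3 (λ h s f → h :* (con 1 :* (s :* f)) := s :* (h :* (con 1 :* f))) refl (length (hookbits l l)) (suc l) (l !)) (cong (suc l *_) (hook-count zero l)))
  hook-count (suc a) (suc l) = trans (cong (_* (suc a ! * suc l !)) (hookbits-suc (a + suc l) l))
    (trans (solve 6 (λ h₁ h₂ A L f g → (h₁ :+ h₂) :* ((A :* f) :* (L :* g)) := A :* (h₁ :* (f :* (L :* g))) :+ L :* (h₂ :* ((A :* f) :* g))) refl
        (length (hookbits (a + suc l) (suc l))) (length (hookbits (a + suc l) l)) (suc a) (suc l) (a !) (l !))
    (trans (cong₂ (λ x y → suc a * x + suc l * y) (hook-count a (suc l))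
        (trans (cong (λ z → length (hookbits z l) * (suc a ! * l !)) (+-suc a l)) (trans (hook-count (suc a) l) (cong _! (sym (+-suc a l))))))
    (sym (*-distribʳ-+ ((a + suc l) !) (suc a) (suc l)))))

  -- The hook length formula with denominators cleared, from the branching rule. The formulas for
  -- `arm` and `leg` carry the factors a and l, so the empty families at a = 0 and l = 0 obey them
  -- too.
  near-count : ∀ a l → length (NR a l) * (suc (suc a) ! * suc (suc l) !) ≡ suc (suc (suc a + suc l)) * (suc a * suc l) * (suc a + suc l) !
  near-count a l = trans (cong (_* (suc (suc a) ! * suc (suc l) !)) (trans (length-++ (map inn (HB (suc a) (suc l))))
        (cong₂ _+_ (length-map inn (HB (suc a) (suc l))) (length-++ (NR-arm a l)))))
    (trans (*-distribʳ-+ F (length (HB (suc a) (suc l))) (length (NR-arm a l) + length (NR-leg a l)))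
    (trans (cong₂ _+_ inner (trans (*-distribʳ-+ F (length (NR-arm a l)) (length (NR-leg a l))) (cong₂ _+_ (arm a) (leg l))))
    (solve 3 (λ a l G → (con 1 :+ a :+ (con 1 :+ l)) :* G :* ((con 2 :+ a) :* (con 2 :+ l))
         :+ ((con 2 :+ a) :* ((con 3 :+ a :+ l) :* (a :* (con 1 :+ l)) :* G) :+ (con 2 :+ l) :* ((con 3 :+ a :+ l) :* ((con 1 :+ a) :* l) :* G))
        := (con 2 :+ (con 1 :+ a :+ (con 1 :+ l))) :* ((con 1 :+ a) :* (con 1 :+ l)) :* ((con 1 :+ a :+ (con 1 :+ l)) :* G)) refl a l G)))
    where
    F = suc (suc a) ! * suc (suc l) !
    G = (a + suc l) !
    inner : length (HB (suc a) (suc l)) * F ≡ (suc a + suc l) * G * (suc (suc a) * suc (suc l))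
    inner = trans (solve 5 (λ h A L f g → h :* ((A :* f) :* (L :* g)) := (h :* (f :* g)) :* (A :* L)) refl
        (length (HB (suc a) (suc l))) (suc (suc a)) (suc (suc l)) (suc a !) (suc l !)) (cong (_* (suc (suc a) * suc (suc l))) (hook-count (suc a) (suc l)))
    arm : ∀ a → length (NR-arm a l) * (suc (suc a) ! * suc (suc l) !) ≡ suc (suc a) * ((3 + a + l) * (a * suc l) * (a + suc l) !)
    arm zero = sym (trans (cong (2 *_) (cong (_* suc l !) (*-zeroʳ (3 + l)))) (*-zeroʳ 2))
    arm (suc a) = trans (cong (_* (suc (suc (suc a)) ! * suc (suc l) !)) (length-map (_++ 0 ∷ []) (NR a l)))
      (trans (solve 4 (λ h A f g → h :* ((A :* f) :* g) := A :* (h :* (f :* g))) refl (length (NR a l)) (3 + a) (suc (suc a) !) (suc (suc l) !))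
      (cong (suc (suc (suc a)) *_) (trans (near-count a l) (cong (λ z → suc (suc z) * (suc a * suc l) * (suc a + suc l) !) (cong suc (+-suc a l))))))
    leg : ∀ l → length (NR-leg a l) * (suc (suc a) ! * suc (suc l) !) ≡ suc (suc l) * ((3 + a + l) * (suc a * l) * (a + suc l) !)
    leg zero = sym (trans (cong (λ z → 2 * ((3 + a + 0) * z * (a + 1) !)) (*-zeroʳ (suc a))) (trans (cong (λ z → 2 * (z * (a + 1) !)) (*-zeroʳ (3 + a + 0))) refl))
    leg (suc l) = trans (cong (_* (suc (suc a) ! * suc (suc (suc l)) !)) (length-map (_++ suc (suc l) ∷ []) (NR a l)))
      (trans (solve 4 (λ h f L g → h :* (f :* (L :* g)) := L :* (h :* (f :* g))) refl (length (NR a l)) (suc (suc a) !) (3 + l) (suc (suc l) !))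
      (cong (suc (suc (suc l)) *_) (trans (near-count a l) (cong (λ z → suc (suc (suc a + suc l)) * (suc a * suc l) * z !) (sym (+-suc a (suc l)))))))

-- n = m + 1 = N + 2; keeping m and n as variables stops Agda from unfolding
-- SYT n and Sym n in conversion checks.
record FamilyFacts (N m n : ℕ) : Set where
  field
    arm-family     : ∀ {k} → k ≤ N → SYTi n (hook n k) (n ∸ k) ↭ map (λ b → wd (true ∷ b)) (hookbits N k)
    leg-family     : ∀ {k} → k ≤ N → SYTi n (hook n (suc k)) 1 ↭ map (λ b → wd (false ∷ b)) (hookbits N k)
    inner-family   : ∀ {k} → 1 ≤ k → k < N → SYTi n (near n k) 2 ↭ map inn (hookbits N k)
    dim-sub        : ∀ {k} → k ≤ N → dim m (hook m k) * ((N ∸ k) ! * k !) ≡ N !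
    dim-sub-length : ∀ {k} → k ≤ N → dim m (hook m k) ≡ length (hookbits N k)
    dim-arm        : ∀ {k} → k ≤ N → dim n (hook n k) * (suc (N ∸ k) ! * k !) ≡ m !
    dim-leg        : ∀ {k} → k ≤ N → dim n (hook n (suc k)) * ((N ∸ k) ! * suc k !) ≡ m !
    dim-inner      : ∀ {k} → 1 ≤ k → k < N → dim n (near n k) * (suc (N ∸ k) ! * suc k !) ≡ n * ((N ∸ k) * k) * N !

∈-hookbits⁻ : ∀ {N k b} → k ≤ N → b ∈ hookbits N k → cnt true b ≡ N ∸ k × cnt false b ≡ k
∈-hookbits⁻ {N} {k} {b} le m = ∈-HB⁻ (N ∸ k) k (subst (λ L → b ∈ hookbits L k) (sym (m∸n+n≡m le)) m)

module Families (N : ℕ) where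

  arm-family : ∀ {k} → k ≤ N → SYTi (2 + N) (hook (2 + N) k) (2 + N ∸ k) ↭ map (λ b → wd (true ∷ b)) (hookbits N k)
  arm-family {k} le = subst (λ M → SYTi (2 + M) (hook (2 + M) k) (2 + M ∸ k) ↭ map (λ b → wd (true ∷ b)) (hookbits M k)) (m∸n+n≡m le)
    (subst₂ (λ h i → SYTi (2 + (a + k)) h i ↭ map (λ b → wd (true ∷ b)) (HB a k)) (sym (hook-hk (suc a) k)) (sym (m+n∸n≡m (2 + a) k)) (SYTi-arm a k))
    where a = N ∸ k

  leg-family : ∀ {k} → k ≤ N → SYTi (2 + N) (hook (2 + N) (suc k)) 1 ↭ map (λ b → wd (false ∷ b)) (hookbits N k)
  leg-family {k} le = subst (λ M → SYTi (2 + M) (hook (2 + M) (suc k)) 1 ↭ map (λ b → wd (false ∷ b)) (hookbits M k)) (m∸n+n≡m le)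
    (subst (λ h → SYTi (2 + (a + k)) h 1 ↭ map (λ b → wd (false ∷ b)) (HB a k)) (cong (_∷ replicate (suc k) 1) (sym (m+n∸n≡m (suc a) k))) (SYTi-leg a k))
    where a = N ∸ k

  inner-family : ∀ {k} → 1 ≤ k → k < N → SYTi (2 + N) (near (2 + N) k) 2 ↭ map inn (hookbits N k)
  inner-family {suc l} _ lt = subst (λ M → SYTi (2 + M) (near (2 + M) (suc l)) 2 ↭ map inn (hookbits M (suc l))) size
    (subst (λ h → SYTi (2 + (suc a + suc l)) h 2 ↭ map inn (HB (suc a) (suc l))) (sym (near-nr a l)) (SYTi-inner a l))
    where
    a = N ∸ suc (suc l)
    size : suc a + suc l ≡ N
    size = trans (sym (+-suc a (suc l))) (m∸n+n≡m lt)

  dim-sub : ∀ {k} → k ≤ N → dim (suc N) (hook (suc N) k) * ((N ∸ k) ! * k !) ≡ N !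
  dim-sub {k} le = subst (λ M → dim (suc M) (hook (suc M) k) * (a ! * k !) ≡ M !) (m∸n+n≡m le)
    (trans (cong (_* (a ! * k !)) (trans (cong (dim (suc (a + k))) (hook-hk a k)) (dim-hook a k))) (hook-count a k))
    where a = N ∸ k

  dim-sub-length : ∀ {k} → k ≤ N → dim (suc N) (hook (suc N) k) ≡ length (hookbits N k)
  dim-sub-length {k} le = subst (λ M → dim (suc M) (hook (suc M) k) ≡ length (hookbits M k)) (m∸n+n≡m le)
    (trans (cong (dim (suc (a + k))) (hook-hk a k)) (dim-hook a k))
    where a = N ∸ k

  dim-arm : ∀ {k} → k ≤ N → dim (2 + N) (hook (2 + N) k) * (suc (N ∸ k) ! * k !) ≡ suc N !
  dim-arm {k} le = subst (λ M → dim (2 + M) (hook (2 + M) k) * (suc a ! * k !) ≡ suc M !) (m∸n+n≡m le)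
    (trans (cong (_* (suc a ! * k !)) (trans (cong (dim (2 + (a + k))) (hook-hk (suc a) k)) (dim-hook (suc a) k))) (hook-count (suc a) k))
    where a = N ∸ k

  dim-leg : ∀ {k} → k ≤ N → dim (2 + N) (hook (2 + N) (suc k)) * ((N ∸ k) ! * suc k !) ≡ suc N !
  dim-leg {k} le = subst (λ M → dim (2 + M) (hook (2 + M) (suc k)) * (a ! * suc k !) ≡ suc M !) (m∸n+n≡m le)
    (trans (cong (_* (a ! * suc k !)) (trans (cong (dim (2 + (a + k))) (cong (_∷ replicate (suc k) 1) (m+n∸n≡m (suc a) k)))
      (trans (cong (λ z → dim (suc z) (hk a (suc k))) (sym (+-suc a k))) (dim-hook a (suc k))))) (trans (hook-count a (suc k)) (cong _! (+-suc a k))))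
    where a = N ∸ k

  dim-inner : ∀ {k} → 1 ≤ k → k < N → dim (2 + N) (near (2 + N) k) * (suc (N ∸ k) ! * suc k !) ≡ (2 + N) * ((N ∸ k) * k) * N !
  dim-inner {suc l} _ lt = subst (λ x → dim (2 + N) (near (2 + N) (suc l)) * (suc x ! * suc (suc l) !) ≡ (2 + N) * (x * suc l) * N !) a-size
    (subst (λ M → dim (2 + M) (near (2 + M) (suc l)) * (suc (suc a) ! * suc (suc l) !) ≡ (2 + M) * (suc a * suc l) * M !) size
      (trans (cong (_* (suc (suc a) ! * suc (suc l) !)) (trans (cong (dim (2 + (suc a + suc l))) (near-nr a l)) (dim-near a l))) (near-count a l)))
    where
    a = N ∸ suc (suc l)
    size : suc a + suc l ≡ N
    size = trans (sym (+-suc a (suc l))) (m∸n+n≡m lt)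
    a-size : suc a ≡ N ∸ suc l
    a-size = trans (sym (m+n∸n≡m (suc a) (suc l))) (cong (_∸ suc l) size)

family-facts : ∀ {N m n} → suc N ≡ m → suc m ≡ n → FamilyFacts N m n
family-facts {N} refl refl = record { Families N }

open ℚSolver.+-*-Solver using (solve; _:=_; _:+_; _:*_; _:-_; :-_; con)

-- The group algebra acting on functions

content-next : ∀ u x v → content (u ++ x ∷ v) (suc (length u)) ≡ ℤ.+ count x u ℤ.- ℤ.+ x
content-next u x v = cong₂ (λ y t → ℤ.+ count y t ℤ.- ℤ.+ y) (at-mid u) (take-mid u)
  where
  at-mid : ∀ u → at (u ++ x ∷ v) (length u) 0 ≡ x
  at-mid [] = refl
  at-mid (y ∷ u) = at-mid u
  take-mid : ∀ u → take (length u) (u ++ x ∷ v) ≡ u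
  take-mid [] = refl
  take-mid (y ∷ u) = cong (y ∷_) (take-mid u)

Agree : (ℕ → ℤ) → List ℤ → Set
Agree cv [] = ⊤
Agree cv (d ∷ c) = cv (suc (length c)) ≡ d × Agree cv c

len-wd : ∀ b → length (cs b) ≡ length (wd b)
len-wd b = trans (cs-length b) (sym (wd-length b))

agree-wd : ∀ b v → Agree (content (wd b ++ v)) (cs b)
agree-wd [] v = refl , tt
agree-wd (true ∷ b) v rewrite ++-assoc (wd b) (0 ∷ []) v | len-wd b =
  trans (content-next (wd b) 0 v) (trans (ℤP.+-identityʳ (ℤ.+ count 0 (wd b))) (cong ℤ.+_ (wd-shape b 0))) , agree-wd b (0 ∷ v)
agree-wd (false ∷ b) v rewrite ++-assoc (wd b) (suc (cnt false b) ∷ []) v | len-wd b =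
  trans (content-next (wd b) (suc (cnt false b)) v) (cong (λ z → ℤ.+ z ℤ.- ℤ.+ suc (cnt false b)) (trans (wd-shape b (suc (cnt false b))) (ones-beyond (cnt false b))))
  , agree-wd b (suc (cnt false b) ∷ v)

agree-end : ∀ b → Agree (content (wd b)) (cs b)
agree-end b = subst (λ w → Agree (content w) (cs b)) (++-identityʳ (wd b)) (agree-wd b [])

agree-inn : ∀ b → 1 ≤ cnt false b → Agree (content (inn b)) (ℤ.+ 0 ∷ cs b)
agree-inn b le = subst (λ k → content (inn b) (suc k) ≡ ℤ.+ 0) (sym (len-wd b))
  (trans (content-next (wd b) 1 []) (cong (λ z → ℤ.+ z ℤ.- ℤ.+ 1) (trans (wd-shape b 1) (ones-in (cnt false b) le)))) , agree-wd b (1 ∷ [])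

module GroupAlgebra (n : ℕ) where
  open SymmetricGroup n
  open CycleSums n
  open Operators action
  open Spectrum action
  open SeminormalUnits action

  monomial : V → List ℕ → ℚ × List ℕ → ℚ
  monomial f π aσ = proj₁ aσ ℚ.* f (π ∘ₚ proj₂ aσ)

  -- Elements are lists with possibly repeated terms; comparing them through their action by right
  -- translations avoids collecting terms.
  act : Alg → V → V
  act Y f π = ∑ (monomial f π) Y

  ValidA : Alg → Set
  ValidA Y = ∀ {aσ} → aσ ∈ Y → Val (proj₂ aσ)

  valid-++ : ∀ Y {W} → ValidA Y → ValidA W → ValidA (Y ++ W)
  valid-++ Y h h′ m with ∈-++⁻ Y m
  ... | inj₁ k = h k
  ... | inj₂ k = h′ k

  valid-one : ValidA (one n)
  valid-one (here refl) = val-id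

  valid-scale : ∀ c Y → ValidA Y → ValidA (scale c Y)
  valid-scale c Y h m with ∈-map⁻ (λ aσ → (c ℚ.* proj₁ aσ , proj₂ aσ)) m
  ... | _ , k , refl = h k

  valid-⊛ : ∀ Y W → ValidA Y → ValidA W → ValidA (Y ⊛ W)
  valid-⊛ Y W h h′ m with find (∈-concatMap⁻ (λ aσ → map (λ bτ → (proj₁ aσ ℚ.* proj₁ bτ , proj₂ aσ ∘ₚ proj₂ bτ)) W) {xs = Y} m)
  ... | aσ , k , k′ with ∈-map⁻ (λ bτ → (proj₁ aσ ℚ.* proj₁ bτ , proj₂ aσ ∘ₚ proj₂ bτ)) k′
  ... | bτ , k″ , refl = val-∘ (h k) (h′ k″)

  valid-JM : ∀ {j} → j < n → ValidA (JM n (suc j))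
  valid-JM {j} lt m with ∈-map⁻ (λ a → (1ℚ , transp n a (suc j))) m
  ... | a , k , refl with ∈-range⁻ {1} {j} k
  ... | la , le = val-tp (∈-range⁺ la (≤-trans le (<⇒≤ lt))) (∈-range⁺ (s≤s z≤n) lt) (<⇒≢ (s≤s le))

  act-⊛ : ∀ Y W f → ValidA Y → ValidA W → act (Y ⊛ W) f ≐ act Y (act W f)
  act-⊛ Y W f h h′ {π} v = trans (∑-concatMap (monomial f π) (λ aσ → map (λ bτ → (proj₁ aσ ℚ.* proj₁ bτ , proj₂ aσ ∘ₚ proj₂ bτ)) W) Y)
    (∑-cong Y (λ aσ k → trans (∑-map (monomial f π) (λ bτ → (proj₁ aσ ℚ.* proj₁ bτ , proj₂ aσ ∘ₚ proj₂ bτ)) W)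
      (trans (∑-cong W (λ bτ k′ → trans (ℚP.*-assoc (proj₁ aσ) (proj₁ bτ) (f (π ∘ₚ (proj₂ aσ ∘ₚ proj₂ bτ))))
          (cong (λ ρ → proj₁ aσ ℚ.* (proj₁ bτ ℚ.* f ρ)) (sym (∘-assoc π (h k) (h′ k′))))))
        (∑-*ˡ (proj₁ aσ) (λ bτ → proj₁ bτ ℚ.* f ((π ∘ₚ proj₂ aσ) ∘ₚ proj₂ bτ)) W))))

  act-cong : ∀ Y {f g} → ValidA Y → f ≐ g → act Y f ≐ act Y g
  act-cong Y h e v = ∑-cong Y (λ aσ k → cong (proj₁ aσ ℚ.*_) (e (val-∘ v (h k))))

  act-one : ∀ f → act (one n) f ≐ f
  act-one f {π} v = trans (ℚP.+-identityʳ _) (trans (ℚP.*-identityˡ _) (cong f (∘-idʳ v)))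

  act-scale : ∀ c Y f → act (scale c Y) f ≐ c *ᵛ act Y f
  act-scale c Y f {π} v = trans (∑-map (monomial f π) (λ aσ → (c ℚ.* proj₁ aσ , proj₂ aσ)) Y)
    (trans (∑-cong′ Y (λ aσ → ℚP.*-assoc c (proj₁ aσ) (f (π ∘ₚ proj₂ aσ)))) (∑-*ˡ c (λ aσ → proj₁ aσ ℚ.* f (π ∘ₚ proj₂ aσ)) Y))

  act-JM : ∀ {j} → j < n → ∀ f → act (JM n (suc j)) f ≐ ⟦ X j ⟧ f
  act-JM {j} lt f {π} v = trans (∑-map (monomial f π) (λ a → (1ℚ , transp n a (suc j))) (range 1 j))
    (trans (∑-cong′ (range 1 j) (λ a → ℚP.*-identityˡ (f (π ∘ₚ transp n a (suc j))))) (sym (X-sum j lt f v)))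

  facA : ℕ → ℤ → ℤ → Alg
  facA k d c = scale (inv (ℤ→ℚ (d ℤ.- c))) (JM n k ++ scale (ℚ.- ℤ→ℚ c) (one n))

  valid-facA : ∀ {j} d c → j < n → ValidA (facA (suc j) d c)
  valid-facA {j} d c lt = valid-scale (inv (ℤ→ℚ (d ℤ.- c))) _ (valid-++ (JM n (suc j)) (valid-JM lt) (valid-scale (ℚ.- ℤ→ℚ c) (one n) valid-one))

  act-facA : ∀ {j} d c → j < n → ∀ f → act (facA (suc j) d c) f ≐ ⟦ fac j d c ⟧ f
  act-facA {j} d c lt f {π} v = trans (act-scale (inv (ℤ→ℚ (d ℤ.- c))) (JM n (suc j) ++ scale (ℚ.- ℤ→ℚ c) (one n)) f v)
    (cong (inv (ℤ→ℚ (d ℤ.- c)) ℚ.*_) (trans (∑-++ (monomial f π) (JM n (suc j)) (scale (ℚ.- ℤ→ℚ c) (one n)))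
      (cong₂ ℚ._+_ (act-JM lt f v) (trans (act-scale (ℚ.- ℤ→ℚ c) (one n) f v) (cong (ℚ.- ℤ→ℚ c ℚ.*_) (act-one f v))))))

  factorsA : (ℕ → ℤ) → ℕ → List Alg
  factorsA cv k = map (facA k (cv k)) (filterB (λ c → not (does (c ℤ.≟ cv k))) (contentRange k))

  AllValid : List Alg → Set
  AllValid Ys = ∀ {Y} → Y ∈ Ys → ValidA Y

  valid-prod : ∀ Ys → AllValid Ys → ValidA (prodAlg n Ys)
  valid-prod [] h = valid-one
  valid-prod (Y ∷ Ys) h = valid-⊛ Y (prodAlg n Ys) (h (here refl)) (valid-prod Ys (λ m → h (there m)))

  act-prod-++ : ∀ Ys Ws f → AllValid Ys → AllValid Ws → act (prodAlg n (Ys ++ Ws)) f ≐ act (prodAlg n Ys) (act (prodAlg n Ws) f)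
  act-prod-++ [] Ws f h h′ v = sym (act-one (act (prodAlg n Ws) f) v)
  act-prod-++ (Y ∷ Ys) Ws f h h′ v = trans (act-⊛ Y (prodAlg n (Ys ++ Ws)) f (h (here refl)) (valid-prod (Ys ++ Ws) valid-both) v)
    (trans (act-cong Y (h (here refl)) (act-prod-++ Ys Ws f (λ m → h (there m)) h′) v)
      (sym (act-⊛ Y (prodAlg n Ys) (act (prodAlg n Ws) f) (h (here refl)) (valid-prod Ys (λ m → h (there m))) v)))
    where
    valid-both : AllValid (Ys ++ Ws)
    valid-both m with ∈-++⁻ Ys m
    ... | inj₁ k = h (there k)
    ... | inj₂ k = h′ k

  valid-factors : ∀ cv {j} → j < n → AllValid (factorsA cv (suc j))
  valid-factors cv {j} lt m with ∈-map⁻ (facA (suc j) (cv (suc j))) m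
  ... | c , _ , refl = valid-facA (cv (suc j)) c lt

  act-prodOp : ∀ {j} d L → j < n → ∀ f → act (prodAlg n (map (facA (suc j) d) L)) f ≐ ⟦ prodOp (map (fac j d) L) ⟧ f
  act-prodOp d [] lt f {π} v = trans (act-one f v) (sym (ℚP.*-identityˡ (f π)))
  act-prodOp {j} d (c ∷ L) lt f v = trans (act-⊛ (facA (suc j) d c) (prodAlg n (map (facA (suc j) d) L)) f (valid-facA d c lt) (valid-prod (map (facA (suc j) d) L) valid-rest) v)
    (trans (act-cong (facA (suc j) d c) (valid-facA d c lt) (act-prodOp d L lt f) v) (act-facA d c lt (⟦ prodOp (map (fac j d) L) ⟧ f) v))
    where
    valid-rest : AllValid (map (facA (suc j) d) L)
    valid-rest m with ∈-map⁻ (facA (suc j) d) m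
    ... | c , _ , refl = valid-facA d c lt

  valid-all : ∀ cv m → m ≤ n → AllValid (concatMap (factorsA cv) (range 1 m))
  valid-all cv m le k with find (∈-concatMap⁻ (factorsA cv) {xs = range 1 m} k)
  ... | zero , k₁ , k₂ with ∈-range⁻ {1} {m} k₁
  ...   | () , _
  valid-all cv m le k | suc j , k₁ , k₂ = valid-factors cv (≤-trans (proj₂ (∈-range⁻ {1} {m} k₁)) le) k₂

  -- The factors of `eT` come in increasing order of k and `E` multiplies in the same order, so
  -- removing the last box removes the last block of factors.
  act-E : ∀ cv c → length c ≤ n → Agree cv c → ∀ f → act (prodAlg n (concatMap (factorsA cv) (range 1 (length c)))) f ≐ ⟦ E c ⟧ f
  act-E cv [] le ag f {π} v = trans (act-one f v) (sym (ℚP.*-identityˡ (f π)))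
  act-E cv (d ∷ c) le (refl , ag) f {π} v = trans (cong (λ l → act (prodAlg n l) f π) split)
    (trans (act-prod-++ (concatMap (factorsA cv) (range 1 (length c))) (factorsA cv (suc (length c))) f (valid-all cv (length c) (<⇒≤ le)) (valid-factors cv le) v)
    (trans (act-cong (prodAlg n (concatMap (factorsA cv) (range 1 (length c)))) (valid-prod (concatMap (factorsA cv) (range 1 (length c))) (valid-all cv (length c) (<⇒≤ le))) (act-prodOp d (others (length c) d) le f) v)
      (act-E cv c (<⇒≤ le) ag (⟦ proj (length c) d ⟧ f) v)))
    where
    concatMap-++ : ∀ (g : ℕ → List Alg) xs ys → concatMap g (xs ++ ys) ≡ concatMap g xs ++ concatMap g ys
    concatMap-++ g [] ys = refl
    concatMap-++ g (x ∷ xs) ys = trans (cong (g x ++_) (concatMap-++ g xs ys)) (sym (++-assoc (g x) (concatMap g xs) (concatMap g ys)))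
    split : concatMap (factorsA cv) (range 1 (suc (length c))) ≡ concatMap (factorsA cv) (range 1 (length c)) ++ factorsA cv (suc (length c))
    split = trans (cong (concatMap (factorsA cv)) (range-snoc (length c)))
      (trans (concatMap-++ (factorsA cv) (range 1 (length c)) (suc (length c) ∷ [])) (cong (concatMap (factorsA cv) (range 1 (length c)) ++_) (++-identityʳ _)))

  act-eT : ∀ w c → length c ≡ n → Agree (content w) c → ∀ f → act (eT n w) f ≐ ⟦ E c ⟧ f
  act-eT w c e ag f {π} v = trans (cong (λ k → act (prodAlg n (concatMap (factorsA (content w)) (range 1 k))) f π) (sym e))
    (act-E (content w) c (≤-reflexive e) ag f v)

  valid-eT : ∀ w → ValidA (eT n w)
  valid-eT w = valid-prod (concatMap (factorsA (content w)) (range 1 n)) (valid-all (content w) n ≤-refl)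

  valid-Gamma : ∀ la i → ValidA (Gamma n la i)
  valid-Gamma la i m with find (∈-concatMap⁻ (eT n) {xs = SYTi n la i} m)
  ... | w , _ , k = valid-eT w k

  act-Gamma : ∀ la i (g : List Bool → List ℕ) (c : List Bool → List ℤ) bs → SYTi n la i ↭ map g bs →
    (∀ {b} → b ∈ bs → length (c b) ≡ n × Agree (content (g b)) (c b)) → ∀ f →
    act (Gamma n la i) f ≐ (λ π → ∑ (λ b → ⟦ E (c b) ⟧ f π) bs)
  act-Gamma la i g c bs p h f {π} v = trans (∑-concatMap (monomial f π) (eT n) (SYTi n la i))
    (trans (∑-↭ (λ w → act (eT n w) f π) p) (trans (∑-map (λ w → act (eT n w) f π) g bs)
      (∑-cong bs (λ b m → act-eT (g b) (c b) (proj₁ (h m)) (proj₂ (h m)) f v))))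

  coeff-act : ∀ Y ρ → ValidA Y → coeff Y ρ ≡ act Y (λ σ → ind (listEq? σ ρ)) id₀
  coeff-act [] ρ h = refl
  coeff-act ((a , σ) ∷ Y) ρ h = cong₂ ℚ._+_ (trans (pick (listEq? σ ρ)) (cong (λ τ → a ℚ.* ind (listEq? τ ρ)) (sym (∘-idˡ (h (here refl)))))) (coeff-act Y ρ (λ m → h (there m)))
    where
    pick : ∀ b → (if b then a else 0ℚ) ≡ a ℚ.* ind b
    pick true = sym (ℚP.*-identityʳ a)
    pick false = sym (ℚP.*-zeroʳ a)

  class-ind : ∀ μ j {σ} → Val σ → ∑ (λ ρ → ind (listEq? σ ρ)) (Cset n μ j) ≡ ind (inC n μ j σ)
  class-ind μ j {σ} v = trans (∑-filterB (inC n μ j) (λ ρ → ind (listEq? σ ρ)) (Sym n))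
    (trans (∑-single (Sym n) sym-unique σ (sym-∈ v) (λ ρ m ne → trans (cong (λ b → ind (inC n μ j ρ) ℚ.* ind b) (listEq-≢ {σ} {ρ} (λ e → ne (sym e)))) (ℚP.*-zeroʳ (ind (inC n μ j ρ)))))
      (trans (cong (λ b → ind (inC n μ j σ) ℚ.* ind b) (listEq-refl σ)) (ℚP.*-identityʳ (ind (inC n μ j σ)))))

  -- The coefficient of ρ in Y is the value at the identity of Y applied to the indicator of ρ; over
  -- a class these indicators add up to that of the class.
  coeff-class : ∀ μ j Y → ValidA Y → foldr (λ π acc → coeff Y π ℚ.+ acc) 0ℚ (Cset n μ j) ≡ act Y (λ σ → ind (inC n μ j σ)) id₀
  coeff-class μ j Y h = trans (∑-cong′ (Cset n μ j) (λ ρ → coeff-act Y ρ h))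
    (trans (∑-swap (λ ρ aσ → proj₁ aσ ℚ.* ind (listEq? (id₀ ∘ₚ proj₂ aσ) ρ)) (Cset n μ j) Y)
    (∑-cong Y (λ aσ m → trans (∑-*ˡ (proj₁ aσ) (λ ρ → ind (listEq? (id₀ ∘ₚ proj₂ aσ) ρ)) (Cset n μ j))
      (cong (proj₁ aσ ℚ.*_) (class-ind μ j (val-∘ val-id (h m)))))))

-- Rational identities

factor-nonzero : ∀ x y {z} → x ℚ.* y ≡ z → z ≢ 0ℚ → x ≢ 0ℚ
factor-nonzero x y e nz q = nz (trans (sym e) (trans (cong (ℚ._* y) q) (ℚP.*-zeroˡ y)))

product-nonzero : ∀ {x y} → x ≢ 0ℚ → y ≢ 0ℚ → x ℚ.* y ≢ 0ℚ
product-nonzero {x} {y} nx ny e = ny (zero-product x y nx e)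

ℕ→ℚ-!≢0 : ∀ k → ℕ→ℚ (k !) ≢ 0ℚ
ℕ→ℚ-!≢0 zero ()
ℕ→ℚ-!≢0 (suc k) e = product-nonzero (ℕ→ℚ-suc≢0 k) (ℕ→ℚ-!≢0 k) (trans (sym (ℕ→ℚ-* (suc k) (k !))) e)

∑-const : (c : ℚ) (xs : List A) → ∑ (λ _ → c) xs ≡ ℕ→ℚ (length xs) ℚ.* c
∑-const c [] = sym (ℚP.*-zeroˡ c)
∑-const c (x ∷ xs) = trans (cong (c ℚ.+_) (∑-const c xs))
  (trans (solve 2 (λ c l → c :+ l :* c := (con 1ℚ :+ l) :* c) refl c (ℕ→ℚ (length xs))) (cong (ℚ._* c) (sym (ℕ→ℚ-+ 1 (length xs)))))

-- For an empty list both sides are 0.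
∑-average : (F : A → ℚ) (xs : List A) → ∑ F xs ≡ ℕ→ℚ (length xs) ℚ.* (∑ F xs ℚ.* inv (ℕ→ℚ (length xs)))
∑-average F [] = refl
∑-average F (x ∷ xs) = sym (trans (solve 3 (λ c s i → c :* (s :* i) := s :* (c :* i)) refl c (∑ F (x ∷ xs)) (inv c))
  (trans (cong (∑ F (x ∷ xs) ℚ.*_) (*-inv c (ℕ→ℚ-suc≢0 (length xs)))) (ℚP.*-identityʳ _)))
  where c = ℕ→ℚ (suc (length xs))

sumQ-map : (g : A → ℚ) (xs : List A) → sumQ (map g xs) ≡ ∑ g xs
sumQ-map g [] = refl
sumQ-map g (x ∷ xs) = cong (g x ℚ.+_) (sumQ-map g xs)

∑-group : (key : A → ℕ) (F : A → ℚ) (M : ℕ) (xs : List A) → (∀ {x} → x ∈ xs → key x ≤ M) →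
  ∑ F xs ≡ ∑ (λ k → ∑ F (filterB (λ x → key x ≡ᵇ k) xs)) (range 0 M)
∑-group key F M xs h = trans (∑-cong xs (λ x m → sym (row-sum x m)))
  (trans (∑-swap (λ x k → ind (key x ≡ᵇ k) ℚ.* F x) xs (range 0 M))
    (∑-cong′ (range 0 M) (λ k → sym (∑-filterB (λ x → key x ≡ᵇ k) F xs))))
  where
  row-sum : ∀ x → x ∈ xs → ∑ (λ k → ind (key x ≡ᵇ k) ℚ.* F x) (range 0 M) ≡ F x
  row-sum x m = trans (∑-single (range 0 M) (range-unique 0 M) (key x) (∈-range⁺ z≤n (h m))
      (λ k _ ne → trans (cong (λ b → ind b ℚ.* F x) (≡ᵇ-≢ {key x} {k} (λ e → ne (sym e)))) (ℚP.*-zeroˡ (F x))))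
    (trans (cong (λ b → ind b ℚ.* F x) (≡ᵇ-refl (key x))) (ℚP.*-identityˡ (F x)))

sgn-suc : ∀ k → sgn (suc k) ≡ ℚ.- sgn k
sgn-suc zero = refl
sgn-suc (suc k) = trans (solve 1 (λ s → s := :- (:- s)) refl (sgn k)) (cong ℚ.-_ (sym (sgn-suc k)))

-- The remaining identities are between rational functions of the following
-- quantities: the sign s, the factorials F = a!, G = l!, R = (n-2)!, the number
-- D of tableaux of the big shape, D′ of the small shape, and the trace t of one
-- seminormal unit.
rim-scalar : ∀ s F G R nn mm α D D′ t → α ≢ 0ℚ → F ≢ 0ℚ → G ≢ 0ℚ → D ≢ 0ℚ → D′ ≢ 0ℚ →
  t ℚ.* (α ℚ.* nn ℚ.* F ℚ.* G) ≡ 1ℚ → D ℚ.* (α ℚ.* F ℚ.* G) ≡ mm ℚ.* R →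
  s ℚ.* (F ℚ.* G) ℚ.* inv (D′ ℚ.* t) ≡ s ℚ.* R ℚ.* (nn ℚ.* mm ℚ.* R) ℚ.* inv D ℚ.* inv D ℚ.* inv D′ ℚ.* (mm ℚ.* inv α)
rim-scalar s F G R nn mm α D D′ t nα nF nG nD nD′ ht hD = *-cancelˡ c _ _
    (product-nonzero (product-nonzero (product-nonzero nD′ nt) (product-nonzero nD nD)) (product-nonzero nα (product-nonzero (product-nonzero nα nF) nG)))
    (trans lhs (sym rhs′))
  where
  c = (D′ ℚ.* t) ℚ.* (D ℚ.* D) ℚ.* (α ℚ.* (α ℚ.* F ℚ.* G))
  nt : t ≢ 0ℚ
  nt = factor-nonzero t (α ℚ.* nn ℚ.* F ℚ.* G) ht (λ ())
  lhs : c ℚ.* (s ℚ.* (F ℚ.* G) ℚ.* inv (D′ ℚ.* t)) ≡ s ℚ.* ((mm ℚ.* R) ℚ.* (mm ℚ.* R))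
  lhs = trans (solve 8 (λ s F G α D D′ t i → (D′ :* t) :* (D :* D) :* (α :* (α :* F :* G)) :* (s :* (F :* G) :* i)
        := ((D′ :* t) :* i) :* (s :* ((D :* (α :* F :* G)) :* (D :* (α :* F :* G))))) refl s F G α D D′ t (inv (D′ ℚ.* t)))
    (trans (cong₂ ℚ._*_ (*-inv (D′ ℚ.* t) (product-nonzero nD′ nt)) (cong (λ z → s ℚ.* (z ℚ.* z)) hD)) (ℚP.*-identityˡ _))
  rhs′ : c ℚ.* (s ℚ.* R ℚ.* (nn ℚ.* mm ℚ.* R) ℚ.* inv D ℚ.* inv D ℚ.* inv D′ ℚ.* (mm ℚ.* inv α)) ≡ s ℚ.* ((mm ℚ.* R) ℚ.* (mm ℚ.* R))
  rhs′ = trans (cong (c ℚ.*_) (solve 7 (λ s R nn mm iD iD′ iα → s :* R :* (nn :* mm :* R) :* iD :* iD :* iD′ :* (mm :* iα)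
          := (iD :* iD :* iD′ :* iα) :* (s :* R :* (nn :* mm :* R) :* mm)) refl s R nn mm (inv D) (inv D′) (inv α)))
    (trans (solve 11 (λ s F G R nn mm α D D′ t iD → (D′ :* t) :* (D :* D) :* (α :* (α :* F :* G)) :* (iD :* (s :* R :* (nn :* mm :* R) :* mm))
          := ((D :* D :* D′ :* α) :* iD) :* ((t :* (α :* nn :* F :* G)) :* (s :* ((mm :* R) :* (mm :* R))))) refl
          s F G R nn mm α D D′ t (inv D ℚ.* inv D ℚ.* inv D′ ℚ.* inv α))
    (trans (cong₂ (λ x y → x ℚ.* (y ℚ.* (s ℚ.* ((mm ℚ.* R) ℚ.* (mm ℚ.* R))))) inverses ht)
      (solve 1 (λ z → con 1ℚ :* (con 1ℚ :* z) := z) refl (s ℚ.* ((mm ℚ.* R) ℚ.* (mm ℚ.* R))))))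
    where
    inverses : (D ℚ.* D ℚ.* D′ ℚ.* α) ℚ.* (inv D ℚ.* inv D ℚ.* inv D′ ℚ.* inv α) ≡ 1ℚ
    inverses = trans (solve 6 (λ D D′ α iD iD′ iα → (D :* D :* D′ :* α) :* (iD :* iD :* iD′ :* iα) := (D :* iD) :* (D :* iD) :* (D′ :* iD′) :* (α :* iα)) refl D D′ α (inv D) (inv D′) (inv α))
      (trans (cong₂ (λ x y → x ℚ.* x ℚ.* (D′ ℚ.* inv D′) ℚ.* y) (*-inv D nD) (*-inv α nα)) (cong (λ z → 1ℚ ℚ.* 1ℚ ℚ.* z ℚ.* 1ℚ) (*-inv D′ nD′)))

-- Here αλ is (a+1)(l+1). Adding the inner corner multiplies the trace t₀ of the hook unit by a l /
-- αλ, and D is the near-hook count. Both sides are compared after multiplication by `c`, which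
-- clears the denominators.
inner-scalar : ∀ s F G R nn mm a l αλ D D′ t₀ t → αλ ≢ 0ℚ → F ≢ 0ℚ → G ≢ 0ℚ → D ≢ 0ℚ → D′ ≢ 0ℚ → t ≢ 0ℚ →
  t₀ ℚ.* (F ℚ.* G ℚ.* mm) ≡ 1ℚ → t ℚ.* αλ ≡ t₀ ℚ.* (a ℚ.* l) → D ℚ.* (αλ ℚ.* F ℚ.* G) ≡ nn ℚ.* (a ℚ.* l) ℚ.* R →
  s ℚ.* (F ℚ.* G) ℚ.* inv (D′ ℚ.* t) ≡ s ℚ.* R ℚ.* (nn ℚ.* mm ℚ.* R) ℚ.* inv D ℚ.* inv D ℚ.* inv D′ ℚ.* (nn ℚ.* l ℚ.* a ℚ.* inv αλ)
inner-scalar s F G R nn mm a l αλ D D′ t₀ t nα nF nG nD nD′ nt h₀ ht hD = *-cancelˡ c _ _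
    (product-nonzero (product-nonzero (product-nonzero nD′ nt) (product-nonzero nD nD)) (product-nonzero nα (product-nonzero (product-nonzero nα nF) nG)))
    (trans lhs (sym rhs′))
  where
  c = (D′ ℚ.* t) ℚ.* (D ℚ.* D) ℚ.* (αλ ℚ.* (αλ ℚ.* F ℚ.* G))
  Y = nn ℚ.* (a ℚ.* l) ℚ.* R
  lhs : c ℚ.* (s ℚ.* (F ℚ.* G) ℚ.* inv (D′ ℚ.* t)) ≡ s ℚ.* (Y ℚ.* Y)
  lhs = trans (solve 8 (λ s F G α D D′ t i → (D′ :* t) :* (D :* D) :* (α :* (α :* F :* G)) :* (s :* (F :* G) :* i)
        := ((D′ :* t) :* i) :* (s :* ((D :* (α :* F :* G)) :* (D :* (α :* F :* G))))) refl s F G αλ D D′ t (inv (D′ ℚ.* t)))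
    (trans (cong₂ ℚ._*_ (*-inv (D′ ℚ.* t) (product-nonzero nD′ nt)) (cong (λ z → s ℚ.* (z ℚ.* z)) hD)) (ℚP.*-identityˡ _))
  rhs′ : c ℚ.* (s ℚ.* R ℚ.* (nn ℚ.* mm ℚ.* R) ℚ.* inv D ℚ.* inv D ℚ.* inv D′ ℚ.* (nn ℚ.* l ℚ.* a ℚ.* inv αλ)) ≡ s ℚ.* (Y ℚ.* Y)
  rhs′ = trans (cong (c ℚ.*_) (solve 9 (λ s R nn mm iD iD′ iα l a → s :* R :* (nn :* mm :* R) :* iD :* iD :* iD′ :* (nn :* l :* a :* iα)
          := (iD :* iD :* iD′ :* iα) :* (s :* R :* (nn :* mm :* R) :* (nn :* l :* a))) refl s R nn mm (inv D) (inv D′) (inv αλ) l a))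
    (trans (solve 13 (λ s F G R nn mm α D D′ t iD l a → (D′ :* t) :* (D :* D) :* (α :* (α :* F :* G)) :* (iD :* (s :* R :* (nn :* mm :* R) :* (nn :* l :* a)))
          := ((D :* D :* D′ :* α) :* iD) :* ((t :* α) :* (s :* (F :* G :* mm) :* (nn :* (a :* l) :* R) :* (nn :* R)))) refl
          s F G R nn mm αλ D D′ t (inv D ℚ.* inv D ℚ.* inv D′ ℚ.* inv αλ) l a)
    (trans (cong₂ (λ x y → x ℚ.* (y ℚ.* (s ℚ.* (F ℚ.* G ℚ.* mm) ℚ.* Y ℚ.* (nn ℚ.* R)))) inverses ht)
    (trans (solve 7 (λ t₀ a l s H nn R → con 1ℚ :* ((t₀ :* (a :* l)) :* (s :* H :* (nn :* (a :* l) :* R) :* (nn :* R))) := (t₀ :* H) :* (s :* ((nn :* (a :* l) :* R) :* (nn :* (a :* l) :* R)))) refl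
        t₀ a l s (F ℚ.* G ℚ.* mm) nn R)
      (trans (cong (ℚ._* (s ℚ.* (Y ℚ.* Y))) h₀) (ℚP.*-identityˡ _)))))
    where
    inverses : (D ℚ.* D ℚ.* D′ ℚ.* αλ) ℚ.* (inv D ℚ.* inv D ℚ.* inv D′ ℚ.* inv αλ) ≡ 1ℚ
    inverses = trans (solve 6 (λ D D′ α iD iD′ iα → (D :* D :* D′ :* α) :* (iD :* iD :* iD′ :* iα) := (D :* iD) :* (D :* iD) :* (D′ :* iD′) :* (α :* iα)) refl D D′ αλ (inv D) (inv D′) (inv αλ))
      (trans (cong₂ (λ x y → x ℚ.* x ℚ.* (D′ ℚ.* inv D′) ℚ.* y) (*-inv D nD) (*-inv αλ nα)) (cong (λ z → 1ℚ ℚ.* 1ℚ ℚ.* z ℚ.* 1ℚ) (*-inv D′ nD′)))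

-- K is the common eigenvalue of J, S the pairing with χD and T the trace of the family. The
-- rank-one relation eliminates S; XC and XD are then written as class sizes times the average
-- coefficients yC and yD.
assemble : ∀ K S T XC XD cC cD R nF s iD iD′ φ yC yD → T ≢ 0ℚ → nF ≢ 0ℚ → S ℚ.* T ≡ XC ℚ.* XD → XC ≡ cC ℚ.* yC → XD ≡ cD ℚ.* yD →
  K ℚ.* inv T ≡ s ℚ.* R ℚ.* nF ℚ.* iD ℚ.* iD ℚ.* iD′ ℚ.* φ →
  K ℚ.* S ≡ cD ℚ.* (((cC ℚ.* R) ℚ.* inv nF) ℚ.* (((s ℚ.* ((nF ℚ.* iD) ℚ.* yC)) ℚ.* ((nF ℚ.* iD) ℚ.* yD)) ℚ.* iD′ ℚ.* φ))
assemble K S T XC XD cC cD R nF s iD iD′ φ yC yD nT nnF hS hC hD hK =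
  trans (solve 2 (λ K S → K :* S := K :* (S :* con 1ℚ)) refl K S)
  (trans (cong (λ z → K ℚ.* (S ℚ.* z)) (sym (*-inv T nT)))
  (trans (solve 4 (λ K S T i → K :* (S :* (T :* i)) := (K :* i) :* (S :* T)) refl K S T (inv T))
  (trans (cong₂ ℚ._*_ hK (trans hS (cong₂ ℚ._*_ hC hD)))
  (trans (solve 10 (λ s R nF iD iD′ φ cC cD yC yD → (s :* R :* nF :* iD :* iD :* iD′ :* φ) :* ((cC :* yC) :* (cD :* yD))
       := con 1ℚ :* (cD :* ((cC :* R) :* (((s :* (iD :* yC)) :* ((nF :* iD) :* yD)) :* iD′ :* φ)))) refl s R nF iD iD′ φ cC cD yC yD)
  (trans (cong (ℚ._* (cD ℚ.* ((cC ℚ.* R) ℚ.* (((s ℚ.* (iD ℚ.* yC)) ℚ.* ((nF ℚ.* iD) ℚ.* yD)) ℚ.* iD′ ℚ.* φ)))) (sym (*-inv nF nnF)))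
  (solve 11 (λ nF j s R iD iD′ φ cC cD yC yD → (nF :* j) :* (cD :* ((cC :* R) :* (((s :* (iD :* yC)) :* ((nF :* iD) :* yD)) :* iD′ :* φ)))
       := cD :* (((cC :* R) :* j) :* (((s :* ((nF :* iD) :* yC)) :* ((nF :* iD) :* yD)) :* iD′ :* φ))) refl nF (inv nF) s R iD iD′ φ cC cD yC yD))))))

-- Assembly of the three sums

module Assembly (N m n p : ℕ) (m-eq : suc N ≡ m) (n-eq : suc m ≡ n) (facts : DipoleFacts N n p) (la : List ℕ) (i : ℕ) where
  open DipoleFacts facts
  open FamilyFacts (family-facts m-eq n-eq)
  open SymmetricGroup n hiding (s)
  open CycleTypes n using (ConjInv; χ; χ-conj)
  open CycleSums n using (JJ-conj)
  open GroupAlgebra n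
  open Operators action
  open Spectrum action
  open SeminormalUnits action
  open Hooks action
  open Regular regular using (tr; hook-trace; module HookTrace; module Convolution)

  private
    δ₀ χC χD : V
    δ₀ π = ind (listEq? π id₀)
    χC = χ la i
    χD = χ (twoRow n p) p
    cC cD R nF mm nn : ℚ
    cC = ℕ→ℚ (length (Cset n la i))
    cD = ℕ→ℚ (length (Cset n (twoRow n p) p))
    R = ℕ→ℚ (N !)
    nF = ℕ→ℚ (n !)
    mm = ℕ→ℚ m
    nn = ℕ→ℚ n

    NN-eq : suc (suc N) ≡ n
    NN-eq = trans (cong suc m-eq) n-eq

    N<n : N < n
    N<n = ≤-trans (s≤s (n≤1+n N)) (≤-reflexive NN-eq)

    m≢0 : mm ≢ 0ℚ
    m≢0 = subst (λ z → ℕ→ℚ z ≢ 0ℚ) m-eq (ℕ→ℚ-suc≢0 N)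

    n≢0 : nn ≢ 0ℚ
    n≢0 = subst (λ z → ℕ→ℚ z ≢ 0ℚ) n-eq (ℕ→ℚ-suc≢0 m)

    m!-value : ℕ→ℚ (m !) ≡ mm ℚ.* R
    m!-value = subst (λ z → ℕ→ℚ (z !) ≡ ℕ→ℚ z ℚ.* R) m-eq (ℕ→ℚ-* (suc N) (N !))

    nF-value : nF ≡ nn ℚ.* mm ℚ.* R
    nF-value = trans (subst (λ z → ℕ→ℚ (z !) ≡ ℕ→ℚ z ℚ.* ℕ→ℚ (m !)) n-eq (ℕ→ℚ-* (suc m) (m !))) (trans (cong (nn ℚ.*_) m!-value) (sym (ℚP.*-assoc nn mm R)))

    -- The arm has contents 1, ..., a and the leg -1, ..., -l; this is the origin of the signs in
    -- the three sums.
    kap-value : ∀ b → kap b ≡ sgn (cnt false b) ℚ.* (ℕ→ℚ (cnt true b !) ℚ.* ℕ→ℚ (cnt false b !))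
    kap-value [] = refl
    kap-value (true ∷ b) = trans (cong (ℕ→ℚ (suc (cnt true b)) ℚ.*_) (kap-value b))
      (trans (solve 4 (λ a s f g → a :* (s :* (f :* g)) := s :* ((a :* f) :* g)) refl (ℕ→ℚ (suc (cnt true b))) (sgn (cnt false b)) (ℕ→ℚ (cnt true b !)) (ℕ→ℚ (cnt false b !)))
        (cong (λ z → sgn (cnt false b) ℚ.* (z ℚ.* ℕ→ℚ (cnt false b !))) (sym (ℕ→ℚ-* (suc (cnt true b)) (cnt true b !)))))
    kap-value (false ∷ b) = trans (cong₂ ℚ._*_ (ℤ→ℚ-neg (ℤ.+ suc (cnt false b))) (kap-value b))
      (trans (solve 4 (λ l s f g → (:- l) :* (s :* (f :* g)) := (:- s) :* (f :* (l :* g))) refl (ℕ→ℚ (suc (cnt false b))) (sgn (cnt false b)) (ℕ→ℚ (cnt true b !)) (ℕ→ℚ (cnt false b !)))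
        (cong₂ (λ x y → x ℚ.* (ℕ→ℚ (cnt true b !) ℚ.* y)) (sym (sgn-suc (cnt false b))) (sym (ℕ→ℚ-* (suc (cnt false b)) (cnt false b !)))))

    ⟨δ⟩ : ∀ g → ⟨ δ₀ , g ⟩ ≡ g id₀
    ⟨δ⟩ g = trans (∑-single (Sym n) sym-unique id₀ (sym-∈ val-id) (λ π m ne → trans (cong (λ b → ind b ℚ.* g π) (listEq-≢ {π} {id₀} ne)) (ℚP.*-zeroˡ (g π))))
      (trans (cong (λ b → ind b ℚ.* g id₀) (listEq-refl id₀)) (ℚP.*-identityˡ (g id₀)))

    inv-unique : ∀ x y → x ℚ.* y ≡ 1ℚ → x ≡ inv y
    inv-unique x y e = *-cancelˡ y x (inv y) ny (trans (ℚP.*-comm y x) (trans e (sym (*-inv y ny))))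
      where
      ny : y ≢ 0ℚ
      ny = factor-nonzero y x (trans (ℚP.*-comm y x) e) (λ ())

    ⟨⟩-∑ : {B : Set} (F : B → V) (g : V) (xs : List B) → ⟨ (λ π → ∑ (λ b → F b π) xs) , g ⟩ ≡ ∑ (λ b → ⟨ F b , g ⟩) xs
    ⟨⟩-∑ F g xs = trans (∑-cong′ (Sym n) (λ π → sym (∑-*ʳ (g π) (λ b → F b π) xs))) (∑-swap (λ π b → F b π ℚ.* g π) (Sym n) xs)

    ⟨⟩-* : ∀ x f g → ⟨ x *ᵛ f , g ⟩ ≡ x ℚ.* ⟨ f , g ⟩
    ⟨⟩-* x f g = trans (∑-cong′ (Sym n) (λ π → ℚP.*-assoc x (f π) (g π))) (∑-*ˡ x (λ π → f π ℚ.* g π) (Sym n))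

    cD≢0 : cD ≢ 0ℚ
    cD≢0 e with Cset n (twoRow n p) p | ∈-filterB⁺ (inC n (twoRow n p) p) (Sym n) (sym-∈ val-πp) πp-inC
    ... | x ∷ xs | _ = ℕ→ℚ-suc≢0 (length xs) e

  -- The tableaux that arise from hooks of leg length k by adding a box of content d.
  module Family {k : ℕ} (le : k ≤ N) (d : ℤ) (c : List Bool → List ℤ) (c-eq : ∀ b → c b ≡ d ∷ cs b) where
    bs : List (List Bool)
    bs = hookbits N k
    S : ℚ
    S = ∑ (λ b → ⟨ ⟦ E (c b) ⟧ χC , χD ⟩) bs
    Γ : V → ℚ
    Γ f = ∑ (λ b → ⟦ E (c b) ⟧ f id₀) bs

    len : ∀ {b} → b ∈ bs → length (c b) ≡ n
    len {b} k∈ = trans (cong length (c-eq b)) (trans (cong suc (trans (cs-length b) (cong suc (trans (sym (cnt-total b))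
      (trans (cong₂ _+_ (proj₁ (∈-hookbits⁻ le k∈)) (proj₂ (∈-hookbits⁻ le k∈))) (m∸n+n≡m le)))))) NN-eq)

    -- The same w satisfies ⟨ Γ f , χD ⟩ = w Γ(f) for all f. Taking f = χC gives S; taking f = δ
    -- gives Γ(χD), since the units are self-adjoint. Then w is eliminated.
    rank-one : S ℚ.* Γ δ₀ ≡ Γ χC ℚ.* Γ χD
    rank-one = trans (cong (ℚ._* Γ δ₀) (scales χC))
      (trans (solve 3 (λ w x t → (w :* x) :* t := x :* (w :* t)) refl w (Γ χC) (Γ δ₀)) (cong (Γ χC ℚ.*_) (trans (sym (scales δ₀)) adjoint)))
      where
      open Convolution χD
      fam = family-scalar (λ {k′} lt v → χ-conj (twoRow n p) p k′ lt v) d bs (N ∸ k) k (∈-hookbits⁻ le) (trans (cong (λ z → suc (suc z)) (m∸n+n≡m le)) NN-eq)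
      w = proj₁ fam
      scales : ∀ f → ∑ (λ b → ⟨ ⟦ E (c b) ⟧ f , χD ⟩) bs ≡ w ℚ.* Γ f
      scales f = trans (∑-cong′ bs (λ b → cong (λ z → ⟨ ⟦ E z ⟧ f , χD ⟩) (c-eq b)))
        (trans (proj₂ fam f) (cong (w ℚ.*_) (∑-cong′ bs (λ b → cong (λ z → ⟦ E z ⟧ f id₀) (sym (c-eq b))))))
      adjoint : ∑ (λ b → ⟨ ⟦ E (c b) ⟧ δ₀ , χD ⟩) bs ≡ Γ χD
      adjoint = ∑-cong bs (λ b m → trans (sa (Pol-SA (E-Pol (c b) (≤-reflexive (len m)))) δ₀ χD) (⟨δ⟩ (⟦ E (c b) ⟧ χD)))

    kap-S : ∑ (λ b → kap b ℚ.* ⟨ ⟦ E (c b) ⟧ χC , χD ⟩) bs ≡ sgn k ℚ.* (ℕ→ℚ ((N ∸ k) !) ℚ.* ℕ→ℚ (k !)) ℚ.* S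
    kap-S = trans (∑-cong bs (λ b m → cong (ℚ._* ⟨ ⟦ E (c b) ⟧ χC , χD ⟩) (trans (kap-value b)
        (cong₂ (λ x y → sgn y ℚ.* (ℕ→ℚ (x !) ℚ.* ℕ→ℚ (y !))) (proj₁ (∈-hookbits⁻ le m)) (proj₂ (∈-hookbits⁻ le m))))))
      (∑-*ˡ (sgn k ℚ.* (ℕ→ℚ ((N ∸ k) !) ℚ.* ℕ→ℚ (k !))) (λ b → ⟨ ⟦ E (c b) ⟧ χC , χD ⟩) bs)

    module _ (ν : List ℕ) (j : ℕ) (g : List Bool → List ℕ) (tableaux : SYTi n ν j ↭ map g bs)
             (agree : ∀ {b} → b ∈ bs → Agree (content (g b)) (c b)) where

      average : ∀ μ m → Γ (χ μ m) ≡ ℕ→ℚ (length (Cset n μ m)) ℚ.* coeffK n μ m (Gamma n ν j)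
      average μ m = trans (sym (trans (coeff-class μ m (Gamma n ν j) (valid-Gamma ν j)) (act-Gamma ν j g c bs tableaux (λ k → len k , agree k) (χ μ m) val-id)))
        (∑-average (coeff (Gamma n ν j)) (Cset n μ m))

      family-term : ∀ (φ t : ℚ) → (∀ {b} → b ∈ bs → tr (c b) ≡ t) → t ≢ 0ℚ →
        sgn k ℚ.* (ℕ→ℚ ((N ∸ k) !) ℚ.* ℕ→ℚ (k !)) ℚ.* inv (ℕ→ℚ (dim m (hook m k)) ℚ.* t) ≡
          sgn k ℚ.* R ℚ.* nF ℚ.* inv (ℕ→ℚ (dim n ν)) ℚ.* inv (ℕ→ℚ (dim n ν)) ℚ.* inv (ℕ→ℚ (dim m (hook m k))) ℚ.* φ →
        ∑ (λ b → kap b ℚ.* ⟨ ⟦ E (c b) ⟧ χC , χD ⟩) bs ≡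
          cD ℚ.* (((cC ℚ.* R) ÷' nF) ℚ.* ((((sgn k ℚ.* gam n ν j la i) ℚ.* gam n ν j (twoRow n p) p) ÷' ℕ→ℚ (dim m (hook m k))) ℚ.* φ))
      family-term φ t ht nt hK = trans kap-S (assemble (sgn k ℚ.* (ℕ→ℚ ((N ∸ k) !) ℚ.* ℕ→ℚ (k !))) S (Γ δ₀) (Γ χC) (Γ χD) cC cD R nF (sgn k)
          (inv (ℕ→ℚ (dim n ν))) (inv D′) φ (coeffK n la i (Gamma n ν j)) (coeffK n (twoRow n p) p (Gamma n ν j))
          (λ e → product-nonzero D′≢0 nt (trans (sym Γδ) e)) (ℕ→ℚ-!≢0 n) rank-one (average la i) (average (twoRow n p) p)
          (trans (cong (λ z → sgn k ℚ.* (ℕ→ℚ ((N ∸ k) !) ℚ.* ℕ→ℚ (k !)) ℚ.* inv z) Γδ) hK))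
        where
        D′ = ℕ→ℚ (dim m (hook m k))
        Γδ : Γ δ₀ ≡ D′ ℚ.* t
        Γδ = trans (∑-cong bs (λ b m → ht m)) (trans (∑-const t bs) (cong (λ z → ℕ→ℚ z ℚ.* t) (sym (dim-sub-length le))))
        D′≢0 : D′ ≢ 0ℚ
        D′≢0 = factor-nonzero D′ (ℕ→ℚ ((N ∸ k) ! * k !)) (trans (sym (ℕ→ℚ-* (dim m (hook m k)) ((N ∸ k) ! * k !))) (cong ℕ→ℚ (dim-sub le))) (ℕ→ℚ-!≢0 N)

  module _ {k : ℕ} (le : k ≤ N) where
    private
      a = N ∸ k
      s F G α λ′ D′ : ℚ
      s = sgn k
      F = ℕ→ℚ (a !)
      G = ℕ→ℚ (k !)
      α = ℕ→ℚ (suc a)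
      λ′ = ℕ→ℚ (suc k)
      D′ = ℕ→ℚ (dim m (hook m k))
      bs = hookbits N k

      cs-size : ∀ {b} → b ∈ bs → length (cs b) ≡ m
      cs-size {b} k∈ = trans (cs-length b) (trans (cong suc (trans (sym (cnt-total b)) (trans (cong₂ _+_ (proj₁ (∈-hookbits⁻ le k∈)) (proj₂ (∈-hookbits⁻ le k∈))) (m∸n+n≡m le)))) m-eq)

      cs-< : ∀ {b} → b ∈ bs → length (cs b) < n
      cs-< k∈ = ≤-trans (s≤s (≤-reflexive (cs-size k∈))) (≤-reflexive n-eq)

      D′≢0 : D′ ≢ 0ℚ
      D′≢0 = factor-nonzero D′ (ℕ→ℚ (a ! * k !)) (trans (sym (ℕ→ℚ-* (dim m (hook m k)) (a ! * k !))) (cong ℕ→ℚ (dim-sub le))) (ℕ→ℚ-!≢0 N)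

      base-trace : ∀ {b} → b ∈ bs → tr (cs b) ℚ.* (F ℚ.* G ℚ.* mm) ≡ 1ℚ
      base-trace {b} m = trans (cong₂ (λ x y → tr (cs b) ℚ.* (x ℚ.* y)) (sym (cong₂ (λ x y → ℕ→ℚ (x !) ℚ.* ℕ→ℚ (y !)) (proj₁ (∈-hookbits⁻ le m)) (proj₂ (∈-hookbits⁻ le m)))) (cong ℕ→ℚ (sym (cs-size m))))
        (hook-trace b (<⇒≤ (cs-< m)))

      rim-trace : ∀ {b} → b ∈ bs → ∀ β t → t ℚ.* (β ℚ.* nn) ≡ mm ℚ.* tr (cs b) → t ℚ.* (β ℚ.* nn ℚ.* F ℚ.* G) ≡ 1ℚ
      rim-trace {b} m β t h = trans (solve 5 (λ t β nn F G → t :* (β :* nn :* F :* G) := (t :* (β :* nn)) :* (F :* G)) refl t β nn F G)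
        (trans (cong (ℚ._* (F ℚ.* G)) h) (trans (solve 4 (λ mm t F G → (mm :* t) :* (F :* G) := t :* (F :* G :* mm)) refl mm (tr (cs b)) F G) (base-trace m)))

      arm-value : ∀ {b} → b ∈ bs → tr (arm-of b) ℚ.* (α ℚ.* nn ℚ.* F ℚ.* G) ≡ 1ℚ
      arm-value {b} m = rim-trace m α (tr (arm-of b)) (trans (cong₂ (λ x y → tr (arm-of b) ℚ.* (ℕ→ℚ (suc x) ℚ.* ℕ→ℚ y)) (sym (proj₁ (∈-hookbits⁻ le m))) (sym (trans (cong suc (cs-size m)) n-eq)))
        (trans (HookTrace.arm-trace b (cs-< m)) (cong (λ y → ℕ→ℚ y ℚ.* tr (cs b)) (cs-size m))))

      leg-value : ∀ {b} → b ∈ bs → tr (leg-of b) ℚ.* (λ′ ℚ.* nn ℚ.* F ℚ.* G) ≡ 1ℚ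
      leg-value {b} m = rim-trace m λ′ (tr (leg-of b)) (trans (cong₂ (λ x y → tr (leg-of b) ℚ.* (ℕ→ℚ (suc x) ℚ.* ℕ→ℚ y)) (sym (proj₂ (∈-hookbits⁻ le m))) (sym (trans (cong suc (cs-size m)) n-eq)))
        (trans (HookTrace.leg-trace b (cs-< m)) (cong (λ y → ℕ→ℚ y ℚ.* tr (cs b)) (cs-size m))))

      inner-value : ∀ {b} → b ∈ bs → tr (inner-of b) ℚ.* (α ℚ.* λ′) ≡ tr (cs b) ℚ.* (ℕ→ℚ a ℚ.* ℕ→ℚ k)
      inner-value {b} m = trans (cong₂ (λ x y → tr (inner-of b) ℚ.* (ℕ→ℚ (suc x) ℚ.* ℕ→ℚ (suc y))) (sym (proj₁ (∈-hookbits⁻ le m))) (sym (proj₂ (∈-hookbits⁻ le m))))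
        (trans (HookTrace.inner-trace b (cs-< m)) (cong₂ (λ x y → tr (cs b) ℚ.* (ℕ→ℚ x ℚ.* ℕ→ℚ y)) (proj₁ (∈-hookbits⁻ le m)) (proj₂ (∈-hookbits⁻ le m))))

      rim-hyp : ∀ β D → β ≢ 0ℚ → D ℚ.* (β ℚ.* F ℚ.* G) ≡ mm ℚ.* R → s ℚ.* (F ℚ.* G) ℚ.* inv (D′ ℚ.* inv (β ℚ.* nn ℚ.* F ℚ.* G)) ≡
        s ℚ.* R ℚ.* nF ℚ.* inv D ℚ.* inv D ℚ.* inv D′ ℚ.* (mm ℚ.* inv β)
      rim-hyp β D nβ hD = trans (rim-scalar s F G R nn mm β D D′ (inv (β ℚ.* nn ℚ.* F ℚ.* G)) nβ (ℕ→ℚ-!≢0 a) (ℕ→ℚ-!≢0 k)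
          (factor-nonzero D (β ℚ.* F ℚ.* G) hD (product-nonzero m≢0 (ℕ→ℚ-!≢0 N))) D′≢0 (trans (ℚP.*-comm (inv (β ℚ.* nn ℚ.* F ℚ.* G)) (β ℚ.* nn ℚ.* F ℚ.* G)) (*-inv (β ℚ.* nn ℚ.* F ℚ.* G) whole)) hD)
        (cong (λ z → s ℚ.* R ℚ.* z ℚ.* inv D ℚ.* inv D ℚ.* inv D′ ℚ.* (mm ℚ.* inv β)) (sym nF-value))
        where
        whole : β ℚ.* nn ℚ.* F ℚ.* G ≢ 0ℚ
        whole = product-nonzero (product-nonzero (product-nonzero nβ n≢0) (ℕ→ℚ-!≢0 a)) (ℕ→ℚ-!≢0 k)

      inv-nonzero : ∀ y → y ≢ 0ℚ → inv y ≢ 0ℚ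
      inv-nonzero y ny = factor-nonzero (inv y) y (trans (ℚP.*-comm (inv y) y) (*-inv y ny)) (λ ())

      rim-nonzero : ∀ β → β ≢ 0ℚ → inv (β ℚ.* nn ℚ.* F ℚ.* G) ≢ 0ℚ
      rim-nonzero β nβ = inv-nonzero _ (product-nonzero (product-nonzero (product-nonzero nβ n≢0) (ℕ→ℚ-!≢0 a)) (ℕ→ℚ-!≢0 k))

      size-diff : n ∸ k ≡ suc (suc a)
      size-diff = trans (cong (_∸ k) (sym NN-eq)) (+-∸-assoc 2 le)

      pred-size : n ∸ k ∸ 1 ≡ suc a
      pred-size = cong (_∸ 1) size-diff

    arm-term : ∑ (λ b → kap b ℚ.* ⟨ ⟦ E (arm-of b) ⟧ χC , χD ⟩) bs ≡ cD ℚ.* (((cC ℚ.* R) ÷' nF) ℚ.*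
      ((((sgn k ℚ.* gam n (hook n k) (n ∸ k) la i) ℚ.* gam n (hook n k) (n ∸ k) (twoRow n p) p) ÷' D′) ℚ.* (mm ÷' ℕ→ℚ (n ∸ k ∸ 1))))
    arm-term = trans (∑-cong bs (λ b m → cong (λ z → kap b ℚ.* ⟨ ⟦ E z ⟧ χC , χD ⟩) (arm-eq m)))
      (trans (family-term (hook n k) (n ∸ k) (λ b → wd (true ∷ b)) (arm-family le)
        (λ {b} m → subst (Agree (content (wd (true ∷ b)))) (arm-eq m) (agree-end (true ∷ b))) (mm ℚ.* inv α) (inv (α ℚ.* nn ℚ.* F ℚ.* G))
        (λ {b} m → trans (cong tr (sym (arm-eq m))) (inv-unique (tr (arm-of b)) _ (arm-value m))) (rim-nonzero α (ℕ→ℚ-suc≢0 a))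
        (rim-hyp α (ℕ→ℚ (dim n (hook n k))) (ℕ→ℚ-suc≢0 a) hD))
        (cong (λ z → cD ℚ.* (((cC ℚ.* R) ÷' nF) ℚ.* ((((sgn k ℚ.* gam n (hook n k) (n ∸ k) la i) ℚ.* gam n (hook n k) (n ∸ k) (twoRow n p) p) ÷' D′) ℚ.* (mm ÷' ℕ→ℚ z)))) (sym pred-size)))
      where
      open Family le (cont true a) (λ b → cont true a ∷ cs b) (λ b → refl) using (family-term)
      arm-eq : ∀ {b} → b ∈ bs → arm-of b ≡ cont true a ∷ cs b
      arm-eq {b} m = cong (λ z → cont true z ∷ cs b) (proj₁ (∈-hookbits⁻ le m))
      hD : ℕ→ℚ (dim n (hook n k)) ℚ.* (α ℚ.* F ℚ.* G) ≡ mm ℚ.* R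
      hD = trans (cong (ℕ→ℚ (dim n (hook n k)) ℚ.*_) (trans (cong (ℚ._* G) (sym (ℕ→ℚ-* (suc a) (a !)))) (sym (ℕ→ℚ-* (suc a !) (k !)))))
        (trans (sym (ℕ→ℚ-* (dim n (hook n k)) (suc a ! * k !))) (trans (cong ℕ→ℚ (dim-arm le)) m!-value))

    leg-term : ∑ (λ b → kap b ℚ.* ⟨ ⟦ E (leg-of b) ⟧ χC , χD ⟩) bs ≡ cD ℚ.* (((cC ℚ.* R) ÷' nF) ℚ.*
      ((((sgn k ℚ.* gam n (hook n (suc k)) 1 la i) ℚ.* gam n (hook n (suc k)) 1 (twoRow n p) p) ÷' D′) ℚ.* (mm ÷' λ′)))
    leg-term = trans (∑-cong bs (λ b m → cong (λ z → kap b ℚ.* ⟨ ⟦ E z ⟧ χC , χD ⟩) (leg-eq m)))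
      (family-term (hook n (suc k)) 1 (λ b → wd (false ∷ b)) (leg-family le)
        (λ {b} m → subst (Agree (content (wd (false ∷ b)))) (leg-eq m) (agree-end (false ∷ b))) (mm ℚ.* inv λ′) (inv (λ′ ℚ.* nn ℚ.* F ℚ.* G))
        (λ {b} m → trans (cong tr (sym (leg-eq m))) (inv-unique (tr (leg-of b)) _ (leg-value m))) (rim-nonzero λ′ (ℕ→ℚ-suc≢0 k))
        (rim-hyp λ′ (ℕ→ℚ (dim n (hook n (suc k)))) (ℕ→ℚ-suc≢0 k) hD))
      where
      open Family le (cont false k) (λ b → cont false k ∷ cs b) (λ b → refl) using (family-term)
      leg-eq : ∀ {b} → b ∈ bs → leg-of b ≡ cont false k ∷ cs b
      leg-eq {b} m = cong (λ z → cont false z ∷ cs b) (proj₂ (∈-hookbits⁻ le m))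
      hD : ℕ→ℚ (dim n (hook n (suc k))) ℚ.* (λ′ ℚ.* F ℚ.* G) ≡ mm ℚ.* R
      hD = trans (cong (ℕ→ℚ (dim n (hook n (suc k))) ℚ.*_) (trans (solve 3 (λ l F G → l :* F :* G := F :* (l :* G)) refl λ′ F G)
          (trans (cong (F ℚ.*_) (sym (ℕ→ℚ-* (suc k) (k !)))) (sym (ℕ→ℚ-* (a !) (suc k !))))))
        (trans (sym (ℕ→ℚ-* (dim n (hook n (suc k))) (a ! * suc k !))) (trans (cong ℕ→ℚ (dim-leg le)) m!-value))

    inner-term : 1 ≤ k → k < N → ∑ (λ b → kap b ℚ.* ⟨ ⟦ E (inner-of b) ⟧ χC , χD ⟩) bs ≡ cD ℚ.* (((cC ℚ.* R) ÷' nF) ℚ.*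
      ((((sgn k ℚ.* gam n (near n k) 2 la i) ℚ.* gam n (near n k) 2 (twoRow n p) p) ÷' D′) ℚ.* (ℕ→ℚ (n * k * (n ∸ k ∸ 2)) ÷' ℕ→ℚ ((n ∸ k ∸ 1) * (k + 1)))))
    inner-term lk lt = trans (family-term (near n k) 2 inn (inner-family lk lt)
        (λ {b} m → agree-inn b (subst (1 ≤_) (sym (proj₂ (∈-hookbits⁻ le m))) lk)) (nn ℚ.* ℕ→ℚ k ℚ.* ℕ→ℚ a ℚ.* inv (α ℚ.* λ′)) tv trace-eq nt
        (trans (inner-scalar s F G R nn mm (ℕ→ℚ a) (ℕ→ℚ k) (α ℚ.* λ′) D D′ t₀ tv nαλ (ℕ→ℚ-!≢0 a) (ℕ→ℚ-!≢0 k) nD D′≢0 nt t₀-eq tv-eq hD)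
          (cong (λ z → s ℚ.* R ℚ.* z ℚ.* inv D ℚ.* inv D ℚ.* inv D′ ℚ.* (nn ℚ.* ℕ→ℚ k ℚ.* ℕ→ℚ a ℚ.* inv (α ℚ.* λ′))) (sym nF-value))))
      (cong (λ z → cD ℚ.* (((cC ℚ.* R) ÷' nF) ℚ.* ((((sgn k ℚ.* gam n (near n k) 2 la i) ℚ.* gam n (near n k) 2 (twoRow n p) p) ÷' D′) ℚ.* z))) (sym ratio))
      where
      open Family le (ℤ.+ 0) (λ b → ℤ.+ 0 ∷ cs b) (λ b → refl) using (family-term)
      D t₀ tv : ℚ
      D = ℕ→ℚ (dim n (near n k))
      t₀ = inv (F ℚ.* G ℚ.* mm)
      tv = t₀ ℚ.* (ℕ→ℚ a ℚ.* ℕ→ℚ k) ℚ.* inv (α ℚ.* λ′)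
      nαλ : α ℚ.* λ′ ≢ 0ℚ
      nαλ = product-nonzero (ℕ→ℚ-suc≢0 a) (ℕ→ℚ-suc≢0 k)
      nFGm : F ℚ.* G ℚ.* mm ≢ 0ℚ
      nFGm = product-nonzero (product-nonzero (ℕ→ℚ-!≢0 a) (ℕ→ℚ-!≢0 k)) m≢0
      pos : ∀ {x} → 1 ≤ x → ℕ→ℚ x ≢ 0ℚ
      pos {suc x} _ = ℕ→ℚ-suc≢0 x
      nal : ℕ→ℚ a ℚ.* ℕ→ℚ k ≢ 0ℚ
      nal = product-nonzero (pos (m<n⇒0<n∸m lt)) (pos lk)
      nt : tv ≢ 0ℚ
      nt = product-nonzero (product-nonzero (inv-nonzero _ nFGm) nal) (inv-nonzero _ nαλ)
      t₀-eq : t₀ ℚ.* (F ℚ.* G ℚ.* mm) ≡ 1ℚ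
      t₀-eq = trans (ℚP.*-comm t₀ (F ℚ.* G ℚ.* mm)) (*-inv (F ℚ.* G ℚ.* mm) nFGm)
      cancel : ∀ x → x ℚ.* inv (α ℚ.* λ′) ℚ.* (α ℚ.* λ′) ≡ x
      cancel x = trans (solve 3 (λ x i y → x :* i :* y := x :* (y :* i)) refl x (inv (α ℚ.* λ′)) (α ℚ.* λ′)) (trans (cong (x ℚ.*_) (*-inv (α ℚ.* λ′) nαλ)) (ℚP.*-identityʳ x))
      tv-eq : tv ℚ.* (α ℚ.* λ′) ≡ t₀ ℚ.* (ℕ→ℚ a ℚ.* ℕ→ℚ k)
      tv-eq = cancel (t₀ ℚ.* (ℕ→ℚ a ℚ.* ℕ→ℚ k))
      trace-eq : ∀ {b} → b ∈ bs → tr (inner-of b) ≡ tv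
      trace-eq {b} m = *-cancelˡ (α ℚ.* λ′) (tr (inner-of b)) tv nαλ (trans (ℚP.*-comm (α ℚ.* λ′) (tr (inner-of b)))
        (trans (inner-value m) (trans (cong (ℚ._* (ℕ→ℚ a ℚ.* ℕ→ℚ k)) (inv-unique (tr (cs b)) _ (base-trace m))) (trans (sym tv-eq) (ℚP.*-comm tv (α ℚ.* λ′))))))
      hD : D ℚ.* (α ℚ.* λ′ ℚ.* F ℚ.* G) ≡ nn ℚ.* (ℕ→ℚ a ℚ.* ℕ→ℚ k) ℚ.* R
      hD = trans (cong (D ℚ.*_) (trans (solve 4 (λ α l F G → α :* l :* F :* G := (α :* F) :* (l :* G)) refl α λ′ F G)
          (trans (cong₂ ℚ._*_ (sym (ℕ→ℚ-* (suc a) (a !))) (sym (ℕ→ℚ-* (suc k) (k !)))) (sym (ℕ→ℚ-* (suc a !) (suc k !))))))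
        (trans (sym (ℕ→ℚ-* (dim n (near n k)) (suc a ! * suc k !))) (trans (cong ℕ→ℚ (dim-inner lk lt))
          (trans (ℕ→ℚ-* (n * (a * k)) (N !)) (cong (ℚ._* R) (trans (ℕ→ℚ-* n (a * k)) (cong (nn ℚ.*_) (ℕ→ℚ-* a k)))))))
      nD : D ≢ 0ℚ
      nD = factor-nonzero D _ hD (product-nonzero (product-nonzero n≢0 nal) (ℕ→ℚ-!≢0 N))
      -- Here a = n-k-2, so α is n-k-1 and λ′ is k+1.
      ratio : ℕ→ℚ (n * k * (n ∸ k ∸ 2)) ÷' ℕ→ℚ ((n ∸ k ∸ 1) * (k + 1)) ≡ nn ℚ.* ℕ→ℚ k ℚ.* ℕ→ℚ a ℚ.* inv (α ℚ.* λ′)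
      ratio = cong₂ ℚ._*_
        (trans (ℕ→ℚ-* (n * k) (n ∸ k ∸ 2)) (cong₂ ℚ._*_ (ℕ→ℚ-* n k) (cong (λ z → ℕ→ℚ (z ∸ 2)) size-diff)))
        (cong inv (trans (ℕ→ℚ-* (n ∸ k ∸ 1) (k + 1)) (cong₂ (λ x y → ℕ→ℚ x ℚ.* ℕ→ℚ y) pred-size (+-comm k 1))))

    -- A hook with an empty limb has no inner corner. With `t` = false this covers k = 0, with `t` =
    -- true it covers k = N, the two ends absent from C.
    inner-zero : ∀ t → (∀ {b} → b ∈ bs → cnt t b ≡ 0) → ∑ (λ b → kap b ℚ.* ⟨ ⟦ E (inner-of b) ⟧ χC , χD ⟩) bs ≡ 0ℚ
    inner-zero t h = ∑-zero bs (λ b m → trans (cong (kap b ℚ.*_) (∑-zero (Sym n) (λ π mπ →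
        trans (cong (ℚ._* χD π) (E-inner-zero b t (cs-< m) (h m) χC (sym-val mπ))) (ℚP.*-zeroˡ (χD π))))) (ℚP.*-zeroʳ (kap b)))

  private
    armS legS innS : ℕ → ℚ
    armS k = ∑ (λ b → kap b ℚ.* ⟨ ⟦ E (arm-of b) ⟧ χC , χD ⟩) (hookbits N k)
    legS k = ∑ (λ b → kap b ℚ.* ⟨ ⟦ E (leg-of b) ⟧ χC , χD ⟩) (hookbits N k)
    innS k = ∑ (λ b → kap b ℚ.* ⟨ ⟦ E (inner-of b) ⟧ χC , χD ⟩) (hookbits N k)
    h : V
    h = ⟦ JJ N ⟧ χC

    -- Replaces the value at the one permutation `πp` by a pairing with the class indicator, to
    -- which the rank-one relation applies.
    class-average : cD ℚ.* h πp ≡ ⟨ h , χD ⟩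
    class-average = trans (sym (∑-const (h πp) (Cset n (twoRow n p) p)))
      (trans (∑-cong (Cset n (twoRow n p) p) (λ π m → sym (class-constant {h} (JJ-conj N NN-eq (χ-conj la i)) m)))
      (trans (∑-filterB (inC n (twoRow n p) p) h (Sym n)) (⟨⟩-sym χD h)))

    expansion : ⟨ h , χD ⟩ ≡ ∑ armS (range 0 N) ℚ.+ ∑ legS (range 0 N) ℚ.+ ∑ innS (range 0 N)
    expansion = trans (⟨⟩-cong {h} {λ π → ∑ (λ b → kap b ℚ.* ⟦ E (cs b) ⟧ χC π) (bits N)} {χD} (JJ-expand N N<n χC) (λ _ → refl))
      (trans (⟨⟩-∑ (λ b → kap b *ᵛ ⟦ E (cs b) ⟧ χC) χD (bits N))
      (trans (∑-cong (bits N) (λ b m → trans (⟨⟩-* (kap b) (⟦ E (cs b) ⟧ χC) χD) (split b (subst (_< n) (sym (trans (cs-length b) (cong suc (bits-length N m)))) (≤-reflexive NN-eq)))))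
      (trans (∑-+ (λ b → arm b ℚ.+ leg b) inn′ (bits N)) (cong₂ ℚ._+_ (trans (∑-+ arm leg (bits N)) (cong₂ ℚ._+_ (group arm) (group leg))) (group inn′)))))
      where
      arm leg inn′ : List Bool → ℚ
      arm b = kap b ℚ.* ⟨ ⟦ E (arm-of b) ⟧ χC , χD ⟩
      leg b = kap b ℚ.* ⟨ ⟦ E (leg-of b) ⟧ χC , χD ⟩
      inn′ b = kap b ℚ.* ⟨ ⟦ E (inner-of b) ⟧ χC , χD ⟩
      group : ∀ F → ∑ F (bits N) ≡ ∑ (λ k → ∑ F (hookbits N k)) (range 0 N)
      group F = ∑-group (cnt false) F N (bits N) (λ {b} m → subst (cnt false b ≤_) (bits-length N m) (cnt-≤ false b))
      split : ∀ b → length (cs b) < n → kap b ℚ.* ⟨ ⟦ E (cs b) ⟧ χC , χD ⟩ ≡ arm b ℚ.+ leg b ℚ.+ inn′ b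
      split b lt = trans (cong (kap b ℚ.*_) (trans (⟨⟩-cong {⟦ E (cs b) ⟧ χC} {⟦ E (arm-of b) ⟧ χC +ᵛ ⟦ E (leg-of b) ⟧ χC +ᵛ ⟦ E (inner-of b) ⟧ χC} {χD} (E-split b lt χC) (λ _ → refl))
          (trans (∑ₑ-+ (⟦ E (arm-of b) ⟧ χC +ᵛ ⟦ E (leg-of b) ⟧ χC) (⟦ E (inner-of b) ⟧ χC) χD) (cong (ℚ._+ ⟨ ⟦ E (inner-of b) ⟧ χC , χD ⟩) (∑ₑ-+ (⟦ E (arm-of b) ⟧ χC) (⟦ E (leg-of b) ⟧ χC) χD)))))
        (solve 4 (λ k a l i → k :* (a :+ l :+ i) := k :* a :+ k :* l :+ k :* i) refl (kap b) ⟨ ⟦ E (arm-of b) ⟧ χC , χD ⟩ ⟨ ⟦ E (leg-of b) ⟧ χC , χD ⟩ ⟨ ⟦ E (inner-of b) ⟧ χC , χD ⟩)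

    pref : ℚ
    pref = (cC ℚ.* R) ÷' nF

    pull : ∀ (g : ℕ → ℚ) xs → ∑ (λ k → cD ℚ.* (pref ℚ.* g k)) xs ≡ cD ℚ.* (pref ℚ.* ∑ g xs)
    pull g xs = trans (∑-*ˡ cD (λ k → pref ℚ.* g k) xs) (cong (cD ℚ.*_) (∑-*ˡ pref g xs))

    gA gB gC : ℕ → ℚ
    gA k = ((sgn k ℚ.* gam n (hook n k) (n ∸ k) la i ℚ.* gam n (hook n k) (n ∸ k) (twoRow n p) p) ÷' ℕ→ℚ (dim m (hook m k))) ℚ.* (mm ÷' ℕ→ℚ (n ∸ k ∸ 1))
    gB k = ((sgn (k ∸ 1) ℚ.* gam n (hook n k) 1 la i ℚ.* gam n (hook n k) 1 (twoRow n p) p) ÷' ℕ→ℚ (dim m (hook m (k ∸ 1)))) ℚ.* (mm ÷' ℕ→ℚ k)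
    gC k = ((sgn k ℚ.* gam n (near n k) 2 la i ℚ.* gam n (near n k) 2 (twoRow n p) p) ÷' ℕ→ℚ (dim m (hook m k))) ℚ.* (ℕ→ℚ (n * k * (n ∸ k ∸ 2)) ÷' ℕ→ℚ ((n ∸ k ∸ 1) * (k + 1)))

    sumA : ∑ armS (range 0 N) ≡ cD ℚ.* (pref ℚ.* sumQ (map gA (range 0 N)))
    sumA = trans (∑-cong (range 0 N) (λ k m → arm-term (proj₂ (∈-range⁻ {0} {N} m))))
      (trans (pull gA (range 0 N)) (cong (λ z → cD ℚ.* (pref ℚ.* z)) (sym (sumQ-map gA (range 0 N)))))

    -- The index shifts by one: B is indexed by the leg after n is added, `legS` by the leg before.
    sumB : ∑ legS (range 0 N) ≡ cD ℚ.* (pref ℚ.* sumQ (map gB (range 1 m)))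
    sumB = trans (∑-cong (range 0 N) (λ k m → leg-term (proj₂ (∈-range⁻ {0} {N} m))))
      (trans (pull (λ k → gB (suc k)) (range 0 N)) (cong (λ z → cD ℚ.* (pref ℚ.* z))
        (trans (sym (∑-map gB suc (range 0 N))) (trans (cong (∑ gB) (map-applyUpTo (λ k → k) suc (suc N))) (trans (cong (λ z → ∑ gB (range 1 z)) m-eq) (sym (sumQ-map gB (range 1 m))))))))

    trim : ∀ M (g : ℕ → ℚ) → g 0 ≡ 0ℚ → g M ≡ 0ℚ → ∑ g (range 0 M) ≡ ∑ g (range 1 (M ∸ 1))
    trim zero g e₀ e₁ = trans (cong (ℚ._+ 0ℚ) e₀) refl
    trim (suc M) g e₀ e₁ = trans (cong (ℚ._+ ∑ g (range 1 (suc M))) e₀) (trans (ℚP.+-identityˡ _)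
      (trans (cong (∑ g) (range-snoc M)) (trans (∑-++ g (range 1 M) (suc M ∷ [])) (trans (cong (λ z → ∑ g (range 1 M) ℚ.+ (z ℚ.+ 0ℚ)) e₁) (ℚP.+-identityʳ _)))))

    sumC : ∑ innS (range 0 N) ≡ cD ℚ.* (pref ℚ.* sumQ (map gC (range 1 (N ∸ 1))))
    sumC = trans (trim N innS (inner-zero z≤n false (λ m → proj₂ (∈-hookbits⁻ {N} z≤n m))) (inner-zero ≤-refl true (λ m → trans (proj₁ (∈-hookbits⁻ {N} ≤-refl m)) (n∸n≡0 N))))
      (trans (∑-cong (range 1 (N ∸ 1)) (λ k m → let (lk , lN) = ∈-range⁻ {1} {N ∸ 1} m in inner-term (≤-trans lN (m∸n≤m N 1)) lk (below lk lN)))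
      (trans (pull gC (range 1 (N ∸ 1))) (cong (λ z → cD ℚ.* (pref ℚ.* z)) (sym (sumQ-map gC (range 1 (N ∸ 1)))))))
      where
      below : ∀ {k M} → 1 ≤ k → k ≤ M ∸ 1 → k < M
      below {M = zero} lk lM = ⊥-elim (1+n≰n (≤-trans lk lM))
      below {M = suc M} lk lM = s≤s lM

  -- The upper end M of the third sum is a parameter because the computation yields (n ∸ 2) ∸ 1
  -- where the theorem has n ∸ 3; only this bound has to be rewritten.
  formula : ℕ → ℚ
  formula M = pref ℚ.* (sumQ (map gA (range 0 N)) ℚ.+ sumQ (map gB (range 1 m)) ℚ.+ sumQ (map gC (range 1 M)))

  dipole-formula : ℕ→ℚ (dipoleCount n p la i) ≡ formula (N ∸ 1)
  dipole-formula = *-cancelˡ cD _ _ cD≢0 (trans (cong (cD ℚ.*_) (dipole-sum la i)) (trans class-average (trans expansion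
    (trans (cong₂ ℚ._+_ (cong₂ ℚ._+_ sumA sumB) sumC)
      (solve 5 (λ c w a b d → c :* (w :* a) :+ c :* (w :* b) :+ c :* (w :* d) := c :* (w :* (a :+ b :+ d))) refl
        cD pref (sumQ (map gA (range 0 N))) (sumQ (map gB (range 1 m))) (sumQ (map gC (range 1 (N ∸ 1)))))))))

mainTheorem7 : (n : ℕ) (la : List ℕ) (i p : ℕ) →
    IsPartition n la → i ∈ la → 1 ≤ p → p ≤ n ∸ 1 →
    ℕ→ℚ (dipoleCount n p la i) ≡ rhs n p la i
mainTheorem7 n la i p _ _ 1≤p p≤n-1 = subst (λ M → ℕ→ℚ (dipoleCount n p la i) ≡ formula M) (∸-+-assoc n 2 1) dipole-formula
  where
  2≤n : 2 ≤ n
  2≤n = ≤-trans (s≤s (≤-trans 1≤p p≤n-1)) (≤-reflexive (sym (+-∸-assoc 1 (pos n (≤-trans 1≤p p≤n-1)))))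
    where
    pos : ∀ n → 1 ≤ n ∸ 1 → 1 ≤ n
    pos (suc n) _ = s≤s z≤n
  m-eq : suc (n ∸ 2) ≡ n ∸ 1
  m-eq = sym (+-∸-assoc 1 2≤n)
  n-eq : suc (n ∸ 1) ≡ n
  n-eq = sym (+-∸-assoc 1 (≤-trans (s≤s z≤n) 2≤n))
  NN-eq : suc (suc (n ∸ 2)) ≡ n
  NN-eq = trans (cong suc m-eq) n-eq
  open Assembly (n ∸ 2) (n ∸ 1) n p m-eq n-eq (dipole-facts NN-eq 1≤p (≤-trans p≤n-1 (≤-reflexive (sym m-eq)))) la i
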